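{- Let $t \geq 2$ and $1 \leq k_1 \leq \cdots \leq k_t$ be integers with $n = k_1 + \cdots + k_t \geq 4$, and let $X$ be a graph on $n$ vertices. Then: \begin{enumerate} \item If $k_t = n-1$, then $\mathsf{FS}(X, K_{1,n-1})$ is connected if and only if $X$ is connected, is non-bipartite, is not a cycle, is not isomorphic to the graph $\theta_0$, and does not contain a cut-vertex (a $1$-bridge). \item If $t = 2$ and $k_1 \geq 2$, then $\mathsf{FS}(X, K_{k_1, n-k_1})$ is connected if and only if $X$ is connected, is non-bipartite, is not a cycle, and does not contain a $k_1$-bridge. \item If $t > 2$ and either $k_t > 2$ or $\gcd(k_1,\ldots,k_t) > 1$, then $\mathsf{FS}(X, K_{k_1,\ldots,k_t})$ is connected if and only if $X$ is connected, is not a cycle, and does not contain an $(n-k_t)$-bridge. \item If $t > 2$, $k_1 = 1$, and $k_t = 2$, then $\mathsf{FS}(X, K_{k_1,\ldots,k_t})$ is connected if and only if $X$ is connected and is not a path (i.e., does not contain an $(n-2)$-bridge). \end{enumerate}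
   Context: All graphs are simple. For graphs $X, Y$ on $n$ vertices, the friends-and-strangers graph $\mathsf{FS}(X,Y)$ has as vertices all bijections $\sigma: V(X) \to V(Y)$; two bijections $\sigma, \sigma'$ are adjacent iff there is an edge $\{a,b\} \in E(X)$ with $\{\sigma(a),\sigma(b)\} \in E(Y)$, $\sigma'(a) = \sigma(b)$, $\sigma'(b) = \sigma(a)$, and $\sigma'(c) = \sigma(c)$ for all other $c$ (an $(X,Y)$-friendly swap across $\{a,b\}$). $K_{k_1,\ldots,k_t}$ denotes the complete $t$-partite graph with partition classes of sizes $k_1,\ldots,k_t$ (two vertices adjacent iff in different classes). A path $v_1, v_2, \ldots, v_k$ in a graph is a $k$-bridge if each edge of the path is a cut-edge, $v_2,\ldots,v_{k-1}$ have degree $2$ in the graph, and $v_1$ and $v_k$ do not have degree $1$; in particular a cut-edge neither of whose ends has degree $1$ is a $2$-bridge, and a single cut-vertex is called a $1$-bridge. The graph $\theta_0$ is the graph on $7$ vertices obtained from a $6$-cycle $a,b,c,d,e,f$ by adding a new vertex $g$ adjacent to $a$ and to $d$. -}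

module Defs where

open import Data.Nat using (ℕ; zero; suc; _+_; _∸_; _<ᵇ_; _≡ᵇ_)
open import Data.Nat.GCD using (gcd)
open import Data.Bool using (Bool; true; false; _∨_; _∧_; not; if_then_else_)
open import Data.Fin using (Fin; toℕ; inject₁; fromℕ) renaming (zero to fzero; suc to fsuc)
open import Data.Fin.Permutation using (Permutation′; _⟨$⟩ʳ_)
open import Data.Vec using (Vec; []; _∷_; toList)
import Data.List as L
open import Data.Nat.ListAction using () renaming (sum to lsum)
open import Data.Product using (Σ; ∃; _×_; _,_)
open import Data.Sum using (_⊎_)
open import Data.Empty using (⊥)
open import Relation.Nullary using (¬_)
open import Relation.Binary.PropositionalEquality using (_≡_; _≢_)
open import Relation.Binary.Construct.Closure.ReflexiveTransitive using (Star)
open import Function.Bundles using (_↔_; Inverse)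
open import Function.Definitions using (Injective)

Graph : ℕ → Set
Graph n = Fin n → Fin n → Bool

IsSimple : ∀ {n} → Graph n → Set
IsSimple {n} X = (∀ (u : Fin n) → X u u ≡ false) × (∀ (u v : Fin n) → X u v ≡ X v u)

Adj : ∀ {n} → Graph n → Fin n → Fin n → Set
Adj X u v = X u v ≡ true

deg : ∀ {n} → Graph n → Fin n → ℕ
deg {n} X v = lsum (L.map (λ u → if X v u then 1 else 0) (L.allFin n))

Connected : ∀ {n} → Graph n → Set
Connected {n} X = ∀ (u v : Fin n) → Star (Adj X) u v

Bipartite : ∀ {n} → Graph n → Set
Bipartite {n} X = Σ (Fin n → Bool) λ c → ∀ (u v : Fin n) → Adj X u v → c u ≢ c v

Iso : ∀ {n m} → Graph n → Graph m → Set
Iso {n} {m} X Y =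
  Σ (Fin n ↔ Fin m) λ f → ∀ (u v : Fin n) → X u v ≡ Y (Inverse.to f u) (Inverse.to f v)

pathGraph : (n : ℕ) → Graph n
pathGraph n i j = (suc (toℕ i) ≡ᵇ toℕ j) ∨ (suc (toℕ j) ≡ᵇ toℕ i)

-- the cycle C_n on 0,1,...,n-1 (used for n ≥ 3)
cycleGraph : (n : ℕ) → Graph n
cycleGraph n i j = pathGraph n i j
  ∨ ((toℕ i ≡ᵇ 0) ∧ (toℕ j ≡ᵇ n ∸ 1))
  ∨ ((toℕ j ≡ᵇ 0) ∧ (toℕ i ≡ᵇ n ∸ 1))

IsPath : ∀ {n} → Graph n → Set
IsPath {n} X = Iso X (pathGraph n)

IsCycle : ∀ {n} → Graph n → Set
IsCycle {n} X = Iso X (cycleGraph n)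

-- θ₀ : the 6-cycle a b c d e f (= 0..5) plus g (= 6) adjacent to a and d
θ₀edge : ℕ → ℕ → Bool
θ₀edge 0 1 = true
θ₀edge 1 2 = true
θ₀edge 2 3 = true
θ₀edge 3 4 = true
θ₀edge 4 5 = true
θ₀edge 5 0 = true
θ₀edge 6 0 = true
θ₀edge 6 3 = true
θ₀edge _ _ = false

θ₀ : Graph 7
θ₀ i j = θ₀edge (toℕ i) (toℕ j) ∨ θ₀edge (toℕ j) (toℕ i)

AdjMinusVertex : ∀ {n} → Graph n → Fin n → Fin n → Fin n → Set
AdjMinusVertex X w u v = Adj X u v × u ≢ w × v ≢ w

IsCutVertex : ∀ {n} → Graph n → Fin n → Set
IsCutVertex {n} X w = Σ (Fin n) λ u → Σ (Fin n) λ v →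
  u ≢ w × v ≢ w × Star (Adj X) u v × ¬ Star (AdjMinusVertex X w) u v

HasCutVertex : ∀ {n} → Graph n → Set
HasCutVertex {n} X = Σ (Fin n) λ w → IsCutVertex X w

AdjMinusEdge : ∀ {n} → Graph n → Fin n → Fin n → Fin n → Fin n → Set
AdjMinusEdge X a b u v = Adj X u v × ¬ ((u ≡ a × v ≡ b) ⊎ (u ≡ b × v ≡ a))

IsCutEdge : ∀ {n} → Graph n → Fin n → Fin n → Set
IsCutEdge X a b = Adj X a b × ¬ Star (AdjMinusEdge X a b) a b

HasBridge : ∀ {n} → Graph n → ℕ → Set
HasBridge X zero = ⊥
HasBridge X (suc zero) = HasCutVertex X
HasBridge {n} X (suc (suc m)) =
  Σ (Fin (suc (suc m)) → Fin n) λ v →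
    Injective _≡_ _≡_ v
    × (∀ (i : Fin (suc m)) → IsCutEdge X (v (inject₁ i)) (v (fsuc i)))
    × (∀ (i : Fin m) → deg X (v (fsuc (inject₁ i))) ≡ 2)
    × deg X (v fzero) ≢ 1
    × deg X (v (fromℕ (suc m))) ≢ 1

-- Complete multipartite graphs K_{k₁,…,k_t} on Fin n: vertex x lies in
-- class i iff k₁+…+k_i ≤ x < k₁+…+k_{i+1}.

partOf : L.List ℕ → ℕ → ℕ
partOf L.[] x = 0
partOf (k L.∷ ks) x = if x <ᵇ k then 0 else suc (partOf ks (x ∸ k))

K : ∀ {t} → Vec ℕ t → (n : ℕ) → Graph n
K ks n u v = not (partOf (toList ks) (toℕ u) ≡ᵇ partOf (toList ks) (toℕ v))

-- first and last entries of a vector (used only for length ≥ 2)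
firstK : ∀ {t} → Vec ℕ t → ℕ
firstK [] = 0
firstK (x ∷ _) = x

lastK : ∀ {t} → Vec ℕ t → ℕ
lastK [] = 0
lastK (x ∷ []) = x
lastK (_ ∷ y ∷ xs) = lastK (y ∷ xs)

gcdAll : ∀ {t} → Vec ℕ t → ℕ
gcdAll ks = L.foldr gcd 0 (toList ks)

-- Friends-and-strangers graphs.  Vertices: bijections σ : V(X) → V(Y),
-- i.e. permutations of Fin n.

FSEdge : ∀ {n} → Graph n → Graph n → Permutation′ n → Permutation′ n → Set
FSEdge {n} X Y σ σ′ = Σ (Fin n) λ a → Σ (Fin n) λ b →
  Adj X a b
  × Adj Y (σ ⟨$⟩ʳ a) (σ ⟨$⟩ʳ b)
  × σ′ ⟨$⟩ʳ a ≡ σ ⟨$⟩ʳ b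
  × σ′ ⟨$⟩ʳ b ≡ σ ⟨$⟩ʳ a
  × (∀ (c : Fin n) → c ≢ a → c ≢ b → σ′ ⟨$⟩ʳ c ≡ σ ⟨$⟩ʳ c)

-- FS(X,Y) is connected: any two bijections are joined by a sequence of
-- friendly swaps (bijections are compared pointwise, since Agda lacks funext).
FSConnected : ∀ {n} → Graph n → Graph n → Set
FSConnected {n} X Y = ∀ (σ τ : Permutation′ n) →
  Σ (Permutation′ n) λ ρ → Star (FSEdge X Y) σ ρ × (∀ (x : Fin n) → ρ ⟨$⟩ʳ x ≡ τ ⟨$⟩ʳ x)

{-# OPTIONS --safe #-}
module Submission where

-- Sufficiency: call two people exchangeable in a state if the state with the
-- two swapped is reachable; FS is connected once neighbours of one class are
-- always exchangeable.  Exchangeability holds around a vertex of degree three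
-- and spreads to all of X by adding one vertex at a time, over an ear or along
-- a path that is not a bridge.  With only two classes one first gets pairs of
-- exchanges (one in each class) or, with a single blank, 3-cycles; turning an
-- odd cycle then isolates one exchange.  With a single blank the start is a
-- theta subgraph, and θ₀ is the one 2-connected graph without a usable theta.
-- Necessity: a parity of inversions (bipartite graphs and cycles), the number
-- of outsiders behind a person on a bridge, and for θ₀ a one-factorization of
-- the complete graph on the six vertices off the blank are preserved by swaps.

open import Defs
open import Data.Nat as ℕ using (ℕ; zero; suc; _+_; _∸_; _≤_; _<_; _≡ᵇ_; _<ᵇ_; z≤n; s≤s)
open import Data.Nat.Properties as ℕₚ using (≤-refl; ≤-trans; ≤-reflexive)
open import Data.Fin as F using (Fin; toℕ; fromℕ<; inject₁; fromℕ)
open import Data.Fin.Properties as Fₚ using (any?; pigeonhole; toℕ-injective; toℕ<n; toℕ-fromℕ<) renaming (_≟_ to _≟ᶠ_)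
open import Data.Fin.Permutation as P using (Permutation′; _⟨$⟩ʳ_; _⟨$⟩ˡ_; transpose; _∘ₚ_; flip; inverseˡ; inverseʳ)
import Data.Fin.Permutation.Transposition.List as TL
open import Data.Bool as B using (Bool; true; false; not; _∧_; _∨_; _xor_; if_then_else_) renaming (_≟_ to _≟ᵇ_)
open import Data.Vec as V using (Vec; []; _∷_)
open import Data.List using (List; []; _∷_; _++_; length; map; lookup; filter; allFin; reverse)
open import Data.List.Properties as Lₚ using (++-assoc; ++-identityʳ; length-++; map-++; unfold-reverse; reverse-++; length-reverse; ∷-injective; ∷ʳ-injective; ∷ʳ-injectiveˡ; ∷ʳ-injectiveʳ)
open import Data.List.Membership.Propositional using (_∈_; _∉_)
open import Data.List.Membership.Propositional.Properties using (∈-allFin; ∈-++⁺ˡ; ∈-++⁺ʳ; ∈-++⁻; ∈-lookup; ∈-filter⁺; ∈-filter⁻; ∈-∃++; ∈-map⁺; ∈-map⁻)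
import Data.List.Membership.DecPropositional as DecMem
open import Data.List.Relation.Unary.Any as Any using (Any; here; there)
open import Data.List.Relation.Unary.All as All using ([]; _∷_)
open import Data.List.Relation.Unary.AllPairs using ([]; _∷_)
open import Data.List.Relation.Unary.Unique.Propositional using (Unique)
import Data.List.Relation.Unary.Unique.Propositional.Properties as Uₚ
open import Data.Product using (Σ; ∃; ∃₂; _×_; _,_; proj₁; proj₂)
open import Data.Sum using (_⊎_; inj₁; inj₂; [_,_]′)
open import Data.Empty using (⊥; ⊥-elim)
open import Data.Unit using (⊤; tt)
open import Function using (_∘_; id; case_of_)
open import Function.Bundles using (_⇔_; mk⇔; Inverse; mk↔ₛ′)
open import Function.Definitions using (Injective)
open import Relation.Nullary using (¬_; Dec; yes; no)
open import Relation.Nullary.Decidable as Dec using (_×-dec_; _⊎-dec_; ¬?; map′; decidable-stable)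
open import Relation.Binary.PropositionalEquality using (_≡_; _≢_; refl; sym; trans; cong; cong₂; subst; subst₂; ≢-sym)
open import Relation.Binary.Construct.Closure.ReflexiveTransitive as Star using (Star; ε; _◅_; _◅◅_)
open import Relation.Unary using (Decidable)
import Data.Nat.ListAction
open import Relation.Binary.Definitions using (tri<; tri≈; tri>)
open import Data.Fin.Patterns using (0F; 1F; 2F; 3F; 4F; 5F; 6F)
open import Relation.Nullary.Decidable using (_→-dec_; from-yes)
open import Data.List.Relation.Unary.Unique.DecPropositional using (unique?)
open import Data.List.Relation.Binary.Permutation.Propositional as Perm using (_↭_; ↭-trans)
import Data.List.Relation.Binary.Permutation.Propositional.Properties as Permₚ
open import Data.Nat.Divisibility using (_∣_; ∣-trans; ∣⇒≤)
import Data.Nat.GCD as GCD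


-- Swaps permute positions, while renaming people within their classes acts from the other side and
-- commutes with swaps. Hence the renamings that a state can realise form a group, which is the same
-- along a component; `Ex` and `Dx` are membership of one transposition and of a product of two.
-- This is why the argument follows people and conjugates rather than vertices. The spreading step
-- keeps all k people outside the class (the blanks) inside the region. A region of k + 2 vertices
-- is the smallest that still holds two people of the class, so the base case concerns a single
-- pair. To add a vertex, its occupant must be traded for somebody inside; along a path this takes a
-- blank on each vertex of the path and one more beside a fork at its end. The search for a fork
-- fails only after k vertices whose edges are all cut-edges, and this is where the k-bridge comes
-- from. A claw needs two blanks, so a single blank requires another source of even permutations:
-- two loops of a theta almost commute, and their commutator moves at most four people.

private variable
  Elt Elt′ : Set
  n : ℕ

-- Booleans and lists without repetition.

_∈?_ : (x : Fin n) (xs : List (Fin n)) → Dec (x ∈ xs)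
_∈?_ = DecMem._∈?_ _≟ᶠ_

∈-single : {P : Elt → Set} {x : Elt} → P x → ∀ {y} → y ∈ x ∷ [] → P y
∈-single p (here refl) = p

bool-cases : (b : Bool) → (b ≡ true) ⊎ (b ≡ false)
bool-cases true = inj₁ refl
bool-cases false = inj₂ refl

true≢false : {b : Bool} → b ≡ true → b ≡ false → ⊥
true≢false refl ()

not-true : {b : Bool} → b ≢ true → b ≡ false
not-true {true} h = ⊥-elim (h refl)
not-true {false} h = refl

not-false : {b : Bool} → b ≢ false → b ≡ true
not-false {true} h = refl
not-false {false} h = ⊥-elim (h refl)

≢⇒≡not : {b c : Bool} → b ≢ c → c ≡ not b
≢⇒≡not {true} {true} h = ⊥-elim (h refl)
≢⇒≡not {true} {false} h = refl
≢⇒≡not {false} {true} h = refl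
≢⇒≡not {false} {false} h = ⊥-elim (h refl)

bool-ext : {b c : Bool} → (b ≡ true → c ≡ true) → (c ≡ true → b ≡ true) → b ≡ c
bool-ext {true} f g = sym (f refl)
bool-ext {false} {true} f g = g refl
bool-ext {false} {false} f g = refl

unique-head : {x : Elt} {xs : List Elt} → Unique (x ∷ xs) → x ∉ xs
unique-head = Uₚ.Unique[x∷xs]⇒x∉xs

unique-tail : {x : Elt} {xs : List Elt} → Unique (x ∷ xs) → Unique xs
unique-tail (_ ∷ u) = u

unique-cons : {x : Elt} {xs : List Elt} → x ∉ xs → Unique xs → Unique (x ∷ xs)
unique-cons {x = x} {xs} x∉ u = All.tabulate (λ y∈ x≡y → x∉ (subst (_∈ xs) (sym x≡y) y∈)) ∷ u

unique-++ˡ : {xs ys : List Elt} → Unique (xs ++ ys) → Unique xs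
unique-++ˡ {xs = []} u = []
unique-++ˡ {xs = x ∷ xs} u = unique-cons (λ x∈ → unique-head u (∈-++⁺ˡ x∈)) (unique-++ˡ (unique-tail u))

unique-++ʳ : (xs : List Elt) {ys : List Elt} → Unique (xs ++ ys) → Unique ys
unique-++ʳ [] u = u
unique-++ʳ (x ∷ xs) u = unique-++ʳ xs (unique-tail u)

unique-disjoint : (xs : List Elt) {ys : List Elt} {x : Elt} → Unique (xs ++ ys) → x ∈ xs → x ∉ ys
unique-disjoint (x ∷ xs) u (here refl) x∈ = unique-head u (∈-++⁺ʳ xs x∈)
unique-disjoint (x ∷ xs) u (there x∈) = unique-disjoint xs (unique-tail u) x∈

unique-++ : {xs ys : List Elt} → Unique xs → Unique ys → (∀ {x} → x ∈ xs → x ∉ ys) → Unique (xs ++ ys)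
unique-++ u v d = Uₚ.++⁺ u v (λ { (a , b) → d a b })

unique-swap : (xs : List Elt) {ys : List Elt} → Unique (xs ++ ys) → Unique (ys ++ xs)
unique-swap xs u = unique-++ (unique-++ʳ xs u) (unique-++ˡ u) (λ y∈ x∈ → unique-disjoint xs u x∈ y∈)

∈-swap : (xs : List Elt) {ys : List Elt} {x : Elt} → x ∈ xs ++ ys → x ∈ ys ++ xs
∈-swap xs {ys} x∈ with ∈-++⁻ xs x∈
... | inj₁ a = ∈-++⁺ʳ ys a
... | inj₂ b = ∈-++⁺ˡ b

∈-reverse : {x : Elt} {xs : List Elt} → x ∈ xs → x ∈ reverse xs
∈-reverse {x = x} {y ∷ xs} x∈ rewrite unfold-reverse y xs with x∈
... | here refl = ∈-++⁺ʳ (reverse xs) (here refl)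
... | there q = ∈-++⁺ˡ (∈-reverse q)

∈-reverse⁻ : {x : Elt} {xs : List Elt} → x ∈ reverse xs → x ∈ xs
∈-reverse⁻ {xs = xs} x∈ = subst (_ ∈_) (Lₚ.reverse-involutive xs) (∈-reverse x∈)

unique-reverse : {xs : List Elt} → Unique xs → Unique (reverse xs)
unique-reverse {xs = []} u = []
unique-reverse {xs = x ∷ xs} u rewrite unfold-reverse x xs =
  unique-++ (unique-reverse (unique-tail u)) ([] ∷ [])
    λ { y∈ (here refl) → unique-head u (∈-reverse⁻ y∈) }

unique-lookup : {xs : List Elt} → Unique xs → {i j : Fin (length xs)} → lookup xs i ≡ lookup xs j → i ≡ j
unique-lookup {xs = x ∷ xs} u {F.zero} {F.zero} e = refl
unique-lookup {xs = x ∷ xs} u {F.zero} {F.suc j} e = ⊥-elim (unique-head u (subst (_∈ xs) (sym e) (∈-lookup j)))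
unique-lookup {xs = x ∷ xs} u {F.suc i} {F.zero} e = ⊥-elim (unique-head u (subst (_∈ xs) e (∈-lookup i)))
unique-lookup {xs = x ∷ xs} u {F.suc i} {F.suc j} e = cong F.suc (unique-lookup (unique-tail u) e)

lookup-index : {x : Elt} {xs : List Elt} (p : x ∈ xs) → x ≡ lookup xs (Any.index p)
lookup-index (here e) = e
lookup-index (there p) = lookup-index p

-- Pigeonhole. The map `g` may use the membership proof and has to be injective only on the members,
-- which allows codes such as the index of `x` in another list.
unique-length : {m : ℕ} {xs : List Elt} (g : ∀ {x} → x ∈ xs → Fin m) →
  (∀ {x y} (p : x ∈ xs) (q : y ∈ xs) → g p ≡ g q → x ≡ y) → Unique xs → length xs ≤ m
unique-length {m = m} {xs} g inj u with length xs ℕ.≤? m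
... | yes p = p
... | no ¬p with pigeonhole (ℕₚ.≰⇒> ¬p) (λ i → g (∈-lookup i))
... | i , j , i<j , e = ⊥-elim (Fₚ.<⇒≢ i<j (unique-lookup u (inj (∈-lookup i) (∈-lookup j) e)))

unique-⊆-length : {xs ys : List Elt} → Unique xs → (∀ {x} → x ∈ xs → x ∈ ys) → length xs ≤ length ys
unique-⊆-length {ys = ys} u s = unique-length (λ p → Any.index (s p))
  (λ p q e → trans (lookup-index (s p)) (trans (cong (lookup ys) e) (sym (lookup-index (s q))))) u

unique-fin-length : {xs : List (Fin n)} → Unique xs → length xs ≤ n
unique-fin-length u = unique-length (λ {x} _ → x) (λ _ _ e → e) u

∈-of-full : {xs : List (Fin n)} → Unique xs → n ≤ length xs → ∀ x → x ∈ xs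
∈-of-full {xs = xs} u h x with x ∈? xs
... | yes p = p
... | no ¬p = ⊥-elim (ℕₚ.<-irrefl refl (≤-trans (s≤s h) (unique-fin-length (unique-cons ¬p u))))

length-of-full : {xs : List (Fin n)} → Unique xs → (∀ x → x ∈ xs) → length xs ≡ n
length-of-full {n = n} {xs} u h = ℕₚ.≤-antisym (unique-fin-length u)
  (subst (_≤ length xs) (Lₚ.length-tabulate {n = n} id) (unique-⊆-length (Uₚ.allFin⁺ n) (λ {x} _ → h x)))

-- Used on the vertices of a closed walk: the two occurrences of `w` mark where the walk is cut in
-- two.
unique-or-dup : (xs : List (Fin n)) →
  Unique xs ⊎ Σ (Fin n) λ w → ∃₂ λ l₁ l₂ → Σ (List (Fin n)) λ l₃ → xs ≡ l₁ ++ w ∷ l₂ ++ w ∷ l₃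
unique-or-dup [] = inj₁ []
unique-or-dup (x ∷ xs) with x ∈? xs
... | yes p = let l , r , e = ∈-∃++ p in inj₂ (x , [] , l , r , cong (x ∷_) e)
... | no ¬p with unique-or-dup xs
... | inj₁ u = inj₁ (unique-cons ¬p u)
... | inj₂ (w , a , b , c , e) = inj₂ (w , x ∷ a , b , c , cong (x ∷_) e)

map-agree : {f g : Elt → Elt′} {xs : List Elt} → map f xs ≡ map g xs → ∀ {x} → x ∈ xs → f x ≡ g x
map-agree {xs = x ∷ xs} e (here refl) = proj₁ (∷-injective e)
map-agree {xs = x ∷ xs} e (there p) = map-agree (proj₂ (∷-injective e)) p

agree-map : {f g : Elt → Elt′} {xs : List Elt} → (∀ {x} → x ∈ xs → f x ≡ g x) → map f xs ≡ map g xs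
agree-map {xs = []} h = refl
agree-map {xs = x ∷ xs} h = cong₂ _∷_ (h (here refl)) (agree-map (h ∘ there))

-- Reachability is decided by allowing one more intermediate vertex at a time.
module _ {R : Fin n → Fin n → Set} (R? : ∀ u v → Dec (R u v)) where

  Via : ℕ → Fin n → Fin n → Set
  Via zero u v = u ≡ v ⊎ R u v
  Via (suc k) u v = Via k u v ⊎ Σ (Fin n) λ w → toℕ w ≡ k × Via k u w × Via k w v

  via? : ∀ k u v → Dec (Via k u v)
  via? zero u v = (u ≟ᶠ v) ⊎-dec R? u v
  via? (suc k) u v = via? k u v ⊎-dec any? (λ w → (toℕ w ℕ.≟ k) ×-dec (via? k u w ×-dec via? k w v))

  via→star : ∀ k {u v} → Via k u v → Star R u v
  via→star zero (inj₁ refl) = ε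
  via→star zero (inj₂ r) = r ◅ ε
  via→star (suc k) (inj₁ p) = via→star k p
  via→star (suc k) (inj₂ (w , _ , p , q)) = via→star k p ◅◅ via→star k q

  via-trans : ∀ k {u w v} → toℕ w < k → Via k u w → Via k w v → Via k u v
  via-trans (suc k) {u} {w} {v} w<k p q with toℕ w ℕ.≟ k
  ... | yes e = inj₂ (w , e , toTop p , fromTop q)
    where
    toTop : Via (suc k) u w → Via k u w
    toTop (inj₁ p) = p
    toTop (inj₂ (w' , e' , p , _)) rewrite toℕ-injective (trans e' (sym e)) = p
    fromTop : Via (suc k) w v → Via k w v
    fromTop (inj₁ p) = p
    fromTop (inj₂ (w' , e' , _ , p)) rewrite toℕ-injective (trans e' (sym e)) = p
  ... | no ¬e with ℕₚ.≤∧≢⇒< (ℕₚ.≤-pred w<k) ¬e | p | q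
  ... | l | inj₁ a | inj₁ b = inj₁ (via-trans k l a b)
  ... | l | inj₁ a | inj₂ (t , e , b , c) = inj₂ (t , e , via-trans k l a b , c)
  ... | l | inj₂ (t , e , a , b) | inj₁ c = inj₂ (t , e , a , via-trans k l b c)
  -- Both halves pass through the vertex of index `k`; the closed walk between the two visits is
  -- dropped.
  ... | l | inj₂ (t , e , a , b) | inj₂ (t' , e' , c , d) = inj₂ (t , e , a , subst (λ z → Via k z v) (toℕ-injective (trans e' (sym e))) d)

  via-weaken : ∀ k {u v} → R u v → Via k u v
  via-weaken zero r = inj₂ r
  via-weaken (suc k) r = inj₁ (via-weaken k r)

  via-refl : ∀ k {u} → Via k u u
  via-refl zero = inj₁ refl
  via-refl (suc k) = inj₁ (via-refl k)

  star→via : ∀ {u v} → Star R u v → Via n u v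
  star→via ε = via-refl n
  star→via (_◅_ {j = j} r s) = via-trans n (toℕ<n j) (via-weaken n r) (star→via s)

  star? : ∀ u v → Dec (Star R u v)
  star? u v = map′ (via→star n) star→via (via? n u v)

-- Parity; last entry and initial segment of a nonempty list.

odd : ℕ → Bool
odd zero = false
odd (suc m) = not (odd m)

not-xorˡ : ∀ b c → not b xor c ≡ not (b xor c)
not-xorˡ true true = refl
not-xorˡ true false = refl
not-xorˡ false c = refl

odd-+ : ∀ a b → odd (a + b) ≡ odd a xor odd b
odd-+ zero b = refl
odd-+ (suc a) b = trans (cong not (odd-+ a b)) (sym (not-xorˡ (odd a) (odd b)))

xor-same : ∀ b → b xor b ≡ false
xor-same true = refl
xor-same false = refl

lst : {A : Set} → A → List A → A
lst x [] = x
lst x (y ∷ l) = lst y l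

ini : {A : Set} → A → List A → List A
ini x [] = []
ini x (y ∷ l) = x ∷ ini y l

ini-lst : {A : Set} (x : A) (l : List A) → ini x l ++ lst x l ∷ [] ≡ x ∷ l
ini-lst x [] = refl
ini-lst x (y ∷ l) = cong (x ∷_) (ini-lst y l)

lst-++ : {A : Set} (x : A) (l : List A) {y : A} (r : List A) → lst x (l ++ y ∷ r) ≡ lst y r
lst-++ x [] r = refl
lst-++ x (z ∷ l) r = lst-++ z l r

ini-++ : {A : Set} (x : A) (l : List A) {y : A} → ini x (l ++ y ∷ []) ≡ x ∷ l
ini-++ x [] = refl
ini-++ x (z ∷ l) = cong (x ∷_) (ini-++ z l)

lst∈ : {A : Set} (x : A) (l : List A) → lst x l ∈ x ∷ l
lst∈ x [] = here refl
lst∈ x (y ∷ l) = there (lst∈ y l)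

-- Paths, ears and odd cycles in a simple graph.

module GraphTheory {n : ℕ} (X : Graph n) (simple : IsSimple X) where

  adj-sym : ∀ {u v} → Adj X u v → Adj X v u
  adj-sym {u} {v} e = trans (proj₂ simple v u) e

  adj-irr : ∀ {u} → ¬ Adj X u u
  adj-irr {u} e = true≢false e (proj₁ simple u)

  adj-≢ : ∀ {u v} → Adj X u v → u ≢ v
  adj-≢ e refl = adj-irr e

  adj? : ∀ u v → Dec (Adj X u v)
  adj? u v = X u v ≟ᵇ true

  -- The list holds the interior vertices only. Edges, paths, ears and closed paths (with equal
  -- ends) then share one form, and joining at `w` is concatenation with `w` in between.
  Path : Fin n → List (Fin n) → Fin n → Set
  Path u [] v = Adj X u v
  Path u (w ∷ l) v = Adj X u w × Path w l v

  path-++ : ∀ {u} l {w m v} → Path u l w → Path w m v → Path u (l ++ w ∷ m) v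
  path-++ [] p q = p , q
  path-++ (x ∷ l) (e , p) q = e , path-++ l p q

  path-split : ∀ {u} l {w m v} → Path u (l ++ w ∷ m) v → Path u l w × Path w m v
  path-split [] (e , p) = e , p
  path-split (x ∷ l) (e , p) = (e , proj₁ (path-split l p)) , proj₂ (path-split l p)

  path-rev : ∀ {u} l {v} → Path u l v → Path v (reverse l) u
  path-rev [] e = adj-sym e
  path-rev (x ∷ l) {v} (e , p) = subst (λ z → Path v z _) (sym (unfold-reverse x l)) (path-++ (reverse l) (path-rev l p) (adj-sym e))

  path-rotate : ∀ {c} l {w m} → Path c (l ++ w ∷ m) c → Path w (m ++ c ∷ l) w
  path-rotate l {w} {m} p = path-++ m (proj₂ (path-split l p)) (proj₁ (path-split l p))

  unique-rotate : ∀ {c : Fin n} l {w m} → Unique (c ∷ l ++ w ∷ m) → Unique (w ∷ m ++ c ∷ l)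
  unique-rotate {c} l u = unique-swap (c ∷ l) u

  ∈-rotate : ∀ {c : Fin n} l {w m x} → x ∈ c ∷ l ++ w ∷ m → x ∈ w ∷ m ++ c ∷ l
  ∈-rotate {c} l = ∈-swap (c ∷ l)

  Chain : List (Fin n) → Set
  Chain [] = ⊤
  Chain (x ∷ []) = ⊤
  Chain (x ∷ y ∷ l) = Adj X x y × Chain (y ∷ l)

  path→chain : ∀ {u} l {v} → Path u l v → Chain (u ∷ l ++ v ∷ [])
  path→chain [] e = e , tt
  path→chain (x ∷ l) (e , p) = e , path→chain l p

  path→chain′ : ∀ {u} l {v} → Path u l v → Chain (u ∷ l)
  path→chain′ [] e = tt
  path→chain′ (x ∷ l) (e , p) = e , path→chain′ l p

  path-last : ∀ {u} l {v} → Path u l v → Adj X (lst u l) v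
  path-last [] e = e
  path-last (x ∷ l) (e , p) = path-last l p

  chain→path : ∀ {u} l {v} → Chain (u ∷ l) → Adj X (lst u l) v → Path u l v
  chain→path [] c e = e
  chain→path (x ∷ l) (d , c) e = d , chain→path l c e

  chain-tail : ∀ {x} l → Chain (x ∷ l) → Chain l
  chain-tail [] c = tt
  chain-tail (y ∷ l) (_ , c) = c

  chain-lookup : ∀ ps → Chain ps → {i j : Fin (length ps)} → suc (toℕ i) ≡ toℕ j → Adj X (lookup ps i) (lookup ps j)
  chain-lookup (x ∷ y ∷ l) (e , c) {F.zero} {F.suc F.zero} h = e
  chain-lookup (x ∷ y ∷ l) (e , c) {F.suc i} {F.suc j} h = chain-lookup (y ∷ l) c (ℕₚ.suc-injective h)

  AdjIn : List (Fin n) → Fin n → Fin n → Set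
  AdjIn H u v = Adj X u v × u ∈ H × v ∈ H

  ConnIn : List (Fin n) → Set
  ConnIn H = ∀ {u v} → u ∈ H → v ∈ H → Star (AdjIn H) u v

  exit : ∀ {H : List (Fin n)} {h x} → h ∈ H → x ∉ H → Star (Adj X) h x → ∃₂ λ a b → a ∈ H × b ∉ H × Adj X a b
  exit h∈ x∉ ε = ⊥-elim (x∉ h∈)
  exit {H} h∈ x∉ (_◅_ {j = j} e s) with j ∈? H
  ... | yes j∈ = exit j∈ x∉ s
  ... | no j∉ = _ , _ , h∈ , j∉ , e

  connIn-mono : ∀ {H K} → (∀ {x} → x ∈ H → x ∈ K) → ∀ {u v} → Star (AdjIn H) u v → Star (AdjIn K) u v
  connIn-mono f = Star.map (λ { (e , a , b) → e , f a , f b })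

  connIn-cons : ∀ {H h z} → ConnIn H → h ∈ H → Adj X h z → ConnIn (z ∷ H)
  connIn-cons c h∈ e (here refl) (here refl) = ε
  connIn-cons c h∈ e (here refl) (there v∈) = (adj-sym e , here refl , there h∈) ◅ connIn-mono there (c h∈ v∈)
  connIn-cons c h∈ e (there u∈) (here refl) = connIn-mono there (c u∈ h∈) ◅◅ ((e , there h∈ , here refl) ◅ ε)
  connIn-cons c h∈ e (there u∈) (there v∈) = connIn-mono there (c u∈ v∈)

  connIn-chain : ∀ ps → Chain ps → ConnIn ps
  connIn-chain (x ∷ []) c (here refl) (here refl) = ε
  connIn-chain (x ∷ y ∷ ps) (e , c) = connIn-cons (connIn-chain (y ∷ ps) c) (here refl) (adj-sym e)

  -- Provides base regions of a prescribed size around a given connected set. The number `f` bounds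
  -- the vertices still to be added.
  grow : Connected X → ∀ f N {H x} → ConnIn H → Unique H → x ∈ H → length H ≤ N → N ≤ length H + f → N ≤ n →
    Σ (List (Fin n)) λ K → ConnIn K × Unique K × (∀ {y} → y ∈ H → y ∈ K) × length K ≡ N
  grow conn f N {H} {x} c u x∈ le ge N≤n with length H ℕ.≟ N
  ... | yes e = H , c , u , id , e
  grow conn zero N {H} c u x∈ le ge N≤n | no ¬e = ⊥-elim (¬e (ℕₚ.≤-antisym le (subst (N ≤_) (ℕₚ.+-identityʳ _) ge)))
  grow conn (suc f) N {H} {x} c u x∈ le ge N≤n | no ¬e with any? (λ y → ¬? (y ∈? H))
  ... | no ¬p = ⊥-elim (ℕₚ.<-irrefl refl (≤-trans (ℕₚ.≤∧≢⇒< le ¬e) (≤-trans N≤n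
                  (≤-reflexive (sym (length-of-full u (λ y → decidable-stable (y ∈? H) (λ y∉ → ¬p (y , y∉)))))))))
  ... | yes (y , y∉) with exit x∈ y∉ (conn x y)
  ... | a , b , a∈ , b∉ , e =
    let K , c' , u' , s , l = grow conn f N (connIn-cons c a∈ e) (unique-cons b∉ u) (there x∈) (ℕₚ.≤∧≢⇒< le ¬e)
                                (subst (N ≤_) (ℕₚ.+-suc _ f) ge) N≤n
    in K , c' , u' , (λ q → s (there q)) , l

  -- The first outer vertex `z` is a parameter because the region grows by `z` alone, not by the
  -- whole ear.
  record Ear (H : List (Fin n)) (h z h' : Fin n) : Set where
    constructor mkEar
    field
      rest : List (Fin n)
      path : Path h (z ∷ rest) h'
      uniq : Unique (z ∷ rest)
      outside : ∀ {x} → x ∈ z ∷ rest → x ∉ H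

  AdjOut : List (Fin n) → Fin n → Fin n → Set
  AdjOut H u v = Adj X u v × v ∉ H

  cut-at : ∀ {y l v z} → Path y l v → z ∈ y ∷ l → Σ (List (Fin n)) λ m → Path z m v × ∃ λ a → y ∷ l ≡ a ++ z ∷ m
  cut-at {l = l} p (here refl) = l , p , [] , refl
  cut-at {y} {x ∷ l} (e , p) (there q) = let m , p' , a , eq = cut-at p q in m , p' , y ∷ a , cong (y ∷_) eq

  -- A walk outside `H` becomes a path by jumping ahead whenever its first vertex occurs again
  -- later; `cut-at` does the jump.
  out-path : ∀ {H z x h'} → z ∉ H → Star (AdjOut H) z x → Adj X x h' →
    Σ (List (Fin n)) λ l → Path z l h' × Unique (z ∷ l) × (∀ {y} → y ∈ z ∷ l → y ∉ H)
  out-path z∉ ε e = [] , e , unique-cons (λ ()) [] , λ { (here refl) → z∉ }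
  out-path {H} {z} z∉ ((d , y∉) ◅ s) e with out-path y∉ s e
  ... | l , p , u , o with z ∈? (_ ∷ l)
  ... | no ¬q = _ ∷ l , (d , p) , unique-cons ¬q u , λ { (here refl) → z∉ ; (there r) → o r }
  ... | yes q = let m , p' , a , eq = cut-at p q in m , p' , unique-++ʳ a (subst Unique eq u)
                  , λ {y} r → o (subst (y ∈_) (sym eq) (∈-++⁺ʳ a r))

  mk-ear : ∀ {H h z x h'} → Adj X h z → z ∉ H → Star (AdjOut H) z x → Adj X x h' → Ear H h z h'
  mk-ear d z∉ s e = let l , p , u , o = out-path z∉ s e in mkEar l (d , p) u o

  -- The part walked so far lies outside `H`; the part still to come avoids `h`, so the vertex where
  -- it enters `H` differs from `h`.
  first-return : ∀ {H h z g} → Adj X h z → z ∉ H → g ∈ H → ∀ {x} → x ∉ H → Star (AdjOut H) z x →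
    Star (AdjMinusVertex X h) x g → ∃ λ h' → h' ∈ H × h' ≢ h × Ear H h z h'
  first-return d z∉ g∈ x∉ s ε = ⊥-elim (x∉ g∈)
  first-return {H} d z∉ g∈ x∉ s (_◅_ {j = y} (e , _ , y≢) t) with y ∈? H
  ... | yes y∈ = y , y∈ , y≢ , mk-ear d z∉ s e
  ... | no y∉ = first-return d z∉ g∈ y∉ (s ◅◅ ((e , y∉) ◅ ε)) t

  -- As `h` is no cut-vertex, `z` still reaches `g` after `h` is removed, and the first vertex of
  -- `H` on the way closes the ear.
  open-ear : Connected X → ¬ HasCutVertex X → ∀ {H h z g} → h ∈ H → g ∈ H → g ≢ h → z ∉ H → Adj X h z →
    ∃ λ h' → h' ∈ H × h' ≢ h × Ear H h z h'
  open-ear conn nocut {H} {h} {z} {g} h∈ g∈ g≢ z∉ e = first-return e z∉ g∈ z∉ ε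
    (decidable-stable (star? (λ a b → adj? a b ×-dec (¬? (a ≟ᶠ h) ×-dec ¬? (b ≟ᶠ h))) z g)
      (λ ¬s → nocut (h , z , g , (λ z≡h → z∉ (subst (_∈ H) (sym z≡h) h∈)) , g≢ , conn z g , ¬s)))

  -- The vertex `base` is not counted in `rest`, hence the even parity. It also excludes the
  -- back-and-forth walk along one edge, which has a single interior vertex.
  record OddCycle : Set where
    constructor mkOdd
    field
      base : Fin n
      rest : List (Fin n)
      closed : Path base rest base
      uniq : Unique (base ∷ rest)
      parity : odd (length rest) ≡ false

  odd-half : ∀ a b → odd (a + suc b) ≡ false → odd a ≡ false ⊎ odd b ≡ false
  odd-half a b h with bool-cases (odd a)
  ... | inj₂ e = inj₁ e
  ... | inj₁ e = inj₂ (lem (trans (sym (odd-+ a (suc b))) h) e)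
    where
    lem : ∀ {p q} → p xor not q ≡ false → p ≡ true → q ≡ false
    lem {true} {false} h e = refl
    lem {true} {true} () e

  -- A repeated vertex cuts the walk into two shorter closed walks whose lengths add up to an odd
  -- number, so one of them is odd again.
  odd-closed-walk : ∀ f {c} l → length l < f → Path c l c → odd (length l) ≡ false → OddCycle
  odd-closed-walk (suc f) {c} l le p o with unique-or-dup (c ∷ l)
  ... | inj₁ u = mkOdd c l p u o
  odd-closed-walk (suc f) {c} l le p o | inj₂ (w , [] , l₂ , l₃ , refl)
    with odd-half (length l₂) (length l₃) (subst (λ z → odd z ≡ false) (length-++ l₂) o) | path-split l₂ p
  ... | inj₁ o' | q , _ = odd-closed-walk f l₂ (≤-trans (ℕₚ.m<m+n (length l₂) (s≤s z≤n)) (subst (_≤ f) (length-++ l₂) (ℕₚ.≤-pred le))) q o'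
  ... | inj₂ o' | _ , q = odd-closed-walk f l₃ (≤-trans (ℕₚ.m≤n+m (suc (length l₃)) (length l₂)) (subst (_≤ f) (length-++ l₂) (ℕₚ.≤-pred le))) q o'
  odd-closed-walk (suc f) {c} l le p o | inj₂ (w , a ∷ l₁ , l₂ , l₃ , refl) =
    [ (λ o' → odd-closed-walk f l₂ (≤-trans (s≤s (ℕₚ.m≤n+m _ _)) le') (proj₁ rest) o')
    , (λ o' → odd-closed-walk f (l₁ ++ w ∷ l₃) (≤-trans (s≤s (≤-trans (≤-reflexive (length-++ l₁)) (ℕₚ.m≤m+n _ _))) le')
                (path-++ l₁ (proj₁ sp) (proj₂ rest)) (trans (cong odd (length-++ l₁)) o')) ]′
    (odd-half (length l₂) (length l₁ + suc (length l₃)) (trans (cong odd eq₂) o))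
    where
    sp = path-split l₁ p
    rest = path-split l₂ (proj₂ sp)
    eq : length (l₁ ++ w ∷ l₂ ++ w ∷ l₃) ≡ length l₁ + suc (length l₂ + suc (length l₃))
    eq = trans (length-++ l₁) (cong (λ z → length l₁ + suc z) (length-++ l₂))
    arith : ∀ a b c → suc ((a + suc c) + b) ≡ a + suc (b + suc c)
    arith a b c = trans (cong suc (trans (ℕₚ.+-assoc a (suc c) b) (cong (a +_) (ℕₚ.+-comm (suc c) b)))) (sym (ℕₚ.+-suc a _))
    eq₂ : length l₂ + suc (length l₁ + suc (length l₃)) ≡ length (l₁ ++ w ∷ l₂ ++ w ∷ l₃)
    eq₂ = trans (trans (ℕₚ.+-suc (length l₂) _) (trans (cong suc (ℕₚ.+-comm (length l₂) _)) (arith (length l₁) (length l₂) (length l₃)))) (sym eq)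
    le' : suc ((length l₁ + suc (length l₃)) + length l₂) ≤ f
    le' = subst (_≤ f) (trans eq (sym (arith (length l₁) (length l₂) (length l₃)))) (ℕₚ.≤-pred le)

  len : ∀ {u v} → Star (Adj X) u v → ℕ
  len ε = 0
  len (_ ◅ s) = suc (len s)

  len-◅◅ : ∀ {u v w} (s : Star (Adj X) u v) (t : Star (Adj X) v w) → len (s ◅◅ t) ≡ len s + len t
  len-◅◅ ε t = refl
  len-◅◅ (_ ◅ s) t = cong suc (len-◅◅ s t)

  back : ∀ {u v} → Star (Adj X) u v → Star (Adj X) v u
  back ε = ε
  back (e ◅ s) = back s ◅◅ (adj-sym e ◅ ε)

  len-back : ∀ {u v} (s : Star (Adj X) u v) → len (back s) ≡ len s
  len-back ε = refl
  len-back (e ◅ s) = trans (len-◅◅ (back s) _) (trans (ℕₚ.+-comm _ 1) (cong suc (len-back s)))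

  path-of-star : ∀ {u v} (s : Star (Adj X) u v) → len s ≡ 0 ⊎ Σ (List (Fin n)) λ l → Path u l v × suc (length l) ≡ len s
  path-of-star ε = inj₁ refl
  path-of-star (e ◅ ε) = inj₂ ([] , e , refl)
  path-of-star (e ◅ s@(_ ◅ _)) with path-of-star s
  ... | inj₂ (l , p , q) = inj₂ (_ ∷ l , (e , p) , cong suc q)

  -- Colour a vertex by the parity of the walk that `conn` gives from the root. Some edge joins two
  -- vertices of one colour, and going out, across it and back is an odd closed walk.
  odd-cycle : Connected X → Fin n → ¬ Bipartite X → OddCycle
  odd-cycle conn r nb with any? (λ u → any? (λ v → adj? u v ×-dec (colour u ≟ᵇ colour v)))
    where
    colour : Fin n → Bool
    colour v = odd (len (conn r v))
  ... | no ¬p = ⊥-elim (nb (_ , λ u v e c → ¬p (u , v , e , c)))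
  ... | yes (u , v , e , c) = go (path-of-star t)
    where
    t = conn r u ◅◅ (e ◅ back (conn r v))
    odd-t : odd (len t) ≡ true
    odd-t = trans (cong odd (len-◅◅ (conn r u) _)) (trans (odd-+ (len (conn r u)) _)
      (trans (cong₂ (λ a b → a xor not (odd b)) c (len-back (conn r v))) (lem (odd (len (conn r v))))))
      where
      lem : ∀ b → b xor not b ≡ true
      lem true = refl
      lem false = refl
    go : len t ≡ 0 ⊎ _ → OddCycle
    go (inj₁ z) = ⊥-elim (true≢false odd-t (cong odd z))
    go (inj₂ (l , p , q)) = odd-closed-walk (suc (length l)) l ≤-refl p
      (not-true (λ o → true≢false odd-t (trans (cong odd (sym q)) (cong not o))))

-- Transpositions of positions and of people.

module _ {n : ℕ} where

  infixl 8 _!_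
  _!_ : Permutation′ n → Fin n → Fin n
  σ ! x = σ ⟨$⟩ʳ x

  !-inj : (σ : Permutation′ n) {x y : Fin n} → σ ! x ≡ σ ! y → x ≡ y
  !-inj σ e = trans (sym (inverseˡ σ)) (trans (cong (σ ⟨$⟩ˡ_) e) (inverseˡ σ))

  infix 4 _≗ₚ_
  _≗ₚ_ : Permutation′ n → Permutation′ n → Set
  σ ≗ₚ τ = ∀ x → σ ! x ≡ τ ! x

  tr-l : (u v : Fin n) → transpose u v ! u ≡ v
  tr-l u v with u ≟ᶠ u
  ... | yes _ = refl
  ... | no h = ⊥-elim (h refl)

  tr-r : (u v : Fin n) → transpose u v ! v ≡ u
  tr-r u v with v ≟ᶠ u
  ... | yes e = e
  ... | no _ with v ≟ᶠ v
  ... | yes _ = refl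
  ... | no h = ⊥-elim (h refl)

  tr-o : (u v : Fin n) {x : Fin n} → x ≢ u → x ≢ v → transpose u v ! x ≡ x
  tr-o u v {x} a b with x ≟ᶠ u
  ... | yes e = ⊥-elim (a e)
  ... | no _ with x ≟ᶠ v
  ... | yes e = ⊥-elim (b e)
  ... | no _ = refl

  tr-cases : (u v x : Fin n) → (x ≡ u × transpose u v ! x ≡ v) ⊎ (x ≡ v × transpose u v ! x ≡ u) ⊎ (x ≢ u × x ≢ v × transpose u v ! x ≡ x)
  tr-cases u v x with x ≟ᶠ u
  ... | yes e = inj₁ (e , refl)
  ... | no a with x ≟ᶠ v
  ... | yes e = inj₂ (inj₁ (e , refl))
  ... | no b = inj₂ (inj₂ (a , b , refl))

  tr-conj : (g : Permutation′ n) (u v x : Fin n) → transpose (g ! u) (g ! v) ! (g ! x) ≡ g ! (transpose u v ! x)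
  tr-conj g u v x with tr-cases u v x
  ... | inj₁ (refl , e) = trans (tr-l (g ! u) (g ! v)) (cong (g !_) (sym e))
  ... | inj₂ (inj₁ (refl , e)) = trans (tr-r (g ! u) (g ! v)) (cong (g !_) (sym e))
  ... | inj₂ (inj₂ (a , b , e)) = trans (tr-o (g ! u) (g ! v) (a ∘ !-inj g) (b ∘ !-inj g)) (cong (g !_) (sym e))

  tr-invol : (u v x : Fin n) → transpose u v ! (transpose u v ! x) ≡ x
  tr-invol u v x with tr-cases u v x
  ... | inj₁ (refl , e) = trans (cong (transpose u v !_) e) (tr-r u v)
  ... | inj₂ (inj₁ (refl , e)) = trans (cong (transpose u v !_) e) (tr-l u v)
  ... | inj₂ (inj₂ (a , b , e)) = trans (cong (transpose u v !_) e) e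

  tr-comm : (u v x : Fin n) → transpose u v ! x ≡ transpose v u ! x
  tr-comm u v x with tr-cases u v x
  ... | inj₁ (refl , e) = trans e (sym (tr-r v u))
  ... | inj₂ (inj₁ (refl , e)) = trans e (sym (tr-l v u))
  ... | inj₂ (inj₂ (a , b , e)) = trans e (sym (tr-o v u b a))

  tr-self : (u x : Fin n) → transpose u u ! x ≡ x
  tr-self u x with tr-cases u u x
  ... | inj₁ (refl , e) = e
  ... | inj₂ (inj₁ (refl , e)) = e
  ... | inj₂ (inj₂ (_ , _ , e)) = e

  swap : Fin n → Fin n → Permutation′ n → Permutation′ n
  swap a b σ = transpose a b ∘ₚ σ

  swap-l : ∀ a b σ → swap a b σ ! a ≡ σ ! b
  swap-l a b σ = cong (σ !_) (tr-l a b)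

  swap-r : ∀ a b σ → swap a b σ ! b ≡ σ ! a
  swap-r a b σ = cong (σ !_) (tr-r a b)

  swap-o : ∀ a b σ {x} → x ≢ a → x ≢ b → swap a b σ ! x ≡ σ ! x
  swap-o a b σ p q = cong (σ !_) (tr-o a b p q)

  -- Translates what a sequence of moves did to positions into a renaming of people; `dx-agree` and
  -- `cyc-agree` do the same for two disjoint transpositions and for a 3-cycle.
  ex-agree : (τ τ' : Permutation′ n) (p q : Fin n) → τ' ! p ≡ τ ! q → τ' ! q ≡ τ ! p →
    (∀ x → x ≢ p → x ≢ q → τ' ! x ≡ τ ! x) → τ' ≗ₚ τ ∘ₚ transpose (τ ! p) (τ ! q)
  ex-agree τ τ' p q ep eq o x with x ≟ᶠ p
  ... | yes refl = trans ep (sym (tr-l (τ ! p) (τ ! q)))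
  ... | no a with x ≟ᶠ q
  ... | yes refl = trans eq (sym (tr-r (τ ! p) (τ ! q)))
  ... | no b = trans (o x a b) (sym (tr-o (τ ! p) (τ ! q) (a ∘ !-inj τ) (b ∘ !-inj τ)))

  dx-agree : (τ τ' : Permutation′ n) (p q r s : Fin n) → p ≢ r → p ≢ s → q ≢ r → q ≢ s →
    τ' ! p ≡ τ ! q → τ' ! q ≡ τ ! p → τ' ! r ≡ τ ! s → τ' ! s ≡ τ ! r →
    (∀ x → x ≢ p → x ≢ q → x ≢ r → x ≢ s → τ' ! x ≡ τ ! x) →
    τ' ≗ₚ (τ ∘ₚ transpose (τ ! p) (τ ! q)) ∘ₚ transpose (τ ! r) (τ ! s)
  dx-agree τ τ' p q r s pr ps qr qs ep eq er es o x with x ≟ᶠ p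
  ... | yes refl = trans ep (sym (trans (cong (transpose (τ ! r) (τ ! s) !_) (tr-l (τ ! p) (τ ! q))) (tr-o (τ ! r) (τ ! s) (qr ∘ !-inj τ) (qs ∘ !-inj τ))))
  ... | no a with x ≟ᶠ q
  ... | yes refl = trans eq (sym (trans (cong (transpose (τ ! r) (τ ! s) !_) (tr-r (τ ! p) (τ ! q))) (tr-o (τ ! r) (τ ! s) (pr ∘ !-inj τ) (ps ∘ !-inj τ))))
  ... | no b with x ≟ᶠ r
  ... | yes refl = trans er (sym (trans (cong (transpose (τ ! r) (τ ! s) !_) (tr-o (τ ! p) (τ ! q) (a ∘ !-inj τ) (b ∘ !-inj τ))) (tr-l (τ ! r) (τ ! s))))
  ... | no c with x ≟ᶠ s
  ... | yes refl = trans es (sym (trans (cong (transpose (τ ! r) (τ ! s) !_) (tr-o (τ ! p) (τ ! q) (a ∘ !-inj τ) (b ∘ !-inj τ))) (tr-r (τ ! r) (τ ! s))))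
  ... | no d = trans (o x a b c d) (sym (trans (cong (transpose (τ ! r) (τ ! s) !_) (tr-o (τ ! p) (τ ! q) (a ∘ !-inj τ) (b ∘ !-inj τ)))
                 (tr-o (τ ! r) (τ ! s) (c ∘ !-inj τ) (d ∘ !-inj τ))))

  cyc-agree : (τ τ' : Permutation′ n) (p q r : Fin n) → p ≢ q → q ≢ r → p ≢ r →
    τ' ! p ≡ τ ! q → τ' ! q ≡ τ ! r → τ' ! r ≡ τ ! p →
    (∀ x → x ≢ p → x ≢ q → x ≢ r → τ' ! x ≡ τ ! x) →
    τ' ≗ₚ (τ ∘ₚ transpose (τ ! p) (τ ! q)) ∘ₚ transpose (τ ! p) (τ ! r)
  cyc-agree τ τ' p q r pq qr pr ep eq er o x with x ≟ᶠ p
  ... | yes refl = trans ep (sym (trans (cong (transpose (τ ! p) (τ ! r) !_) (tr-l (τ ! p) (τ ! q))) (tr-o (τ ! p) (τ ! r) (pq ∘ sym ∘ !-inj τ) (qr ∘ !-inj τ))))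
  ... | no a with x ≟ᶠ q
  ... | yes refl = trans eq (sym (trans (cong (transpose (τ ! p) (τ ! r) !_) (tr-r (τ ! p) (τ ! q))) (tr-l (τ ! p) (τ ! r))))
  ... | no b with x ≟ᶠ r
  ... | yes refl = trans er (sym (trans (cong (transpose (τ ! p) (τ ! r) !_) (tr-o (τ ! p) (τ ! q) (a ∘ !-inj τ) (b ∘ !-inj τ))) (tr-r (τ ! p) (τ ! r))))
  ... | no c = trans (o x a b c) (sym (trans (cong (transpose (τ ! p) (τ ! r) !_) (tr-o (τ ! p) (τ ! q) (a ∘ !-inj τ) (b ∘ !-inj τ)))
                 (tr-o (τ ! p) (τ ! r) (a ∘ !-inj τ) (c ∘ !-inj τ))))

-- Reachable states and the renamings that they realise.

module FSCore {n : ℕ} (X : Graph n) (simple : IsSimple X) (part : Fin n → ℕ) where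

  open GraphTheory X simple

  Y : Graph n
  Y u v = not (part u ≡ᵇ part v)

  ≡ᵇ-refl : ∀ m → (m ≡ᵇ m) ≡ true
  ≡ᵇ-refl zero = refl
  ≡ᵇ-refl (suc m) = ≡ᵇ-refl m

  friend : ∀ u v → part u ≢ part v → Adj Y u v
  friend u v h with part u ≡ᵇ part v in eq
  ... | false = refl
  ... | true = ⊥-elim (h (ℕₚ.≡ᵇ⇒≡ _ _ (subst B.T (sym eq) tt)))

  friend⁻¹ : ∀ u v → Adj Y u v → part u ≢ part v
  friend⁻¹ u v e h rewrite h | ≡ᵇ-refl (part v) = true≢false e refl

  infix 4 _⇝_
  -- Reachability up to pointwise equality of the last state, so that a computed state may be
  -- replaced by any bijection with the same values.
  data _⇝_ (σ τ : Permutation′ n) : Set where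
    done : σ ≗ₚ τ → σ ⇝ τ
    step : ∀ {ρ} → FSEdge X Y σ ρ → ρ ⇝ τ → σ ⇝ τ

  ⇝-out : ∀ {σ τ} → σ ⇝ τ → Σ (Permutation′ n) λ ρ → Star (FSEdge X Y) σ ρ × (∀ x → ρ ⟨$⟩ʳ x ≡ τ ⟨$⟩ʳ x)
  ⇝-out (done e) = _ , ε , e
  ⇝-out (step d r) = let ρ , s , e = ⇝-out r in ρ , d ◅ s , e

  edge-resp : ∀ {σ σ' ρ} → σ ≗ₚ σ' → FSEdge X Y σ ρ → FSEdge X Y σ' ρ
  edge-resp e (a , b , ab , f , p , q , o) =
    a , b , ab , subst₂ (Adj Y) (e a) (e b) f , trans p (e b) , trans q (e a) , λ c x y → trans (o c x y) (e c)

  edge-sym : ∀ {σ ρ} → FSEdge X Y σ ρ → FSEdge X Y ρ σ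
  edge-sym {σ} {ρ} (a , b , ab , f , p , q , o) =
    a , b , ab , subst₂ (Adj Y) (sym p) (sym q) (friend (σ ! b) (σ ! a) (friend⁻¹ (σ ! a) (σ ! b) f ∘ sym)) , sym q , sym p , λ c x y → sym (o c x y)

  ⇝-refl : ∀ {σ} → σ ⇝ σ
  ⇝-refl = done (λ _ → refl)

  ⇝-respˡ : ∀ {σ σ' τ} → σ ≗ₚ σ' → σ' ⇝ τ → σ ⇝ τ
  ⇝-respˡ e (done h) = done (λ x → trans (e x) (h x))
  ⇝-respˡ {σ} {σ'} e (step {ρ} d r) = step (edge-resp {σ'} {σ} {ρ} (λ x → sym (e x)) d) r

  ⇝-trans : ∀ {σ τ ρ} → σ ⇝ τ → τ ⇝ ρ → σ ⇝ ρ
  ⇝-trans (done e) r = ⇝-respˡ e r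
  ⇝-trans (step d r) r' = step d (⇝-trans r r')

  ⇝-respʳ : ∀ {σ τ τ'} → σ ⇝ τ → τ ≗ₚ τ' → σ ⇝ τ'
  ⇝-respʳ r e = ⇝-trans r (done e)

  ⇝-sym : ∀ {σ τ} → σ ⇝ τ → τ ⇝ σ
  ⇝-sym (done e) = done (λ x → sym (e x))
  ⇝-sym {σ} (step {ρ} d r) = ⇝-trans (⇝-sym r) (step (edge-sym {σ} {ρ} d) ⇝-refl)

  swap-step : ∀ {σ a b} → Adj X a b → part (σ ! a) ≢ part (σ ! b) → σ ⇝ swap a b σ
  swap-step {σ} {a} {b} e f = step (a , b , e , friend (σ ! a) (σ ! b) f , swap-l a b σ , swap-r a b σ , λ c p q → swap-o a b σ p q) ⇝-refl

  Pres : Permutation′ n → Set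
  Pres g = ∀ x → part (g ! x) ≡ part x

  tr-pres : ∀ {u v} → part u ≡ part v → Pres (transpose u v)
  tr-pres {u} {v} h x with tr-cases u v x
  ... | inj₁ (refl , e) = trans (cong part e) (sym h)
  ... | inj₂ (inj₁ (refl , e)) = trans (cong part e) h
  ... | inj₂ (inj₂ (_ , _ , e)) = cong part e

  -- A class-preserving renaming is an automorphism of `Y`, so it carries a sequence of swaps to a
  -- sequence of swaps. All the group calculus below rests on this.
  act : ∀ {σ τ} (g : Permutation′ n) → Pres g → σ ⇝ τ → σ ∘ₚ g ⇝ τ ∘ₚ g
  act g pg (done e) = done (λ x → cong (g !_) (e x))
  act {σ} g pg (step (a , b , ab , f , p , q , o) r) =
    step (a , b , ab , friend (g ! (σ ! a)) (g ! (σ ! b)) (subst₂ _≢_ (sym (pg (σ ! a))) (sym (pg (σ ! b))) (friend⁻¹ (σ ! a) (σ ! b) f)) , cong (g !_) p , cong (g !_) q , λ c x y → cong (g !_) (o c x y))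
      (act g pg r)

  flip-pres : ∀ {g} → Pres g → Pres (flip g)
  flip-pres {g} pg x = trans (sym (pg (g ⟨$⟩ˡ x))) (cong part (inverseʳ g))

  G-comp : ∀ {σ} (g h : Permutation′ n) → Pres h → σ ⇝ σ ∘ₚ g → σ ⇝ σ ∘ₚ h → σ ⇝ (σ ∘ₚ g) ∘ₚ h
  G-comp {σ} g h ph a b = ⇝-trans b (act {σ} {σ ∘ₚ g} h ph a)

  G-conj : ∀ {σ} (g h : Permutation′ n) → Pres g → Pres h → σ ⇝ σ ∘ₚ g → σ ⇝ σ ∘ₚ h → σ ⇝ σ ∘ₚ (flip g ∘ₚ h ∘ₚ g)
  G-conj {σ} g h pg ph a b = ⇝-sym (⇝-trans (act {(σ ∘ₚ flip g) ∘ₚ h} {σ ∘ₚ h} g pg (act {σ ∘ₚ flip g} {σ} h ph inv))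
      (⇝-trans (act {σ ∘ₚ h} {σ} g pg (⇝-sym b)) (⇝-sym a)))
    where
    inv : σ ∘ₚ flip g ⇝ σ
    inv = ⇝-respʳ {σ ∘ₚ flip g} {(σ ∘ₚ g) ∘ₚ flip g} (act {σ} {σ ∘ₚ g} (flip g) (flip-pres {g} pg) a) (λ x → inverseˡ g)

  Ex : Permutation′ n → Fin n → Fin n → Set
  Ex σ u v = σ ⇝ σ ∘ₚ transpose u v

  Dx : Permutation′ n → Fin n → Fin n → Fin n → Fin n → Set
  Dx σ u v x y = σ ⇝ (σ ∘ₚ transpose u v) ∘ₚ transpose x y

  -- Go from σ to τ, exchange there, and go back along the renamed route: exchangeability belongs to
  -- people and a component, not to a state.
  Ex-inv : ∀ {σ τ u v} → part u ≡ part v → σ ⇝ τ → Ex τ u v → Ex σ u v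
  Ex-inv {σ} {τ} {u} {v} h r e = ⇝-trans r (⇝-trans e (⇝-sym (act {σ} {τ} (transpose u v) (tr-pres h) r)))

  Dx-inv : ∀ {σ τ u v x y} → part u ≡ part v → part x ≡ part y → σ ⇝ τ → Dx τ u v x y → Dx σ u v x y
  Dx-inv {σ} {τ} {u} {v} {x} {y} h k r e = ⇝-trans r (⇝-trans e
    (⇝-sym (act {σ ∘ₚ transpose u v} {τ ∘ₚ transpose u v} (transpose x y) (tr-pres k) (act {σ} {τ} (transpose u v) (tr-pres h) r))))

  Ex-refl : ∀ {σ u} → Ex σ u u
  Ex-refl {σ} {u} = done (λ x → sym (tr-self u (σ ! x)))

  Ex-comm : ∀ {σ u v} → Ex σ u v → Ex σ v u
  Ex-comm {σ} {u} {v} e = ⇝-respʳ e (λ x → tr-comm u v (σ ! x))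

  Dx-commˡ : ∀ {σ u v x y} → Dx σ u v x y → Dx σ v u x y
  Dx-commˡ {σ} {u} {v} {x} {y} e = ⇝-respʳ e (λ z → cong (transpose x y !_) (tr-comm u v (σ ! z)))

  Dx-commʳ : ∀ {σ u v x y} → Dx σ u v x y → Dx σ u v y x
  Dx-commʳ {σ} {u} {v} {x} {y} e = ⇝-respʳ e (λ z → tr-comm x y (transpose u v ! (σ ! z)))

  Dx-refl : ∀ {σ u v} → Dx σ u v u v
  Dx-refl {σ} {u} {v} = done (λ x → sym (tr-invol u v (σ ! x)))

  Dx-sym : ∀ {σ u v x y} → part u ≡ part v → part x ≡ part y → Dx σ u v x y → Dx σ x y u v
  Dx-sym {σ} {u} {v} {x} {y} h k e = ⇝-sym (⇝-respʳ (act {σ ∘ₚ t} {σ ∘ₚ s} s (tr-pres h)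
      (⇝-respʳ {σ ∘ₚ t} {((σ ∘ₚ s) ∘ₚ t) ∘ₚ t} (act {σ} {(σ ∘ₚ s) ∘ₚ t} t (tr-pres k) e) (λ z → tr-invol x y (s ! (σ ! z)))))
      (λ z → tr-invol u v (σ ! z)))
    where
    s = transpose u v
    t = transpose x y

  -- The middle transposition occurs twice and cancels. With `Dx-refl` and `Dx-sym` this makes `Dx`
  -- an equivalence relation on pairs of classmates.
  Dx-trans : ∀ {σ u v x y a b} → part x ≡ part y → part a ≡ part b → Dx σ u v x y → Dx σ x y a b → Dx σ u v a b
  Dx-trans {σ} {u} {v} {x} {y} {a} {b} k l d e =
    ⇝-respʳ (G-comp {σ} (transpose u v ∘ₚ transpose x y) (transpose x y ∘ₚ transpose a b)
               (λ z → trans (tr-pres l (transpose x y ! z)) (tr-pres k z)) d e)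
      (λ z → cong (transpose a b !_) (tr-invol x y (transpose u v ! (σ ! z))))

  Dx-Ex : ∀ {σ u v x y} → part x ≡ part y → Dx σ u v x y → Ex σ x y → Ex σ u v
  Dx-Ex {σ} {u} {v} {x} {y} k d e =
    ⇝-respʳ (G-comp {σ} (transpose u v ∘ₚ transpose x y) (transpose x y) (tr-pres k) d e) (λ z → tr-invol x y (transpose u v ! (σ ! z)))

  Ex-conj : ∀ {σ u v} (g : Permutation′ n) → Pres g → part u ≡ part v → σ ⇝ σ ∘ₚ g → Ex σ u v → Ex σ (g ! u) (g ! v)
  Ex-conj {σ} {u} {v} g pg h r e = ⇝-respʳ (G-conj {σ} g (transpose u v) pg (tr-pres h) r e)
    (λ x → trans (sym (tr-conj g u v (g ⟨$⟩ˡ (σ ! x)))) (cong (transpose (g ! u) (g ! v) !_) (inverseʳ g)))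

  Dx-conj : ∀ {σ u v x y} (g : Permutation′ n) → Pres g → part u ≡ part v → part x ≡ part y → σ ⇝ σ ∘ₚ g →
    Dx σ u v x y → Dx σ (g ! u) (g ! v) (g ! x) (g ! y)
  Dx-conj {σ} {u} {v} {x} {y} g pg h k r e =
    ⇝-respʳ (G-conj {σ} g (transpose u v ∘ₚ transpose x y) pg (λ z → trans (tr-pres k (transpose u v ! z)) (tr-pres h z)) r e)
    (λ z → trans (sym (tr-conj g x y (transpose u v ! (g ⟨$⟩ˡ (σ ! z))))) (cong (transpose (g ! x) (g ! y) !_)
             (trans (sym (tr-conj g u v (g ⟨$⟩ˡ (σ ! z)))) (cong (transpose (g ! u) (g ! v) !_) (inverseʳ g)))))

  -- Conjugating (v w) by (u v) gives (u w).
  Ex-trans : ∀ {σ u v w} → part u ≡ part v → part v ≡ part w → Ex σ u v → Ex σ v w → Ex σ u w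
  Ex-trans {σ} {u} {v} {w} h k d e with w ≟ᶠ u | w ≟ᶠ v
  ... | yes refl | _ = Ex-refl {σ}
  ... | no _ | yes refl = d
  ... | no a | no b = subst₂ (Ex σ) (tr-r u v) (tr-o u v a b) (Ex-conj {σ} (transpose u v) (tr-pres h) k d e)


  -- The contents are read along the list `ps`, so that the shift of a whole row is a single
  -- equation between lists.
  record Moved (σ : Permutation′ n) (ps : List (Fin n)) (cs : List (Fin n)) : Set where
    constructor moved
    field
      state : Permutation′ n
      reach : σ ⇝ state
      content : map (state !_) ps ≡ cs
      fixed : ∀ {x} → x ∉ ps → state ! x ≡ σ ! x

  -- The person on `q` walks to the end of the row, and everybody passed falls back by one vertex.
  -- In `carryBack′` the last person walks to the front instead.
  carry′ : ∀ σ q ps → Chain (q ∷ ps) → Unique (q ∷ ps) → (∀ {p} → p ∈ ps → part (σ ! p) ≢ part (σ ! q)) →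
    Moved σ (q ∷ ps) (map (σ !_) ps ++ σ ! q ∷ [])
  carry′ σ q [] c u f = moved σ ⇝-refl refl (λ _ → refl)
  carry′ σ q (p ∷ ps) (e , c) u f = moved τ (⇝-trans (swap-step e (f (here refl) ∘ sym)) r)
      (cong₂ _∷_ (trans (fx (unique-head u)) (swap-l q p σ)) (trans ct (cong₂ (λ a b → a ++ b ∷ []) same (swap-r q p σ))))
      (λ x∉ → trans (fx (x∉ ∘ there)) (swap-o q p σ (λ { refl → x∉ (here refl) }) (λ { refl → x∉ (there (here refl)) })))
    where
    σ₁ = swap q p σ
    off : ∀ {r} → r ∈ ps → σ₁ ! r ≡ σ ! r
    off r∈ = swap-o q p σ (λ { refl → unique-head u (there r∈) }) (λ { refl → unique-head (unique-tail u) r∈ })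
    open Moved (carry′ σ₁ p ps c (unique-tail u)
      (λ r∈ e → f (there r∈) (trans (sym (cong part (off r∈))) (trans e (cong part (swap-r q p σ)))))) renaming (state to τ; reach to r; content to ct; fixed to fx)
    same : map (σ₁ !_) ps ≡ map (σ !_) ps
    same = agree-map off

  carryBack′ : ∀ σ q ps → Chain (q ∷ ps) → Unique (q ∷ ps) → (∀ {p} → p ∈ ini q ps → part (σ ! p) ≢ part (σ ! lst q ps)) →
    Moved σ (q ∷ ps) (σ ! lst q ps ∷ map (σ !_) (ini q ps))
  carryBack′ σ q [] c u f = moved σ ⇝-refl refl (λ _ → refl)
  carryBack′ σ q (p ∷ ps) (e , c) u f = moved (swap q p τ) (⇝-trans r (swap-step e fr))
      (cong₂ _∷_ (trans (swap-l q p τ) τp) (cong₂ _∷_ (trans (swap-r q p τ) τq)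
        (trans (agree-map (λ {x} x∈ → swap-o q p τ (λ { refl → unique-head u (there x∈) }) (λ { refl → unique-head (unique-tail u) x∈ })))
               (proj₂ (∷-injective ct)))))
      (λ x∉ → trans (swap-o q p τ (λ { refl → x∉ (here refl) }) (λ { refl → x∉ (there (here refl)) })) (fx (x∉ ∘ there)))
    where
    open Moved (carryBack′ σ p ps c (unique-tail u) (λ r∈ → f (there r∈))) renaming (state to τ; reach to r; content to ct; fixed to fx)
    τp : τ ! p ≡ σ ! lst p ps
    τp = proj₁ (∷-injective ct)
    τq : τ ! q ≡ σ ! q
    τq = fx (unique-head u)
    fr : part (τ ! q) ≢ part (τ ! p)
    fr h = f (here refl) (trans (sym (cong part τq)) (trans h (cong part τp)))

  abstract
    carry : ∀ σ q ps → Chain (q ∷ ps) → Unique (q ∷ ps) → (∀ {p} → p ∈ ps → part (σ ! p) ≢ part (σ ! q)) →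
      Moved σ (q ∷ ps) (map (σ !_) ps ++ σ ! q ∷ [])
    carry = carry′

    carryBack : ∀ σ q ps → Chain (q ∷ ps) → Unique (q ∷ ps) → (∀ {p} → p ∈ ini q ps → part (σ ! p) ≢ part (σ ! lst q ps)) →
      Moved σ (q ∷ ps) (σ ! lst q ps ∷ map (σ !_) (ini q ps))
    carryBack = carryBack′

  -- With j next to a, (a b) = (a j)(j b)(a j), and the middle transposition is obtained from the
  -- shorter walk.
  swap-any : (∀ σ a b → Adj X a b → σ ⇝ swap a b σ) → ∀ {a b} → Star (Adj X) a b → ∀ σ → σ ⇝ swap a b σ
  swap-any h {a} ε σ = done (λ x → cong (σ !_) (sym (tr-self a x)))
  swap-any h {a} {b} (_◅_ {j = j} e s) σ with b ≟ᶠ a | b ≟ᶠ j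
  ... | yes refl | _ = done (λ x → cong (σ !_) (sym (tr-self a x)))
  ... | no _ | yes refl = h σ a b e
  ... | no p | no q = ⇝-respʳ (⇝-trans (h σ a j e) (⇝-trans (swap-any h s (swap a j σ)) (h (swap j b (swap a j σ)) a j e)))
      (λ x → cong (σ !_) (trans (sym (tr-conj (transpose a j) j b (transpose a j ! x)))
        (trans (cong (transpose (transpose a j ! j) (transpose a j ! b) !_) (tr-invol a j x))
               (cong₂ (λ c d → transpose c d ! x) (tr-r a j) (tr-o a j p q)))))

  connected-of-swaps : Connected X → (∀ σ a b → Adj X a b → σ ⇝ swap a b σ) → FSConnected X Y
  connected-of-swaps conn h σ τ = ⇝-out (⇝-respʳ {σ} {TL.eval (TL.decompose π) ∘ₚ σ} {τ} (go (TL.decompose π)) (λ x → trans (cong (σ !_) (TL.eval-decompose π x)) (inverseʳ σ)))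
    where
    π = τ ∘ₚ flip σ
    go : ∀ xs → σ ⇝ TL.eval xs ∘ₚ σ
    go [] = ⇝-refl
    go ((i , j) ∷ xs) = ⇝-trans (go xs) (swap-any h (conn i j) (TL.eval xs ∘ₚ σ))

  -- Swaps across edges generate all permutations. Such a swap is either friendly, hence a step, or
  -- an exchange of two classmates; only the latter has to be supplied.
  connected-of-exchanges : Connected X → (∀ σ a b → Adj X a b → part (σ ! a) ≡ part (σ ! b) → Ex σ (σ ! a) (σ ! b)) → FSConnected X Y
  connected-of-exchanges conn h = connected-of-swaps conn λ σ a b e → case part (σ ! a) ℕ.≟ part (σ ! b) of λ where
    (yes p) → ⇝-respʳ (h σ a b e p) (λ x → tr-conj σ a b x)
    (no p) → swap-step e p

bool-≢-≢ : {a b c : Bool} → a ≢ c → b ≢ c → a ≡ b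
bool-≢-≢ {true} {true} p q = refl
bool-≢-≢ {false} {false} p q = refl
bool-≢-≢ {true} {false} {true} p q = ⊥-elim (p refl)
bool-≢-≢ {true} {false} {false} p q = ⊥-elim (q refl)
bool-≢-≢ {false} {true} {true} p q = ⊥-elim (q refl)
bool-≢-≢ {false} {true} {false} p q = ⊥-elim (p refl)

-- Two colours of people, and growing a region that holds all blanks.

module TwoColours {n : ℕ} (X : Graph n) (simple : IsSimple X) (part : Fin n → ℕ)
  (isT : Fin n → Bool) (apart : ∀ u v → isT u ≢ isT v → part u ≢ part v) where

  open GraphTheory X simple
  open FSCore X simple part

  pos : Permutation′ n → Fin n → Fin n
  pos σ u = σ ⟨$⟩ˡ u

  !-pos : ∀ σ u → σ ! pos σ u ≡ u
  !-pos σ u = inverseʳ σ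

  pos-of : ∀ σ {u q} → σ ! q ≡ u → pos σ u ≡ q
  pos-of σ refl = inverseˡ σ

  record Within (H : List (Fin n)) (σ τ : Permutation′ n) : Set where
    constructor within
    field
      reach : σ ⇝ τ
      keep : ∀ {x} → x ∉ H → τ ! x ≡ σ ! x

  within-refl : ∀ {H σ} → Within H σ σ
  within-refl = within ⇝-refl (λ _ → refl)

  within-trans : ∀ {H σ τ ρ} → Within H σ τ → Within H τ ρ → Within H σ ρ
  within-trans (within r k) (within r' k') = within (⇝-trans r r') (λ x∉ → trans (k' x∉) (k x∉))

  within-mono : ∀ {H K σ τ} → (∀ {x} → x ∈ H → x ∈ K) → Within H σ τ → Within K σ τ
  within-mono s (within r k) = within r (λ x∉ → k (x∉ ∘ s))

  keep-pos : ∀ {H} σ τ {u} → (∀ {x} → x ∉ H → τ ! x ≡ σ ! x) → pos σ u ∈ H → pos τ u ∈ H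
  keep-pos {H} σ τ {u} k p with pos τ u ∈? H
  ... | yes q = q
  ... | no q = ⊥-elim (q (subst (_∈ H) (pos-of σ (trans (sym (k q)) (!-pos τ u))) p))

  AllIn : Bool → List (Fin n) → Permutation′ n → Set
  AllIn β H σ = ∀ q → isT (σ ! q) ≡ β → q ∈ H

  keep-allIn : ∀ {β H} σ τ → (∀ {x} → x ∉ H → τ ! x ≡ σ ! x) → AllIn β H σ → AllIn β H τ
  keep-allIn {β} {H} σ τ k a q e with q ∈? H
  ... | yes p = p
  ... | no p = a q (trans (cong isT (sym (k p))) e)

  -- Only colours are controlled here; who carries a colour may change along the whole walk.
  record Transfer (H : List (Fin n)) (σ : Permutation′ n) (y p : Fin n) : Set where
    constructor transferred
    field
      state : Permutation′ n
      stays : Within H σ state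
      at-y : isT (state ! y) ≡ isT (σ ! p)
      at-p : isT (state ! p) ≡ isT (σ ! y)
      other : ∀ {q} → q ≢ y → q ≢ p → isT (state ! q) ≡ isT (σ ! q)

  transfer′ : ∀ {H y p} → Star (AdjIn H) y p → ∀ σ → isT (σ ! y) ≢ isT (σ ! p) → Transfer H σ y p
  transfer′ ε σ h = ⊥-elim (h refl)
  transfer′ {H} {y} {p} (_◅_ {j = j} (e , y∈ , j∈) s) σ h with isT (σ ! j) ≟ᵇ isT (σ ! y)
  -- An edge between two people of one colour may be blocked. The rest of the walk goes first and
  -- brings the other colour to `j`.
  ... | yes same = transferred (swap y j τ) (within-trans w (within (swap-step e (apart _ _ diff)) (λ x∉ → swap-o y j τ (λ { refl → x∉ y∈ }) (λ { refl → x∉ j∈ }))))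
      (trans (cong isT (swap-l y j τ)) aj)
      (trans (cong isT (swap-o y j τ (p≢y) (p≢j))) (trans ap same))
      other'
    where
    open Transfer (transfer′ s σ (h ∘ trans (sym same))) renaming (state to τ; stays to w; at-y to aj; at-p to ap; other to ot)
    y≢j : y ≢ j
    y≢j = adj-≢ e
    p≢y : p ≢ y
    p≢y refl = h refl
    p≢j : p ≢ j
    p≢j refl = h (sym same)
    τy : isT (τ ! y) ≡ isT (σ ! y)
    τy = ot y≢j (p≢y ∘ sym)
    diff : isT (τ ! y) ≢ isT (τ ! j)
    diff q = h (trans (sym τy) (trans q aj))
    other' : ∀ {q} → q ≢ y → q ≢ p → isT (swap y j τ ! q) ≡ isT (σ ! q)
    other' {q} a b with q ≟ᶠ j
    ... | yes refl = trans (cong isT (swap-r y j τ)) (trans τy (sym same))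
    ... | no c = trans (cong isT (swap-o y j τ a c)) (ot c b)
  ... | no diff with j ≟ᶠ p
  ... | yes refl = transferred (swap y j σ) (within (swap-step e (apart _ _ h)) (λ x∉ → swap-o y j σ (λ { refl → x∉ y∈ }) (λ { refl → x∉ j∈ })))
      (cong isT (swap-l y j σ)) (cong isT (swap-r y j σ)) (λ a b → cong isT (swap-o y j σ a b))
  ... | no j≢p = transferred τ (within-trans (within (swap-step e (apart _ _ (diff ∘ sym))) (λ x∉ → swap-o y j σ (λ { refl → x∉ y∈ }) (λ { refl → x∉ j∈ }))) w)
      (trans (ot y≢j (p≢y ∘ sym)) (trans (cong isT (swap-l y j σ)) (bool-≢-≢ diff (h ∘ sym))))
      (trans ap σ₁j)
      other'
    where
    σ₁ = swap y j σ
    p≢y : p ≢ y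
    p≢y refl = h refl
    y≢j : y ≢ j
    y≢j = adj-≢ e
    σ₁j : isT (σ₁ ! j) ≡ isT (σ ! y)
    σ₁j = cong isT (swap-r y j σ)
    σ₁p : isT (σ₁ ! p) ≡ isT (σ ! p)
    σ₁p = cong isT (swap-o y j σ p≢y (j≢p ∘ sym))
    open Transfer (transfer′ s σ₁ (λ q → h (trans (sym σ₁j) (trans q σ₁p)))) renaming (state to τ; stays to w; at-y to aj; at-p to ap; other to ot)
    other' : ∀ {q} → q ≢ y → q ≢ p → isT (τ ! q) ≡ isT (σ ! q)
    other' {q} a b with q ≟ᶠ j
    ... | yes refl = trans aj (trans σ₁p (sym (bool-≢-≢ diff (h ∘ sym))))
    ... | no c = trans (ot c b) (cong isT (swap-o y j σ a c))

  abstract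
    transfer : ∀ {H y p} → Star (AdjIn H) y p → ∀ σ → isT (σ ! y) ≢ isT (σ ! p) → Transfer H σ y p
    transfer = transfer′

  position-outside : ∀ {β} {ps : List (Fin n)} → Unique ps → (∀ {u} → u ∈ ps → isT u ≡ β) →
    ∀ σ (F : List (Fin n)) → length F < length ps → ∃ λ q → q ∉ F × isT (σ ! q) ≡ β
  position-outside {β} {ps} u h σ F l with any? (λ q → ¬? (q ∈? F) ×-dec (isT (σ ! q) ≟ᵇ β))
  ... | yes p = p
  ... | no ¬p = ⊥-elim (ℕₚ.<⇒≱ l (subst (_≤ length F) (Lₚ.length-map (pos σ) ps)
      (unique-⊆-length (Uₚ.map⁺ (λ e → !-inj (flip σ) e) u) sub)))
    where
    sub : ∀ {q} → q ∈ map (pos σ) ps → q ∈ F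
    sub q∈ with ∈-map⁻ (pos σ) q∈
    ... | v , v∈ , refl = decidable-stable (_ ∈? F) (λ q∉ → ¬p (_ , q∉ , trans (cong isT (!-pos σ v)) (h v∈)))

  -- By `off` the positions outside `D` receive no further person of colour β, so a pattern of the
  -- opposite colour prepared there survives.
  record Made (β : Bool) (H D : List (Fin n)) (σ : Permutation′ n) : Set where
    constructor made
    field
      state : Permutation′ n
      stays : Within H σ state
      on : ∀ {q} → q ∈ D → isT (state ! q) ≡ β
      off : ∀ {q} → q ∉ D → isT (state ! q) ≡ β → isT (σ ! q) ≡ β

  make′ : ∀ β {ps} → Unique ps → (∀ {u} → u ∈ ps → isT u ≡ β) → ∀ {H} → ConnIn H →
    ∀ D → Unique D → length D ≤ length ps → (∀ {x} → x ∈ D → x ∈ H) → ∀ σ → AllIn β H σ → Made β H D σ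
  make′ β up hp ch [] u l s σ a = made σ within-refl (λ ()) (λ _ e → e)
  make′ β up hp {H} ch (d ∷ D) u l s σ a with make′ β up hp ch D (unique-tail u) (ℕₚ.<⇒≤ l) (s ∘ there) σ a
  ... | made τ w on off with isT (τ ! d) ≟ᵇ β
  ... | yes e = made τ w (λ { (here refl) → e ; (there q∈) → on q∈ }) (λ q∉ → off (q∉ ∘ there))
  ... | no e with position-outside up hp τ D l
  ... | q , q∉ , eq = made τ' (within-trans w w')
      (λ { (here refl) → trans ad eq ; (there x∈) → trans (ot (λ { refl → q∉ x∈ }) (λ { refl → unique-head u x∈ })) (on x∈) })
      off'
    where
    open Transfer (transfer (ch (keep-allIn σ τ (Within.keep w) a q eq) (s (here refl))) τ (λ x → e (trans (sym x) eq)))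
      renaming (state to τ'; stays to w'; at-y to aq; at-p to ad; other to ot)
    off' : ∀ {x} → x ∉ d ∷ D → isT (τ' ! x) ≡ β → isT (σ ! x) ≡ β
    off' {x} x∉ h with x ≟ᶠ q
    ... | yes refl = off (x∉ ∘ there) eq
    ... | no x≢q = off (x∉ ∘ there) (trans (sym (ot x≢q (λ { refl → x∉ (here refl) }))) h)

  abstract
    make : ∀ β {ps} → Unique ps → (∀ {u} → u ∈ ps → isT u ≡ β) → ∀ {H} → ConnIn H →
      ∀ D → Unique D → length D ≤ length ps → (∀ {x} → x ∈ D → x ∈ H) → ∀ σ → AllIn β H σ → Made β H D σ
    make = make′

  -- tokens are the people with isT, blanks the others; bs lists the blanks
  module Blanks (bs : List (Fin n)) (bs-unique : Unique bs) (bs-blank : ∀ {u} → u ∈ bs → isT u ≡ false)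
    (bs-all : ∀ u → isT u ≡ false → u ∈ bs) where

    AllB : List (Fin n) → Permutation′ n → Set
    AllB = AllIn false

    token-in : ∀ σ {F : List (Fin n)} → Unique F → length bs < length F → ∃ λ q → q ∈ F × isT (σ ! q) ≡ true
    token-in σ {F} u l with any? (λ q → (q ∈? F) ×-dec (isT (σ ! q) ≟ᵇ true))
    ... | yes p = p
    ... | no ¬p = ⊥-elim (ℕₚ.<⇒≱ l (subst (_≤ length bs) (Lₚ.length-map (σ !_) F)
        (unique-⊆-length (Uₚ.map⁺ (!-inj σ) u) sub)))
      where
      sub : ∀ {v} → v ∈ map (σ !_) F → v ∈ bs
      sub v∈ with ∈-map⁻ (σ !_) v∈
      ... | q , q∈ , refl = bs-all _ (not-true (λ e → ¬p (q , q∈ , e)))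

    token-in-other : ∀ σ {H p} → Unique H → p ∈ H → 2 + length bs ≤ length H → ∃ λ q → q ∈ H × q ≢ p × isT (σ ! q) ≡ true
    token-in-other σ {H} {p} u p∈ l with ∈-∃++ p∈
    ... | a , b , refl with token-in σ {a ++ b} (unique-++ (unique-++ˡ u) (unique-tail (unique-++ʳ a u)) (λ x∈ y∈ → unique-disjoint a u x∈ (there y∈)))
            (ℕₚ.≤-pred (subst (2 + length bs ≤_) (trans (length-++ a) (trans (ℕₚ.+-suc (length a) (length b)) (cong suc (sym (length-++ a))))) l))
    ... | q , q∈ , e = q , [ ∈-++⁺ˡ , (λ y → ∈-++⁺ʳ a (there y)) ]′ (∈-++⁻ a q∈)
        , (λ { refl → [ (λ x → unique-disjoint a u x (here refl)) , unique-head (unique-++ʳ a u) ]′ (∈-++⁻ a q∈) }) , e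

    ∈-snoc : ∀ (l : List (Fin n)) {x z} → x ∈ l ++ z ∷ [] → x ∈ l ⊎ x ≡ z
    ∈-snoc l x∈ with ∈-++⁻ l x∈
    ... | inj₁ p = inj₁ p
    ... | inj₂ (here e) = inj₂ e

    allB-after : ∀ {H z} σ τ → (∀ {x} → x ∉ H → x ≢ z → τ ! x ≡ σ ! x) → isT (τ ! z) ≡ true → AllB H σ → AllB H τ
    allB-after {H} {z} σ τ ag zT a q e with q ∈? H | q ≟ᶠ z
    ... | yes q∈ | _ = q∈
    ... | no q∉ | yes refl = ⊥-elim (true≢false zT e)
    ... | no q∉ | no q≢z = a q (trans (cong isT (sym (ag q∉ q≢z))) e)

    pos-after : ∀ {H z} σ τ → (∀ {x} → x ∉ H → x ≢ z → τ ! x ≡ σ ! x) → ∀ {u} → pos σ u ∈ H → u ≢ τ ! z → pos τ u ∈ H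
    pos-after {H} {z} σ τ ag {u} u∈ u≢ with pos τ u ∈? H | pos τ u ≟ᶠ z
    ... | yes q∈ | _ = q∈
    ... | no q∉ | yes e = ⊥-elim (u≢ (trans (sym (!-pos τ u)) (cong (τ !_) e)))
    ... | no q∉ | no q≢z = ⊥-elim (q∉ (subst (_∈ H) (pos-of σ (trans (sym (ag q∉ q≢z)) (!-pos τ u))) u∈))

    -- Taking in the person on `z` may push one person `w` out of the region, because the blanks
    -- stay inside. Everything else that was inside has to remain.
    Entered : List (Fin n) → Fin n → Permutation′ n → Set
    Entered H z σ = Σ (Permutation′ n) λ τ → σ ⇝ τ × AllB H τ × pos τ (σ ! z) ∈ H ×
      Σ (Fin n) λ w → ∀ u → isT u ≡ true → pos σ u ∈ H → u ≢ w → pos τ u ∈ H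

    SwapIn : List (Fin n) → Fin n → Set
    SwapIn H z = ∀ σ → AllB H σ → Entered H z σ

    record Prepared (H D : List (Fin n)) (y : Fin n) (σ : Permutation′ n) : Set where
      constructor prepared
      field
        state : Permutation′ n
        stays : Within H σ state
        blank : ∀ {q} → q ∈ D → isT (state ! q) ≡ false
        token : isT (state ! y) ≡ true

    prepare′ : ∀ {H} → ConnIn H → Unique H → 2 + length bs ≤ length H → ∀ D {y} → Unique D → length D ≤ length bs →
      (∀ {x} → x ∈ D → x ∈ H) → y ∈ H → y ∉ D → ∀ σ → AllB H σ → Prepared H D y σ
    prepare′ {H} ch uh lh D {y} u l s y∈ y∉ σ a with make false bs-unique bs-blank ch D u l s σ a
    ... | made τ w on off with bool-cases (isT (τ ! y))
    ... | inj₁ e = prepared τ w on e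
    ... | inj₂ e with token-in τ uh (ℕₚ.<⇒≤ lh)
    ... | q , q∈ , eq = prepared state (within-trans w stays)
        (λ x∈ → trans (other (λ { refl → true≢false eq (on x∈) }) (λ { refl → y∉ x∈ })) (on x∈)) (trans at-p eq)
      where open Transfer (transfer (ch q∈ y∈) τ (λ h → true≢false eq (trans h e)))

    abstract
      prepare : ∀ {H} → ConnIn H → Unique H → 2 + length bs ≤ length H → ∀ D {y} → Unique D → length D ≤ length bs →
        (∀ {x} → x ∈ D → x ∈ H) → y ∈ H → y ∉ D → ∀ σ → AllB H σ → Prepared H D y σ
      prepare = prepare′

    -- With blanks on `y` and on the stick and a token on `y'`, the token on `z` is drawn through
    -- the stick into the side vertex `y`. The stick is then blank again, and the token from `y'`
    -- runs out to `z`. The fork at `p` lets the two tokens pass each other.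
    swapIn-stick′ : ∀ {H} → ConnIn H → Unique H → 2 + length bs ≤ length H →
      ∀ {y y' p ps z} → Chain (p ∷ ps ++ z ∷ []) → Adj X y p → Adj X y' p → Unique (y ∷ y' ∷ p ∷ ps) →
      (∀ {x} → x ∈ y ∷ y' ∷ p ∷ ps → x ∈ H) → z ∉ H → length (y ∷ p ∷ ps) ≤ length bs → SwapIn H z
    swapIn-stick′ {H} ch uh lh {y} {y'} {p} {ps} {z} c ey ey' u s z∉ l σ a =
        Ready.result (prepare ch uh lh (y ∷ p ∷ ps) {y'} (unique-cons y∉ uP) l D⊆ (s (there (here refl))) y'∉D σ a)
      where
      y∉ : y ∉ p ∷ ps
      y∉ = unique-head u ∘ there
      y'∉ : y' ∉ p ∷ ps
      y'∉ = unique-head (unique-tail u)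
      uP : Unique (p ∷ ps)
      uP = unique-tail (unique-tail u)
      D⊆ : ∀ {x} → x ∈ y ∷ p ∷ ps → x ∈ H
      D⊆ (here e) = s (here e)
      D⊆ (there e) = s (there (there e))
      y'∉D : y' ∉ y ∷ p ∷ ps
      y'∉D (here refl) = unique-head u (here refl)
      y'∉D (there q) = y'∉ q
      module Ready (pr : Prepared H (y ∷ p ∷ ps) y' σ) where
        open Prepared pr renaming (state to σ₂; stays to w₂; blank to bl; token to tk)
        P = p ∷ ps ++ z ∷ []
        uPz : Unique P
        uPz = unique-++ uP (unique-cons (λ ()) []) (λ { q (here refl) → z∉ (s (there (there q))) })
        y∉P : y ∉ P
        y∉P q = [ y∉ , (λ e → z∉ (subst (_∈ H) e (s (here refl)))) ]′ (∈-snoc (p ∷ ps) q)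
        y'∉P : y' ∉ P
        y'∉P q = [ y'∉ , (λ e → z∉ (subst (_∈ H) e (s (there (here refl))))) ]′ (∈-snoc (p ∷ ps) q)
        σ₂z : σ₂ ! z ≡ σ ! z
        σ₂z = Within.keep w₂ z∉
        zT : isT (σ ! z) ≡ true
        zT = not-false (z∉ ∘ a z)
        iniP : ini y P ≡ y ∷ p ∷ ps
        iniP = ini-++ y (p ∷ ps)
        lstP : lst y P ≡ z
        lstP = lst-++ y (p ∷ ps) []
        module Pulled (mv : Moved σ₂ (y ∷ P) (σ₂ ! lst y P ∷ map (σ₂ !_) (ini y P))) where
          open Moved mv renaming (state to σ₃; reach to r₃; content to c₃; fixed to f₃)
          σ₃y : σ₃ ! y ≡ σ ! z
          σ₃y = trans (proj₁ (∷-injective c₃)) (trans (cong (σ₂ !_) lstP) σ₂z)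
          P-blank : ∀ {q} → q ∈ P → isT (σ₃ ! q) ≡ false
          P-blank {q} q∈ = let r , r∈ , e = ∈-map⁻ (σ₂ !_) (subst (σ₃ ! q ∈_) (trans (proj₂ (∷-injective c₃)) (cong (map (σ₂ !_)) iniP)) (∈-map⁺ (σ₃ !_) q∈))
                           in trans (cong isT e) (bl r∈)
          σ₃y' : σ₃ ! y' ≡ σ₂ ! y'
          σ₃y' = f₃ (λ { (here refl) → unique-head u (here refl) ; (there q) → y'∉P q })
          module Pushed (mv′ : Moved σ₃ (y' ∷ P) (map (σ₃ !_) P ++ σ₃ ! y' ∷ [])) where
            open Moved mv′ renaming (state to σ₄; reach to r₄; content to c₄; fixed to f₄)
            σ₄y : σ₄ ! y ≡ σ ! z
            σ₄y = trans (f₄ (λ { (here refl) → unique-head u (here refl) ; (there q) → y∉P q })) σ₃y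
            σ₄z : σ₄ ! z ≡ σ₂ ! y'
            σ₄z = trans (∷ʳ-injectiveʳ (map (σ₄ !_) (y' ∷ p ∷ ps)) (map (σ₃ !_) P)
                    (trans (sym (map-++ (σ₄ !_) (y' ∷ p ∷ ps) (z ∷ []))) c₄)) σ₃y'
            agree : ∀ {x} → x ∉ H → x ≢ z → σ₄ ! x ≡ σ₂ ! x
            agree x∉ x≢z = trans (f₄ (λ { (here refl) → x∉ (s (there (here refl))) ; (there q) → no-P q }))
                                 (f₃ (λ { (here refl) → x∉ (s (here refl)) ; (there q) → no-P q }))
              where
              no-P : _ ∉ P
              no-P q = [ (λ r → x∉ (s (there (there r)))) , x≢z ]′ (∈-snoc (p ∷ ps) q)
            result : Entered H z σ
            result =
              σ₄ , ⇝-trans (Within.reach w₂) (⇝-trans r₃ r₄)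
              , allB-after σ₂ σ₄ agree (trans (cong isT σ₄z) tk) (keep-allIn σ σ₂ (Within.keep w₂) a)
              , subst (_∈ H) (sym (pos-of σ₄ σ₄y)) (s (here refl))
              , σ₄ ! z , λ u _ u∈ u≢ → pos-after σ₂ σ₄ agree (keep-pos σ σ₂ (Within.keep w₂) u∈) u≢
          result : Entered H z σ
          result = Pushed.result (carry σ₃ y' P (ey' , c) (unique-cons y'∉P uPz) (λ {q} q∈ → apart _ _ (λ h → true≢false (trans (cong isT σ₃y') tk) (trans (sym h) (P-blank q∈)))))
        result : Entered H z σ
        result = Pulled.result (carryBack σ₂ y P (ey , c) (unique-cons y∉P uPz) (λ {q} q∈ → apart _ _ (λ h → true≢false (trans (cong isT (trans (cong (σ₂ !_) lstP) σ₂z)) zT) (trans (sym h) (bl (subst (q ∈_) iniP q∈))))))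

    -- The blank on `h` runs along the ear to `h'`. Every token on the way falls back by one: the
    -- one on `z` enters at `h`, and the one on `h'` leaves at the far end. One blank suffices.
    swapIn-ear′ : ∀ {H} → ConnIn H → Unique H → 2 + length bs ≤ length H → 1 ≤ length bs →
      ∀ {h z h'} → h ∈ H → h' ∈ H → h' ≢ h → Ear H h z h' → SwapIn H z
    swapIn-ear′ {H} ch uh lh k≥1 {h} {z} {h'} h∈ h'∈ h'≢h (mkEar rest path uniq outside) σ a =
        Ready.result (prepare ch uh lh (h ∷ []) {h'} (unique-cons (λ ()) []) k≥1 (∈-single h∈) h'∈ (λ e → h'≢h (∈-single {P = λ y → y ≡ h} refl e)) σ a)
      where
      E = z ∷ rest
      module Ready (pr : Prepared H (h ∷ []) h' σ) where
        open Prepared pr renaming (state to σ₂; stays to w₂; blank to bl; token to tk)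
        E-token : ∀ {q} → q ∈ E ++ h' ∷ [] → isT (σ₂ ! q) ≡ true
        E-token q∈ = [ (λ q → not-false (λ e → outside q (a _ (trans (cong isT (sym (Within.keep w₂ (outside q)))) e))))
                     , (λ e → trans (cong (isT ∘ (σ₂ !_)) e) tk) ]′ (∈-snoc E q∈)
        h∉ : h ∉ E ++ h' ∷ []
        h∉ q = [ (λ r → outside r h∈) , h'≢h ∘ sym ]′ (∈-snoc E q)
        module Pushed (mv : Moved σ₂ (h ∷ E ++ h' ∷ []) (map (σ₂ !_) (E ++ h' ∷ []) ++ σ₂ ! h ∷ [])) where
          open Moved mv renaming (state to σ₃; reach to r₃; content to c₃; fixed to f₃)
          c₃' : map (σ₃ !_) (h ∷ E) ≡ map (σ₂ !_) (E ++ h' ∷ [])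
          c₃' = ∷ʳ-injectiveˡ (map (σ₃ !_) (h ∷ E)) (map (σ₂ !_) (E ++ h' ∷ [])) (trans (sym (map-++ (σ₃ !_) (h ∷ E) (h' ∷ []))) c₃)
          σ₃h : σ₃ ! h ≡ σ ! z
          σ₃h = trans (proj₁ (∷-injective c₃')) (Within.keep w₂ (outside (here refl)))
          hE-token : ∀ {q} → q ∈ h ∷ E → isT (σ₃ ! q) ≡ true
          hE-token {q} q∈ = let r , r∈ , e = ∈-map⁻ (σ₂ !_) (subst (σ₃ ! q ∈_) c₃' (∈-map⁺ (σ₃ !_) q∈))
                            in trans (cong isT e) (E-token r∈)
          avoid : ∀ {q} → q ∉ H → q ∉ h ∷ E → q ∉ h ∷ E ++ h' ∷ []
          avoid q∉ r x = [ r , (λ e → q∉ (subst (_∈ H) (sym e) h'∈)) ]′ (∈-snoc (h ∷ E) x)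
          allB : AllB H σ₃
          allB q e = decidable-stable (q ∈? H) λ q∉ → q∉ (a q (trans (cong isT (trans (sym (Within.keep w₂ q∉))
            (sym (f₃ (avoid q∉ (λ r → true≢false (hE-token r) e)))))) e))
          others : ∀ u → isT u ≡ true → pos σ u ∈ H → u ≢ σ₂ ! h' → pos σ₃ u ∈ H
          others v vT v∈ v≢ = subst (_∈ H) (sym (pos-of σ₃ (trans (f₃ avoid′) (!-pos σ₂ v)))) s∈
            where
            s∈ : pos σ₂ v ∈ H
            s∈ = keep-pos σ σ₂ (Within.keep w₂) v∈
            avoid′ : pos σ₂ v ∉ h ∷ E ++ h' ∷ []
            avoid′ (here e) = true≢false vT (trans (cong isT (trans (sym (!-pos σ₂ v)) (cong (σ₂ !_) e))) (bl (here refl)))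
            avoid′ (there x) = [ (λ y → outside y s∈) , (λ e → v≢ (trans (sym (!-pos σ₂ v)) (cong (σ₂ !_) e))) ]′ (∈-snoc E x)
          result : Entered H z σ
          result = σ₃ , ⇝-trans (Within.reach w₂) r₃ , allB , subst (_∈ H) (sym (pos-of σ₃ σ₃h)) h∈ , σ₂ ! h' , others
        result : Entered H z σ
        result = Pushed.result (carry σ₂ h (E ++ h' ∷ []) (path→chain E path) (unique-cons h∉ (unique-++ uniq (unique-cons (λ ()) []) (λ q e → outside (subst (_∈ E) (∈-single {P = λ y → y ≡ h'} refl e) q) h'∈))) (λ q∈ → apart _ _ (λ e → true≢false (E-token q∈) (trans e (bl (here refl))))))

    abstract
      swapIn-stick : ∀ {H} → ConnIn H → Unique H → 2 + length bs ≤ length H →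
        ∀ {y y' p ps z} → Chain (p ∷ ps ++ z ∷ []) → Adj X y p → Adj X y' p → Unique (y ∷ y' ∷ p ∷ ps) →
        (∀ {x} → x ∈ y ∷ y' ∷ p ∷ ps → x ∈ H) → z ∉ H → length (y ∷ p ∷ ps) ≤ length bs → SwapIn H z
      swapIn-stick = swapIn-stick′

      swapIn-ear : ∀ {H} → ConnIn H → Unique H → 2 + length bs ≤ length H → 1 ≤ length bs →
        ∀ {h z h'} → h ∈ H → h' ∈ H → h' ≢ h → Ear H h z h' → SwapIn H z
      swapIn-ear = swapIn-ear′

    module Grow (R : Permutation′ n → Fin n → Fin n → Set)
      (R-refl : ∀ {σ u} → R σ u u)
      (R-sym : ∀ {σ u v} → isT u ≡ true → isT v ≡ true → R σ u v → R σ v u)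
      (R-trans : ∀ {σ u v w} → isT u ≡ true → isT v ≡ true → isT w ≡ true → R σ u v → R σ v w → R σ u w)
      (R-inv : ∀ {σ τ u v} → isT u ≡ true → isT v ≡ true → σ ⇝ τ → R τ u v → R σ u v) where

      Good : List (Fin n) → Set
      Good H = ∀ σ → AllB H σ → ∀ u v → isT u ≡ true → isT v ≡ true → pos σ u ∈ H → pos σ v ∈ H → R σ u v

      module _ {H z h} (ch : ConnIn H) (uh : Unique H) (lh : 2 + length bs ≤ length H) (h∈ : h ∈ H) (e : Adj X h z)
        (z∉ : z ∉ H) (sw : SwapIn H z) (good : Good H) where

        -- After `u` is taken into `H` the hypothesis applies, unless `v` is the token that was
        -- pushed out. In that case a second token `q` of `H` serves as intermediary; it exists
        -- because `H` has two more vertices than there are blanks.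
        relate-new : ∀ σ → AllB H σ → ∀ u v → isT u ≡ true → isT v ≡ true → σ ! z ≡ u → pos σ v ∈ H → R σ u v
        relate-new σ a u v uT vT refl v∈ with token-in-other σ uh v∈ lh | sw σ a
        ... | q , q∈ , q≢ , qT | τ , r , a' , u∈ , w , others with v ≟ᶠ w
        ... | no v≢w = R-inv uT vT r (good τ a' u v uT vT u∈ (others v vT v∈ v≢w))
        ... | yes refl = R-trans uT qT vT
              (R-inv uT qT r (good τ a' u (σ ! q) uT qT u∈ (others (σ ! q) qT q∈' (λ e → q≢ (sym (pos-of σ e))))))
              (good σ a (σ ! q) v qT vT q∈' v∈)
          where
          q∈' : pos σ (σ ! q) ∈ H
          q∈' = subst (_∈ H) (sym (pos-of σ refl)) q∈

        extend-token : ∀ σ → AllB (z ∷ H) σ → isT (σ ! z) ≡ true → ∀ u v → isT u ≡ true → isT v ≡ true →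
          pos σ u ∈ z ∷ H → pos σ v ∈ z ∷ H → R σ u v
        extend-token σ a zT u v uT vT u∈ v∈ = go u∈ v∈
          where
          a' : AllB H σ
          a' q e with a q e
          ... | here refl = ⊥-elim (true≢false zT e)
          ... | there q∈ = q∈
          at : ∀ {u} → pos σ u ≡ z → σ ! z ≡ u
          at {u} e = trans (cong (σ !_) (sym e)) (!-pos σ u)
          go : pos σ u ∈ z ∷ H → pos σ v ∈ z ∷ H → R σ u v
          go (here p) (here q) = subst (R σ u) (trans (sym (at p)) (at q)) R-refl
          go (here p) (there q) = relate-new σ a' u v uT vT (at p) q
          go (there p) (here q) = R-sym vT uT (relate-new σ a' v u vT uT (at q) p)
          go (there p) (there q) = good σ a' u v uT vT p q

        extend : Good (z ∷ H)
        extend σ a u v uT vT u∈ v∈ with bool-cases (isT (σ ! z))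
        ... | inj₁ zT = extend-token σ a zT u v uT vT u∈ v∈
        -- A blank on `z` is first traded for a token of `H`, which leads back to the case of a
        -- token on `z`.
        ... | inj₂ zB with token-in σ uh (ℕₚ.<⇒≤ lh)
        ... | q , q∈ , qT = R-inv uT vT (Within.reach stays)
            (extend-token state (keep-allIn σ state (Within.keep stays) a) (trans at-p qT) u v uT vT
              (keep-pos σ state (Within.keep stays) u∈) (keep-pos σ state (Within.keep stays) v∈))
          where
          open Transfer (transfer (connIn-cons ch h∈ e (there q∈) (here refl)) σ (λ x → true≢false qT (trans x zB)))

      Extendable : Set
      Extendable = ∀ {H x} → ConnIn H → Unique H → 2 + length bs ≤ length H → x ∉ H →
        ∃₂ λ h z → h ∈ H × z ∉ H × Adj X h z × SwapIn H z

      spread : Extendable → ∀ f {H} → n < length H + f → ConnIn H → Unique H → 2 + length bs ≤ length H → Good H →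
        ∀ σ u v → isT u ≡ true → isT v ≡ true → R σ u v
      spread ext f {H} lf ch uh lh good σ u v uT vT with any? (λ x → ¬? (x ∈? H))
      ... | no ¬p = good σ (λ q _ → all q) u v uT vT (all _) (all _)
        where
        all : ∀ q → q ∈ H
        all q = decidable-stable (q ∈? H) (λ q∉ → ¬p (q , q∉))
      spread ext zero {H} lf ch uh lh good σ u v uT vT | yes (x , x∉) =
        ⊥-elim (ℕₚ.<⇒≱ (subst (n <_) (ℕₚ.+-identityʳ _) lf) (unique-fin-length uh))
      spread ext (suc f) {H} lf ch uh lh good σ u v uT vT | yes (x , x∉) with ext ch uh lh x∉
      ... | h , z , h∈ , z∉ , e , sw = spread ext f (subst (n <_) (ℕₚ.+-suc _ f) lf) (connIn-cons ch h∈ e) (unique-cons z∉ uh)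
            (≤-trans lh (ℕₚ.n≤1+n _)) (extend ch uh lh h∈ e z∉ sw good) σ u v uT vT

-- Where a connected region can be enlarged.

module Entries {n : ℕ} (X : Graph n) (simple : IsSimple X) where

  open GraphTheory X simple

  neighbours : Fin n → List (Fin n)
  neighbours v = filter (adj? v) (allFin n)

  deg-length : ∀ v → deg X v ≡ length (neighbours v)
  deg-length v = go (allFin n)
    where
    go : ∀ l → Data.Nat.ListAction.sum (map (λ u → if X v u then 1 else 0) l) ≡ length (filter (adj? v) l)
    go [] = refl
    go (u ∷ l) with X v u
    ... | true = cong suc (go l)
    ... | false = go l

  neighbours-unique : ∀ v → Unique (neighbours v)
  neighbours-unique v = Uₚ.filter⁺ (adj? v) (Uₚ.allFin⁺ n)

  ∈-neighbours : ∀ {v u} → Adj X v u → u ∈ neighbours v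
  ∈-neighbours {v} {u} e = ∈-filter⁺ (adj? v) (∈-allFin u) e

  neighbours-adj : ∀ {v u} → u ∈ neighbours v → Adj X v u
  neighbours-adj {v} u∈ = proj₂ (∈-filter⁻ (adj? v) {xs = allFin n} u∈)

  two-unique : ∀ {q r : Fin n} → q ≢ r → Unique (q ∷ r ∷ [])
  two-unique h = unique-cons (λ { (here e) → h e }) (unique-cons (λ ()) [])

  ∉-two : ∀ {x a b : Fin n} → x ≢ a → x ≢ b → x ∉ a ∷ b ∷ []
  ∉-two p q (here e) = p e
  ∉-two p q (there (here e)) = q e

  deg-≥ : ∀ {v l} → Unique l → (∀ {u} → u ∈ l → Adj X v u) → length l ≤ deg X v
  deg-≥ {v} u h = subst (_ ≤_) (sym (deg-length v)) (unique-⊆-length u (∈-neighbours ∘ h))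

  deg-≤ : ∀ {v l} → (∀ {u} → Adj X v u → u ∈ l) → deg X v ≤ length l
  deg-≤ {v} h = subst (_≤ _) (sym (deg-length v)) (unique-⊆-length (neighbours-unique v) (h ∘ neighbours-adj))

  two-adj : ∀ {v q r : Fin n} → Adj X v q → Adj X v r → ∀ {u} → u ∈ q ∷ r ∷ [] → Adj X v u
  two-adj a b (here refl) = a
  two-adj a b (there (here refl)) = b

  deg≢1 : ∀ {v q r} → q ≢ r → Adj X v q → Adj X v r → deg X v ≢ 1
  deg≢1 {v} q≢r a b e = ℕₚ.<⇒≱ (s≤s (s≤s z≤n)) (subst (2 ≤_) e (deg-≥ (two-unique q≢r) (two-adj a b)))

  third-neighbour : ∀ {v q r} → q ≢ r → Adj X v q → Adj X v r → deg X v ≢ 2 → ∃ λ w → Adj X v w × w ≢ q × w ≢ r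
  third-neighbour {v} {q} {r} q≢r a b d with any? (λ w → adj? v w ×-dec (¬? (w ≟ᶠ q) ×-dec ¬? (w ≟ᶠ r)))
  ... | yes p = p
  ... | no ¬p = ⊥-elim (d (ℕₚ.≤-antisym (deg-≤ {l = q ∷ r ∷ []} sub) (deg-≥ (two-unique q≢r) (two-adj a b))))
    where
    sub : ∀ {u} → Adj X v u → u ∈ q ∷ r ∷ []
    sub {u} e with u ≟ᶠ q | u ≟ᶠ r
    ... | yes p | _ = here p
    ... | no _ | yes p = there (here p)
    ... | no p | no p' = ⊥-elim (¬p (u , e , p , p'))

  deg2-neighbours : ∀ {v q r w} → q ≢ r → Adj X v q → Adj X v r → deg X v ≡ 2 → Adj X v w → w ≡ q ⊎ w ≡ r
  deg2-neighbours {v} {q} {r} {w} q≢r a b d e with w ≟ᶠ q | w ≟ᶠ r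
  ... | yes p | _ = inj₁ p
  ... | no _ | yes p = inj₂ p
  ... | no p | no p' = ⊥-elim (ℕₚ.<⇒≱ {2} {3} ≤-refl (subst (3 ≤_) d
        (deg-≥ (unique-cons (∉-two p p') (two-unique q≢r))
          λ { (here refl) → e ; (there x) → two-adj a b x })))

  other-neighbour : ∀ {v q} → Adj X v q → deg X v ≢ 1 → ∃ λ w → Adj X v w × w ≢ q
  other-neighbour {v} {q} a d with any? (λ w → adj? v w ×-dec ¬? (w ≟ᶠ q))
  ... | yes p = p
  ... | no ¬p = ⊥-elim (d (ℕₚ.≤-antisym (deg-≤ {l = q ∷ []} (λ {u} e → here (decidable-stable (u ≟ᶠ q) (λ h → ¬p (u , e , h)))))
                  (deg-≥ (unique-cons (λ ()) []) λ { (here refl) → a })))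

  -- The two geometric situations in which the occupant of an outer vertex can be traded in: a
  -- forked path with few enough vertices for `k` blanks, or an ear.
  data Entry (H : List (Fin n)) (k : ℕ) : Set where
    by-stick : ∀ {h y y' p ps z} → h ∈ H → Adj X h z → Chain (p ∷ ps ++ z ∷ []) → Adj X y p → Adj X y' p →
      Unique (y ∷ y' ∷ p ∷ ps) → (∀ {x} → x ∈ y ∷ y' ∷ p ∷ ps → x ∈ H) → z ∉ H → length (y ∷ p ∷ ps) ≤ k → Entry H k
    by-ear : ∀ {h z h'} → h ∈ H → h' ∈ H → h' ≢ h → Ear H h z h' → Entry H k

  other-in : ∀ {H : List (Fin n)} {h} → Unique H → 2 ≤ length H → ∃ λ g → g ∈ H × g ≢ h
  other-in {[]} u ()
  other-in {x ∷ []} u (s≤s ())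
  other-in {x ∷ y ∷ H} {h} u l with x ≟ᶠ h
  ... | no p = x , here refl , p
  ... | yes refl = y , there (here refl) , λ { refl → unique-head u (here refl) }

  entry-no-cut-vertex : Connected X → ¬ HasCutVertex X → ∀ {H k x} → Unique H → 2 ≤ length H → x ∉ H → Entry H k
  entry-no-cut-vertex conn nocut {[]} u () x∉
  entry-no-cut-vertex conn nocut {H@(h₀ ∷ _)} {x = x} u l x∉ with exit (here refl) x∉ (conn h₀ x)
  ... | h , z , h∈ , z∉ , e with other-in {h = h} u l
  ... | g , g∈ , g≢ with open-ear conn nocut h∈ g∈ g≢ z∉ e
  ... | h' , h'∈ , h'≢ , ear = by-ear h∈ h'∈ h'≢ ear

  vlookup-∈ : ∀ {j} (v : Vec (Fin n) j) i → V.lookup v i ∈ V.toList v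
  vlookup-∈ (x ∷ v) F.zero = here refl
  vlookup-∈ (x ∷ v) (F.suc i) = there (vlookup-∈ v i)

  vindex : ∀ {j} {v : Vec (Fin n) j} {x} → x ∈ V.toList v → ∃ λ i → x ≡ V.lookup v i
  vindex {v = y ∷ v} (here e) = F.zero , e
  vindex {v = y ∷ v} (there p) = let i , e = vindex {v = v} p in F.suc i , e

  vlookup-inj : ∀ {j} {v : Vec (Fin n) j} → Unique (V.toList v) → ∀ {a b} → V.lookup v a ≡ V.lookup v b → a ≡ b
  vlookup-inj {v = x ∷ v} u {F.zero} {F.zero} e = refl
  vlookup-inj {v = x ∷ v} u {F.zero} {F.suc b} e = ⊥-elim (unique-head u (subst (_∈ V.toList v) (sym e) (vlookup-∈ v b)))
  vlookup-inj {v = x ∷ v} u {F.suc a} {F.zero} e = ⊥-elim (unique-head u (subst (_∈ V.toList v) e (vlookup-∈ v a)))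
  vlookup-inj {v = x ∷ v} u {F.suc a} {F.suc b} e = cong F.suc (vlookup-inj (unique-tail u) e)

  prev : ∀ {j} → Vec (Fin n) j → List (Fin n)
  prev [] = []
  prev (q ∷ _) = q ∷ []

  module Sticks {H : List (Fin n)} (cH : ConnIn H) (uH : Unique H) (z : Fin n) (z∉ : z ∉ H) where

    -- a walk in H away from z, newest vertex first, all of whose earlier vertices have no other neighbours in H
    data Stick : ∀ {j} → Vec (Fin n) (suc j) → Set where
      one : ∀ {h} → h ∈ H → Adj X h z → Stick (h ∷ [])
      more : ∀ {j y p} {ps : Vec (Fin n) j} → Stick (p ∷ ps) → y ∈ H → Adj X y p → y ∉ V.toList (p ∷ ps) →
        (∀ {y'} → y' ∈ H → Adj X p y' → y' ≡ y ⊎ y' ∈ prev ps) → Stick (y ∷ p ∷ ps)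

    stick-∈ : ∀ {j} {v : Vec (Fin n) (suc j)} → Stick v → ∀ i → V.lookup v i ∈ H
    stick-∈ (one h∈ _) F.zero = h∈
    stick-∈ (more s y∈ _ _ _) F.zero = y∈
    stick-∈ (more s y∈ _ _ _) (F.suc i) = stick-∈ s i

    stick-⊆ : ∀ {j} {v : Vec (Fin n) (suc j)} → Stick v → ∀ {x} → x ∈ V.toList v → x ∈ H
    stick-⊆ s x∈ = let i , e = vindex x∈ in subst (_∈ H) (sym e) (stick-∈ s i)

    stick-adj : ∀ {j} {v : Vec (Fin n) (suc j)} → Stick v → (i : Fin j) → Adj X (V.lookup v (inject₁ i)) (V.lookup v (F.suc i))
    stick-adj (more s y∈ e _ _) F.zero = e
    stick-adj (more s y∈ e _ _) (F.suc i) = stick-adj s i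

    stick-last : ∀ {j} {v : Vec (Fin n) (suc j)} → Stick v → Adj X (V.lookup v (fromℕ j)) z
    stick-last (one _ e) = e
    stick-last (more s _ _ _ _) = stick-last s

    stick-unique : ∀ {j} {v : Vec (Fin n) (suc j)} → Stick v → Unique (V.toList v)
    stick-unique (one _ _) = unique-cons (λ ()) []
    stick-unique (more s _ _ y∉ _) = unique-cons y∉ (stick-unique s)

    stick-chain : ∀ {j} {v : Vec (Fin n) (suc j)} → Stick v → Chain (V.toList v ++ z ∷ [])
    stick-chain (one _ e) = e , tt
    stick-chain (more s _ e _ _) = e , stick-chain s

    stick-only : ∀ {j} {v : Vec (Fin n) (suc j)} → Stick v → (i : Fin j) → ∀ {y} → y ∈ H → Adj X (V.lookup v (F.suc i)) y →
      ∃ λ i' → y ≡ V.lookup v i' × (toℕ i' ≡ toℕ i ⊎ toℕ i' ≡ 2 + toℕ i)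
    stick-only (more s y∈ e y∉ o) F.zero y'∈ a with o y'∈ a
    ... | inj₁ p = F.zero , p , inj₁ refl
    stick-only (more {ps = q ∷ ps} s y∈ e y∉ o) F.zero y'∈ a | inj₂ (here p) = F.suc (F.suc F.zero) , p , inj₂ refl
    stick-only (more s y∈ e y∉ o) (F.suc i) y'∈ a with stick-only s i y'∈ a
    ... | i' , p , inj₁ q = F.suc i' , p , inj₁ (cong suc q)
    ... | i' , p , inj₂ q = F.suc i' , p , inj₂ (cong suc q)

    -- An older stick vertex has only its stick neighbours within `H`, so the head `p` can be
    -- adjacent to none of them except its predecessor.
    stick-new : ∀ {j p} {ps : Vec (Fin n) j} → Stick (p ∷ ps) → ∀ {y} → y ∈ H → Adj X p y → y ∉ prev ps → y ∉ V.toList (p ∷ ps)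
    stick-new s y∈ e y∉ (here refl) = adj-irr e
    stick-new {p = p} {ps} s y∈ e y∉ (there q) with vindex {v = ps} q
    ... | i , refl with stick-only s i {p} (stick-∈ s F.zero) (adj-sym e)
    ... | i' , p≡ , r with vlookup-inj (stick-unique s) {F.zero} {i'} p≡
    stick-new {ps = q' ∷ ps} s y∈ e y∉ (there q) | F.zero , refl | i' , p≡ , r | refl = y∉ (here refl)
    stick-new {ps = q' ∷ ps} s y∈ e y∉ (there q) | F.suc i , refl | i' , p≡ , inj₁ () | refl
    stick-new {ps = q' ∷ ps} s y∈ e y∉ (there q) | F.suc i , refl | i' , p≡ , inj₂ () | refl

    prev-⊆ : ∀ {j} (ps : Vec (Fin n) j) {x} → x ∈ prev ps → x ∈ V.toList ps
    prev-⊆ (q ∷ ps) (here e) = here e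

    stick-closed : ∀ {j p} {ps : Vec (Fin n) j} → Stick (p ∷ ps) → (∀ {y} → y ∈ H → Adj X p y → y ∈ prev ps) →
      ∀ {u x} → u ∈ V.toList (p ∷ ps) → Star (AdjIn H) u x → x ∈ V.toList (p ∷ ps)
    stick-closed s c u∈ ε = u∈
    stick-closed {p = p} {ps} s c u∈ (_◅_ {j = w} (e , _ , w∈) t) = stick-closed s c (next u∈) t
      where
      next : _ ∈ V.toList (p ∷ ps) → w ∈ V.toList (p ∷ ps)
      next (here refl) = there (prev-⊆ ps (c w∈ e))
      next (there q) with vindex {v = ps} q
      ... | i , refl = let i' , w≡ , _ = stick-only s i w∈ e in subst (_∈ _) (sym w≡) (vlookup-∈ (p ∷ ps) i')

    toList-length : ∀ {j} (v : Vec (Fin n) j) → length (V.toList v) ≡ j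
    toList-length [] = refl
    toList-length (x ∷ v) = cong suc (toList-length v)

    -- If the head had no further neighbour in `H`, the stick would be closed under adjacency in the
    -- connected region `H` and would exhaust it.
    continues : ∀ {j p} {ps : Vec (Fin n) j} → Stick (p ∷ ps) → suc j < length H → ∃ λ y → y ∈ H × Adj X p y × y ∉ prev ps
    continues {j} {p} {ps} s l with any? (λ y → (y ∈? H) ×-dec (adj? p y ×-dec ¬? (y ∈? prev ps)))
    ... | yes q = q
    ... | no ¬q = ⊥-elim (ℕₚ.<⇒≱ l (subst (length H ≤_) (toList-length (p ∷ ps)) (unique-⊆-length uH
          (λ {x} x∈ → stick-closed s (λ {y} y∈ e → decidable-stable (y ∈? prev ps) (λ y∉ → ¬q (y , y∈ , e , y∉))) (here refl) (cH (stick-∈ s F.zero) x∈)))))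

    module _ {m : ℕ} {v : Vec (Fin n) (suc (suc m))} (s : Stick v) (deg2 : ∀ (i : Fin m) → deg X (V.lookup v (F.suc (inject₁ i))) ≡ 2) where

      last : Fin n
      last = V.lookup v (fromℕ (suc m))

      inner-neighbours : ∀ (i : Fin m) {y} → Adj X (V.lookup v (F.suc (inject₁ i))) y → y ∈ H
      inner-neighbours i {y} e with deg2-neighbours (λ q → distinct (vlookup-inj (stick-unique s) q))
          (adj-sym (stick-adj s (inject₁ i))) (stick-adj s (F.suc i)) (deg2 i) e
        where
        distinct : inject₁ (inject₁ i) ≢ F.suc (F.suc i)
        distinct q = ℕₚ.<⇒≢ (ℕₚ.m<n+m (toℕ i) {2} (s≤s z≤n)) (trans (sym (trans (Fₚ.toℕ-inject₁ (inject₁ i)) (Fₚ.toℕ-inject₁ i))) (cong toℕ q))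
      ... | inj₁ refl = stick-∈ s _
      ... | inj₂ refl = stick-∈ s _

      module _ (i : Fin (suc m)) where
        private
          a b : Fin n
          a = V.lookup v (inject₁ i)
          b = V.lookup v (F.suc i)

        Beyond : Fin n → Set
        Beyond x = ∃ λ (l : Fin (suc m)) → toℕ i ≤ toℕ l × x ≡ V.lookup v (F.suc l)

        last-beyond : Beyond last
        last-beyond = fromℕ m , subst (toℕ i ≤_) (sym (Fₚ.toℕ-fromℕ m)) (ℕₚ.≤-pred (toℕ<n i)) , refl

        Found : Set
        Found = Σ (Fin n) λ z' → Σ (Fin n) λ h' → h' ∈ H × h' ≢ last × Ear H last z' h'

        last-or-inner : (l : Fin (suc m)) → l ≡ fromℕ m ⊎ ∃ λ l' → l ≡ inject₁ l'
        last-or-inner l with toℕ l ℕ.≟ m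
        ... | yes e = inj₁ (toℕ-injective (trans e (sym (Fₚ.toℕ-fromℕ m))))
        ... | no ne = inj₂ (F.lower₁ l (ne ∘ sym) , sym (Fₚ.inject₁-lower₁ l (ne ∘ sym)))

        mutual
          -- Follows a walk that returns to the near end of the edge without using it. The inner
          -- vertices have degree 2, so the walk stays on the stick beyond the edge or leaves `H` at
          -- `last`. Coming back to `last` starts the search anew; coming back anywhere else
          -- completes an ear.
          from-beyond : ∀ {x} → Beyond x → Star (AdjMinusEdge X a b) x a → Found
          from-beyond (l , il , x≡) ε = ⊥-elim (ℕₚ.<⇒≢ (s≤s il) (trans (sym (Fₚ.toℕ-inject₁ i)) (cong toℕ (vlookup-inj (stick-unique s) x≡))))
          from-beyond {x} (l , il , refl) (_◅_ {j = y} (e , notab) t) with y ∈? H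
          ... | no y∉ with last-or-inner l
          ... | inj₁ refl = from-outside e y∉ y∉ ε t
          ... | inj₂ (l' , refl) = ⊥-elim (y∉ (inner-neighbours l' e))
          from-beyond {x} (l , il , refl) (_◅_ {j = y} (e , notab) t) | yes y∈ with stick-only s l y∈ e
          ... | F.zero , refl , inj₁ q = ⊥-elim (notab (inj₂ (cong (V.lookup v ∘ F.suc) l≡i , cong (V.lookup v) (toℕ-injective (trans q (trans (cong toℕ l≡i) (sym (Fₚ.toℕ-inject₁ i))))))))
            where
            l≡i : l ≡ i
            l≡i = toℕ-injective (ℕₚ.≤-antisym (subst (_≤ toℕ i) q z≤n) il)
          ... | F.suc l'' , refl , inj₂ q = from-beyond (l'' , ≤-trans il (≤-trans (ℕₚ.n≤1+n _) (≤-reflexive (ℕₚ.suc-injective (sym q)))) , refl) t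
          ... | F.suc l'' , refl , inj₁ q with toℕ i ℕ.≟ toℕ l
          ... | no ne = from-beyond (l'' , ℕₚ.≤-pred (subst (suc (toℕ i) ≤_) (sym q) (ℕₚ.≤∧≢⇒< il ne)) , refl) t
          ... | yes eq = ⊥-elim (notab (inj₂ (cong (V.lookup v ∘ F.suc) (toℕ-injective (sym eq)) , cong (V.lookup v) (toℕ-injective (trans q (trans (sym eq) (sym (Fₚ.toℕ-inject₁ i))))))))

          from-outside : ∀ {z' x} → Adj X last z' → z' ∉ H → x ∉ H → Star (AdjOut H) z' x → Star (AdjMinusEdge X a b) x a → Found
          from-outside d z'∉ x∉ w ε = ⊥-elim (x∉ (stick-∈ s (inject₁ i)))
          from-outside {z'} d z'∉ x∉ w (_◅_ {j = y} (e , _) t) with y ∈? H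
          ... | no y∉ = from-outside d z'∉ y∉ (w ◅◅ ((e , y∉) ◅ ε)) t
          ... | yes y∈ with y ≟ᶠ last
          ... | yes refl = from-beyond last-beyond t
          ... | no ne = z' , y , y∈ , ne , mk-ear d z'∉ w e

        minus-sym : ∀ {u w} → AdjMinusEdge X a b u w → AdjMinusEdge X a b w u
        minus-sym (e , ne) = adj-sym e , λ { (inj₁ (p , q)) → ne (inj₂ (q , p)) ; (inj₂ (p , q)) → ne (inj₁ (q , p)) }

        detour : Star (AdjMinusEdge X a b) a b → Found
        detour t = from-beyond (i , ≤-refl , refl) (Star.reverse minus-sym t)

    minus? : ∀ a b u w → Dec (AdjMinusEdge X a b u w)
    minus? a b u w = adj? u w ×-dec ¬? (((u ≟ᶠ a) ×-dec (w ≟ᶠ b)) ⊎-dec ((u ≟ᶠ b) ×-dec (w ≟ᶠ a)))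

    -- A stick of k vertices is a k-bridge unless an inner vertex has a third neighbour, which gives
    -- a short fork, or one of its edges can be bypassed, which gives an ear.
    long-stick : ∀ {m} → ¬ HasBridge X (suc (suc m)) → suc (suc m) < length H → {v : Vec (Fin n) (suc (suc m))} → Stick v → Entry H (suc (suc m))
    long-stick {m} nb l {v} s with any? (λ i → ¬? (deg X (V.lookup v (F.suc (inject₁ i))) ℕ.≟ 2))
    ... | yes (i , d) with third-neighbour q≢r (adj-sym (stick-adj s (inject₁ i))) (stick-adj s (F.suc i)) d
      where
      q≢r : V.lookup v (inject₁ (inject₁ i)) ≢ V.lookup v (F.suc (F.suc i))
      q≢r e = ℕₚ.<⇒≢ (ℕₚ.m<n+m (toℕ i) {2} (s≤s z≤n)) (trans (sym (trans (Fₚ.toℕ-inject₁ (inject₁ i)) (Fₚ.toℕ-inject₁ i)))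
                (cong toℕ (vlookup-inj (stick-unique s) {inject₁ (inject₁ i)} {F.suc (F.suc i)} e)))
    -- The vertex itself is a stick of length one towards `w`, with its two stick neighbours as the
    -- fork, so two blanks are enough.
    ... | w , e , w≢q , w≢r = by-stick (stick-∈ s (F.suc (inject₁ i))) e (e , tt) (stick-adj s (inject₁ i)) (adj-sym (stick-adj s (F.suc i)))
          (unique-cons (∉-two q≢r (adj-≢ (stick-adj s (inject₁ i))))
             (two-unique (adj-≢ (adj-sym (stick-adj s (F.suc i))))))
          (λ { (here refl) → stick-∈ s _ ; (there (here refl)) → stick-∈ s _ ; (there (there (here refl))) → stick-∈ s (F.suc (inject₁ i)) })
          w∉ (s≤s (s≤s z≤n))
      where
      q≢r : V.lookup v (inject₁ (inject₁ i)) ≢ V.lookup v (F.suc (F.suc i))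
      q≢r e = ℕₚ.<⇒≢ (ℕₚ.m<n+m (toℕ i) {2} (s≤s z≤n)) (trans (sym (trans (Fₚ.toℕ-inject₁ (inject₁ i)) (Fₚ.toℕ-inject₁ i)))
                (cong toℕ (vlookup-inj (stick-unique s) {inject₁ (inject₁ i)} {F.suc (F.suc i)} e)))
      w∉ : w ∉ H
      w∉ w∈ with stick-only s (inject₁ i) w∈ e
      ... | i' , w≡ , inj₁ x = w≢q (trans w≡ (cong (V.lookup v) (toℕ-injective (trans x (sym (Fₚ.toℕ-inject₁ (inject₁ i)))))))
      ... | i' , w≡ , inj₂ x = w≢r (trans w≡ (cong (V.lookup v) (toℕ-injective (trans x (cong (2 +_) (Fₚ.toℕ-inject₁ i))))))
    long-stick {m} nb l {v} s | no ¬d with any? (λ i → star? (minus? (V.lookup v (inject₁ i)) (V.lookup v (F.suc i))) (V.lookup v (inject₁ i)) (V.lookup v (F.suc i)))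
    ... | yes (i , t) = let z' , h' , h'∈ , ne , ear = detour s (λ j → decidable-stable (_ ℕ.≟ 2) (λ d → ¬d (j , d))) i t
                        in by-ear (stick-∈ s (fromℕ (suc m))) h'∈ ne ear
    long-stick {m} nb l {v = p ∷ q ∷ ps} s | no ¬d | no ¬t with continues s l
    -- The end conditions of a bridge: the head has the further neighbour `y`, and the last vertex
    -- has `z` outside the region.
    ... | y , y∈ , e , y∉ = ⊥-elim (nb (V.lookup (p ∷ q ∷ ps) , vlookup-inj (stick-unique s) , (λ i → stick-adj s i , λ t → ¬t (i , t))
          , (λ j → decidable-stable (_ ℕ.≟ 2) (λ d → ¬d (j , d))) , deg≢1 (λ x → y∉ (here x)) e (stick-adj s F.zero)
          , deg≢1 (λ x → z∉ (subst (_∈ H) (sym x) (stick-∈ s (inject₁ (fromℕ m))))) (stick-last s) (adj-sym (stick-adj s (fromℕ m)))))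

    -- Two ways to continue form a fork over a path that is still short enough. With only one way,
    -- the stick is prolonged, until it has k vertices.
    walk-stick : ∀ {m} → ¬ HasBridge X (suc (suc m)) → suc (suc m) < length H → ∀ f j → j + f ≡ suc m → {v : Vec (Fin n) (suc j)} → Stick v →
      Entry H (suc (suc m))
    walk-stick nb l zero j eq s rewrite trans (sym (ℕₚ.+-identityʳ j)) eq = long-stick nb l s
    walk-stick {m} nb l (suc f) j eq {p ∷ ps} s with continues s (≤-trans (s≤s (s≤s (≤-trans (ℕₚ.m≤m+n j (suc f)) (≤-reflexive eq)))) l)
    ... | y , y∈ , e , y∉ with any? (λ y' → (y' ∈? H) ×-dec (adj? p y' ×-dec (¬? (y' ∈? prev ps) ×-dec ¬? (y' ≟ᶠ y))))
    ... | yes (y' , y'∈ , e' , y'∉ , ne) = by-stick (stick-∈ s' (fromℕ j)) (stick-last s') (stick-chain s') (adj-sym e) (adj-sym e')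
          (unique-cons (λ { (here x) → ne (sym x) ; (there x) → stick-new s y∈ e y∉ x }) (unique-cons (stick-new s y'∈ e' y'∉) (stick-unique s)))
          (λ { (here refl) → y∈ ; (there (here refl)) → y'∈ ; (there (there x)) → stick-⊆ s x }) z∉
          (subst (_≤ suc (suc m)) (cong suc (sym (toList-length (p ∷ ps)))) (s≤s (≤-trans (≤-trans (ℕₚ.m≤m+n (suc j) f) (≤-reflexive (trans (sym (ℕₚ.+-suc j f)) eq))) ≤-refl)))
      where s' = s
    ... | no ¬y' = walk-stick nb l f (suc j) (trans (sym (ℕₚ.+-suc j f)) eq) (more s y∈ (adj-sym e) (stick-new s y∈ e y∉) only)
      where
      only : ∀ {y'} → y' ∈ H → Adj X p y' → y' ≡ y ⊎ y' ∈ prev ps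
      only {y'} y'∈ e' with y' ≟ᶠ y | y' ∈? prev ps
      ... | yes x | _ = inj₁ x
      ... | no _ | yes x = inj₂ x
      ... | no a | no b = ⊥-elim (¬y' (y' , y'∈ , e' , b , a))

  entry-no-bridge : Connected X → ∀ k → 1 ≤ k → ¬ HasBridge X k → ∀ {H x} → ConnIn H → Unique H → 2 + k ≤ length H → x ∉ H → Entry H k
  entry-no-bridge conn (suc zero) 1≤k nb ch uh l x∉ = entry-no-cut-vertex conn nb uh (ℕₚ.<⇒≤ l) x∉
  entry-no-bridge conn (suc (suc m)) 1≤k nb {H@(h₀ ∷ _)} {x} ch uh l x∉ with exit (here refl) x∉ (conn h₀ x)
  ... | h , z , h∈ , z∉ , e = walk-stick nb (ℕₚ.<⇒≤ l) (suc m) 0 refl (one h∈ e)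
    where open Sticks ch uh z z∉

-- Exchanges around a vertex of degree three.

module Claws {n : ℕ} (X : Graph n) (simple : IsSimple X) where

  open GraphTheory X simple

  record Claw : Set where
    constructor claw
    field
      c b₁ b₂ b₃ : Fin n
      e₁ : Adj X c b₁
      e₂ : Adj X c b₂
      e₃ : Adj X c b₃
      b₁≢b₂ : b₁ ≢ b₂
      b₁≢b₃ : b₁ ≢ b₃
      b₂≢b₃ : b₂ ≢ b₃

    verts : List (Fin n)
    verts = b₃ ∷ b₂ ∷ b₁ ∷ c ∷ []

    verts-unique : Unique verts
    verts-unique = unique-cons (λ { (here e) → b₂≢b₃ (sym e) ; (there (here e)) → b₁≢b₃ (sym e) ; (there (there (here e))) → adj-≢ e₃ (sym e) })
      (unique-cons (λ { (here e) → b₁≢b₂ (sym e) ; (there (here e)) → adj-≢ e₂ (sym e) })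
      (unique-cons (λ { (here e) → adj-≢ e₁ (sym e) }) (unique-cons (λ ()) [])))

    singleton : ConnIn (c ∷ [])
    singleton (here refl) (here refl) = ε

    verts-connected : ConnIn verts
    verts-connected = connIn-cons (connIn-cons (connIn-cons singleton (here refl) e₁) (there (here refl)) e₂) (there (there (here refl))) e₃

  claw? : Dec Claw
  claw? = map′ (λ (c , b₁ , b₂ , b₃ , e₁ , e₂ , e₃ , p , q , r) → claw c b₁ b₂ b₃ e₁ e₂ e₃ p q r)
               (λ (claw c b₁ b₂ b₃ e₁ e₂ e₃ p q r) → c , b₁ , b₂ , b₃ , e₁ , e₂ , e₃ , p , q , r)
    (any? λ c → any? λ b₁ → any? λ b₂ → any? λ b₃ →
      adj? c b₁ ×-dec (adj? c b₂ ×-dec (adj? c b₃ ×-dec (¬? (b₁ ≟ᶠ b₂) ×-dec (¬? (b₁ ≟ᶠ b₃) ×-dec ¬? (b₂ ≟ᶠ b₃))))))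

  module ClawMoves (part : Fin n → ℕ) (C : Claw) where

    open Claw C
    open FSCore X simple part

    record At (σ τ : Permutation′ n) (w x y z : Fin n) : Set where
      constructor at
      field
        reach : σ ⇝ τ
        at-c : τ ! c ≡ w
        at-1 : τ ! b₁ ≡ x
        at-2 : τ ! b₂ ≡ y
        at-3 : τ ! b₃ ≡ z
        rest : ∀ {p} → p ≢ c → p ≢ b₁ → p ≢ b₂ → p ≢ b₃ → τ ! p ≡ σ ! p

    start : ∀ σ → At σ σ (σ ! c) (σ ! b₁) (σ ! b₂) (σ ! b₃)
    start σ = at ⇝-refl refl refl refl refl (λ _ _ _ _ → refl)

    move₁ : ∀ {σ τ w x y z} → At σ τ w x y z → part w ≢ part x → At σ (swap c b₁ τ) x w y z
    move₁ {τ = τ} (at r refl refl refl refl o) d = at (⇝-trans r (swap-step e₁ d)) (swap-l c b₁ τ) (swap-r c b₁ τ)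
      (swap-o c b₁ τ (adj-≢ e₂ ∘ sym) (b₁≢b₂ ∘ sym)) (swap-o c b₁ τ (adj-≢ e₃ ∘ sym) (b₁≢b₃ ∘ sym))
      (λ p q s t → trans (swap-o c b₁ τ p q) (o p q s t))

    move₂ : ∀ {σ τ w x y z} → At σ τ w x y z → part w ≢ part y → At σ (swap c b₂ τ) y x w z
    move₂ {τ = τ} (at r refl refl refl refl o) d = at (⇝-trans r (swap-step e₂ d)) (swap-l c b₂ τ)
      (swap-o c b₂ τ (adj-≢ e₁ ∘ sym) b₁≢b₂) (swap-r c b₂ τ) (swap-o c b₂ τ (adj-≢ e₃ ∘ sym) (b₂≢b₃ ∘ sym))
      (λ p q s t → trans (swap-o c b₂ τ p s) (o p q s t))

    move₃ : ∀ {σ τ w x y z} → At σ τ w x y z → part w ≢ part z → At σ (swap c b₃ τ) z x y w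
    move₃ {τ = τ} (at r refl refl refl refl o) d = at (⇝-trans r (swap-step e₃ d)) (swap-l c b₃ τ)
      (swap-o c b₃ τ (adj-≢ e₁ ∘ sym) b₁≢b₃) (swap-o c b₃ τ (adj-≢ e₂ ∘ sym) b₂≢b₃) (swap-r c b₃ τ)
      (λ p q s t → trans (swap-o c b₃ τ p t) (o p q s t))

    -- The moves along the third, first and second leg compose to a 4-cycle of the four positions;
    -- doing them twice gives its square, two disjoint transpositions. The centre alternates between
    -- the two sides, so every move is friendly.
    claw-Dx : ∀ σ → part (σ ! c) ≢ part (σ ! b₂) → part (σ ! c) ≢ part (σ ! b₃) → part (σ ! b₁) ≢ part (σ ! b₂) → part (σ ! b₁) ≢ part (σ ! b₃) →
      Dx σ (σ ! c) (σ ! b₁) (σ ! b₂) (σ ! b₃)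
    claw-Dx σ ux uy vx vy = conclude
        (move₂ (move₁ (move₃ (move₂ (move₁ (move₃ (start σ) uy) (vy ∘ sym)) vx) (ux ∘ sym)) uy) (vy ∘ sym))
      where
      conclude : ∀ {τ} → At σ τ (σ ! b₁) (σ ! c) (σ ! b₃) (σ ! b₂) → Dx σ (σ ! c) (σ ! b₁) (σ ! b₂) (σ ! b₃)
      conclude {τ} (at r p₀ p₁ p₂ p₃ o) = ⇝-respʳ r (dx-agree σ τ c b₁ b₂ b₃ (adj-≢ e₂) (adj-≢ e₃) b₁≢b₂ b₁≢b₃ p₀ p₁ p₂ p₃ (λ x a b d e → o a b d e))

    -- Friendship between the occupants of `b₂` and `b₃` permits one extra kind of move, and an odd
    -- number of swaps, here seven, can restore these two.
    claw-Ex : ∀ σ → part (σ ! c) ≢ part (σ ! b₂) → part (σ ! c) ≢ part (σ ! b₃) → part (σ ! b₁) ≢ part (σ ! b₂) → part (σ ! b₁) ≢ part (σ ! b₃) →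
      part (σ ! b₂) ≢ part (σ ! b₃) → Ex σ (σ ! c) (σ ! b₁)
    claw-Ex σ ux uy vx vy xy = conclude
        (move₃ (move₁ (move₂ (move₁ (move₃ (move₁ (move₂ (start σ) ux) (vx ∘ sym)) vy) (xy ∘ sym)) (ux ∘ sym)) uy) (vy ∘ sym))
      where
      conclude : ∀ {τ} → At σ τ (σ ! b₁) (σ ! c) (σ ! b₂) (σ ! b₃) → Ex σ (σ ! c) (σ ! b₁)
      conclude {τ} (at r p₀ p₁ p₂ p₃ o) = ⇝-respʳ r (ex-agree σ τ c b₁ p₀ p₁ others)
        where
        others : ∀ x → x ≢ c → x ≢ b₁ → τ ! x ≡ σ ! x
        others x a b with x ≟ᶠ b₂ | x ≟ᶠ b₃
        ... | yes refl | _ = p₂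
        ... | no _ | yes refl = p₃
        ... | no d | no e = o a b d e

-- Base regions with exactly two tokens.

module Bases {n : ℕ} (X : Graph n) (simple : IsSimple X) (part : Fin n → ℕ)
  (isT : Fin n → Bool) (apart : ∀ u v → isT u ≢ isT v → part u ≢ part v)
  (bs : List (Fin n)) (bs-unique : Unique bs) (bs-blank : ∀ {u} → u ∈ bs → isT u ≡ false)
  (bs-all : ∀ u → isT u ≡ false → u ∈ bs) where

  open GraphTheory X simple
  open FSCore X simple part
  open TwoColours X simple part isT apart
  open Blanks bs bs-unique bs-blank bs-all
  open Entries X simple
  open Claws X simple

  tb-apart : ∀ {u v} → isT u ≡ true → isT v ≡ false → part u ≢ part v
  tb-apart {u} {v} p q = apart u v (λ e → true≢false p (trans e q))

  entry-swapIn : ∀ {H} → ConnIn H → Unique H → 2 + length bs ≤ length H → 1 ≤ length bs → Entry H (length bs) →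
    ∃₂ λ h z → h ∈ H × z ∉ H × Adj X h z × SwapIn H z
  entry-swapIn ch uh l k≥1 (by-stick h∈ e c ey ey' u s z∉ lk) = _ , _ , h∈ , z∉ , e , swapIn-stick ch uh l c ey ey' u s z∉ lk
  entry-swapIn ch uh l k≥1 (by-ear h∈ h'∈ ne ear) = _ , _ , h∈ , Ear.outside ear (here refl) , proj₁ (Ear.path ear) , swapIn-ear ch uh l k≥1 h∈ h'∈ ne ear

  other? : ∀ c b → Decidable (λ (q : Fin n) → q ≢ c × q ≢ b)
  other? c b q = ¬? (q ≟ᶠ c) ×-dec ¬? (q ≟ᶠ b)

  others : Fin n → Fin n → List (Fin n) → List (Fin n)
  others c b K = filter (other? c b) K

  others-unique : ∀ {c b K} → Unique K → Unique (others c b K)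
  others-unique {c} {b} = Uₚ.filter⁺ (other? c b)

  others-⊆ : ∀ {c b K x} → x ∈ others c b K → x ∈ K
  others-⊆ {c} {b} {K} x∈ = proj₁ (∈-filter⁻ (other? c b) {xs = K} x∈)

  others-ok : ∀ {c b K x} → x ∈ others c b K → x ≢ c × x ≢ b
  others-ok {c} {b} {K} x∈ = proj₂ (∈-filter⁻ (other? c b) {xs = K} x∈)

  others-length : ∀ {c b K k} → Unique K → length K ≡ 2 + k → c ∈ K → b ∈ K → c ≢ b → length (others c b K) ≤ k
  others-length {c} {b} {K} {k} uK lK c∈ b∈ c≢b = ℕₚ.≤-pred (ℕₚ.≤-pred (subst (2 + length (others c b K) ≤_) lK (unique-⊆-length
      (unique-cons (λ { (here e) → c≢b e ; (there x) → proj₁ (others-ok {c} {b} {K} x) refl })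
        (unique-cons (λ x → proj₂ (others-ok {c} {b} {K} x) refl) (others-unique uK)))
      λ { (here refl) → c∈ ; (there (here refl)) → b∈ ; (there (there x)) → others-⊆ {c} {b} x })))

  record TokensAt (K : List (Fin n)) (c b u v : Fin n) (σ : Permutation′ n) : Set where
    constructor tokensAt
    field
      state : Permutation′ n
      stays : Within K σ state
      blank : ∀ {q} → q ∈ K → q ≢ c → q ≢ b → isT (state ! q) ≡ false
      place : (state ! c ≡ u × state ! b ≡ v) ⊎ (state ! c ≡ v × state ! b ≡ u)

  -- Once every vertex of `K` other than `c` and `b` holds a blank, the two tokens of `K` can only
  -- be on these two; their order remains open and is left to symmetry.
  tokens-at : ∀ {K c b u v} → ConnIn K → Unique K → length K ≡ 2 + length bs → c ∈ K → b ∈ K → c ≢ b →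
    isT u ≡ true → isT v ≡ true → u ≢ v → ∀ σ → AllB K σ → pos σ u ∈ K → pos σ v ∈ K → TokensAt K c b u v σ
  tokens-at {K} {c} {b} {u} {v} ch uK lK c∈ b∈ c≢b uT vT u≢v σ a u∈ v∈
    with make false bs-unique bs-blank ch (others c b K) (others-unique uK) (others-length uK lK c∈ b∈ c≢b) (others-⊆ {c} {b}) σ a
  ... | made τ w on off = tokensAt τ w (λ q∈ p q → on (∈-filter⁺ (other? c b) q∈ (p , q))) (go (where-is uT u∈) (where-is vT v∈))
    where
    where-is : ∀ {t} → isT t ≡ true → pos σ t ∈ K → (τ ! c ≡ t) ⊎ (τ ! b ≡ t)
    where-is {t} tT t∈ with pos τ t ≟ᶠ c | pos τ t ≟ᶠ b
    ... | yes e | _ = inj₁ (trans (cong (τ !_) (sym e)) (!-pos τ t))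
    ... | no _ | yes e = inj₂ (trans (cong (τ !_) (sym e)) (!-pos τ t))
    ... | no p | no q = ⊥-elim (true≢false tT (trans (cong isT (sym (!-pos τ t))) (on (∈-filter⁺ (other? c b) (keep-pos σ τ (Within.keep w) t∈) (p , q)))))
    go : (τ ! c ≡ u) ⊎ (τ ! b ≡ u) → (τ ! c ≡ v) ⊎ (τ ! b ≡ v) → (τ ! c ≡ u × τ ! b ≡ v) ⊎ (τ ! c ≡ v × τ ! b ≡ u)
    go (inj₁ p) (inj₁ q) = ⊥-elim (u≢v (trans (sym p) q))
    go (inj₁ p) (inj₂ q) = inj₁ (p , q)
    go (inj₂ p) (inj₁ q) = inj₂ (q , p)
    go (inj₂ p) (inj₂ q) = ⊥-elim (u≢v (trans (sym p) q))

  module Relation (R : Permutation′ n → Fin n → Fin n → Set)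
    (R-refl : ∀ {σ u} → R σ u u)
    (R-sym : ∀ {σ u v} → isT u ≡ true → isT v ≡ true → R σ u v → R σ v u)
    (R-trans : ∀ {σ u v w} → isT u ≡ true → isT v ≡ true → isT w ≡ true → R σ u v → R σ v w → R σ u w)
    (R-inv : ∀ {σ τ u v} → isT u ≡ true → isT v ≡ true → σ ⇝ τ → R τ u v → R σ u v) where

    open Grow R R-refl R-sym R-trans R-inv

    module _ (conn : Connected X) (k≥2 : 2 ≤ length bs) (nb : ¬ HasBridge X (length bs)) (C : Claw)
      (base : ∀ {K} → ConnIn K → (∀ {q} → q ∈ Claw.verts C → q ∈ K) → ∀ τ → AllB K τ → isT (τ ! Claw.c C) ≡ true → isT (τ ! Claw.b₁ C) ≡ true →
        (∀ {q} → q ∈ K → q ≢ Claw.c C → q ≢ Claw.b₁ C → isT (τ ! q) ≡ false) → R τ (τ ! Claw.c C) (τ ! Claw.b₁ C)) where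

      open Claw C

      base-good : ∀ {S} → ConnIn S → Unique S → length S ≡ 2 + length bs → (∀ {q} → q ∈ verts → q ∈ S) → Good S
      base-good cK uK lK v⊆ σ a u v uT vT u∈ v∈ with u ≟ᶠ v
      ... | yes refl = R-refl
      ... | no u≢v with tokens-at cK uK lK (v⊆ (there (there (there (here refl))))) (v⊆ (there (there (here refl)))) (adj-≢ e₁) uT vT u≢v σ a u∈ v∈
      ... | tokensAt τ w bl (inj₁ (refl , refl)) = R-inv uT vT (Within.reach w) (base cK v⊆ τ (keep-allIn σ τ (Within.keep w) a) uT vT bl)
      ... | tokensAt τ w bl (inj₂ (refl , refl)) = R-sym vT uT (R-inv vT uT (Within.reach w) (base cK v⊆ τ (keep-allIn σ τ (Within.keep w) a) vT uT bl))

      -- A claw has four vertices, so with at least two blanks it fits into a base region of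
      -- `2 + length bs` vertices, from which the relation spreads.
      related : 2 + length bs ≤ n → ∀ σ u v → isT u ≡ true → isT v ≡ true → R σ u v
      related ln with grow conn n (2 + length bs) verts-connected verts-unique (here refl) (s≤s (s≤s k≥2)) (≤-trans ln (ℕₚ.m≤n+m n 4)) ln
      ... | S , cK , uK , v⊆ , lK = spread ext (suc n) (≤-trans (ℕₚ.n<1+n n) (ℕₚ.m≤n+m _ (length S))) cK uK (≤-reflexive (sym lK)) (base-good cK uK lK v⊆)
        where
        ext : Extendable
        ext ch uh l x∉ = entry-swapIn ch uh l (ℕₚ.<⇒≤ k≥2) (entry-no-bridge conn (length bs) (ℕₚ.<⇒≤ k≥2) nb ch uh l x∉)

-- Three or more classes.

module ThreeClasses {n : ℕ} (X : Graph n) (simple : IsSimple X) (part : Fin n → ℕ) where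

  open GraphTheory X simple
  open FSCore X simple part
  open Claws X simple

  inClass : Fin n → Fin n → Bool
  inClass u x = part x ≡ᵇ part u

  inClass-true : ∀ {u x} → inClass u x ≡ true → part x ≡ part u
  inClass-true {u} {x} e = ℕₚ.≡ᵇ⇒≡ (part x) (part u) (subst B.T (sym e) tt)

  inClass-false : ∀ {u x} → inClass u x ≡ false → part x ≢ part u
  inClass-false {u} {x} e h = true≢false (trans (cong (_≡ᵇ part u) h) (≡ᵇ-refl (part u))) e

  false-inClass : ∀ {u x} → part x ≢ part u → inClass u x ≡ false
  false-inClass {u} {x} h = not-true (h ∘ inClass-true {u} {x})

  inClass-apart : ∀ u x y → inClass u x ≢ inClass u y → part x ≢ part y
  inClass-apart u x y h e = h (cong (_≡ᵇ part u) e)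

  outsiders : Fin n → List (Fin n)
  outsiders u = filter (λ x → inClass u x ≟ᵇ false) (allFin n)

  outsiders-unique : ∀ u → Unique (outsiders u)
  outsiders-unique u = Uₚ.filter⁺ (λ x → inClass u x ≟ᵇ false) (Uₚ.allFin⁺ n)

  outsiders-out : ∀ u {x} → x ∈ outsiders u → inClass u x ≡ false
  outsiders-out u x∈ = proj₂ (∈-filter⁻ (λ x → inClass u x ≟ᵇ false) {xs = allFin n} x∈)

  outsiders-all : ∀ u x → inClass u x ≡ false → x ∈ outsiders u
  outsiders-all u x e = ∈-filter⁺ (λ x → inClass u x ≟ᵇ false) (∈-allFin x) e

  module _ (u₀ : Fin n) where

    private
      isT = inClass u₀
    open TwoColours X simple part isT (inClass-apart u₀)
    open Blanks (outsiders u₀) (outsiders-unique u₀) (outsiders-out u₀) (outsiders-all u₀)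
    open Bases X simple part isT (inClass-apart u₀) (outsiders u₀) (outsiders-unique u₀) (outsiders-out u₀) (outsiders-all u₀)

    private
      same : ∀ {u v} → isT u ≡ true → isT v ≡ true → part u ≡ part v
      same {u} {v} p q = trans (inClass-true {u₀} {u} p) (sym (inClass-true {u₀} {v} q))

    module _ (C : Claw) {S : List (Fin n)} (v⊆ : ∀ {q} → q ∈ Claw.verts C → q ∈ S) where

      open Claw C

      private
        c∈ = v⊆ (there (there (there (here refl))))
        b₁∈ = v⊆ (there (there (here refl)))
        b₂∈ = v⊆ (there (here refl))
        b₃∈ = v⊆ (here refl)

      record Setup (τ : Permutation′ n) : Set where
        constructor setup
        field
          tc : isT (τ ! c) ≡ true
          tb : isT (τ ! b₁) ≡ true
          blank : ∀ {q} → q ∈ S → q ≢ c → q ≢ b₁ → isT (τ ! q) ≡ false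

        ne-c : ∀ {q} → isT (τ ! q) ≡ false → q ≢ c
        ne-c e refl = true≢false tc e

        ne-b : ∀ {q} → isT (τ ! q) ≡ false → q ≢ b₁
        ne-b e refl = true≢false tb e

        blank₂ : isT (τ ! b₂) ≡ false
        blank₂ = blank b₂∈ (adj-≢ e₂ ∘ sym) (b₁≢b₂ ∘ sym)

        blank₃ : isT (τ ! b₃) ≡ false
        blank₃ = blank b₃∈ (adj-≢ e₃ ∘ sym) (b₁≢b₃ ∘ sym)

      -- a blank x on a vertex q next to c, friendly to the blank on b₂
      exchange-at : ∀ τ → Setup τ → ∀ {q} → Adj X c q → b₁ ≢ q → q ≢ b₂ → isT (τ ! q) ≡ false → part (τ ! q) ≢ part (τ ! b₂) → Ex τ (τ ! c) (τ ! b₁)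
      exchange-at τ s {q} e p r qB d = ClawMoves.claw-Ex part (claw c b₁ q b₂ e₁ e e₂ p b₁≢b₂ r) τ
          (tb-apart tc qB) (tb-apart tc blank₂) (tb-apart tb qB) (tb-apart tb blank₂) d
        where open Setup s

      module _ {q : Fin n} (e : Adj X q b₁) (q≢c : q ≢ c) (q≢b₁ : q ≢ b₁) (q≢b₂ : q ≢ b₂) (q≢b₃ : q ≢ b₃) where

        record Five (σ τ : Permutation′ n) (x v u a b : Fin n) : Set where
          constructor five
          field
            reach : σ ⇝ τ
            at-q : τ ! q ≡ x
            at-1 : τ ! b₁ ≡ v
            at-c : τ ! c ≡ u
            at-2 : τ ! b₂ ≡ a
            at-3 : τ ! b₃ ≡ b

        swap-q1 : ∀ {σ τ x v u a b} → Five σ τ x v u a b → part x ≢ part v → Five σ (swap q b₁ τ) v x u a b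
        swap-q1 {τ = τ} (five r refl refl refl refl refl) d = five (⇝-trans r (swap-step e d)) (swap-l q b₁ τ) (swap-r q b₁ τ)
          (swap-o q b₁ τ (q≢c ∘ sym) (adj-≢ e₁)) (swap-o q b₁ τ (q≢b₂ ∘ sym) (b₁≢b₂ ∘ sym)) (swap-o q b₁ τ (q≢b₃ ∘ sym) (b₁≢b₃ ∘ sym))

        swap-c2 : ∀ {σ τ x v u a b} → Five σ τ x v u a b → part u ≢ part a → Five σ (swap c b₂ τ) x v a u b
        swap-c2 {τ = τ} (five r refl refl refl refl refl) d = five (⇝-trans r (swap-step e₂ d)) (swap-o c b₂ τ q≢c q≢b₂)
          (swap-o c b₂ τ (adj-≢ e₁ ∘ sym) b₁≢b₂) (swap-l c b₂ τ) (swap-r c b₂ τ) (swap-o c b₂ τ (adj-≢ e₃ ∘ sym) (b₂≢b₃ ∘ sym))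

        swap-c1 : ∀ {σ τ x v u a b} → Five σ τ x v u a b → part u ≢ part v → Five σ (swap c b₁ τ) x u v a b
        swap-c1 {τ = τ} (five r refl refl refl refl refl) d = five (⇝-trans r (swap-step e₁ d)) (swap-o c b₁ τ q≢c q≢b₁)
          (swap-r c b₁ τ) (swap-l c b₁ τ) (swap-o c b₁ τ (adj-≢ e₂ ∘ sym) (b₁≢b₂ ∘ sym)) (swap-o c b₁ τ (adj-≢ e₃ ∘ sym) (b₁≢b₃ ∘ sym))

        -- If the useful blank stands beyond `b₁`, five moves bring it onto `b₁` and the two tokens
        -- onto `c` and `b₂`. There `b₁` and `b₃` are leaves with friendly occupants.
        via-b₁ : ∀ τ → Setup τ → isT (τ ! q) ≡ false → part (τ ! q) ≢ part (τ ! b₂) → part (τ ! q) ≢ part (τ ! b₃) → Ex τ (τ ! c) (τ ! b₁)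
        via-b₁ τ s qB d₂ d₃ = conclude (swap-c1 (swap-q1 (swap-c1 (swap-c2 (swap-q1 (five ⇝-refl refl refl refl refl refl)
            (tb-apart tb qB ∘ sym)) (tb-apart tc blank₂)) (d₂ ∘ sym)) (tb-apart tb blank₂)) (tb-apart tb qB ∘ sym))
          where
          open Setup s
          conclude : ∀ {ρ} → Five τ ρ (τ ! b₂) (τ ! q) (τ ! b₁) (τ ! c) (τ ! b₃) → Ex τ (τ ! c) (τ ! b₁)
          conclude {ρ} (five r _ p₁ pc p₂ p₃) = Ex-inv (same tc tb) r (Ex-comm {ρ} (subst₂ (Ex ρ) pc p₂
            (ClawMoves.claw-Ex part (claw c b₂ b₁ b₃ e₂ e₁ e₃ (b₁≢b₂ ∘ sym) b₂≢b₃ b₁≢b₃) ρ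
              (subst₂ (λ y z → part y ≢ part z) (sym pc) (sym p₁) (tb-apart tb qB))
              (subst₂ (λ y z → part y ≢ part z) (sym pc) (sym p₃) (tb-apart tb blank₃))
              (subst₂ (λ y z → part y ≢ part z) (sym p₂) (sym p₁) (tb-apart tc qB))
              (subst₂ (λ y z → part y ≢ part z) (sym p₂) (sym p₃) (tb-apart tc blank₃))
              (subst₂ (λ y z → part y ≢ part z) (sym p₁) (sym p₃) d₃))))

      move-setup : ∀ {τ q j} → Setup τ → isT (τ ! q) ≡ false → isT (τ ! j) ≡ false → Setup (swap q j τ)
      move-setup {τ} {q} {j} s qB jB = setup (trans (cong isT keep-c) tc) (trans (cong isT keep-b) tb) blank'
        where
        open Setup s
        keep-c : swap q j τ ! c ≡ τ ! c
        keep-c = swap-o q j τ (ne-c qB ∘ sym) (ne-c jB ∘ sym)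
        keep-b : swap q j τ ! b₁ ≡ τ ! b₁
        keep-b = swap-o q j τ (ne-b qB ∘ sym) (ne-b jB ∘ sym)
        blank' : ∀ {x} → x ∈ S → x ≢ c → x ≢ b₁ → isT (swap q j τ ! x) ≡ false
        blank' {x} x∈ p r with tr-cases q j x
        ... | inj₁ (_ , h) = trans (cong (λ z → isT (τ ! z)) h) jB
        ... | inj₂ (inj₁ (_ , h)) = trans (cong (λ z → isT (τ ! z)) h) qB
        ... | inj₂ (inj₂ (_ , _ , h)) = trans (cong (λ z → isT (τ ! z)) h) (blank x∈ p r)

      -- bring a blank whose class differs from the class of the blanks on b₂ and b₃ along a walk to the claw
      chase : ∀ {q} → Star (AdjIn S) q c → ∀ τ → Setup τ → part (τ ! b₂) ≡ part (τ ! b₃) → isT (τ ! q) ≡ false →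
        part (τ ! q) ≢ part (τ ! b₂) → Ex τ (τ ! c) (τ ! b₁)
      chase ε τ s e₂₃ qB d = ⊥-elim (true≢false (Setup.tc s) qB)
      chase {q} (_◅_ {j = j} (e , q∈ , j∈) t) τ s e₂₃ qB d with j ≟ᶠ c
      ... | yes refl = exchange-at τ s (adj-sym e) (Setup.ne-b s qB ∘ sym) (λ { refl → d refl }) qB d
      ... | no j≢c with j ≟ᶠ b₁
      ... | yes refl = via-b₁ e (Setup.ne-c s qB) (Setup.ne-b s qB) (λ { refl → d refl }) (λ { refl → d (sym e₂₃) }) τ s qB d (λ h → d (trans h (sym e₂₃)))
      ... | no j≢b₁ with part (τ ! q) ℕ.≟ part (τ ! j)
      -- The occupant of `j` has the same class and takes over the role of the blank that is being
      -- brought; nothing moves.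
      ... | yes h = chase t τ s e₂₃ (Setup.blank s j∈ j≢c j≢b₁) (λ h' → d (trans h h'))
      ... | no dj = subst₂ (λ y z → Ex τ y z) (swap-o q j τ (Setup.ne-c s qB ∘ sym) (j≢c ∘ sym)) (swap-o q j τ (Setup.ne-b s qB ∘ sym) (j≢b₁ ∘ sym))
            (Ex-inv (same (Setup.tc s') (Setup.tb s')) (swap-step e dj) (case j ≟ᶠ b₂ of λ where
              (yes refl) → exchange-at τ' s' e₃ b₁≢b₃ (b₂≢b₃ ∘ sym) (Setup.blank₃ s') (subst₂ (λ y z → part y ≢ part z) (sym (swap-o q b₂ τ (λ { refl → d (sym e₂₃) }) (b₂≢b₃ ∘ sym))) (sym (swap-r q b₂ τ)) (λ h → d (trans (sym h) (sym e₂₃))))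
              (no j≢b₂) → case j ≟ᶠ b₃ of λ where
                (yes refl) → exchange-at τ' s' e₃ b₁≢b₃ (b₂≢b₃ ∘ sym) (Setup.blank₃ s') (subst₂ (λ y z → part y ≢ part z) (sym (swap-r q b₃ τ)) (sym (swap-o q b₃ τ (λ { refl → d refl }) b₂≢b₃)) d)
                (no j≢b₃) → chase t τ' s'
                  (subst₂ (λ y z → part y ≡ part z) (sym (swap-o q j τ (λ { refl → d refl }) (j≢b₂ ∘ sym))) (sym (swap-o q j τ (λ { refl → d (sym e₂₃) }) (j≢b₃ ∘ sym))) e₂₃)
                  (trans (cong isT (swap-r q j τ)) qB)
                  (subst₂ (λ y z → part y ≢ part z) (sym (swap-r q j τ)) (sym (swap-o q j τ (λ { refl → d refl }) (j≢b₂ ∘ sym))) d)))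
        where
        τ' = swap q j τ
        s' : Setup τ'
        s' = move-setup s qB (Setup.blank s j∈ j≢c j≢b₁)

    -- If the blanks on `b₂` and `b₃` are classmates, a person of a third class is needed. Being a
    -- blank, it stands in the region, and a walk inside the region leads it to the claw.
    exact : Connected X → Claw → (∀ a b → ∃ λ e → part e ≢ part a × part e ≢ part b) → 2 ≤ length (outsiders u₀) →
      ¬ HasBridge X (length (outsiders u₀)) → 2 + length (outsiders u₀) ≤ n → ∀ σ u v → isT u ≡ true → isT v ≡ true → Ex σ u v
    exact conn C third k≥2 nb ln = related conn k≥2 nb C base ln
      where
      open Claw C
      open Relation Ex (λ {σ} → Ex-refl {σ}) (λ {σ} _ _ → Ex-comm {σ}) (λ {σ} p q r → Ex-trans {σ} (same p q) (same q r)) (λ p q → Ex-inv (same p q))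
      base : ∀ {S} → ConnIn S → (∀ {q} → q ∈ verts → q ∈ S) → ∀ τ → AllB S τ → isT (τ ! c) ≡ true → isT (τ ! b₁) ≡ true →
        (∀ {q} → q ∈ S → q ≢ c → q ≢ b₁ → isT (τ ! q) ≡ false) → Ex τ (τ ! c) (τ ! b₁)
      base ch v⊆ τ a tc tb bl with part (τ ! b₂) ℕ.≟ part (τ ! b₃) | third u₀ (τ ! b₂)
      ... | no ne | _ = exchange-at C v⊆ τ (setup tc tb bl) e₃ b₁≢b₃ (b₂≢b₃ ∘ sym) (bl (v⊆ (here refl)) (adj-≢ e₃ ∘ sym) (b₁≢b₃ ∘ sym)) (ne ∘ sym)
      ... | yes eq | x , x≢u , x≢b₂ = chase C v⊆ (ch (a (pos τ x) xB) (v⊆ (there (there (there (here refl)))))) τ (setup tc tb bl) eq xB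
            (λ h → x≢b₂ (trans (cong part (sym (!-pos τ x))) h))
        where
        xB : isT (τ ! pos τ x) ≡ false
        xB = trans (cong isT (!-pos τ x)) (false-inClass {u₀} {x} x≢u)

  two-outsiders : (∀ a b → ∃ λ e → part e ≢ part a × part e ≢ part b) → ∀ u → 2 ≤ length (outsiders u)
  two-outsiders third u with third u u
  ... | x , x≢u , _ with third u x
  ... | y , y≢u , y≢x = unique-⊆-length (unique-cons {x = x} {y ∷ []} (λ { (here e) → y≢x (cong part (sym e)) }) (unique-cons (λ ()) []))
        λ { (here refl) → outsiders-all u x (false-inClass {u} {x} x≢u) ; (there (here refl)) → outsiders-all u y (false-inClass {u} {y} y≢u) }

  -- Exchanges are needed only for two distinct classmates, and these two together with their
  -- outsiders account for the bound `2 + length (outsiders u) ≤ n`.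
  connected-three : Connected X → Claw → (∀ a b → ∃ λ e → part e ≢ part a × part e ≢ part b) →
    (∀ u v → u ≢ v → part u ≡ part v → ¬ HasBridge X (length (outsiders u))) → FSConnected X Y
  connected-three conn C third nb = connected-of-exchanges conn λ σ a b e same →
    let u = σ ! a ; v = σ ! b ; u≢v = λ h → adj-≢ e (!-inj σ h) in
    exact u conn C third (two-outsiders third u) (nb u v u≢v same)
      (unique-fin-length (unique-cons {x = u} {v ∷ outsiders u} (λ { (here h) → u≢v h ; (there h) → inClass-false {u} {u} (outsiders-out u h) refl })
        (unique-cons (λ h → inClass-false {u} {v} (outsiders-out u h) (sym same)) (outsiders-unique u))))
      σ u v (≡ᵇ-refl (part u)) (trans (cong (_≡ᵇ part u) (sym same)) (≡ᵇ-refl (part u)))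

-- Spanning paths and cycles; connected graphs without a claw.

∨-split : ∀ {b c} → b ∨ c ≡ true → b ≡ true ⊎ c ≡ true
∨-split {true} e = inj₁ refl
∨-split {false} e = inj₂ e

∨-left : ∀ {b c} → b ≡ true → b ∨ c ≡ true
∨-left refl = refl

∨-right : ∀ {b c} → c ≡ true → b ∨ c ≡ true
∨-right {true} e = refl
∨-right {false} e = e

∧-split : ∀ {b c} → b ∧ c ≡ true → b ≡ true × c ≡ true
∧-split {true} e = refl , e

≡ᵇ-sound : ∀ {a b} → (a ≡ᵇ b) ≡ true → a ≡ b
≡ᵇ-sound {a} {b} e = ℕₚ.≡ᵇ⇒≡ a b (subst B.T (sym e) tt)

≡ᵇ-complete : ∀ {a b} → a ≡ b → (a ≡ᵇ b) ≡ true
≡ᵇ-complete {zero} refl = refl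
≡ᵇ-complete {suc a} refl = ≡ᵇ-complete {a} refl

Consecutive : ∀ {n} → Fin n → Fin n → Set
Consecutive i j = suc (toℕ i) ≡ toℕ j ⊎ suc (toℕ j) ≡ toℕ i

CyclicPair : ∀ n → Fin n → Fin n → Set
CyclicPair n i j = Consecutive i j ⊎ (toℕ i ≡ 0 × toℕ j ≡ n ∸ 1) ⊎ (toℕ j ≡ 0 × toℕ i ≡ n ∸ 1)

pathGraph-sound : ∀ {n} {i j : Fin n} → pathGraph n i j ≡ true → Consecutive i j
pathGraph-sound e with ∨-split e
... | inj₁ p = inj₁ (≡ᵇ-sound p)
... | inj₂ p = inj₂ (≡ᵇ-sound p)

pathGraph-complete : ∀ {n} {i j : Fin n} → Consecutive i j → pathGraph n i j ≡ true
pathGraph-complete (inj₁ e) = ∨-left (≡ᵇ-complete e)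
pathGraph-complete {i = i} {j} (inj₂ e) = ∨-right {suc (toℕ i) ≡ᵇ toℕ j} (≡ᵇ-complete e)

cycleGraph-sound : ∀ {n} {i j : Fin n} → cycleGraph n i j ≡ true → CyclicPair n i j
cycleGraph-sound {n} {i} {j} e with ∨-split {pathGraph n i j} e
... | inj₁ p = inj₁ (pathGraph-sound p)
... | inj₂ q with ∨-split {(toℕ i ≡ᵇ 0) ∧ (toℕ j ≡ᵇ n ∸ 1)} q
... | inj₁ r = let a , b = ∧-split r in inj₂ (inj₁ (≡ᵇ-sound a , ≡ᵇ-sound b))
... | inj₂ r = let a , b = ∧-split r in inj₂ (inj₂ (≡ᵇ-sound a , ≡ᵇ-sound b))

cycleGraph-complete : ∀ {n} {i j : Fin n} → CyclicPair n i j → cycleGraph n i j ≡ true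
cycleGraph-complete (inj₁ p) = ∨-left (pathGraph-complete p)
cycleGraph-complete {n} {i} {j} (inj₂ (inj₁ (a , b))) = ∨-right {pathGraph n i j}
  (∨-left (cong₂ _∧_ (≡ᵇ-complete a) (≡ᵇ-complete b)))
cycleGraph-complete {n} {i} {j} (inj₂ (inj₂ (a , b))) = ∨-right {pathGraph n i j}
  (∨-right {(toℕ i ≡ᵇ 0) ∧ (toℕ j ≡ᵇ n ∸ 1)} (cong₂ _∧_ (≡ᵇ-complete a) (≡ᵇ-complete b)))

module Shapes {n : ℕ} (X : Graph n) (simple : IsSimple X) where

  open GraphTheory X simple
  open Claws X simple

  span-iso : ∀ {ps : List (Fin n)} → Unique ps → (∀ x → x ∈ ps) → (g : Graph (length ps)) →
    (∀ i j → X (lookup ps i) (lookup ps j) ≡ g i j) → Iso X g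
  span-iso {ps} u full g h = mk↔ₛ′ (λ x → Any.index (full x)) (lookup ps)
      (λ i → unique-lookup u (sym (lookup-index (full (lookup ps i))))) (λ x → sym (lookup-index (full x)))
    , λ x y → trans (cong₂ X (lookup-index (full x)) (lookup-index (full y))) (h _ _)

  split-two : ∀ (ps : List (Fin n)) (i j : Fin (length ps)) → toℕ i < toℕ j →
    ∃₂ λ a b → ∃ λ d → ps ≡ a ++ lookup ps i ∷ b ++ lookup ps j ∷ d × length a ≡ toℕ i × suc (toℕ i + length b) ≡ toℕ j
  split-two (x ∷ ps) F.zero (F.suc j) (s≤s z≤n) = let b , d , e , l = split-one ps j in [] , b , d , cong (x ∷_) e , refl , cong suc l
    where
    split-one : ∀ (ps : List (Fin n)) (j : Fin (length ps)) → ∃₂ λ b d → ps ≡ b ++ lookup ps j ∷ d × length b ≡ toℕ j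
    split-one (x ∷ ps) F.zero = [] , ps , refl , refl
    split-one (x ∷ ps) (F.suc j) = let b , d , e , l = split-one ps j in x ∷ b , d , cong (x ∷_) e , cong suc l
  split-two (x ∷ ps) (F.suc i) (F.suc j) (s≤s l) = let a , b , d , e , p , q = split-two ps i j l in
    x ∷ a , b , d , cong (x ∷_) e , cong suc p , cong suc q

  -- The cycle is turned so that it starts at one end of the chord. Both arcs have an interior
  -- vertex, otherwise the chord would be an edge of the cycle.
  record Chord (vs : List (Fin n)) : Set where
    constructor chord
    field
      x y : Fin n
      l₁ l₂ : List (Fin n)
      path₁ : Path x l₁ y
      path₂ : Path y l₂ x
      edge : Adj X x y
      uniq : Unique (x ∷ l₁ ++ y ∷ l₂)
      nonempty₁ : 1 ≤ length l₁
      nonempty₂ : 1 ≤ length l₂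
      covers : ∀ {v} → v ∈ vs → v ∈ x ∷ l₁ ++ y ∷ l₂
      same-length : length vs ≡ length (x ∷ l₁ ++ y ∷ l₂)

  nonempty : (l : List (Fin n)) → length l ≢ 0 → 1 ≤ length l
  nonempty [] h = ⊥-elim (h refl)
  nonempty (_ ∷ _) h = s≤s z≤n

  chord-of : ∀ {c l} → Path c l c → Unique (c ∷ l) → ∀ (i j : Fin (length (c ∷ l))) → toℕ i < toℕ j →
    Adj X (lookup (c ∷ l) i) (lookup (c ∷ l) j) → ¬ CyclicPair (length (c ∷ l)) i j → Chord (c ∷ l)
  chord-of {c} {l} p u i j i<j e nc with split-two (c ∷ l) i j i<j
  ... | [] , b , d , eq , la , lb = go (proj₁ (∷-injective eq)) (proj₂ (∷-injective eq))
    where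
    x = lookup (c ∷ l) i
    y = lookup (c ∷ l) j
    go : c ≡ x → l ≡ b ++ y ∷ d → Chord (c ∷ l)
    go cx ld = chord x y b d (proj₁ sp) (proj₂ sp) e (subst Unique eq u)
        (nonempty b (λ h → nc (inj₁ (inj₁ (trans (cong suc (sym (trans (cong (toℕ i +_) h) (ℕₚ.+-identityʳ (toℕ i))))) lb)))))
        (nonempty d (λ h → nc (inj₂ (inj₁ (sym la , trans (sym lb) (trans (cong suc (cong (_+ length b) (sym la))) (last-index h)))))))
        (λ {v} → subst (v ∈_) eq) (cong length eq)
      where
      sp = path-split b (subst₂ (λ z m → Path z m z) cx ld p)
      last-index : length d ≡ 0 → suc (length b) ≡ length l
      last-index h = sym (trans (cong length ld) (trans (length-++ b) (trans (ℕₚ.+-suc (length b) (length d)) (cong suc (trans (cong (length b +_) h) (ℕₚ.+-identityʳ _))))))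
  ... | a₀ ∷ a , b , d , eq , la , lb = go (proj₁ (∷-injective eq)) (proj₂ (∷-injective eq))
    where
    x = lookup (c ∷ l) i
    y = lookup (c ∷ l) j
    go : c ≡ a₀ → l ≡ a ++ x ∷ b ++ y ∷ d → Chord (c ∷ l)
    go cx ld = chord x y b (d ++ c ∷ a) (proj₁ sp) (proj₂ sp) e (subst Unique rot (unique-rotate a (subst (λ m → Unique (c ∷ m)) ld u)))
        (nonempty b (λ h → nc (inj₁ (inj₁ (trans (cong suc (sym (trans (cong (toℕ i +_) h) (ℕₚ.+-identityʳ (toℕ i))))) lb)))))
        (subst (1 ≤_) (sym (trans (length-++ d) (ℕₚ.+-suc _ _))) (s≤s z≤n))
        (λ {v} v∈ → subst (v ∈_) rot (∈-rotate a (subst (λ m → v ∈ c ∷ m) ld v∈)))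
        (trans (cong (suc ∘ length) ld) (trans (length-swap (c ∷ a) (x ∷ b ++ y ∷ d)) (cong length rot)))
      where
      rot : x ∷ (b ++ y ∷ d) ++ c ∷ a ≡ x ∷ b ++ y ∷ (d ++ c ∷ a)
      rot = cong (x ∷_) (++-assoc b (y ∷ d) (c ∷ a))
      sp = path-split b (subst (λ m → Path x m x) (++-assoc b (y ∷ d) (c ∷ a)) (path-rotate a (subst (λ m → Path c m c) ld p)))
      length-swap : ∀ (r s : List (Fin n)) → length (r ++ s) ≡ length (s ++ r)
      length-swap r s = trans (length-++ r) (trans (ℕₚ.+-comm (length r) (length s)) (sym (length-++ s)))

  consecutive-adj : ∀ {ps} → Chain ps → ∀ {i j} → Consecutive i j → Adj X (lookup ps i) (lookup ps j)
  consecutive-adj {ps} ch (inj₁ e) = chain-lookup ps ch e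
  consecutive-adj {ps} ch (inj₂ e) = adj-sym (chain-lookup ps ch e)

  cyclicPair-sym : ∀ {m} {i j : Fin m} → CyclicPair m i j → CyclicPair m j i
  cyclicPair-sym (inj₁ (inj₁ e)) = inj₁ (inj₂ e)
  cyclicPair-sym (inj₁ (inj₂ e)) = inj₁ (inj₁ e)
  cyclicPair-sym (inj₂ (inj₁ e)) = inj₂ (inj₂ e)
  cyclicPair-sym (inj₂ (inj₂ e)) = inj₂ (inj₁ e)

  lookup-last : ∀ x (l : List (Fin n)) (j : Fin (length (x ∷ l))) → toℕ j ≡ length l → lookup (x ∷ l) j ≡ lst x l
  lookup-last x [] F.zero e = refl
  lookup-last x (y ∷ l) (F.suc j) e = lookup-last y l j (ℕₚ.suc-injective e)

  cyclic-adj : ∀ {c l} → Path c l c → ∀ {i j} → CyclicPair (length (c ∷ l)) i j → Adj X (lookup (c ∷ l) i) (lookup (c ∷ l) j)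
  cyclic-adj {c} {l} p (inj₁ h) = consecutive-adj (path→chain′ l p) h
  cyclic-adj {c} {l} p {F.zero} {j} (inj₂ (inj₁ (a , b))) = adj-sym (subst (λ z → Adj X z c) (sym (lookup-last c l j b)) (path-last l p))
  cyclic-adj {c} {l} p {i} {F.zero} (inj₂ (inj₂ (a , b))) = subst (λ z → Adj X z c) (sym (lookup-last c l i b)) (path-last l p)

  cyclicPair? : ∀ m (i j : Fin m) → Dec (CyclicPair m i j)
  cyclicPair? m i j = ((_ ℕ.≟ _) ⊎-dec (_ ℕ.≟ _)) ⊎-dec (((_ ℕ.≟ _) ×-dec (_ ℕ.≟ _)) ⊎-dec ((_ ℕ.≟ _) ×-dec (_ ℕ.≟ _)))

  cycle-or-chord : ∀ {c l} → Path c l c → Unique (c ∷ l) → (∀ x → x ∈ c ∷ l) → IsCycle X ⊎ Chord (c ∷ l)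
  cycle-or-chord {c} {l} p u full with any? (λ i → any? (λ j → (toℕ i ℕ.<? toℕ j) ×-dec (adj? (lookup (c ∷ l) i) (lookup (c ∷ l) j) ×-dec ¬? (cyclicPair? _ i j))))
  ... | yes (i , j , i<j , e , nc) = inj₂ (chord-of p u i j i<j e nc)
  ... | no none = inj₁ (subst (λ m → Iso X (cycleGraph m)) (length-of-full u full) (span-iso u full _ agree))
    where
    pair : ∀ i j → Adj X (lookup (c ∷ l) i) (lookup (c ∷ l) j) → CyclicPair _ i j
    pair i j e with ℕₚ.<-cmp (toℕ i) (toℕ j)
    ... | tri< a _ _ = decidable-stable (cyclicPair? _ i j) (λ nc → none (i , j , a , e , nc))
    ... | tri≈ _ a _ = ⊥-elim (adj-≢ e (cong (lookup (c ∷ l)) (toℕ-injective a)))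
    ... | tri> _ _ a = cyclicPair-sym (decidable-stable (cyclicPair? _ j i) (λ nc → none (j , i , a , adj-sym e , nc)))
    agree : ∀ i j → X (lookup (c ∷ l) i) (lookup (c ∷ l) j) ≡ cycleGraph _ i j
    agree i j = bool-ext (λ e → cycleGraph-complete {i = i} {j} (pair i j e)) (λ e → cyclic-adj p {i} {j} (cycleGraph-sound {i = i} {j} e))

  chord-claw : ∀ {vs} → Chord vs → Claw
  chord-claw (chord x y (a ∷ l₁) (b ∷ l₂) (ea , p) q e u n₁ n₂ _ _) =
    claw x a y (lst b l₂) ea e (adj-sym (path-last (b ∷ l₂) q))
      (λ h → unique-disjoint (a ∷ l₁) (unique-tail u) (here refl) (here h))
      (λ h → unique-disjoint (a ∷ l₁) (unique-tail u) (here refl) (there (subst (_∈ b ∷ l₂) (sym h) (lst∈ b l₂))))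
      (λ h → unique-head (unique-++ʳ (a ∷ l₁) (unique-tail u)) (subst (_∈ b ∷ l₂) (sym h) (lst∈ b l₂)))

  two-neighbours : ¬ Claw → ∀ {b a c y} → Adj X b a → Adj X b c → a ≢ c → Adj X b y → y ≡ a ⊎ y ≡ c
  two-neighbours nc {b} {a} {c} {y} ea ec a≢c ey with y ≟ᶠ a | y ≟ᶠ c
  ... | yes e | _ = inj₁ e
  ... | no _ | yes e = inj₂ e
  ... | no p | no q = ⊥-elim (nc (claw b a c y ea ec ey a≢c (p ∘ sym) (q ∘ sym)))

  -- An inner vertex of a path already has two neighbours on it, and without a claw there is no
  -- third.
  inner-closed : ¬ Claw → ∀ p₀ p ps {x y} → Chain (p₀ ∷ p ∷ ps) → Unique (p₀ ∷ p ∷ ps) → x ∈ p ∷ ps → Adj X x y →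
    y ∈ p₀ ∷ p ∷ ps ⊎ x ≡ lst p ps
  inner-closed nc p₀ p [] ch u (here refl) e = inj₂ refl
  inner-closed nc p₀ p (q ∷ ps) (d , d' , ch) u (here refl) e with two-neighbours nc (adj-sym d) d' (λ { refl → unique-head u (there (here refl)) }) e
  ... | inj₁ refl = inj₁ (here refl)
  ... | inj₂ refl = inj₁ (there (there (here refl)))
  inner-closed nc p₀ p (q ∷ ps) (d , ch) u (there x∈) e with inner-closed nc p q ps ch (unique-tail u) x∈ e
  ... | inj₁ y∈ = inj₁ (there y∈)
  ... | inj₂ h = inj₂ h

  before-last : ∀ p q ps → Chain (p ∷ q ∷ ps) → Σ (Fin n) λ a → a ∈ ini p (q ∷ ps) × Adj X a (lst p (q ∷ ps))
  before-last p q [] (e , _) = p , here refl , e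
  before-last p q (r ∷ ps) (e , ch) = let a , a∈ , d = before-last q r ps ch in a , there a∈ , d

  ini-⊆ : ∀ (x : Fin n) l {y} → y ∈ ini x l → y ∈ x ∷ l
  ini-⊆ x (z ∷ l) (here e) = here e
  ini-⊆ x (z ∷ l) (there p) = there (ini-⊆ z l p)

  closed-spans : Connected X → ∀ {ps : List (Fin n)} {v} → v ∈ ps → (∀ {x y} → x ∈ ps → Adj X x y → y ∈ ps) → ∀ x → x ∈ ps
  closed-spans conn {ps} {v} v∈ cl x = go v∈ (conn v x)
    where
    go : ∀ {u} → u ∈ ps → Star (Adj X) u x → x ∈ ps
    go u∈ ε = u∈
    go u∈ (e ◅ s) = go (cl u∈ e) s

  record Maximal (v : Fin n) : Set where
    constructor maximal
    field
      hd : Fin n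
      tl : List (Fin n)
      chain : Chain (hd ∷ tl)
      uniq : Unique (hd ∷ tl)
      last≡ : lst hd tl ≡ v
      stuck : ∀ {y} → Adj X hd y → y ∈ hd ∷ tl

  maximal-path : ∀ f q qs → n < length (q ∷ qs) + f → Chain (q ∷ qs) → Unique (q ∷ qs) → Maximal (lst q qs)
  maximal-path zero q qs l ch u = ⊥-elim (ℕₚ.<⇒≱ (subst (n <_) (ℕₚ.+-identityʳ _) l) (unique-fin-length u))
  maximal-path (suc f) q qs l ch u with any? (λ y → adj? q y ×-dec ¬? (y ∈? (q ∷ qs)))
  ... | no ¬p = maximal q qs ch u refl (λ {y} e → decidable-stable (y ∈? (q ∷ qs)) (λ y∉ → ¬p (y , e , y∉)))
  ... | yes (y , e , y∉) = maximal-path f y (q ∷ qs) (subst (n <_) (cong suc (ℕₚ.+-suc _ f)) l) (adj-sym e , ch) (unique-cons y∉ u)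

  data Shape : Set where
    cyclic : ∀ c l → Path c l c → Unique (c ∷ l) → (∀ x → x ∈ c ∷ l) → Shape
    linear : ∀ q p r → Chain (q ∷ p ∷ r) → Unique (q ∷ p ∷ r) → (∀ x → x ∈ q ∷ p ∷ r) → (∀ {y} → Adj X q y → y ≡ p) → Shape

  module _ (conn : Connected X) (nc : ¬ Claw) where

    isolated : ∀ {v w : Fin n} → v ≢ w → ¬ (∀ {y} → Adj X v y → y ∈ v ∷ [])
    isolated {v} {w} v≢w h = go (conn v w)
      where
      go : Star (Adj X) v w → ⊥
      go ε = v≢w refl
      go (e ◅ s) with h e
      ... | here refl = adj-irr e

    -- the head of a maximal path with a second neighbour closes up with the last vertex
    head-closes : ∀ q p qs → Chain (q ∷ p ∷ qs) → Unique (q ∷ p ∷ qs) → ∀ {y} → y ∈ q ∷ p ∷ qs → Adj X q y → y ≢ p →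
      ∃₂ λ r rs → qs ≡ r ∷ rs × y ≡ lst p qs
    head-closes q p qs ch u (here refl) e ne = ⊥-elim (adj-irr e)
    head-closes q p qs ch u (there (here refl)) e ne = ⊥-elim (ne refl)
    head-closes q p (r ∷ rs) (_ , ch) u (there (there y∈)) e ne with inner-closed nc p r rs ch (unique-tail u) y∈ (adj-sym e)
    ... | inj₁ q∈ = ⊥-elim (unique-head u q∈)
    ... | inj₂ h = r , rs , refl , h

    -- The head of a path that cannot be prolonged has all its neighbours on the path. A second one
    -- can only be the last vertex, since inner vertices are saturated; this closes a cycle, which
    -- spans X by connectedness.
    shape : ∀ v w → v ≢ w → Shape
    shape v w v≢w with maximal-path n v [] (ℕₚ.n<1+n n) tt (unique-cons (λ ()) [])
    ... | maximal q [] ch u refl st = ⊥-elim (isolated v≢w st)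
    ... | maximal q (p ∷ qs) ch u la st with any? (λ y → adj? q y ×-dec ¬? (y ≟ᶠ p))
    ... | yes (y , e , y≢p) with head-closes q p qs ch u (st e) e y≢p
    ... | r , rs , refl , refl = cyclic q (p ∷ r ∷ rs) (chain→path (p ∷ r ∷ rs) ch (adj-sym e)) u (closed-spans conn (here refl) closed)
      where
      around : Chain (p ∷ (r ∷ rs) ++ q ∷ [])
      around = chain-tail ((p ∷ r ∷ rs) ++ q ∷ []) (path→chain (p ∷ r ∷ rs) (chain→path (p ∷ r ∷ rs) ch (adj-sym e)))
      closed : ∀ {x y} → x ∈ q ∷ p ∷ r ∷ rs → Adj X x y → y ∈ q ∷ p ∷ r ∷ rs
      closed (here refl) d = st d
      closed (there (here refl)) d with inner-closed nc q p (r ∷ rs) ch u (here refl) d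
      ... | inj₁ h = h
      ... | inj₂ h = ⊥-elim (unique-head (unique-tail u) (subst (_∈ r ∷ rs) (sym h) (lst∈ r rs)))
      closed {x} (there (there x∈)) d with inner-closed nc p r (rs ++ q ∷ []) around (unique-swap (q ∷ []) u) (∈-++⁺ˡ x∈) d
      ... | inj₁ h = ∈-swap (p ∷ r ∷ rs) h
      ... | inj₂ h = ⊥-elim (unique-head u (there (subst (_∈ r ∷ rs) (trans h (lst-++ r rs [])) x∈)))
    shape v w v≢w | maximal q (p ∷ qs) ch u la st | no ¬y = second
      where
      leaf : ∀ {y} → Adj X q y → y ≡ p
      leaf {y} e = decidable-stable (y ≟ᶠ p) (λ ne → ¬y (y , e , ne))
      second : Shape
      -- The first path may have begun in the middle of X. Its head is a leaf, so a maximal path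
      -- that starts from this leaf has both ends settled and spans X.
      second with maximal-path n q [] (ℕₚ.n<1+n n) tt (unique-cons (λ ()) [])
      ... | maximal q' [] ch' u' refl st' = ⊥-elim (isolated {w = p} (λ e → unique-head u (here e)) st')
      ... | maximal q' (p' ∷ r) ch' u' la' st' with any? (λ y → adj? q' y ×-dec ¬? (y ≟ᶠ p'))
      ... | no ¬y' = linear q' p' r ch' u' (closed-spans conn (here refl) closed) (λ {y} e → decidable-stable (y ≟ᶠ p') (λ ne → ¬y' (y , e , ne)))
        where
        closed : ∀ {x y} → x ∈ q' ∷ p' ∷ r → Adj X x y → y ∈ q' ∷ p' ∷ r
        closed (here refl) d = st' d
        closed (there x∈) d with inner-closed nc q' p' r ch' u' x∈ d
        ... | inj₁ h = h
        ... | inj₂ h = let a , a∈ , e = before-last q' p' r ch' in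
              subst (_∈ q' ∷ p' ∷ r) (trans (leaf (adj-sym (subst (Adj X a) la' e))) (sym (leaf (subst (λ z → Adj X z _) (trans h la') d)))) (ini-⊆ q' (p' ∷ r) a∈)
      ... | yes (y , e , ne) with head-closes q' p' r ch' u' (st' e) e ne
      ... | s , ss , refl , refl = ⊥-elim (unique-head u' (subst (_∈ p' ∷ s ∷ ss)
              (trans (leaf (adj-sym (subst (Adj X a) la' d))) (sym (leaf (adj-sym (subst (Adj X q') la' e))))) (ini-⊆ p' (s ∷ ss) a∈)))
        where
        bl = before-last p' s ss (proj₂ ch')
        a = proj₁ bl
        a∈ = proj₁ (proj₂ bl)
        d = proj₂ (proj₂ bl)

    linear-consecutive : ∀ {q p r} → Chain (q ∷ p ∷ r) → Unique (q ∷ p ∷ r) → (∀ {y} → Adj X q y → y ≡ p) →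
      ∀ (i j : Fin (length (q ∷ p ∷ r))) → toℕ i < toℕ j → Adj X (lookup (q ∷ p ∷ r) i) (lookup (q ∷ p ∷ r) j) → suc (toℕ i) ≡ toℕ j
    linear-consecutive ch u leaf F.zero j l e = cong toℕ (unique-lookup u {F.suc F.zero} {j} (sym (leaf e)))
    linear-consecutive {q} {p} {r} ch u leaf (F.suc i) j l e with suc (suc (toℕ i)) ℕ.≟ toℕ j
    ... | yes h = h
    ... | no ne = ⊥-elim (nc (claw (lookup ps (F.suc i)) (lookup ps (inject₁ i)) (lookup ps next) (lookup ps j)
        (consecutive-adj ch {F.suc i} {inject₁ i} (inj₂ (cong suc (Fₚ.toℕ-inject₁ i)))) (consecutive-adj ch {F.suc i} {next} (inj₁ (sym toℕ-next))) e
        (λ h → ℕₚ.<⇒≢ (ℕₚ.m<n+m (toℕ i) {2} (s≤s z≤n)) (trans (sym (Fₚ.toℕ-inject₁ i)) (trans (cong toℕ (unique-lookup u h)) toℕ-next)))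
        (λ h → ℕₚ.<⇒≢ (ℕₚ.<⇒≤ l) (trans (sym (Fₚ.toℕ-inject₁ i)) (cong toℕ (unique-lookup u h))))
        (λ h → ne (trans (sym toℕ-next) (cong toℕ (unique-lookup u h))))))
      where
      ps = q ∷ p ∷ r
      lt : suc (suc (toℕ i)) < length ps
      lt = ℕₚ.<-trans (ℕₚ.≤∧≢⇒< l ne) (toℕ<n j)
      next : Fin (length ps)
      next = fromℕ< lt
      toℕ-next : toℕ next ≡ suc (suc (toℕ i))
      toℕ-next = toℕ-fromℕ< lt

    linear-iso : ∀ {q p r} → Chain (q ∷ p ∷ r) → Unique (q ∷ p ∷ r) → (∀ x → x ∈ q ∷ p ∷ r) → (∀ {y} → Adj X q y → y ≡ p) → IsPath X
    linear-iso {q} {p} {r} ch u full leaf = subst (λ m → Iso X (pathGraph m)) (length-of-full u full) (span-iso u full _ agree)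
      where
      pair : ∀ i j → Adj X (lookup (q ∷ p ∷ r) i) (lookup (q ∷ p ∷ r) j) → Consecutive i j
      pair i j e with ℕₚ.<-cmp (toℕ i) (toℕ j)
      ... | tri< a _ _ = inj₁ (linear-consecutive {r = r} ch u leaf i j a e)
      ... | tri≈ _ a _ = ⊥-elim (adj-≢ e (cong (lookup (q ∷ p ∷ r)) (toℕ-injective a)))
      ... | tri> _ _ a = inj₂ (linear-consecutive {r = r} ch u leaf j i a (adj-sym e))
      agree : ∀ i j → X (lookup (q ∷ p ∷ r) i) (lookup (q ∷ p ∷ r) j) ≡ pathGraph _ i j
      agree i j = bool-ext (λ e → pathGraph-complete {i = i} {j} (pair i j e)) (λ e → consecutive-adj ch {i} {j} (pathGraph-sound {i = i} {j} e))

++-cancel : {A : Set} (xs xs' : List A) {ys ys' : List A} → length xs ≡ length xs' → xs ++ ys ≡ xs' ++ ys' → xs ≡ xs' × ys ≡ ys'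
++-cancel [] [] l e = refl , e
++-cancel (x ∷ xs) (x' ∷ xs') l e with ∷-injective e
... | refl , e' with ++-cancel xs xs' (ℕₚ.suc-injective l) e'
... | refl , e'' = refl , e''

-- A cycle whose classes have one or two members, one of them a singleton.

module CycleExchange {n : ℕ} (X : Graph n) (simple : IsSimple X) (part : Fin n → ℕ) where

  open GraphTheory X simple
  open FSCore X simple part
  open Shapes X simple
  open Claws X simple

  module _ (w : Fin n) (lone : ∀ {x} → x ≢ w → part x ≢ part w) where

    -- The person `w` is friendly with everybody. Having passed all the others, `w` stands one
    -- vertex before its start and the others have fallen back by one, so the whole arrangement has
    -- turned by one step.
    rotate-all : ∀ {c l} → Path c l c → Unique (c ∷ l) → (∀ x → x ∈ c ∷ l) → ∀ σ →
      Σ (Permutation′ n) λ τ → σ ⇝ τ × map (τ !_) (c ∷ l) ≡ map (σ !_) l ++ σ ! c ∷ []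
    rotate-all {c} {l} p u full σ = go (∈-∃++ (full (σ ⟨$⟩ˡ w)))
      where
      friendly : ∀ {x q} → x ≢ q → q ≡ σ ⟨$⟩ˡ w → part (σ ! x) ≢ part (σ ! q)
      friendly {x} {q} x≢q refl h = lone (λ e → x≢q (!-inj σ (trans e (sym (inverseʳ σ))))) (trans h (cong part (inverseʳ σ)))
      go : (∃₂ λ a b → c ∷ l ≡ a ++ (σ ⟨$⟩ˡ w) ∷ b) → _
      go ([] , b , e) = state , reach , content
        where open Moved (carry σ c l (path→chain′ l p) u (λ {q} q∈ → friendly {q} {c} (λ q≡c → unique-head u (subst (_∈ l) q≡c q∈)) (proj₁ (∷-injective e))))
      go (a₀ ∷ a , b , e) with ∷-injective e
      ... | refl , refl = state , reach , rotated
        where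
        z = σ ⟨$⟩ˡ w
        u' : Unique (z ∷ b ++ c ∷ a)
        u' = unique-rotate a u
        open Moved (carry σ z (b ++ c ∷ a) (path→chain′ (b ++ c ∷ a) (path-rotate a p)) u' (λ {q} q∈ → friendly {q} {z} (λ q≡z → unique-head u' (subst (_∈ b ++ c ∷ a) q≡z q∈)) refl))
        τ = state
        parts : map (τ !_) (z ∷ b) ≡ map (σ !_) b ++ σ ! c ∷ [] × map (τ !_) (c ∷ a) ≡ map (σ !_) a ++ σ ! z ∷ []
        parts = ++-cancel (map (τ !_) (z ∷ b)) (map (σ !_) b ++ σ ! c ∷ [])
          (trans (cong suc (trans (Lₚ.length-map (τ !_) b) (sym (Lₚ.length-map (σ !_) b)))) (sym (trans (length-++ (map (σ !_) b)) (ℕₚ.+-comm _ 1))))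
          (trans (sym (map-++ (τ !_) (z ∷ b) (c ∷ a))) (trans content (trans (cong (_++ σ ! z ∷ []) (map-++ (σ !_) b (c ∷ a)))
            (trans (++-assoc (map (σ !_) b) _ _) (sym (++-assoc (map (σ !_) b) _ _))))))
        rotated : map (τ !_) (c ∷ a ++ z ∷ b) ≡ map (σ !_) (a ++ z ∷ b) ++ σ ! c ∷ []
        rotated = trans (map-++ (τ !_) (c ∷ a) (z ∷ b)) (trans (cong₂ _++_ (proj₂ parts) (proj₁ parts))
          (trans (++-assoc (map (σ !_) a) _ _) (sym (trans (cong (_++ σ ! c ∷ []) (map-++ (σ !_) a (z ∷ b))) (++-assoc (map (σ !_) a) _ _)))))

    -- The person on `c` passes everybody except its classmate on `d`. In the cyclic order only
    -- these two have changed places, and one turn of the whole cycle puts all the others back.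
    exchange-first : ∀ {c d f l} → Path c (d ∷ f ∷ l) c → Unique (c ∷ d ∷ f ∷ l) → (∀ x → x ∈ c ∷ d ∷ f ∷ l) → ∀ σ →
      (∀ x → x ≢ σ ! c → x ≢ σ ! d → part x ≢ part (σ ! c)) → Ex σ (σ ! c) (σ ! d)
    exchange-first {c} {d} {f} {l} p@(e₁ , e₂ , p') u full σ pair = finish (rotate-all p u full state)
      where
      L = f ∷ l
      uL : Unique (L ++ c ∷ [])
      uL = unique-tail (unique-swap (c ∷ []) u)
      d∉ : d ∉ L ++ c ∷ []
      d∉ = unique-head (unique-swap (c ∷ []) u)
      lstL : lst f (l ++ c ∷ []) ≡ c
      lstL = lst-++ f l []
      apart-on : ∀ {q} → q ∈ L → part (σ ! q) ≢ part (σ ! c)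
      apart-on {q} q∈L = pair (σ ! q) (λ e → unique-head u (there (subst (_∈ L) (!-inj σ e) q∈L))) (λ e → d∉ (∈-++⁺ˡ (subst (_∈ L) (!-inj σ e) q∈L)))
      open Moved (carryBack σ f (l ++ c ∷ []) (path→chain l p') uL
        (λ {q} q∈ h → apart-on (subst (q ∈_) (ini-++ f l) q∈) (trans h (cong (λ z → part (σ ! z)) lstL))))
      ct : map (state !_) (L ++ c ∷ []) ≡ σ ! c ∷ map (σ !_) L
      ct = trans content (cong₂ _∷_ (cong (σ !_) lstL) (cong (map (σ !_)) (ini-++ f l)))
      finish : Σ (Permutation′ n) (λ τ → state ⇝ τ × map (τ !_) (c ∷ d ∷ L) ≡ map (state !_) (d ∷ L) ++ state ! c ∷ []) → Ex σ (σ ! c) (σ ! d)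
      finish (τ , r , e) = ⇝-respʳ (⇝-trans reach r) (ex-agree σ τ c d (proj₁ (∷-injective e')) (proj₁ (∷-injective (proj₂ (∷-injective e'))))
          (λ x x≢c x≢d → map-agree {f = τ !_} {g = σ !_} (proj₂ (∷-injective (proj₂ (∷-injective e')))) (inside x x≢c x≢d (full x))))
        where
        e' : map (τ !_) (c ∷ d ∷ L) ≡ σ ! d ∷ σ ! c ∷ map (σ !_) L
        e' = trans e (cong₂ _∷_ (fixed d∉) (trans (sym (map-++ (state !_) L (c ∷ []))) ct))
        inside : ∀ x → x ≢ c → x ≢ d → x ∈ c ∷ d ∷ L → x ∈ L
        inside x a b (here h) = ⊥-elim (a h)
        inside x a b (there (here h)) = ⊥-elim (b h)
        inside x a b (there (there h)) = h

  connected-cycle : Connected X → ¬ Claw → 3 ≤ n → (w : Fin n) → (∀ {x} → x ≢ w → part x ≢ part w) →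
    (∀ {u v x} → part u ≡ part v → u ≢ v → x ≢ u → x ≢ v → part x ≢ part u) →
    ∀ {c l} → Path c l c → Unique (c ∷ l) → (∀ x → x ∈ c ∷ l) → FSConnected X Y
  connected-cycle conn nc n≥3 w lone pair {c} {l} p u full = connected-of-exchanges conn λ σ a b e same →
      exchange σ a b e same (∈-∃++ (full a))
    where
    long : ∀ {a m} → Unique (a ∷ m) → (∀ x → x ∈ a ∷ m) → ∃₂ λ d f → ∃ λ r → m ≡ d ∷ f ∷ r
    long {a} {[]} u full = ⊥-elim (ℕₚ.<⇒≱ n≥3 (subst (_≤ 2) (length-of-full u full) (s≤s z≤n)))
    long {a} {_ ∷ []} u full = ⊥-elim (ℕₚ.<⇒≱ n≥3 (subst (_≤ 2) (length-of-full u full) (s≤s (s≤s z≤n))))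
    long {a} {d ∷ f ∷ r} u full = d , f , r , refl
    at-start : ∀ σ a b → Adj X a b → part (σ ! a) ≡ part (σ ! b) → ∀ {m} → Path a m a → Unique (a ∷ m) → (∀ x → x ∈ a ∷ m) → Ex σ (σ ! a) (σ ! b)
    at-start σ a b e same {m} p u full with long u full
    ... | d , f , r , refl with two-neighbours nc (proj₁ p) (adj-sym (path-last (d ∷ f ∷ r) p)) (λ h → unique-head (unique-tail u) (subst (_∈ f ∷ r) (sym h) (lst∈ f r))) e
    ... | inj₁ refl = exchange-first w lone p u full σ (λ x → pair same (λ h → adj-≢ e (!-inj σ h)))
    -- The classmate stands on the preceding vertex of the cycle; reversing the cycle makes it the
    -- next one.
    ... | inj₂ refl = from-rev (reverse (d ∷ f ∷ r)) refl (path-rev (d ∷ f ∷ r) p)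
          (unique-cons (λ h → unique-head u (∈-reverse⁻ h)) (unique-reverse (unique-tail u)))
          (λ x → reversed (full x))
      where
      reversed : ∀ {x} → x ∈ a ∷ d ∷ f ∷ r → x ∈ a ∷ reverse (d ∷ f ∷ r)
      reversed (here h) = here h
      reversed (there h) = there (∈-reverse h)
      from-rev : ∀ m → reverse (d ∷ f ∷ r) ≡ m → Path a m a → Unique (a ∷ m) → (∀ x → x ∈ a ∷ m) → Ex σ (σ ! a) (σ ! lst d (f ∷ r))
      from-rev m eq p' u' full' with long u' full'
      ... | d' , f' , r' , refl with trans (sym (Lₚ.reverse-involutive (d ∷ f ∷ r))) (trans (cong reverse eq) (unfold-reverse d' (f' ∷ r')))
      ... | h = subst (λ z → Ex σ (σ ! a) (σ ! z)) (sym (trans (cong (lst′ d) h) (lst-snoc (reverse (f' ∷ r')) d')))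
            (exchange-first w lone p' u' full' σ (λ x → pair (trans same (cong (λ z → part (σ ! z)) (trans (cong (lst′ d) h) (lst-snoc (reverse (f' ∷ r')) d')))) (λ h' → adj-≢ (proj₁ p') (!-inj σ h'))))
        where
        lst′ : Fin n → List (Fin n) → Fin n
        lst′ x [] = x
        lst′ x (y ∷ l) = lst y l
        lst-snoc : ∀ l y → lst′ d (l ++ y ∷ []) ≡ y
        lst-snoc [] y = refl
        lst-snoc (x ∷ l) y = lst-++ x l []
    exchange : ∀ σ a b → Adj X a b → part (σ ! a) ≡ part (σ ! b) → (∃₂ λ s t → c ∷ l ≡ s ++ a ∷ t) → Ex σ (σ ! a) (σ ! b)
    exchange σ a b e same ([] , t , refl) = at-start σ a b e same p u full
    exchange σ a b e same (_ ∷ s , t , refl) = at-start σ a b e same (path-rotate s p) (unique-rotate s u) (λ x → ∈-rotate s (full x))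

-- Shorter bridges inside longer ones, and the bridges of a path.

module PathBridges {n : ℕ} (X : Graph n) (simple : IsSimple X) where

  open GraphTheory X simple
  open Entries X simple

  bridge-shorten : ∀ m → HasBridge X (suc (suc (suc m))) → HasBridge X (suc (suc m))
  bridge-shorten m (v , inj , cut , d2 , d₀ , d₁) = (λ i → v (inject₁ i)) , (λ e → Fₚ.inject₁-injective (inj e)) , (λ i → cut (inject₁ i))
    , (λ i → d2 (inject₁ i)) , d₀ , (λ e → case trans (sym (d2 (fromℕ m))) e of λ ())

  bridge-mono : ∀ d k → 2 ≤ k → HasBridge X (d + k) → HasBridge X k
  bridge-mono zero k h b = b
  bridge-mono (suc d) (suc zero) (s≤s ()) b
  bridge-mono (suc d) k@(suc (suc m)) h b = bridge-mono d k h (subst (HasBridge X) (sym (trans (ℕₚ.+-suc d (suc m)) (cong suc (ℕₚ.+-suc d m))))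
    (bridge-shorten (d + m) (subst (HasBridge X) (cong suc (trans (ℕₚ.+-suc d (suc m)) (cong suc (ℕₚ.+-suc d m)))) b)))

  bridge-≤ : ∀ {k k'} → 2 ≤ k → k ≤ k' → ¬ HasBridge X k → ¬ HasBridge X k'
  bridge-≤ {k} {k'} h le nb b = nb (bridge-mono (k' ∸ k) k h (subst (HasBridge X) (sym (ℕₚ.m∸n+n≡m le)) b))

  path-bridge : IsPath X → ∀ m → 4 + m ≤ n → HasBridge X (suc (suc m))
  path-bridge (f , agree) m le = v , v-inj , (λ i → adj-step i , cut i) , (λ i → inner-deg (F.suc (inject₁ i))) , ends F.zero , ends (fromℕ (suc m))
    where
    open Inverse f using (to; from)
    to-from : ∀ x → to (from x) ≡ x
    to-from x = Inverse.inverseˡ f refl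
    from-to : ∀ x → from (to x) ≡ x
    from-to x = Inverse.inverseʳ f refl
    at : ∀ {e} → e < n → Fin n
    at h = from (fromℕ< h)
    at-index : ∀ {e} (h : e < n) → toℕ (to (at h)) ≡ e
    at-index h = trans (cong toℕ (to-from (fromℕ< h))) (toℕ-fromℕ< h)
    index-≡ : ∀ {x y} → toℕ (to x) ≡ toℕ (to y) → x ≡ y
    index-≡ {x} {y} h = trans (sym (from-to x)) (trans (cong from (toℕ-injective h)) (from-to y))
    adj-of : ∀ {x y} → Consecutive (to x) (to y) → Adj X x y
    adj-of {x} {y} h = trans (agree x y) (pathGraph-complete {i = to x} {to y} h)
    of-adj : ∀ {x y} → Adj X x y → Consecutive (to x) (to y)
    of-adj {x} {y} e = pathGraph-sound {i = to x} {to y} (trans (sym (agree x y)) e)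
    bound : (i : Fin (suc (suc m))) → suc (suc (toℕ i)) < n
    bound i = ≤-trans (s≤s (s≤s (toℕ<n i))) le
    -- The bridge takes the places 1 to m + 2 of the path; the places 0 and m + 3 keep its ends from
    -- being leaves.
    v : Fin (suc (suc m)) → Fin n
    v i = at (ℕₚ.<⇒≤ (bound i))
    v-index : ∀ i → toℕ (to (v i)) ≡ suc (toℕ i)
    v-index i = at-index (ℕₚ.<⇒≤ (bound i))
    v-inj : Injective _≡_ _≡_ v
    v-inj {i} {j} e = toℕ-injective (ℕₚ.suc-injective (trans (sym (v-index i)) (trans (cong (toℕ ∘ to) e) (v-index j))))
    adj-step : (i : Fin (suc m)) → Adj X (v (inject₁ i)) (v (F.suc i))
    adj-step i = adj-of (inj₁ (trans (cong suc (trans (v-index (inject₁ i)) (cong suc (Fₚ.toℕ-inject₁ i)))) (sym (v-index (F.suc i)))))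
    cut : (i : Fin (suc m)) → ¬ Star (AdjMinusEdge X (v (inject₁ i)) (v (F.suc i))) (v (inject₁ i)) (v (F.suc i))
    cut i s = ℕₚ.<-irrefl refl (subst (_≤ suc (toℕ i)) (v-index (F.suc i)) (stay s (≤-reflexive (trans (v-index (inject₁ i)) (cong suc (Fₚ.toℕ-inject₁ i))))))
      where
      stay : ∀ {x y} → Star (AdjMinusEdge X (v (inject₁ i)) (v (F.suc i))) x y → toℕ (to x) ≤ suc (toℕ i) → toℕ (to y) ≤ suc (toℕ i)
      stay ε h = h
      stay {x} (_◅_ {j = y} (e , ne) s) h with of-adj e
      ... | inj₂ q = stay s (≤-trans (ℕₚ.n≤1+n _) (≤-trans (≤-reflexive q) h))
      ... | inj₁ q with toℕ (to x) ℕ.≟ suc (toℕ i)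
      ... | no lt = stay s (subst (_≤ suc (toℕ i)) q (ℕₚ.≤∧≢⇒< h lt))
      ... | yes eq = ⊥-elim (ne (inj₁ (index-≡ (trans eq (sym (trans (v-index (inject₁ i)) (cong suc (Fₚ.toℕ-inject₁ i)))))
                                      , index-≡ (trans (sym q) (trans (cong suc eq) (sym (v-index (F.suc i))))))))
    before after : Fin (suc (suc m)) → Fin n
    before i = at (ℕₚ.<⇒≤ (ℕₚ.<⇒≤ (bound i)))
    after i = at (bound i)
    b≢a : ∀ i → before i ≢ after i
    b≢a i h = ℕₚ.<⇒≢ (ℕₚ.m<n+m (toℕ i) {2} (s≤s z≤n)) (trans (sym (at-index (ℕₚ.<⇒≤ (ℕₚ.<⇒≤ (bound i))))) (trans (cong (toℕ ∘ to) h) (at-index (bound i))))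
    adj-b : ∀ i → Adj X (v i) (before i)
    adj-b i = adj-of (inj₂ (trans (cong suc (at-index (ℕₚ.<⇒≤ (ℕₚ.<⇒≤ (bound i))))) (sym (v-index i))))
    adj-a : ∀ i → Adj X (v i) (after i)
    adj-a i = adj-of (inj₁ (trans (cong suc (v-index i)) (sym (at-index (bound i)))))
    ends : ∀ i → deg X (v i) ≢ 1
    ends i = deg≢1 (b≢a i) (adj-b i) (adj-a i)
    inner-deg : ∀ i → deg X (v i) ≡ 2
    inner-deg i = ℕₚ.≤-antisym (deg-≤ {l = before i ∷ after i ∷ []} only) (deg-≥ (two-unique (b≢a i)) (two-adj (adj-b i) (adj-a i)))
      where
      only : ∀ {u} → Adj X (v i) u → u ∈ before i ∷ after i ∷ []
      only e with of-adj e
      ... | inj₁ q = there (here (index-≡ (trans (sym q) (trans (cong suc (v-index i)) (sym (at-index (bound i)))))))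
      ... | inj₂ q = here (index-≡ (ℕₚ.suc-injective (trans q (trans (v-index i) (cong suc (sym (at-index (ℕₚ.<⇒≤ (ℕₚ.<⇒≤ (bound i)))))))))) 

-- Two classes: an exchange in each at once.

module Pairings {n : ℕ} (X : Graph n) (simple : IsSimple X) (part : Fin n → ℕ)
  (isT : Fin n → Bool) (apart : ∀ u v → isT u ≢ isT v → part u ≢ part v) (same : ∀ u v → isT u ≡ isT v → part u ≡ part v)
  (bs : List (Fin n)) (bs-unique : Unique bs) (bs-blank : ∀ {u} → u ∈ bs → isT u ≡ false)
  (bs-all : ∀ u → isT u ≡ false → u ∈ bs) where

  open GraphTheory X simple
  open FSCore X simple part
  open TwoColours X simple part isT apart
  open Blanks bs bs-unique bs-blank bs-all
  open Bases X simple part isT apart bs bs-unique bs-blank bs-all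
  open Claws X simple

  same-tt : ∀ {u v} → isT u ≡ true → isT v ≡ true → part u ≡ part v
  same-tt {u} {v} p q = same u v (trans p (sym q))

  same-bb : ∀ {u v} → isT u ≡ false → isT v ≡ false → part u ≡ part v
  same-bb {u} {v} p q = same u v (trans p (sym q))

  -- With two classes a claw can only exchange two tokens together with two blanks. Which blanks are
  -- used is left open, and this freedom makes the relation transitive.
  record Paired (σ : Permutation′ n) (u v : Fin n) : Set where
    constructor paired
    field
      x y : Fin n
      xB : isT x ≡ false
      yB : isT y ≡ false
      x≢y : x ≢ y
      exchange : Dx σ u v x y

  tr-colour : ∀ {u v} → isT u ≡ isT v → ∀ z → isT (transpose u v ! z) ≡ isT z
  tr-colour {u} {v} h z with tr-cases u v z
  ... | inj₁ (refl , e) = trans (cong isT e) (sym h)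
  ... | inj₂ (inj₁ (refl , e)) = trans (cong isT e) h
  ... | inj₂ (inj₂ (_ , _ , e)) = cong isT e

  differ : ∀ {u v} → isT u ≡ true → isT v ≡ false → u ≢ v
  differ p q refl = true≢false p q

  -- Conjugating the second pair of exchanges by the first sends (v w) to (u w), and the two
  -- accompanying blanks to two distinct blanks.
  paired-trans : ∀ {σ u v w} → isT u ≡ true → isT v ≡ true → isT w ≡ true → w ≢ u → w ≢ v → Paired σ u v → Paired σ v w → Paired σ u w
  paired-trans {σ} {u} {v} {w} uT vT wT w≢u w≢v (paired x y xB yB x≢y d) (paired x' y' xB' yB' x≢y' d') =
      paired (g ! x') (g ! y') (trans (g-colour x') xB') (trans (g-colour y') yB') (x≢y' ∘ !-inj g)
        (subst₂ (λ a b → Dx σ a b (g ! x') (g ! y')) gv gw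
          (Dx-conj {σ} g (λ z → trans (tr-pres (same-bb xB yB) (transpose u v ! z)) (tr-pres (same-tt uT vT) z)) (same-tt vT wT) (same-bb xB' yB') d d'))
    where
    g = transpose u v ∘ₚ transpose x y
    g-colour : ∀ z → isT (g ! z) ≡ isT z
    g-colour z = trans (tr-colour {x} {y} (trans xB (sym yB)) (transpose u v ! z)) (tr-colour {u} {v} (trans uT (sym vT)) z)
    gv : g ! v ≡ u
    gv = trans (cong (transpose x y !_) (tr-r u v)) (tr-o x y (differ uT xB) (differ uT yB))
    gw : g ! w ≡ w
    gw = trans (cong (transpose x y !_) (tr-o u v w≢u w≢v)) (tr-o x y (differ wT xB) (differ wT yB))

  R : Permutation′ n → Fin n → Fin n → Set
  R σ u v = u ≡ v ⊎ Paired σ u v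

  R-sym : ∀ {σ u v} → isT u ≡ true → isT v ≡ true → R σ u v → R σ v u
  R-sym _ _ (inj₁ e) = inj₁ (sym e)
  R-sym {σ} _ _ (inj₂ (paired x y xB yB x≢y d)) = inj₂ (paired x y xB yB x≢y (Dx-commˡ {σ} d))

  R-trans : ∀ {σ u v w} → isT u ≡ true → isT v ≡ true → isT w ≡ true → R σ u v → R σ v w → R σ u w
  R-trans _ _ _ (inj₁ refl) r = r
  R-trans _ _ _ r@(inj₂ _) (inj₁ refl) = r
  R-trans {σ} {u} {v} {w} uT vT wT (inj₂ p) (inj₂ q) with w ≟ᶠ u | w ≟ᶠ v
  ... | yes e | _ = inj₁ (sym e)
  ... | no _ | yes refl = inj₂ p
  ... | no a | no b = inj₂ (paired-trans uT vT wT a b p q)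

  R-inv : ∀ {σ τ u v} → isT u ≡ true → isT v ≡ true → σ ⇝ τ → R τ u v → R σ u v
  R-inv _ _ r (inj₁ e) = inj₁ e
  R-inv uT vT r (inj₂ (paired x y xB yB x≢y d)) = inj₂ (paired x y xB yB x≢y (Dx-inv (same-tt uT vT) (same-bb xB yB) r d))

  all-paired : Connected X → 2 ≤ length bs → ¬ HasBridge X (length bs) → Claw → 2 + length bs ≤ n →
    ∀ σ u v → isT u ≡ true → isT v ≡ true → u ≢ v → Paired σ u v
  all-paired conn k≥2 nb C ln σ u v uT vT u≢v with related conn k≥2 nb C base ln σ u v uT vT
    where
    open Claw C
    open Relation R (inj₁ refl) R-sym R-trans R-inv
    base : ∀ {S} → ConnIn S → (∀ {q} → q ∈ verts → q ∈ S) → ∀ τ → AllB S τ → isT (τ ! c) ≡ true → isT (τ ! b₁) ≡ true →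
      (∀ {q} → q ∈ S → q ≢ c → q ≢ b₁ → isT (τ ! q) ≡ false) → R τ (τ ! c) (τ ! b₁)
    base ch v⊆ τ a tc tb bl = inj₂ (paired (τ ! b₂) (τ ! b₃) B₂ B₃ (b₂≢b₃ ∘ !-inj τ)
        (ClawMoves.claw-Dx part C τ (tb-apart tc B₂) (tb-apart tc B₃) (tb-apart tb B₂) (tb-apart tb B₃)))
      where
      B₂ = bl (v⊆ (there (here refl))) (adj-≢ e₂ ∘ sym) (b₁≢b₂ ∘ sym)
      B₃ = bl (v⊆ (here refl)) (adj-≢ e₃ ∘ sym) (b₁≢b₃ ∘ sym)
  ... | inj₁ e = ⊥-elim (u≢v e)
  ... | inj₂ p = p

-- If any two exchanges within classes can be performed together, an odd
-- number of exchanges within classes can be traded for a single one.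
module Parity {n : ℕ} (X : Graph n) (simple : IsSimple X) (part : Fin n → ℕ) where

  open GraphTheory X simple
  open FSCore X simple part

  module _ {t₀ t₁ : Fin n} (t-same : part t₀ ≡ part t₁)
    (double : ∀ σ u v → part u ≡ part v → u ≢ v → Dx σ u v t₀ t₁) where

    -- Equality up to one fixed exchange: the flag records the parity of the exchanges that have
    -- been replaced by (t₀ t₁).
    Par : Bool → Permutation′ n → Permutation′ n → Set
    Par false σ τ = σ ⇝ τ
    Par true σ τ = σ ⇝ τ ∘ₚ transpose t₀ t₁

    twist : ∀ {σ τ} → σ ⇝ τ ∘ₚ transpose t₀ t₁ → σ ∘ₚ transpose t₀ t₁ ⇝ τ
    twist {σ} {τ} r = ⇝-respʳ (act {σ} {τ ∘ₚ transpose t₀ t₁} (transpose t₀ t₁) (tr-pres t-same) r) (λ x → tr-invol t₀ t₁ (τ ! x))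

    par-trans : ∀ b c {σ τ ρ} → Par b σ τ → Par c τ ρ → Par (b xor c) σ ρ
    par-trans false c {σ} {τ} {ρ} p q = go c q
      where
      go : ∀ c → Par c τ ρ → Par c σ ρ
      go false q = ⇝-trans p q
      go true q = ⇝-trans p q
    par-trans true false {σ} {τ} {ρ} p q = ⇝-trans p (act {τ} {ρ} (transpose t₀ t₁) (tr-pres t-same) q)
    par-trans true true {σ} {τ} {ρ} p q = ⇝-trans p (twist {τ} {ρ} q)

    par-sym : ∀ b {σ τ} → Par b σ τ → Par b τ σ
    par-sym false p = ⇝-sym p
    par-sym true {σ} {τ} p = ⇝-sym (twist {σ} {τ} p)

    par-respʳ : ∀ b {σ τ τ'} → Par b σ τ → τ ≗ₚ τ' → Par b σ τ'
    par-respʳ false p e = ⇝-respʳ p e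
    par-respʳ true p e = ⇝-respʳ p (λ x → cong (transpose t₀ t₁ !_) (e x))

    par-swap : ∀ σ q r → q ≢ r → part (σ ! q) ≡ part (σ ! r) → Par true σ (swap q r σ)
    par-swap σ q r q≢r h = ⇝-respʳ (double σ (σ ! q) (σ ! r) h (q≢r ∘ !-inj σ)) (λ x → cong (transpose t₀ t₁ !_) (tr-conj σ q r x))

    record Shifted (σ : Permutation′ n) (q : Fin n) (ps : List (Fin n)) : Set where
      constructor shifted
      field
        state : Permutation′ n
        par : Par (odd (length ps)) σ state
        content : map (state !_) (q ∷ ps) ≡ map (σ !_) ps ++ σ ! q ∷ []
        fixed : ∀ {x} → x ∉ q ∷ ps → state ! x ≡ σ ! x

    -- A cyclic shift of m + 1 classmates costs m exchanges, hence the parity of `length ps`.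
    shift′ : ∀ σ q ps → Unique (q ∷ ps) → (∀ {p} → p ∈ ps → part (σ ! p) ≡ part (σ ! q)) → Shifted σ q ps
    shift′ σ q [] u f = shifted σ ⇝-refl refl (λ _ → refl)
    shift′ σ q (p ∷ ps) u f = shifted τ (par-trans true (odd (length ps)) {σ} {σ₁} {τ} (par-swap σ q p (λ { refl → unique-head u (here refl) }) (sym (f (here refl)))) pr)
        (cong₂ _∷_ (trans (fx (unique-head u)) (swap-l q p σ)) (trans ct (cong₂ (λ a b → a ++ b ∷ []) (agree-map off) (swap-r q p σ))))
        (λ x∉ → trans (fx (x∉ ∘ there)) (swap-o q p σ (λ { refl → x∉ (here refl) }) (λ { refl → x∉ (there (here refl)) })))
      where
      σ₁ = swap q p σ
      off : ∀ {r} → r ∈ ps → σ₁ ! r ≡ σ ! r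
      off r∈ = swap-o q p σ (λ { refl → unique-head u (there r∈) }) (λ { refl → unique-head (unique-tail u) r∈ })
      open Shifted (shift′ σ₁ p ps (unique-tail u) (λ r∈ → trans (cong part (off r∈)) (trans (f (there r∈)) (sym (cong part (swap-r q p σ))))))
        renaming (state to τ; par to pr; content to ct; fixed to fx)

    abstract
      shift : ∀ σ q ps → Unique (q ∷ ps) → (∀ {p} → p ∈ ps → part (σ ! p) ≡ part (σ ! q)) → Shifted σ q ps
      shift = shift′

-- An odd cycle with a pendant vertex.

module Lollipop {n : ℕ} (X : Graph n) (simple : IsSimple X) (part : Fin n → ℕ)
  (isT : Fin n → Bool) (apart : ∀ u v → isT u ≢ isT v → part u ≢ part v) (same : ∀ u v → isT u ≡ isT v → part u ≡ part v)
  (ts bs : List (Fin n)) (ts-unique : Unique ts) (bs-unique : Unique bs)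
  (ts-token : ∀ {u} → u ∈ ts → isT u ≡ true) (bs-blank : ∀ {u} → u ∈ bs → isT u ≡ false)
  (conn : Connected X)
  (pair-t : ∀ σ u v → isT u ≡ true → isT v ≡ true → u ≢ v → ∃₂ λ x y → isT x ≡ false × isT y ≡ false × x ≢ y × FSCore.Dx X simple part σ u v x y)
  (pair-b : ∀ σ x y → isT x ≡ false → isT y ≡ false → x ≢ y → ∃₂ λ u v → isT u ≡ true × isT v ≡ true × u ≢ v × FSCore.Dx X simple part σ x y u v) where

  open GraphTheory X simple
  open FSCore X simple part
  open TwoColours X simple part isT apart
  open Claws X simple

  tt-same : ∀ {u v} → isT u ≡ true → isT v ≡ true → part u ≡ part v
  tt-same {u} {v} p q = same u v (trans p (sym q))

  bb-same : ∀ {u v} → isT u ≡ false → isT v ≡ false → part u ≡ part v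
  bb-same {u} {v} p q = same u v (trans p (sym q))

  tok-apart : ∀ {u v} → isT u ≡ true → isT v ≡ false → part u ≢ part v
  tok-apart {u} {v} p q = apart u v (λ e → true≢false p (trans e q))

  module _ (one : ∀ σ → ∃₂ λ t t' → isT t ≡ true × isT t' ≡ true × t ≢ t' × Ex σ t t') where

    colour-tr : ∀ {p q a} → isT p ≡ true → isT q ≡ true → isT a ≡ true → isT (transpose p q ! a) ≡ true
    colour-tr {p} {q} {a} pT qT aT with tr-cases p q a
    ... | inj₁ (_ , h) = trans (cong isT h) qT
    ... | inj₂ (inj₁ (_ , h)) = trans (cong isT h) pT
    ... | inj₂ (inj₂ (_ , _ , h)) = trans (cong isT h) aT

    move-exchange : ∀ {σ a b} p q → isT a ≡ true → isT b ≡ true → isT p ≡ true → isT q ≡ true → Ex σ a b → Ex σ (transpose p q ! a) (transpose p q ! b)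
    move-exchange {σ} {a} {b} p q aT bT pT qT e with p ≟ᶠ q
    ... | yes refl = subst₂ (Ex σ) (sym (tr-self p a)) (sym (tr-self p b)) e
    ... | no p≢q with pair-t σ p q pT qT p≢q
    ... | x , y , xB , yB , _ , d = subst₂ (Ex σ) (fix aT) (fix bT)
          (Ex-conj {σ} (transpose p q ∘ₚ transpose x y) (λ z → trans (tr-pres (bb-same xB yB) (transpose p q ! z)) (tr-pres (tt-same pT qT) z)) (tt-same aT bT) d e)
      where
      fix : ∀ {a} → isT a ≡ true → transpose x y ! (transpose p q ! a) ≡ transpose p q ! a
      fix aT = tr-o x y (λ h → true≢false (colour-tr pT qT aT) (trans (cong isT h) xB)) (λ h → true≢false (colour-tr pT qT aT) (trans (cong isT h) yB))

    -- One exchange of some two tokens is carried to any two by conjugation. The carrying elements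
    -- are the paired exchanges, whose blank part does not affect tokens.
    exchange-tokens : ∀ σ u v → isT u ≡ true → isT v ≡ true → u ≢ v → Ex σ u v
    exchange-tokens σ u v uT vT u≢v with one σ
    ... | t , t' , tT , tT' , t≢t' , e = subst₂ (Ex σ) (tr-o t'' v (λ h → t''≢u (sym h)) u≢v) (tr-l t'' v)
          (move-exchange {σ} {u} {t''} t'' v uT t''T t''T vT (subst (λ z → Ex σ z t'') (tr-l t u) (move-exchange {σ} {t} {t'} t u tT tT' tT uT e)))
      where
      t'' = transpose t u ! t'
      t''T : isT t'' ≡ true
      t''T = colour-tr tT uT tT'
      t''≢u : t'' ≢ u
      t''≢u h = t≢t' (!-inj (transpose t u) (trans (tr-l t u) (sym h)))

    exchange-all : ∀ σ u v → part u ≡ part v → u ≢ v → Ex σ u v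
    exchange-all σ u v h u≢v with bool-cases (isT u) | bool-cases (isT v)
    ... | inj₁ uT | inj₂ vB = ⊥-elim (tok-apart uT vB h)
    ... | inj₂ uB | inj₁ vT = ⊥-elim (tok-apart vT uB (sym h))
    ... | inj₁ uT | inj₁ vT = exchange-tokens σ u v uT vT u≢v
    ... | inj₂ uB | inj₂ vB with pair-b σ u v uB vB u≢v
    ... | a , b , aT , bT , a≢b , d = Dx-Ex {σ} (tt-same aT bT) d (exchange-tokens σ a b aT bT a≢b)

  module _ {c d f p : Fin n} {Dt Db : List (Fin n)} (cyc : Path c (d ∷ Dt ++ f ∷ Db) c) (uniq : Unique (c ∷ d ∷ Dt ++ f ∷ Db))
    (cp : Adj X c p) (p∉ : p ∉ c ∷ d ∷ Dt ++ f ∷ Db) where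

    T B : List (Fin n)
    T = c ∷ d ∷ Dt
    B = f ∷ Db

    -- Tokens occupy an arc that starts at `c`, and blanks fill the rest of the cycle and the
    -- pendant vertex. Around `c` this is the colouring that `claw-Dx` requires.
    record Pattern (τ : Permutation′ n) : Set where
      constructor pattern-of
      field
        tok : ∀ {q} → q ∈ T → isT (τ ! q) ≡ true
        blk : ∀ {q} → q ∈ B → isT (τ ! q) ≡ false
        pendant : isT (τ ! p) ≡ false

    e : Fin n
    e = lst f Db

    uT : Unique T
    uT = unique-++ˡ uniq

    uB : Unique B
    uB = unique-++ʳ T uniq

    T∩B : ∀ {x} → x ∈ T → x ∉ B
    T∩B = unique-disjoint T uniq

    p∉T : p ∉ T
    p∉T x = p∉ (∈-++⁺ˡ x)

    p∉B : p ∉ B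
    p∉B x = p∉ (∈-++⁺ʳ T x)

    arrange′ : length T ≤ length ts → suc (length B) ≤ length bs → ∀ σ → ∃ λ τ → σ ⇝ τ × Pattern τ
    arrange′ lt lb σ = finish (make true ts-unique ts-token everywhere T uT lt (λ _ → ∈-allFin _) σ (λ q _ → ∈-allFin q))
      where
      everywhere : ConnIn (allFin n)
      everywhere {u} {v} _ _ = Star.map (λ e → e , ∈-allFin _ , ∈-allFin _) (conn u v)
      finish : Made true (allFin n) T σ → ∃ λ τ → σ ⇝ τ × Pattern τ
      finish (made τ w on off) = finish′ (make false bs-unique bs-blank everywhere (p ∷ B) (unique-cons p∉B uB) lb (λ _ → ∈-allFin _) τ (λ q _ → ∈-allFin q))
        where
        finish′ : Made false (allFin n) (p ∷ B) τ → ∃ λ τ → σ ⇝ τ × Pattern τ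
        finish′ (made ρ w' on' off') = ρ , ⇝-trans (Within.reach w) (Within.reach w')
          , pattern-of (λ {q} q∈ → not-false (λ h → true≢false (on q∈) (off' (λ { (here refl) → p∉T q∈ ; (there r) → T∩B q∈ r }) h)))
              (λ q∈ → on' (there q∈)) (on' (here refl))

    abstract
      arrange : length T ≤ length ts → suc (length B) ≤ length bs → ∀ σ → ∃ λ τ → σ ⇝ τ × Pattern τ
      arrange = arrange′

    claw-pair : ∀ τ → Pattern τ → Dx τ (τ ! c) (τ ! d) (τ ! e) (τ ! p)
    claw-pair τ (pattern-of tok blk pen) = ClawMoves.claw-Dx part
        (claw c d e p (proj₁ cyc) (adj-sym (subst (λ z → Adj X z c) (lst-++ d Dt Db) (path-last (d ∷ Dt ++ f ∷ Db) cyc))) cp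
          (λ h → T∩B (there (here refl)) (subst (_∈ B) (sym h) (lst∈ f Db))) (λ h → p∉T (there (here (sym h)))) (λ h → p∉B (subst (_∈ B) h (lst∈ f Db)))) τ
        (tok-apart (tok (here refl)) (blk (lst∈ f Db))) (tok-apart (tok (here refl)) pen)
        (tok-apart (tok (there (here refl))) (blk (lst∈ f Db))) (tok-apart (tok (there (here refl))) pen)

    record Rotated (τ : Permutation′ n) : Set where
      constructor rotated
      field
        state : Permutation′ n
        reach : τ ⇝ state
        patt : Pattern state
        on-T : map (state !_) T ≡ map (τ !_) (d ∷ Dt) ++ τ ! c ∷ []
        on-B : map (state !_) B ≡ τ ! e ∷ map (τ !_) (ini f Db)
        fixed : ∀ {x} → x ∉ T ++ B → state ! x ≡ τ ! x

    ini-≢ : ∀ {x} → x ∈ ini f Db → x ≢ e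
    ini-≢ {x} x∈ refl = unique-disjoint (ini f Db) (subst Unique (sym (ini-lst f Db)) uB) x∈ (here refl)

    ini-B : ∀ {x} → x ∈ ini f Db → x ∈ B
    ini-B {x} x∈ = subst (x ∈_) (ini-lst f Db) (∈-++⁺ˡ x∈)

    e∈B : e ∈ B
    e∈B = lst∈ f Db

    c≢ : ∀ {x} → x ∈ B → x ≢ c
    c≢ x∈ refl = T∩B (here refl) x∈

    first-part : Path c (d ∷ Dt) f × Path f Db c
    first-part = path-split (d ∷ Dt) cyc

    -- The token on `c` goes backwards through the blank arc while the last blank goes forwards
    -- through the token arc. Both arcs turn by one in themselves and the pattern is restored.
    rotate′ : ∀ τ → Pattern τ → Rotated τ
    rotate′ τ (pattern-of tok blk pen) = Pulled.result (carryBack τ₁ f Db (path→chain′ Db (proj₂ first-part)) uB (λ {x} x∈ → subst₂ (λ y z → part y ≢ part z) (sym (τ₁-ini x∈)) (sym (swap-r c e τ)) (tok-apart (tok (here refl)) (blk (ini-B x∈)) ∘ sym)))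
      where
      τ₁ = swap c e τ
      τ₁-ini : ∀ {x} → x ∈ ini f Db → τ₁ ! x ≡ τ ! x
      τ₁-ini x∈ = swap-o c e τ (c≢ (ini-B x∈)) (ini-≢ x∈)
      τ₁-T : ∀ {x} → x ∈ d ∷ Dt → τ₁ ! x ≡ τ ! x
      τ₁-T x∈ = swap-o c e τ (λ { refl → unique-head uT x∈ }) (λ { refl → T∩B (there x∈) e∈B })
      module Pulled (mv : Moved τ₁ (f ∷ Db) (τ₁ ! lst f Db ∷ map (τ₁ !_) (ini f Db))) where
        open Moved mv renaming (state to τ₂; reach to r₂; content to c₂; fixed to f₂)
        τ₂c : τ₂ ! c ≡ τ ! e
        τ₂c = trans (f₂ (T∩B (here refl))) (swap-l c e τ)
        τ₂f : τ₂ ! f ≡ τ ! c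
        τ₂f = trans (proj₁ (∷-injective c₂)) (swap-r c e τ)
        τ₂-Db : map (τ₂ !_) Db ≡ map (τ !_) (ini f Db)
        τ₂-Db = trans (proj₂ (∷-injective c₂)) (agree-map τ₁-ini)
        τ₂-T : ∀ {x} → x ∈ d ∷ Dt → τ₂ ! x ≡ τ ! x
        τ₂-T x∈ = trans (f₂ (T∩B (there x∈))) (τ₁-T x∈)
        Q = d ∷ Dt ++ f ∷ []
        uQ : Unique (c ∷ Q)
        uQ = unique-++ uT (unique-cons (λ ()) []) (λ { x∈ (here refl) → T∩B x∈ (here refl) })
        Q-tok : ∀ {x} → x ∈ d ∷ Dt → isT (τ₂ ! x) ≡ true
        Q-tok x∈ = trans (cong isT (τ₂-T x∈)) (tok (there x∈))
        module Pushed (mv′ : Moved τ₂ (c ∷ Q) (map (τ₂ !_) Q ++ τ₂ ! c ∷ [])) where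
          open Moved mv′ renaming (state to τ₃; reach to r₃; content to c₃; fixed to f₃)
          c₃' : map (τ₃ !_) T ++ τ₃ ! f ∷ [] ≡ map (τ₂ !_) Q ++ τ₂ ! c ∷ []
          c₃' = trans (sym (map-++ (τ₃ !_) T (f ∷ []))) c₃
          on-T : map (τ₃ !_) T ≡ map (τ !_) (d ∷ Dt) ++ τ ! c ∷ []
          on-T = trans (∷ʳ-injectiveˡ (map (τ₃ !_) T) (map (τ₂ !_) Q) c₃')
                 (trans (map-++ (τ₂ !_) (d ∷ Dt) (f ∷ [])) (cong₂ (λ a b → a ++ b ∷ []) (agree-map τ₂-T) τ₂f))
          notQ : ∀ {x} → x ∉ T → x ≢ f → x ∉ c ∷ Q
          notQ x∉ x≢f x∈ = [ x∉ , (λ { (here h) → x≢f h }) ]′ (∈-++⁻ T x∈)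
          on-B : map (τ₃ !_) B ≡ τ ! e ∷ map (τ !_) (ini f Db)
          on-B = cong₂ _∷_ (trans (∷ʳ-injectiveʳ (map (τ₃ !_) T) (map (τ₂ !_) Q) c₃') τ₂c)
            (trans (agree-map (λ {x} x∈ → f₃ (notQ (λ x∈T → T∩B x∈T (there x∈)) (λ { refl → unique-head uB x∈ })))) τ₂-Db)
          outside : ∀ {x} → x ∉ T ++ B → τ₃ ! x ≡ τ ! x
          outside {x} x∉ = trans (f₃ (notQ (λ h → x∉ (∈-++⁺ˡ h)) (λ { refl → x∉ (∈-++⁺ʳ T (here refl)) })))
            (trans (f₂ (λ h → x∉ (∈-++⁺ʳ T h))) (swap-o c e τ (λ { refl → x∉ (here refl) }) (λ { refl → x∉ (∈-++⁺ʳ T e∈B) })))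
          tok' : ∀ {q} → q ∈ T → isT (τ₃ ! q) ≡ true
          tok' {q} q∈ = [ (λ h → let r , r∈ , eq = ∈-map⁻ (τ !_) h in trans (cong isT eq) (tok (there r∈)))
                        , (λ { (here eq) → trans (cong isT eq) (tok (here refl)) }) ]′
              (∈-++⁻ (map (τ !_) (d ∷ Dt)) (subst (τ₃ ! q ∈_) on-T (∈-map⁺ (τ₃ !_) q∈)))
          blk-of : ∀ {z} → z ∈ τ ! e ∷ map (τ !_) (ini f Db) → isT z ≡ false
          blk-of (here eq) = trans (cong isT eq) (blk e∈B)
          blk-of (there h) = let r , r∈ , eq = ∈-map⁻ (τ !_) h in trans (cong isT eq) (blk (ini-B r∈))
          blk' : ∀ {q} → q ∈ B → isT (τ₃ ! q) ≡ false
          blk' {q} q∈ = blk-of (subst (τ₃ ! q ∈_) on-B (∈-map⁺ (τ₃ !_) q∈))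
          result : Rotated τ
          result = rotated τ₃ (⇝-trans (swap-step (adj-sym (path-last Db (proj₂ first-part))) (tok-apart (tok (here refl)) (blk e∈B))) (⇝-trans r₂ r₃)) (pattern-of tok' blk' (trans (cong isT (outside p∉)) pen)) on-T on-B outside
        result : Rotated τ
        result = Pushed.result (carry τ₂ c Q (path→chain (d ∷ Dt) (proj₁ first-part)) uQ (λ {x} x∈ → [ (λ x∈D → tok-apart (Q-tok x∈D) (trans (cong isT τ₂c) (blk e∈B))) , (λ h → tok-apart (trans (cong isT (trans (cong (τ₂ !_) (∈-single {P = λ y → y ≡ f} refl h)) τ₂f)) (tok (here refl))) (trans (cong isT τ₂c) (blk e∈B))) ]′ (∈-++⁻ (d ∷ Dt) x∈)))

    abstract
      rotate : ∀ τ → Pattern τ → Rotated τ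
      rotate = rotate′

    record Turned (τ : Permutation′ n) (ct cb : List (Fin n)) : Set where
      constructor turned
      field
        state : Permutation′ n
        reach : τ ⇝ state
        patt : Pattern state
        on-T : map (state !_) T ≡ ct
        on-B : map (state !_) B ≡ cb
        at-p : state ! p ≡ τ ! p

    snoc-view : ∀ {A : Set} (l : List A) m → length l ≡ suc m → Σ (List A) λ l' → Σ A λ b → l ≡ l' ++ b ∷ [] × length l' ≡ m
    snoc-view (x ∷ l) m h = ini x l , lst x l , sym (ini-lst x l) ,
      ℕₚ.suc-injective (trans (sym (trans (length-++ (ini x l)) (ℕₚ.+-comm _ 1))) (trans (cong length (ini-lst x l)) h))

    map-B : ∀ τ {l b} → map (τ !_) B ≡ l ++ b ∷ [] → map (τ !_) (ini f Db) ≡ l × τ ! e ≡ b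
    map-B τ {l} h = ∷ʳ-injective (map (τ !_) (ini f Db)) l
      (trans (sym (map-++ (τ !_) (ini f Db) (e ∷ []))) (trans (cong (map (τ !_)) (ini-lst f Db)) h))

    turn : ∀ T₁ {T₂ B₁} B₂ → length T₁ ≡ length B₂ → ∀ τ → Pattern τ → map (τ !_) T ≡ T₁ ++ T₂ → map (τ !_) B ≡ B₁ ++ B₂ →
      Turned τ (T₂ ++ T₁) (B₂ ++ B₁)
    turn [] {T₂} {B₁} [] l τ pt eT eB = turned τ ⇝-refl pt (trans eT (sym (++-identityʳ T₂))) (trans eB (++-identityʳ B₁)) refl
    turn (t ∷ T₁) {T₂} {B₁} B₂ l τ pt eT eB with snoc-view B₂ (length T₁) (sym l)
    ... | B₂' , b , refl , l' with map-B τ (trans eB (sym (++-assoc B₁ B₂' (b ∷ []))))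
    ... | hi , he with rotate τ pt
    ... | rotated ρ r pt' on-T on-B fx with turn T₁ {T₂ ++ t ∷ []} {b ∷ B₁} B₂' (sym l') ρ pt'
            (trans on-T (trans (cong₂ (λ x y → x ++ y ∷ []) (proj₂ (∷-injective eT)) (proj₁ (∷-injective eT))) (++-assoc T₁ T₂ (t ∷ []))))
            (trans on-B (cong₂ _∷_ he hi))
    ... | turned ρ' r' pt'' on-T' on-B' at-p = turned ρ' (⇝-trans r r') pt'' (trans on-T' (++-assoc T₂ (t ∷ []) T₁))
          (trans on-B' (sym (++-assoc B₂' (b ∷ []) B₁))) (trans at-p (fx (λ h → p∉ h)))

    -- A second state with the same tokens on `c` and `d` and the same blank on `p`, but another
    -- blank on `e`. The paired exchanges at the two states share the tokens and multiply to a
    -- 3-cycle of blanks.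
    record Overlap (τ : Permutation′ n) : Set where
      constructor overlapped
      field
        state : Permutation′ n
        reach : τ ⇝ state
        patt : Pattern state
        at-c : state ! c ≡ τ ! c
        at-d : state ! d ≡ τ ! d
        at-p : state ! p ≡ τ ! p
        at-e : state ! e ≢ τ ! e

    drop-end : ∀ {A : Set} m (l : List A) → m < length l → ∃₂ λ l₁ l₂ → Σ A λ b → l ≡ (l₁ ++ b ∷ []) ++ l₂ × length l₂ ≡ m
    drop-end m (x ∷ l) h with m ℕ.≟ length l
    ... | yes e = [] , l , x , refl , sym e
    ... | no ne with drop-end m l (ℕₚ.≤∧≢⇒< (ℕₚ.≤-pred h) ne)
    ... | l₁ , l₂ , b , refl , e = x ∷ l₁ , l₂ , b , refl , e

    uτB : ∀ τ → Unique (map (τ !_) B)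
    uτB τ = Uₚ.map⁺ (!-inj τ) uB

    T-contents : ∀ τ ρ → map (ρ !_) T ≡ map (τ !_) T → ρ ! c ≡ τ ! c × ρ ! d ≡ τ ! d
    T-contents τ ρ h = proj₁ (∷-injective h) , proj₁ (∷-injective (proj₂ (∷-injective h)))

    -- After `length T` rotations the tokens are home, while the longer ring of blanks has not
    -- completed a turn.
    overlap-shorter : length T < length B → ∀ τ → Pattern τ → Overlap τ
    overlap-shorter lt τ pt with drop-end (length T) (map (τ !_) B) (subst (length T <_) (sym (Lₚ.length-map (τ !_) B)) lt)
    ... | l₁ , l₂ , b , eq , len₂ with snoc-view l₂ (suc (length Dt)) len₂ | turn (map (τ !_) T) {[]} {l₁ ++ b ∷ []} l₂ (trans (Lₚ.length-map (τ !_) T) (sym len₂)) τ pt (sym (++-identityʳ _)) eq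
    ... | l₂' , b₂ , refl , _ | turned ρ r pt' on-T on-B at-p = overlapped ρ r pt' (proj₁ (T-contents τ ρ on-T)) (proj₂ (T-contents τ ρ on-T)) at-p
          λ h → unique-disjoint (l₁ ++ b ∷ []) {x = b} (subst Unique eq (uτB τ)) (∈-++⁺ʳ l₁ (here refl))
            (∈-++⁺ʳ l₂' (here (trans (sym (proj₂ (map-B ρ (trans on-B (sym (++-assoc (l₂' ++ b₂ ∷ []) l₁ (b ∷ []))))))) (trans h (proj₂ (map-B τ (trans eq (sym (++-assoc (l₁ ++ b ∷ []) l₂' (b₂ ∷ []))))))))))

    -- After `length T` rotations the tokens are home and the blanks have made one full turn and one
    -- step, which displaces them as there are at least two on the arc.
    overlap-longer : length T ≡ suc (length B) → 2 ≤ length B → ∀ τ → Pattern τ → Overlap τ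
    overlap-longer lT l2 τ pt with snoc-view (map (τ !_) T) (length B) (trans (Lₚ.length-map (τ !_) T) lT)
    ... | T₁ , t , eT , lT₁ = once (turn T₁ {t ∷ []} {[]} (map (τ !_) B) (trans lT₁ (sym (Lₚ.length-map (τ !_) B))) τ pt eT refl)
      where
      twice : ∀ {ρ l₁ b₂ b} → τ ⇝ ρ → ρ ! p ≡ τ ! p → map (τ !_) B ≡ (l₁ ++ b ∷ []) ++ b₂ ∷ [] → Turned ρ (T₁ ++ t ∷ []) (b₂ ∷ l₁ ++ b ∷ []) → Overlap τ
      twice {ρ} {l₁} {b₂} {b} r at-p eq (turned ρ' r' pt'' on-T' on-B' at-p') =
        overlapped ρ' (⇝-trans r r') pt'' (proj₁ contents) (proj₂ contents) (trans at-p' at-p)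
          λ h → unique-disjoint (l₁ ++ b ∷ []) {x = b} (subst Unique eq (uτB τ)) (∈-++⁺ʳ l₁ (here refl))
            (here (trans (sym (proj₂ (map-B ρ' {b₂ ∷ l₁} on-B'))) (trans h (proj₂ (map-B τ {l₁ ++ b ∷ []} eq)))))
        where
        contents : ρ' ! c ≡ τ ! c × ρ' ! d ≡ τ ! d
        contents = T-contents τ ρ' (trans on-T' (sym eT))
      once : Turned τ (t ∷ T₁) (map (τ !_) B ++ []) → Overlap τ
      once (turned ρ r pt' on-T on-B at-p) with drop-end 1 (map (τ !_) B) (subst (1 <_) (sym (Lₚ.length-map (τ !_) B)) l2)
      ... | l₁ , (b₂ ∷ []) , b , eq , refl = twice r at-p eq
            (turn (t ∷ []) {T₁} {l₁ ++ b ∷ []} (b₂ ∷ []) refl ρ pt' on-T (trans on-B (trans (++-identityʳ _) eq)))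

    module FromOverlap (ov : ∀ τ → Pattern τ → Overlap τ) (lt : length T ≤ length ts) (lb : suc (length B) ≤ length bs)
      (parity : odd (length (d ∷ Dt ++ f ∷ Db)) ≡ false) where

      move-pair : ∀ {σ x y z w} p q → isT x ≡ false → isT y ≡ false → isT z ≡ false → isT w ≡ false → isT p ≡ false → isT q ≡ false →
        Dx σ x y z w → Dx σ (transpose p q ! x) (transpose p q ! y) (transpose p q ! z) (transpose p q ! w)
      move-pair {σ} {x} {y} {z} {w} p q xB yB zB wB pB qB dx with p ≟ᶠ q
      ... | yes refl = subst₂ (λ a b → Dx σ (transpose p p ! x) (transpose p p ! y) a b) (sym (tr-self p z)) (sym (tr-self p w))
                        (subst₂ (λ a b → Dx σ a b z w) (sym (tr-self p x)) (sym (tr-self p y)) dx)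
      ... | no p≢q with pair-b σ p q pB qB p≢q
      ... | u , v , uT' , vT' , _ , d' = subst₂ (λ a b → Dx σ (transpose p q ! x) (transpose p q ! y) a b) (fix zB) (fix wB)
             (subst₂ (λ a b → Dx σ a b (g ! z) (g ! w)) (fix xB) (fix yB)
              (Dx-conj {σ} g (λ a → trans (tr-pres (tt-same uT' vT') (transpose p q ! a)) (tr-pres (bb-same pB qB) a)) (bb-same xB yB) (bb-same zB wB) d' dx))
        where
        g = transpose p q ∘ₚ transpose u v
        blank : ∀ {a} → isT a ≡ false → isT (transpose p q ! a) ≡ false
        blank {a} aB with tr-cases p q a
        ... | inj₁ (_ , h) = trans (cong isT h) qB
        ... | inj₂ (inj₁ (_ , h)) = trans (cong isT h) pB
        ... | inj₂ (inj₂ (_ , _ , h)) = trans (cong isT h) aB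
        fix : ∀ {a} → isT a ≡ false → g ! a ≡ transpose p q ! a
        fix aB = tr-o u v (λ h → true≢false (trans (cong isT h) uT') (blank aB)) (λ h → true≢false (trans (cong isT h) vT') (blank aB))

      blank-tr : ∀ {p q a} → isT p ≡ false → isT q ≡ false → isT a ≡ false → isT (transpose p q ! a) ≡ false
      blank-tr {p} {q} {a} pB qB aB with tr-cases p q a
      ... | inj₁ (_ , h) = trans (cong isT h) qB
      ... | inj₂ (inj₁ (_ , h)) = trans (cong isT h) pB
      ... | inj₂ (inj₂ (_ , _ , h)) = trans (cong isT h) aB

      record Triple (σ : Permutation′ n) (x y z : Fin n) : Set where
        constructor triple
        field
          xB : isT x ≡ false
          yB : isT y ≡ false
          zB : isT z ≡ false
          x≢y : x ≢ y
          x≢z : x ≢ z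
          y≢z : y ≢ z
          dx : Dx σ x y x z

      move-triple : ∀ {σ x y z} p q → isT p ≡ false → isT q ≡ false → Triple σ x y z → Triple σ (transpose p q ! x) (transpose p q ! y) (transpose p q ! z)
      move-triple {σ} p q pB qB (triple xB yB zB a b c dx) = triple (blank-tr pB qB xB) (blank-tr pB qB yB) (blank-tr pB qB zB)
        (a ∘ !-inj (transpose p q)) (b ∘ !-inj (transpose p q)) (c ∘ !-inj (transpose p q)) (move-pair {σ} p q xB yB xB zB pB qB dx)

      some-triple′ : ∀ σ → ∃₂ λ x y → ∃ λ z → Triple σ x y z
      some-triple′ σ with arrange lt lb σ
      ... | τ , r , pt@(pattern-of tok blk pen) with ov τ pt
      ... | overlapped ρ r' pt'@(pattern-of tok' blk' _) ec ed ep ee = τ ! p , τ ! e , ρ ! e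
          , triple pen (blk e∈B) (blk' e∈B) (λ h → p∉B (subst (_∈ B) (sym (!-inj τ h)) e∈B))
              (λ h → p∉B (subst (_∈ B) (sym (!-inj ρ (trans ep h))) e∈B)) (ee ∘ sym)
              (Dx-commˡ {σ} (Dx-commʳ {σ} (Dx-trans {σ} tsame bsame'
                (Dx-sym {σ} tsame bsame (Dx-inv tsame bsame r (claw-pair τ pt)))
                (Dx-inv tsame bsame' (⇝-trans r r') claw'))))
        where
        tsame : part (τ ! c) ≡ part (τ ! d)
        tsame = tt-same (tok (here refl)) (tok (there (here refl)))
        bsame : part (τ ! e) ≡ part (τ ! p)
        bsame = bb-same (blk e∈B) pen
        bsame' : part (ρ ! e) ≡ part (τ ! p)
        bsame' = bb-same (blk' e∈B) pen
        claw' : Dx ρ (τ ! c) (τ ! d) (ρ ! e) (τ ! p)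
        claw' = subst₂ (λ a b → Dx ρ a b (ρ ! e) (τ ! p)) ec ed (subst (Dx ρ (ρ ! c) (ρ ! d) (ρ ! e)) ep (claw-pair ρ pt'))

      abstract
        some-triple : ∀ σ → ∃₂ λ x y → ∃ λ z → Triple σ x y z
        some-triple = some-triple′

      move-to : ∀ {σ x y z x' y' z'} p q → isT p ≡ false → isT q ≡ false →
        transpose p q ! x ≡ x' → transpose p q ! y ≡ y' → transpose p q ! z ≡ z' → Triple σ x y z → Triple σ x' y' z'
      move-to p q pB qB refl refl refl t = move-triple p q pB qB t

      triple-first : ∀ σ x → isT x ≡ false → ∃₂ λ y z → Triple σ x y z
      triple-first σ x xB with some-triple σ
      ... | x₀ , y₀ , z₀ , t = transpose x₀ x ! y₀ , transpose x₀ x ! z₀ ,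
        move-to {σ} {x₀} {y₀} {z₀} {x} {transpose x₀ x ! y₀} {transpose x₀ x ! z₀} x₀ x (Triple.xB t) xB (tr-l x₀ x) refl refl t

      triple-second : ∀ σ {x y z} y' → isT y' ≡ false → x ≢ y' → Triple σ x y z → ∃ λ z' → Triple σ x y' z'
      triple-second σ {x} {y} {z} y' yB x≢y' t = transpose y y' ! z , move-to {σ} {x} {y} {z} {x} {y'} {transpose y y' ! z} y y' (Triple.yB t) yB (tr-o y y' (Triple.x≢y t) x≢y') (tr-l y y') refl t

      triple-third : ∀ σ {x y z} z' → isT z' ≡ false → x ≢ z' → y ≢ z' → Triple σ x y z → Triple σ x y z'
      triple-third σ {x} {y} {z} z' zB x≢z' y≢z' t = move-to {σ} {x} {y} {z} {x} {y} {z'} z z' (Triple.zB t) zB (tr-o z z' (Triple.x≢z t) x≢z') (tr-o z z' (Triple.y≢z t) y≢z') (tr-l z z') t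

      -- The three entries of the known 3-cycle are replaced one after another by conjugation with
      -- exchanges of two blanks; the tokens exchanged along with them leave a 3-cycle of blanks
      -- untouched.
      every-triple : ∀ σ x y z → isT x ≡ false → isT y ≡ false → isT z ≡ false → x ≢ y → x ≢ z → y ≢ z → Dx σ x y x z
      every-triple σ x y z xB yB zB x≢y x≢z y≢z with triple-first σ x xB
      ... | _ , _ , t with triple-second σ y yB x≢y t
      ... | _ , t' = Triple.dx (triple-third σ z zB x≢z y≢z t')

      blank-pairs : ∀ σ x y z w → isT x ≡ false → isT y ≡ false → isT z ≡ false → isT w ≡ false → x ≢ y → z ≢ w → Dx σ x y z w
      blank-pairs σ x y z w xB yB zB wB x≢y z≢w = go
        where
        share : ∀ a b c → isT a ≡ false → isT b ≡ false → isT c ≡ false → a ≢ b → a ≢ c → Dx σ a b a c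
        share a b c aB bB cB a≢b a≢c with b ≟ᶠ c
        ... | yes refl = Dx-refl {σ}
        ... | no b≢c = every-triple σ a b c aB bB cB a≢b a≢c b≢c
        go : Dx σ x y z w
        go with z ≟ᶠ x
        ... | yes refl = share x y w xB yB wB x≢y z≢w
        ... | no z≢x = Dx-trans {σ} (bb-same xB zB) (bb-same zB wB) (share x y z xB yB zB x≢y (z≢x ∘ sym))
                (Dx-commˡ {σ} (share z x w zB xB wB z≢x z≢w))

      two-tokens : ∃₂ λ t t' → isT t ≡ true × isT t' ≡ true × t ≢ t'
      two-tokens = go ts ts-unique ts-token lt
        where
        go : ∀ l → Unique l → (∀ {u} → u ∈ l → isT u ≡ true) → length T ≤ length l → _
        go (t ∷ t' ∷ l) u h _ = t , t' , h (here refl) , h (there (here refl)) , λ e → unique-head u (here e)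
        go (t ∷ []) u h (s≤s ())

      module _ {t₀ t₁ : Fin n} (t₀T : isT t₀ ≡ true) (t₁T : isT t₁ ≡ true) (t₀≢t₁ : t₀ ≢ t₁) where

        -- Any two pairs of blanks are interchangeable by now, so every exchange, of tokens or of
        -- blanks, can be traded for one pair of blanks and from there for (t₀ t₁).
        double : ∀ σ u v → part u ≡ part v → u ≢ v → Dx σ u v t₀ t₁
        double σ u v h u≢v with pair-t σ t₀ t₁ t₀T t₁T t₀≢t₁ | bool-cases (isT u) | bool-cases (isT v)
        ... | _ | inj₁ uT | inj₂ vB = ⊥-elim (tok-apart uT vB h)
        ... | _ | inj₂ uB | inj₁ vT = ⊥-elim (tok-apart vT uB (sym h))
        ... | x , y , xB , yB , x≢y , dx | inj₂ uB | inj₂ vB = Dx-trans {σ} (bb-same xB yB) (tt-same t₀T t₁T) (blank-pairs σ u v x y uB vB xB yB u≢v x≢y)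
                (Dx-sym {σ} (tt-same t₀T t₁T) (bb-same xB yB) dx)
        ... | x , y , xB , yB , x≢y , dx | inj₁ uT | inj₁ vT with pair-t σ u v uT vT u≢v
        ... | x' , y' , x'B , y'B , x'≢y' , dx' = Dx-trans {σ} (bb-same x'B y'B) (tt-same t₀T t₁T) dx'
                (Dx-trans {σ} (bb-same xB yB) (tt-same t₀T t₁T) (blank-pairs σ x' y' x y x'B y'B xB yB x'≢y' x≢y) (Dx-sym {σ} (tt-same t₀T t₁T) (bb-same xB yB) dx))

        open Parity X simple part

        tS = tt-same t₀T t₁T

        -- The rotation amounts to `length T - 1` exchanges on one arc and `length B - 1` on the
        -- other. Their total is odd because the cycle is odd, and since it is made of friendly
        -- swaps, a single exchange comes for free.
        loop : ∀ τ (ro : Rotated τ) → Shifted tS double τ c (d ∷ Dt) → Shifted tS double (Rotated.state ro) f Db → Ex τ t₀ t₁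
        loop τ (rotated ρ r' pt' on-T on-B fx) s₁ s₂ = subst (λ b → Par tS double b τ τ) odd-total
            (par-trans tS double (odd (suc (length Dt))) (odd (length Db)) {τ} {Shifted.state s₁} {τ} (Shifted.par s₁)
                (subst (λ b → Par tS double b (Shifted.state s₁) τ) (xor-false (odd (length Db)))
                  (par-trans tS double (odd (length Db)) false {Shifted.state s₁} {ρ} {τ}
                    (par-sym tS double (odd (length Db)) {ρ} {Shifted.state s₁} (par-respʳ tS double (odd (length Db)) {ρ} {Shifted.state s₂} {Shifted.state s₁} (Shifted.par s₂) meet)) (⇝-sym r'))))
          where
          xor-false : ∀ b → b xor false ≡ b
          xor-false true = refl
          xor-false false = refl
          odd-total : odd (suc (length Dt)) xor odd (length Db) ≡ true
          odd-total = trans (sym (odd-+ (suc (length Dt)) (length Db)))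
            (trans (sym (not-involutive′ _)) (cong not (trans (cong odd (sym (trans (cong suc (length-++ Dt)) (cong suc (ℕₚ.+-suc (length Dt) (length Db)))))) parity)))
            where
            not-involutive′ : ∀ b → not (not b) ≡ b
            not-involutive′ true = refl
            not-involutive′ false = refl
          s₂-B : map (Shifted.state s₂ !_) B ≡ map (τ !_) B
          s₂-B = trans (Shifted.content s₂) (trans (cong₂ (λ a b → a ++ b ∷ []) (proj₂ (∷-injective on-B)) (proj₁ (∷-injective on-B)))
                   (trans (sym (map-++ (τ !_) (ini f Db) (e ∷ []))) (cong (map (τ !_)) (ini-lst f Db))))
          meet : Shifted.state s₂ ≗ₚ Shifted.state s₁
          meet x with x ∈? T | x ∈? B
          ... | yes x∈ | _ = trans (Shifted.fixed s₂ (T∩B x∈)) (map-agree {f = ρ !_} {g = Shifted.state s₁ !_} (trans on-T (sym (Shifted.content s₁))) x∈)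
          ... | no x∉ | yes x∈ = trans (map-agree {f = Shifted.state s₂ !_} {g = τ !_} s₂-B x∈) (sym (Shifted.fixed s₁ x∉))
          ... | no x∉ | no x∉' = trans (Shifted.fixed s₂ x∉') (trans (fx (λ h → [ x∉ , x∉' ]′ (∈-++⁻ T h))) (sym (Shifted.fixed s₁ x∉)))

        single-of : ∀ σ → ∃₂ λ t t' → isT t ≡ true × isT t' ≡ true × t ≢ t' × Ex σ t t'
        single-of σ with arrange lt lb σ
        ... | τ , r , pt@(pattern-of tok blk pen) with rotate τ pt
        ... | ro@(rotated ρ r' pt' on-T on-B fx) = t₀ , t₁ , t₀T , t₁T , t₀≢t₁ , Ex-inv tS r (loop τ ro
            (shift tS double τ c (d ∷ Dt) uT (λ x∈ → tt-same (tok (there x∈)) (tok (here refl))))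
            (shift tS double ρ f Db uB (λ x∈ → bb-same (Pattern.blk pt' (there x∈)) (Pattern.blk pt' (here refl)))))

      single : ∀ σ → ∃₂ λ t t' → isT t ≡ true × isT t' ≡ true × t ≢ t' × Ex σ t t'
      single = let _ , _ , t₀T , t₁T , t₀≢t₁ = two-tokens in single-of t₀T t₁T t₀≢t₁

  -- on a triangle with a pendant vertex the rotation itself exchanges the two tokens
  triangle-exchange : ∀ {c d f p} (cyc : Path c (d ∷ f ∷ []) c) → Unique (c ∷ d ∷ f ∷ []) → Adj X c p → p ∉ c ∷ d ∷ f ∷ [] →
    2 ≤ length ts → 2 ≤ length bs → ∀ σ → ∃₂ λ t t' → isT t ≡ true × isT t' ≡ true × t ≢ t' × Ex σ t t'
  triangle-exchange {c} {d} {f} {p} cyc u cp p∉ lt lb σ with arrange {Dt = []} {[]} cyc u cp p∉ lt lb σ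
  ... | τ , r , pt@(pattern-of tok blk pen) with rotate {Dt = []} {[]} cyc u cp p∉ τ pt
  ... | rotated ρ r' pt' on-T on-B fx = τ ! c , τ ! d , tok (here refl) , tok (there (here refl)) , (adj-≢ (proj₁ cyc) ∘ !-inj τ)
      , Ex-inv (tt-same (tok (here refl)) (tok (there (here refl)))) r (⇝-respʳ r' (ex-agree τ ρ c d (proj₁ (∷-injective on-T)) (proj₁ (∷-injective (proj₂ (∷-injective on-T)))) others))
    where
    others : ∀ x → x ≢ c → x ≢ d → ρ ! x ≡ τ ! x
    others x a b with x ≟ᶠ f
    ... | yes refl = proj₁ (∷-injective on-B)
    ... | no q = fx (λ { (here h) → a h ; (there (here h)) → b h ; (there (there (here h))) → q h })

-- Finding a lollipop and distributing tokens and blanks on it.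

module Lollipops {n : ℕ} (X : Graph n) (simple : IsSimple X) where

  open GraphTheory X simple
  open Shapes X simple
  open Claws X simple

  record OddLollipop : Set where
    constructor mkLollipop
    field
      c p : Fin n
      l : List (Fin n)
      cyc : Path c l c
      uniq : Unique (c ∷ l)
      parity : odd (length l) ≡ false
      stem : Adj X c p
      outside : p ∉ c ∷ l

  lollipop-outside : Connected X → ∀ {c l x} → Path c l c → Unique (c ∷ l) → odd (length l) ≡ false → x ∉ c ∷ l → OddLollipop
  lollipop-outside conn {c} {l} {x} p u o x∉ with exit (here refl) x∉ (conn c x)
  ... | a , b , here refl , b∉ , e = mkLollipop c b l p u o e b∉
  ... | a , b , there a∈ , b∉ , e with ∈-∃++ a∈
  ... | l₁ , l₂ , refl = mkLollipop a b (l₂ ++ c ∷ l₁) (path-rotate l₁ p) (unique-rotate l₁ u)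
        (trans (cong odd (trans (length-++ l₂) (trans (ℕₚ.+-comm (length l₂) _) (trans (sym (ℕₚ.+-suc (length l₁) (length l₂))) (sym (length-++ l₁)))))) o)
        e (λ b∈ → b∉ (∈-swap (a ∷ l₂) b∈))

  -- If the odd cycle spans X, it has a chord. One of the two cycles that the chord cuts off is odd,
  -- and it misses the interior of the other arc.
  lollipop : Connected X → ¬ IsCycle X → OddCycle → OddLollipop
  lollipop conn nc (mkOdd c l p u o) with any? (λ x → ¬? (x ∈? (c ∷ l)))
  ... | yes (x , x∉) = lollipop-outside conn p u o x∉
  ... | no none with cycle-or-chord p u (λ x → decidable-stable (x ∈? (c ∷ l)) (λ x∉ → none (x , x∉)))
  ... | inj₁ cyc = ⊥-elim (nc cyc)
  ... | inj₂ (chord x y (a ∷ l₁) (b ∷ l₂) q₁ q₂ e uq n₁ n₂ cov len) with bool-cases (odd (length (a ∷ l₁)))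
  ... | inj₁ o₁ = lollipop-outside conn {x} {(a ∷ l₁) ++ y ∷ []} {b} (path-++ (a ∷ l₁) q₁ (adj-sym e))
        (unique-++ˡ {xs = x ∷ (a ∷ l₁) ++ y ∷ []} (subst Unique (sym (++-assoc (x ∷ a ∷ l₁) (y ∷ []) (b ∷ l₂))) uq))
        (trans (cong odd (trans (length-++ (a ∷ l₁)) (ℕₚ.+-comm _ 1))) (cong not o₁))
        (λ b∈ → unique-disjoint (x ∷ (a ∷ l₁) ++ y ∷ []) (subst Unique (sym (++-assoc (x ∷ a ∷ l₁) (y ∷ []) (b ∷ l₂))) uq) b∈ (here refl))
  ... | inj₂ o₁ = lollipop-outside conn {y} {(b ∷ l₂) ++ x ∷ []} {a} (path-++ (b ∷ l₂) q₂ e) uq′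
        (trans (cong odd (trans (length-++ (b ∷ l₂)) (ℕₚ.+-comm _ 1))) (cong not o₂))
        (λ a∈ → unique-disjoint (y ∷ (b ∷ l₂) ++ x ∷ []) (subst Unique (sym (++-assoc (y ∷ b ∷ l₂) (x ∷ []) (a ∷ l₁))) (unique-swap (x ∷ a ∷ l₁) uq)) a∈ (here refl))
    where
    uq′ : Unique (y ∷ (b ∷ l₂) ++ x ∷ [])
    uq′ = unique-++ˡ {xs = y ∷ (b ∷ l₂) ++ x ∷ []} (subst Unique (sym (++-assoc (y ∷ b ∷ l₂) (x ∷ []) (a ∷ l₁))) (unique-swap (x ∷ a ∷ l₁) uq))
    o₂ : odd (length (b ∷ l₂)) ≡ true
    o₂ = lem (odd (length (a ∷ l₁))) (odd (length (b ∷ l₂))) o₁ (trans (cong not (sym (odd-+ (length (a ∷ l₁)) (length (b ∷ l₂)))))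
          (trans (cong odd (trans (sym (ℕₚ.+-suc (length (a ∷ l₁)) (length (b ∷ l₂)))) (trans (sym (length-++ (a ∷ l₁))) (sym (ℕₚ.suc-injective len))))) o))
      where
      lem : ∀ p q → p ≡ false → not (p xor q) ≡ false → q ≡ true
      lem false true refl e = refl
      lem false false refl ()

  even-half : ∀ m → odd m ≡ false → ∃ λ h → m ≡ h + h
  even-half zero e = 0 , refl
  even-half (suc zero) ()
  even-half (suc (suc m)) e with even-half m (trans (sym (lem (odd m))) e)
    where
    lem : ∀ b → not (not b) ≡ b
    lem true = refl
    lem false = refl
  ... | h , refl = suc h , cong suc (sym (ℕₚ.+-suc h h))

  split-at : ∀ {A : Set} t (l : List A) → t < length l → ∃₂ λ a f → Σ (List A) λ b → l ≡ a ++ f ∷ b × length a ≡ t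
  split-at zero (x ∷ l) h = [] , x , l , refl , refl
  split-at (suc t) (x ∷ l) (s≤s h) = let a , f , b , e , le = split-at t l h in x ∷ a , f , b , cong (x ∷_) e , cong suc le

  lollipop-claw : OddLollipop → Claw
  lollipop-claw (mkLollipop c p [] cyc u o e p∉) = ⊥-elim (adj-irr cyc)
  lollipop-claw (mkLollipop c p (d ∷ []) cyc u () e p∉)
  lollipop-claw (mkLollipop c p (d ∷ f ∷ l) cyc u o e p∉) = claw c d (lst d (f ∷ l)) p (proj₁ cyc) (adj-sym (path-last (d ∷ f ∷ l) cyc)) e
    (λ h → unique-head (unique-tail u) (subst (_∈ f ∷ l) (sym h) (lst∈ f l))) (λ h → p∉ (there (here (sym h))))
    (λ h → p∉ (subst (_∈ c ∷ d ∷ f ∷ l) h (there (lst∈ d (f ∷ l)))))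

  module Exchange (part : Fin n → ℕ)
    (isT : Fin n → Bool) (apart : ∀ u v → isT u ≢ isT v → part u ≢ part v) (same : ∀ u v → isT u ≡ isT v → part u ≡ part v)
    (ts bs : List (Fin n)) (ts-unique : Unique ts) (bs-unique : Unique bs)
    (ts-token : ∀ {u} → u ∈ ts → isT u ≡ true) (bs-blank : ∀ {u} → u ∈ bs → isT u ≡ false)
    (conn : Connected X)
    (pair-t : ∀ σ u v → isT u ≡ true → isT v ≡ true → u ≢ v → ∃₂ λ x y → isT x ≡ false × isT y ≡ false × x ≢ y × FSCore.Dx X simple part σ u v x y)
    (pair-b : ∀ σ x y → isT x ≡ false → isT y ≡ false → x ≢ y → ∃₂ λ u v → isT u ≡ true × isT v ≡ true × u ≢ v × FSCore.Dx X simple part σ x y u v) where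

    open FSCore X simple part
    open Lollipop X simple part isT apart same ts bs ts-unique bs-unique ts-token bs-blank conn pair-t pair-b

    Exchanges : Set
    Exchanges = ∀ σ u v → part u ≡ part v → u ≢ v → Ex σ u v

    -- Few tokens: all of them form the arc `T`, and the remaining part of the cycle is longer.
    exchange-shorter : (P : OddLollipop) → 2 ≤ length ts → length ts + length ts ≤ length (OddLollipop.l P) →
      2 + length (OddLollipop.l P) ≤ length ts + length bs → Exchanges
    exchange-shorter (mkLollipop c p [] cyc u o e p∉) t2 t+t lb = ⊥-elim (adj-irr cyc)
    -- The arc already contains `c` and `d`, so two fewer vertices are taken from `rest`.
    exchange-shorter (mkLollipop c p (d ∷ rest) cyc u o e p∉) t2 t+t lb with split-at (length ts ∸ 2) rest
        (≤-trans (≤-trans (≤-reflexive (sym (ℕₚ.+-∸-assoc 1 t2))) (ℕₚ.m∸n≤m (suc (length ts)) 2)) (ℕₚ.≤-pred (≤-trans (≤-trans (s≤s (s≤s ≤-refl)) (ℕₚ.+-monoˡ-≤ (length ts) t2)) t+t)))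
    ... | Dt , f , Db , refl , lD = exchange-all (FromOverlap.single cyc u e p∉
            (overlap-shorter cyc u e p∉ shorter) (≤-reflexive lT) fits o)
      where
      lT : suc (suc (length Dt)) ≡ length ts
      lT = trans (cong (2 +_) lD) (ℕₚ.m+[n∸m]≡n t2)
      ll : length (Dt ++ f ∷ Db) ≡ length Dt + suc (length Db)
      ll = length-++ Dt
      shorter : suc (suc (length Dt)) < suc (length Db)
      shorter = s≤s (ℕₚ.+-cancelˡ-≤ (2 + length Dt) _ _ (≤-trans (≤-reflexive (cong₂ _+_ lT lT)) (≤-trans t+t (≤-reflexive (cong suc (trans ll (ℕₚ.+-suc (length Dt) (length Db))))))))
      fits : suc (suc (length Db)) ≤ length bs
      fits = ℕₚ.+-cancelˡ-≤ (2 + length Dt) _ _ (≤-trans (≤-reflexive (cong (2 +_) (trans (ℕₚ.+-suc (length Dt) (suc (length Db))) (cong suc (sym ll))))) (≤-trans lb (≤-reflexive (cong (_+ length bs) (sym lT)))))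

    -- Enough of both colours: the cycle of 2h + 1 vertices is split into h + 1 tokens and h blanks,
    -- one more blank being on the stem. A triangle has too few blanks for `overlap-longer` and is
    -- treated directly.
    exchange-equal : (P : OddLollipop) → ∀ h → length (OddLollipop.l P) ≡ h + h → suc h ≤ length ts → suc h ≤ length bs → Exchanges
    exchange-equal (mkLollipop c p [] cyc u o e p∉) h eq ht hb = ⊥-elim (adj-irr cyc)
    exchange-equal (mkLollipop c p (d ∷ rest) cyc u o e p∉) (suc zero) eq ht hb with rest | cyc | u | p∉ | eq
    ... | f ∷ [] | cyc | u | p∉ | refl = exchange-all (triangle-exchange cyc u e p∉ ht hb)
    exchange-equal (mkLollipop c p (d ∷ rest) cyc u o e p∉) (suc (suc h)) eq ht hb with split-at (suc h) rest (≤-trans (ℕₚ.m≤n+m (suc (suc h)) (suc h)) (≤-reflexive (ℕₚ.suc-injective (sym eq))))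
    ... | Dt , f , Db , refl , lD = exchange-all (FromOverlap.single cyc u e p∉
            (overlap-longer cyc u e p∉ (cong (2 +_) lT) (subst (λ z → 2 ≤ suc z) lB (s≤s (s≤s z≤n)))) (subst (_≤ length ts) (cong (2 +_) (sym lD)) ht) (subst (λ z → suc (suc z) ≤ length bs) lB hb) o)
      where
      lB : suc h ≡ length Db
      lB = ℕₚ.suc-injective (ℕₚ.+-cancelˡ-≡ (suc h) _ _ (trans (ℕₚ.suc-injective (sym eq)) (trans (length-++ Dt) (cong (_+ suc (length Db)) lD))))
      lT : length Dt ≡ length Db
      lT = trans lD lB

-- Sufficiency for two classes of at least two people each.

module TwoClasses {n : ℕ} (X : Graph n) (simple : IsSimple X) (part : Fin n → ℕ)
  (isT : Fin n → Bool) (apart : ∀ u v → isT u ≢ isT v → part u ≢ part v) (same : ∀ u v → isT u ≡ isT v → part u ≡ part v) where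

  open GraphTheory X simple
  open FSCore X simple part
  open Lollipops X simple

  coloured : Bool → List (Fin n)
  coloured β = filter (λ u → isT u ≟ᵇ β) (allFin n)

  coloured-unique : ∀ β → Unique (coloured β)
  coloured-unique β = Uₚ.filter⁺ (λ u → isT u ≟ᵇ β) (Uₚ.allFin⁺ n)

  coloured-is : ∀ β {u} → u ∈ coloured β → isT u ≡ β
  coloured-is β u∈ = proj₂ (∈-filter⁻ (λ u → isT u ≟ᵇ β) {xs = allFin n} u∈)

  coloured-all : ∀ β u → isT u ≡ β → u ∈ coloured β
  coloured-all β u e = ∈-filter⁺ (λ u → isT u ≟ᵇ β) (∈-allFin u) e

  m k : ℕ
  m = length (coloured true)
  k = length (coloured false)

  total : m + k ≡ n
  total = trans (sym (length-++ (coloured true))) (length-of-full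
    (unique-++ (coloured-unique true) (coloured-unique false) (λ a b → true≢false (coloured-is true a) (coloured-is false b)))
    (λ x → [ (λ e → ∈-++⁺ˡ (coloured-all true x e)) , (λ e → ∈-++⁺ʳ (coloured true) (coloured-all false x e)) ]′ (bool-cases (isT x))))

  isB : Fin n → Bool
  isB u = not (isT u)

  not-inj : ∀ {b c} → not b ≡ not c → b ≡ c
  not-inj {true} {true} e = refl
  not-inj {false} {false} e = refl

  apart-b : ∀ u v → isB u ≢ isB v → part u ≢ part v
  apart-b u v h = apart u v (h ∘ cong not)

  same-b : ∀ u v → isB u ≡ isB v → part u ≡ part v
  same-b u v h = same u v (not-inj h)

  connected-two : Connected X → ¬ IsCycle X → ¬ Bipartite X → Fin n → 2 ≤ m → 2 ≤ k → ¬ HasBridge X m → ¬ HasBridge X k → FSConnected X Y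
  connected-two conn ncyc nbip r m2 k2 nbm nbk = connected-of-exchanges conn λ σ a b e h → exchanges σ (σ ! a) (σ ! b) h (adj-≢ e ∘ !-inj σ)
    where
    P = lollipop conn ncyc (odd-cycle conn r nbip)
    open OddLollipop P
    C = lollipop-claw P
    pair-t : ∀ σ u v → isT u ≡ true → isT v ≡ true → u ≢ v → ∃₂ λ x y → isT x ≡ false × isT y ≡ false × x ≢ y × Dx σ u v x y
    pair-t σ u v uT vT u≢v = go (Pairings.all-paired X simple part isT apart same (coloured false) (coloured-unique false) (coloured-is false) (coloured-all false)
        conn k2 nbk C (subst (2 + k ≤_) total (ℕₚ.+-monoˡ-≤ k m2)) σ u v uT vT u≢v)
      where
      go : Pairings.Paired X simple part isT apart same (coloured false) (coloured-unique false) (coloured-is false) (coloured-all false) σ u v → _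
      go (Pairings.paired x y xB yB ne d) = x , y , xB , yB , ne , d
    pair-b : ∀ σ u v → isT u ≡ false → isT v ≡ false → u ≢ v → ∃₂ λ x y → isT x ≡ true × isT y ≡ true × x ≢ y × Dx σ u v x y
    pair-b σ u v uB vB u≢v = go (Pairings.all-paired X simple part isB apart-b same-b (coloured true) (coloured-unique true) (cong not ∘ coloured-is true) (λ x e → coloured-all true x (not-inj e))
        conn m2 nbm C (subst (2 + m ≤_) (trans (ℕₚ.+-comm k m) total) (ℕₚ.+-monoˡ-≤ m k2)) σ u v (cong not uB) (cong not vB) u≢v)
      where
      go : Pairings.Paired X simple part isB apart-b same-b (coloured true) (coloured-unique true) (cong not ∘ coloured-is true) (λ x e → coloured-all true x (not-inj e)) σ u v → _
      go (Pairings.paired x y xT yT ne d) = x , y , not-inj xT , not-inj yT , ne , d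
    module ET = Exchange part isT apart same (coloured true) (coloured false) (coloured-unique true) (coloured-unique false) (coloured-is true) (coloured-is false) conn pair-t pair-b
    flipped : ∀ σ {u v b} → (∃₂ λ x y → isT x ≡ b × isT y ≡ b × x ≢ y × Dx σ u v x y) → ∃₂ λ x y → isB x ≡ not b × isB y ≡ not b × x ≢ y × Dx σ u v x y
    flipped σ (x , y , a , b , c , d) = x , y , cong not a , cong not b , c , d
    module EB = Exchange part isB apart-b same-b (coloured false) (coloured true) (coloured-unique false) (coloured-unique true) (cong not ∘ coloured-is false) (cong not ∘ coloured-is true) conn
      (λ σ u v uB vB ne → flipped σ (pair-b σ u v (not-inj uB) (not-inj vB) ne)) (λ σ u v uT vT ne → flipped σ (pair-t σ u v (not-inj uT) (not-inj vT) ne))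
    long : 2 + length l ≤ m + k
    long = subst (2 + length l ≤_) (sym total) (unique-fin-length (unique-cons outside uniq))
    exchanges : ∀ σ u v → part u ≡ part v → u ≢ v → Ex σ u v
    exchanges with even-half (length l) parity
    -- Either both colours can fill half of the cycle, or one is scarce and plays the tokens; `EB`
    -- is `ET` with the colours interchanged.
    ... | h , eq with suc h ℕ.≤? m | suc h ℕ.≤? k
    ... | yes a | yes b = ET.exchange-equal P h eq a b
    ... | no a | _ = ET.exchange-shorter P m2 (≤-trans (ℕₚ.+-mono-≤ m≤h m≤h) (≤-reflexive (sym eq))) long
      where m≤h = ℕₚ.≤-pred (ℕₚ.≰⇒> a)
    ... | yes _ | no b = EB.exchange-shorter P k2 (≤-trans (ℕₚ.+-mono-≤ k≤h k≤h) (≤-reflexive (sym eq))) (≤-trans long (≤-reflexive (ℕₚ.+-comm m k)))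
      where k≤h = ℕₚ.≤-pred (ℕₚ.≰⇒> b)

-- A single blank: 3-cycles of tokens.

module Wilson {n : ℕ} (X : Graph n) (simple : IsSimple X) (part : Fin n → ℕ)
  (x₀ : Fin n) (lone : ∀ {u} → u ≢ x₀ → part u ≢ part x₀) (tokens : ∀ {u v} → u ≢ x₀ → v ≢ x₀ → part u ≡ part v) where

  open GraphTheory X simple
  open FSCore X simple part

  record Tri (σ : Permutation′ n) (u v w : Fin n) : Set where
    constructor tri
    field
      uT : u ≢ x₀
      vT : v ≢ x₀
      wT : w ≢ x₀
      u≢v : u ≢ v
      v≢w : v ≢ w
      u≢w : u ≢ w
      dx : Dx σ u v v w

  open Tri

  g₃ : Fin n → Fin n → Fin n → Permutation′ n
  g₃ a b c = transpose a b ∘ₚ transpose b c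

  g₃-a : ∀ {a b c} → g₃ a b c ! a ≡ c
  g₃-a {a} {b} {c} = trans (cong (transpose b c !_) (tr-l a b)) (tr-l b c)

  g₃-b : ∀ {a b c} → a ≢ b → a ≢ c → g₃ a b c ! b ≡ a
  g₃-b {a} {b} {c} p q = trans (cong (transpose b c !_) (tr-r a b)) (tr-o b c p q)

  g₃-c : ∀ {a b c} → a ≢ c → b ≢ c → g₃ a b c ! c ≡ b
  g₃-c {a} {b} {c} p q = trans (cong (transpose b c !_) (tr-o a b (p ∘ sym) (q ∘ sym))) (tr-r b c)

  g₃-o : ∀ {a b c x} → x ≢ a → x ≢ b → x ≢ c → g₃ a b c ! x ≡ x
  g₃-o {a} {b} {c} {x} p q r = trans (cong (transpose b c !_) (tr-o a b p q)) (tr-o b c q r)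

  g₃-pres : ∀ {a b c} → a ≢ x₀ → b ≢ x₀ → c ≢ x₀ → Pres (g₃ a b c)
  g₃-pres {a} {b} {c} aT bT cT z = trans (tr-pres (tokens bT cT) (transpose a b ! z)) (tr-pres (tokens aT bT) z)

  tri-conj : ∀ {σ a b c u v w} → Tri σ a b c → Tri σ u v w → Tri σ (g₃ a b c ! u) (g₃ a b c ! v) (g₃ a b c ! w)
  tri-conj {σ} {a} {b} {c} s t = tri (tok (uT t)) (tok (vT t)) (tok (wT t)) (u≢v t ∘ !-inj g) (v≢w t ∘ !-inj g) (u≢w t ∘ !-inj g)
      (Dx-conj {σ} g (g₃-pres (uT s) (vT s) (wT s)) (tokens (uT t) (vT t)) (tokens (vT t) (wT t)) (dx s) (dx t))
    where
    g = g₃ a b c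
    fixes : g ! x₀ ≡ x₀
    fixes = g₃-o (uT s ∘ sym) (vT s ∘ sym) (wT s ∘ sym)
    tok : ∀ {z} → z ≢ x₀ → g ! z ≢ x₀
    tok z≢ h = z≢ (!-inj g (trans h (sym fixes)))

  tri-at : ∀ {σ u v w u' v' w'} → u ≡ u' → v ≡ v' → w ≡ w' → Tri σ u v w → Tri σ u' v' w'
  tri-at refl refl refl t = t

  tri-rot : ∀ {σ u v w} → Tri σ u v w → Tri σ w u v
  tri-rot {σ} {u} {v} {w} t = tri-at (g₃-a {u} {v} {w}) (g₃-b (u≢v t) (u≢w t)) (g₃-c (u≢w t) (v≢w t)) (tri-conj t t)

  tri-flip : ∀ {σ u v w} → Tri σ u v w → Tri σ w v u
  tri-flip {σ} {u} {v} {w} t = tri (wT t) (vT t) (uT t) (v≢w t ∘ sym) (u≢v t ∘ sym) (u≢w t ∘ sym)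
    (Dx-commˡ {σ} (Dx-commʳ {σ} (Dx-sym {σ} (tokens (uT t) (vT t)) (tokens (vT t) (wT t)) (dx t))))

  tri-swap : ∀ {σ u v w} → Tri σ u v w → Tri σ u w v
  tri-swap t = tri-flip (tri-rot (tri-rot t))

  -- Relates two tokens that lie on a common realisable 3-cycle. Once all tokens are related, all
  -- 3-cycles are realisable, so this is the relation to be spread.
  R : Permutation′ n → Fin n → Fin n → Set
  R σ u v = u ≡ v ⊎ ∃ λ w → Tri σ u v w

  R-sym : ∀ {σ u v} → R σ u v → R σ v u
  R-sym (inj₁ e) = inj₁ (sym e)
  R-sym (inj₂ (w , t)) = inj₂ (w , tri-flip (tri-rot t))

  -- The 3-cycle through `u` and `v` is conjugated by one that sends `v` to the third token and
  -- fixes `u`; if the latter contains `u` as well, it already answers the question.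
  R-trans : ∀ {σ u v w} → R σ u v → R σ v w → R σ u w
  R-trans (inj₁ refl) r = r
  R-trans r@(inj₂ _) (inj₁ refl) = r
  R-trans {σ} {u} {v} {z} (inj₂ (w , t)) (inj₂ (y , s)) with u ≟ᶠ z | u ≟ᶠ y
  ... | yes e | _ = inj₁ e
  ... | no _ | yes refl = inj₂ (v , tri-swap (tri-rot s))
  ... | no u≢z | no u≢y = inj₂ (_ , tri-at (g₃-o (u≢v t) u≢y u≢z) (g₃-a {v} {y} {z}) refl (tri-conj (tri-swap s) t))

  Tri-inv : ∀ {σ τ u v w} → σ ⇝ τ → Tri τ u v w → Tri σ u v w
  Tri-inv r (tri a b c d e f x) = tri a b c d e f (Dx-inv (tokens a b) (tokens b c) r x)

  R-inv : ∀ {σ τ u v} → σ ⇝ τ → R τ u v → R σ u v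
  R-inv r (inj₁ e) = inj₁ e
  R-inv r (inj₂ (w , t)) = inj₂ (w , Tri-inv r t)

  -- The common factor (c d) cancels, and the product of (u a) and (u b) is a 3-cycle.
  tri-of-share : ∀ {σ a b c d u} → u ≢ x₀ → a ≢ x₀ → b ≢ x₀ → c ≢ x₀ → d ≢ x₀ → u ≢ a → u ≢ b → a ≢ b → Dx σ c d u a → Dx σ c d u b → Tri σ a u b
  tri-of-share {σ} {a} {b} {c} {d} {u} uT aT bT cT dT ua ub ab p q = tri aT uT bT (ua ∘ sym) ub ab
    (Dx-commˡ {σ} (Dx-trans {σ} (tokens cT dT) (tokens uT bT) (Dx-sym {σ} (tokens cT dT) (tokens uT aT) p) q))

  module Full (rel : ∀ σ u v → u ≢ x₀ → v ≢ x₀ → R σ u v) where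

    -- Starting from a 3-cycle on a, b, w, conjugation by one that contains w and c replaces w by c.
    -- The cases differ in whether its third entry y meets a or b.
    every-tri : ∀ σ a b c → a ≢ x₀ → b ≢ x₀ → c ≢ x₀ → a ≢ b → a ≢ c → b ≢ c → Tri σ a b c
    every-tri σ a b c aT bT cT a≢b a≢c b≢c with rel σ a b aT bT
    ... | inj₁ e = ⊥-elim (a≢b e)
    ... | inj₂ (w , t) with rel σ w c (wT t) cT
    ... | inj₁ refl = t
    ... | inj₂ (y , s) with y ≟ᶠ a | y ≟ᶠ b
    ... | yes refl | _ = tri-flip (tri-at (g₃-a {a} {w} {c}) (g₃-o (a≢b ∘ sym) (v≢w t) b≢c) (g₃-b (u≢w t) a≢c) (tri-conj (tri-rot s) t))
    ... | no _ | yes refl = tri-swap (tri-at (g₃-o a≢b (u≢w t) a≢c) (g₃-a {b} {w} {c}) (g₃-b (v≢w t) b≢c) (tri-conj (tri-rot s) t))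
    ... | no y≢a | no y≢b = tri-at (g₃-o (u≢w t) (y≢a ∘ sym) a≢c) (g₃-o (v≢w t) (y≢b ∘ sym) b≢c) (g₃-a {w} {y} {c})
                        (tri-conj (tri-swap s) t)

    share : ∀ σ a b c → a ≢ x₀ → b ≢ x₀ → c ≢ x₀ → a ≢ b → a ≢ c → Dx σ a b a c
    share σ a b c aT bT cT a≢b a≢c with b ≟ᶠ c
    ... | yes refl = Dx-refl {σ}
    ... | no b≢c = Dx-commˡ {σ} (dx (every-tri σ b a c bT aT cT (a≢b ∘ sym) b≢c a≢c))

    double-all : ∀ σ a b c d → a ≢ x₀ → b ≢ x₀ → c ≢ x₀ → d ≢ x₀ → a ≢ b → c ≢ d → Dx σ a b c d
    double-all σ a b c d aT bT cT dT a≢b c≢d with c ≟ᶠ a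
    ... | yes refl = share σ a b d aT bT dT a≢b c≢d
    ... | no c≢a = Dx-trans {σ} (tokens aT cT) (tokens cT dT) (share σ a b c aT bT cT a≢b (c≢a ∘ sym))
            (Dx-commˡ {σ} (share σ c a d cT aT dT c≢a c≢d))

  token-part : ∀ {σ : Permutation′ n} {p q} → σ ! p ≡ x₀ → q ≢ p → σ ! q ≢ x₀
  token-part {σ} h ne e = ne (!-inj σ (trans e (sym h)))

  record Cycled (σ : Permutation′ n) (p d : Fin n) (l : List (Fin n)) : Set where
    constructor cycled
    field
      state : Permutation′ n
      reach : σ ⇝ state
      blank : state ! p ≡ x₀
      content : map (state !_) (d ∷ l) ≡ map (σ !_) l ++ σ ! d ∷ []
      fixed : ∀ {x} → x ∉ p ∷ d ∷ l → state ! x ≡ σ ! x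

  -- The blank goes once round the cycle and returns to `p`; the tokens on the remaining vertices
  -- have turned by one.
  cycle-once′ : ∀ {p d l} → Path p (d ∷ l) p → Unique (p ∷ d ∷ l) → ∀ σ → σ ! p ≡ x₀ → Cycled σ p d l
  cycle-once′ {p} {d} {l} cyc u σ bp = cycled (swap p e τ) (⇝-trans r (swap-step (adj-sym (path-last (d ∷ l) cyc)) fr))
      (trans (swap-l p e τ) τe)
      ct (λ x∉ → trans (swap-o p e τ (λ { refl → x∉ (here refl) }) (λ { refl → x∉ (there (lst∈ d l)) })) (fx x∉))
    where
    e = lst d l
    open Moved (carry σ p (d ∷ l) (path→chain′ (d ∷ l) cyc) u
      (λ {q} q∈ h → lone (token-part {σ} bp (λ q≡p → unique-head u (subst (_∈ d ∷ l) q≡p q∈))) (trans h (cong part bp))))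
      renaming (state to τ; reach to r; content to c; fixed to fx)
    cl : map (τ !_) (ini d l) ≡ map (σ !_) l × τ ! e ≡ σ ! p
    cl = ∷ʳ-injective (map (τ !_) (ini d l)) (map (σ !_) l)
      (trans (sym (map-++ (τ !_) (ini d l) (e ∷ []))) (trans (cong (map (τ !_)) (ini-lst d l)) (proj₂ (∷-injective c))))
    τe : τ ! e ≡ x₀
    τe = trans (proj₂ cl) bp
    τp : τ ! p ≡ σ ! d
    τp = proj₁ (∷-injective c)
    fr : part (τ ! p) ≢ part (τ ! e)
    fr h = lone (token-part {σ} bp (λ { refl → unique-head u (here refl) })) (trans (cong part (sym τp)) (trans h (cong part τe)))
    ini-out : ∀ {x} → x ∈ ini d l → x ≢ p × x ≢ e
    ini-out {x} x∈ = (λ { refl → unique-head u (subst (x ∈_) (ini-lst d l) (∈-++⁺ˡ x∈)) })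
      , (λ { refl → unique-disjoint (ini d l) (subst Unique (sym (ini-lst d l)) (unique-tail u)) x∈ (here refl) })
    ct : map (swap p e τ !_) (d ∷ l) ≡ map (σ !_) l ++ σ ! d ∷ []
    ct = trans (cong (map (swap p e τ !_)) (sym (ini-lst d l))) (trans (map-++ (swap p e τ !_) (ini d l) (e ∷ []))
           (cong₂ (λ a b → a ++ b ∷ []) (trans (agree-map (λ x∈ → swap-o p e τ (proj₁ (ini-out x∈)) (proj₂ (ini-out x∈)))) (proj₁ cl)) (trans (swap-r p e τ) τp)))

  abstract
    cycle-once : ∀ {p d l} → Path p (d ∷ l) p → Unique (p ∷ d ∷ l) → ∀ σ → σ ! p ≡ x₀ → Cycled σ p d l
    cycle-once = cycle-once′

  record Turned (σ : Permutation′ n) (p : Fin n) (l : List (Fin n)) (c : List (Fin n)) : Set where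
    constructor turned
    field
      state : Permutation′ n
      reach : σ ⇝ state
      blank : state ! p ≡ x₀
      content : map (state !_) l ≡ c
      fixed : ∀ {x} → x ∉ p ∷ l → state ! x ≡ σ ! x

  cycle-turn′ : ∀ {p l} → Path p l p → Unique (p ∷ l) → ∀ s₁ {s₂} σ → σ ! p ≡ x₀ → map (σ !_) l ≡ s₁ ++ s₂ → Turned σ p l (s₂ ++ s₁)
  cycle-turn′ cyc u [] {s₂} σ bp e = turned σ ⇝-refl bp (trans e (sym (++-identityʳ s₂))) (λ _ → refl)
  cycle-turn′ {p} {[]} cyc u (s ∷ s₁) σ bp ()
  cycle-turn′ {p} {d ∷ l} cyc u (s ∷ s₁) {s₂} σ bp e with cycle-once cyc u σ bp
  ... | cycled τ r bτ c f with cycle-turn′ cyc u s₁ {s₂ ++ s ∷ []} τ bτ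
          (trans c (trans (cong₂ (λ a b → a ++ b ∷ []) (proj₂ (∷-injective e)) (proj₁ (∷-injective e))) (++-assoc s₁ s₂ (s ∷ []))))
  ... | turned ρ r' bρ c' f' = turned ρ (⇝-trans r r') bρ (trans c' (++-assoc s₂ (s ∷ []) s₁)) (λ x∉ → trans (f' x∉) (f x∉))

  abstract
    cycle-turn : ∀ {p l} → Path p l p → Unique (p ∷ l) → ∀ s₁ {s₂} σ → σ ! p ≡ x₀ → map (σ !_) l ≡ s₁ ++ s₂ → Turned σ p l (s₂ ++ s₁)
    cycle-turn = cycle-turn′

-- Theta subgraphs.

module Thetas {n : ℕ} (X : Graph n) (simple : IsSimple X) where

  open GraphTheory X simple

  Disjoint : List (Fin n) → List (Fin n) → Set
  Disjoint A B = ∀ {x} → x ∈ A → x ∉ B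

  -- three internally disjoint paths from P to Q with interiors A, B, C
  record Theta (P Q : Fin n) (A B C : List (Fin n)) : Set where
    constructor theta
    field
      pA : Path P A Q
      pB : Path P B Q
      pC : Path P C Q
      P≢Q : P ≢ Q
      uA : Unique (P ∷ Q ∷ A)
      uB : Unique (P ∷ Q ∷ B)
      uC : Unique (P ∷ Q ∷ C)
      AB : Disjoint A B
      AC : Disjoint A C
      BC : Disjoint B C

  th-AB : ∀ {P Q A B C} → Theta P Q A B C → Theta P Q B A C
  th-AB (theta pA pB pC ne uA uB uC AB AC BC) = theta pB pA pC ne uB uA uC (λ p q → AB q p) BC AC

  th-BC : ∀ {P Q A B C} → Theta P Q A B C → Theta P Q A C B
  th-BC (theta pA pB pC ne uA uB uC AB AC BC) = theta pA pC pB ne uA uC uB AC AB (λ p q → BC q p)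

  th-AC : ∀ {P Q A B C} → Theta P Q A B C → Theta P Q C B A
  th-AC t = th-AB (th-BC (th-AB t))

  module _ {P Q A B C} (Θ : Theta P Q A B C) where
    open Theta Θ

    cycle-path : Path P (A ++ Q ∷ reverse B) P
    cycle-path = path-++ A pA (path-rev B pB)

    cycle-unique : Unique (P ∷ A ++ Q ∷ reverse B)
    cycle-unique = unique-cons
      (λ x → [ (λ a → unique-head uA (there a)) , (λ { (here e) → P≢Q e ; (there b) → unique-head uB (there (∈-reverse⁻ b)) }) ]′ (∈-++⁻ A x))
      (unique-++ (unique-tail (unique-tail uA)) (unique-cons (λ b → unique-head (unique-tail uB) (∈-reverse⁻ b)) (unique-reverse (unique-tail (unique-tail uB))))
        (λ { a (here refl) → unique-head (unique-tail uA) a ; a (there b) → AB a (∈-reverse⁻ b) }))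

    verts : List (Fin n)
    verts = P ∷ Q ∷ A ++ B ++ C

    verts-unique : Unique verts
    verts-unique = unique-cons
      (λ { (here e) → P≢Q e ; (there x) → [ unique-head uA ∘ there , (λ y → [ unique-head uB ∘ there , unique-head uC ∘ there ]′ (∈-++⁻ B y)) ]′ (∈-++⁻ A x) })
      (unique-cons (λ x → [ unique-head (unique-tail uA) , (λ y → [ unique-head (unique-tail uB) , unique-head (unique-tail uC) ]′ (∈-++⁻ B y)) ]′ (∈-++⁻ A x))
        (unique-++ (unique-tail (unique-tail uA)) (unique-++ (unique-tail (unique-tail uB)) (unique-tail (unique-tail uC)) BC)
          (λ a y → [ AB a , AC a ]′ (∈-++⁻ B y))))

    data Where (x : Fin n) : Set where
      isP : x ≡ P → Where x
      isQ : x ≡ Q → Where x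
      inA : x ∈ A → Where x
      inB : x ∈ B → Where x
      inC : x ∈ C → Where x

    where-of : ∀ {x} → x ∈ verts → Where x
    where-of (here e) = isP e
    where-of (there (here e)) = isQ e
    where-of (there (there x)) = [ inA , (λ y → [ inB , inC ]′ (∈-++⁻ B y)) ]′ (∈-++⁻ A x)

    of-where : ∀ {x} → Where x → x ∈ verts
    of-where (isP e) = here e
    of-where (isQ e) = there (here e)
    of-where (inA a) = there (there (∈-++⁺ˡ a))
    of-where (inB b) = there (there (∈-++⁺ʳ A (∈-++⁺ˡ b)))
    of-where (inC c) = there (there (∈-++⁺ʳ A (∈-++⁺ʳ B c)))

    -- The length patterns for which a 3-cycle is found below. The roles of A, B, C differ, so a
    -- given theta may have to be relabelled to fit.
    data Good : Set where
      zero-B : 1 ≤ length A → B ≡ [] → 1 ≤ length C → Good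
      equal : 1 ≤ length A → length A ≡ length B → 2 ≤ length C → Good
      single-C : 1 ≤ length A → 1 ≤ length B → length A ≢ length B → length C ≡ 1 → Good
      long : 3 ≤ length A → 3 ≤ length B → 1 ≤ length C → Good

-- Loops of the blank in a theta and their commutators.

module ThetaMoves {n : ℕ} (X : Graph n) (simple : IsSimple X) (part : Fin n → ℕ)
  (x₀ : Fin n) (lone : ∀ {u} → u ≢ x₀ → part u ≢ part x₀) (tokens : ∀ {u v} → u ≢ x₀ → v ≢ x₀ → part u ≡ part v) where

  open GraphTheory X simple
  open FSCore X simple part
  open Wilson X simple part x₀ lone tokens
  open Thetas X simple

  record Looped (P Q : Fin n) (A : List (Fin n)) (α : Fin n) (A′ B : List (Fin n)) (σ : Permutation′ n) : Set where
    constructor looped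
    field
      state : Permutation′ n
      reach : σ ⇝ state
      blank : state ! P ≡ x₀
      on-ini : map (state !_) (ini α A′) ≡ map (σ !_) A′
      on-lst : state ! lst α A′ ≡ σ ! Q
      on-BQ : map (state !_) (B ++ Q ∷ []) ≡ σ ! α ∷ map (σ !_) B
      fixed : ∀ {x} → x ≢ P → x ≢ Q → x ∉ A → x ∉ B → state ! x ≡ σ ! x

  loop′ : ∀ {P Q α A′ B C} → Theta P Q (α ∷ A′) B C → ∀ σ → σ ! P ≡ x₀ → Looped P Q (α ∷ A′) α A′ B σ
  loop′ {P} {Q} {α} {A′} {B} {C} Θ σ bp = looped τ r bτ (proj₁ onA) (proj₂ onA)
      (Lₚ.reverse-injective (trans (sym (Lₚ.reverse-map (τ !_) (B ++ Q ∷ []))) (trans (cong (map (τ !_)) (reverse-++ B (Q ∷ [])))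
        (trans (proj₂ parts) (sym (trans (unfold-reverse (σ ! α) (map (σ !_) B)) (cong (_++ σ ! α ∷ []) (sym (Lₚ.reverse-map (σ !_) B)))))))))
      (λ xP xQ xA xB → fx λ { (here e) → xP e ; (there y) → [ xA , (λ { (here e) → xQ e ; (there z) → xB (∈-reverse⁻ z) }) ]′ (∈-++⁻ (α ∷ A′) y) })
    where
    open Cycled (cycle-once (cycle-path Θ) (cycle-unique Θ) σ bp) renaming (state to τ; reach to r; blank to bτ; content to ct; fixed to fx)
    parts : map (τ !_) (α ∷ A′) ≡ map (σ !_) A′ ++ σ ! Q ∷ [] × map (τ !_) (Q ∷ reverse B) ≡ map (σ !_) (reverse B) ++ σ ! α ∷ []
    parts = ++-cancel (map (τ !_) (α ∷ A′)) (map (σ !_) A′ ++ σ ! Q ∷ [])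
      (trans (cong suc (trans (Lₚ.length-map (τ !_) A′) (sym (Lₚ.length-map (σ !_) A′)))) (sym (trans (length-++ (map (σ !_) A′)) (ℕₚ.+-comm _ 1))))
      (trans (sym (map-++ (τ !_) (α ∷ A′) (Q ∷ reverse B))) (trans ct (trans (cong (_++ σ ! α ∷ []) (map-++ (σ !_) A′ (Q ∷ reverse B)))
        (trans (++-assoc (map (σ !_) A′) _ _) (sym (++-assoc (map (σ !_) A′) _ _))))))
    onA : map (τ !_) (ini α A′) ≡ map (σ !_) A′ × τ ! lst α A′ ≡ σ ! Q
    onA = ∷ʳ-injective (map (τ !_) (ini α A′)) (map (σ !_) A′)
      (trans (sym (map-++ (τ !_) (ini α A′) (lst α A′ ∷ []))) (trans (cong (map (τ !_)) (ini-lst α A′)) (proj₁ parts)))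

  abstract
    loop : ∀ {P Q α A′ B C} → Theta P Q (α ∷ A′) B C → ∀ σ → σ ! P ≡ x₀ → Looped P Q (α ∷ A′) α A′ B σ
    loop = loop′

  -- The vertex that follows the first one of the arc on the way to `Q`; it is `Q` itself when the
  -- arc has only one vertex.
  second : Fin n → List (Fin n) → Fin n
  second q [] = q
  second q (a ∷ _) = a

  loop-B : ∀ {P Q A α A′ β B′ σ} (l : Looped P Q A α A′ (β ∷ B′) σ) → let open Looped l in
    state ! β ≡ σ ! α × map (state !_) B′ ≡ map (σ !_) (ini β B′) × state ! Q ≡ σ ! lst β B′
  loop-B {Q = Q} {β = β} {B′} {σ} l = proj₁ (∷-injective on-BQ) , proj₁ rest , proj₂ rest
    where
    open Looped l
    rest : map (state !_) B′ ≡ map (σ !_) (ini β B′) × state ! Q ≡ σ ! lst β B′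
    rest = ∷ʳ-injective (map (state !_) B′) (map (σ !_) (ini β B′)) (trans (sym (map-++ (state !_) B′ (Q ∷ []))) (trans (proj₂ (∷-injective on-BQ))
      (trans (cong (map (σ !_)) (sym (ini-lst β B′))) (map-++ (σ !_) (ini β B′) (lst β B′ ∷ [])))))

  loop-first : ∀ {P Q A α A′ B σ} (l : Looped P Q A α A′ B σ) → Looped.state l ! α ≡ σ ! second Q A′
  loop-first {A′ = []} l = Looped.on-lst l
  loop-first {A′ = a ∷ A′} l = proj₁ (∷-injective (Looped.on-ini l))

  ini-or-lst : ∀ {α : Fin n} {A′ x} → x ∈ α ∷ A′ → x ≢ lst α A′ → x ∈ ini α A′
  ini-or-lst {α} {A′} {x} x∈ ne = [ id , (λ { (here e) → ⊥-elim (ne e) }) ]′ (∈-++⁻ (ini α A′) (subst (x ∈_) (sym (ini-lst α A′)) x∈))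

module ThetaRelations {n : ℕ} (X : Graph n) (simple : IsSimple X) (part : Fin n → ℕ)
  (x₀ : Fin n) (lone : ∀ {u} → u ≢ x₀ → part u ≢ part x₀) (tokens : ∀ {u v} → u ≢ x₀ → v ≢ x₀ → part u ≡ part v) where

  open GraphTheory X simple
  open FSCore X simple part
  open Wilson X simple part x₀ lone tokens
  open Thetas X simple
  open ThetaMoves X simple part x₀ lone tokens

  tok : ∀ {σ : Permutation′ n} {p q} → σ ! p ≡ x₀ → p ≢ q → σ ! q ≢ x₀
  tok {σ} h ne = token-part {σ} h (ne ∘ sym)

  head∉ : ∀ {P Q : Fin n} {A x} → Unique (P ∷ Q ∷ A) → x ∈ A → P ≢ x
  head∉ u x∈ refl = unique-head u (there x∈)

  Q∉ : ∀ {P Q : Fin n} {A x} → Unique (P ∷ Q ∷ A) → x ∈ A → Q ≢ x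
  Q∉ u x∈ refl = unique-head (unique-tail u) x∈

  module _ {P Q α A′ β B′ γ C′} (Θ : Theta P Q (α ∷ A′) (β ∷ B′) (γ ∷ C′)) (σ : Permutation′ n) (bp : σ ! P ≡ x₀) where

    open Theta Θ

    private
      α* = lst α A′
      β* = lst β B′
      γ* = lst γ C′
      α∈ = lst∈ α A′
      β∈ = lst∈ β B′
      γ∈ = lst∈ γ C′

    -- The loops through A, B and through A, C turn the common arc alike. In the two orders the
    -- results differ only at the ends of the common part and on the first vertices of B and C: two
    -- disjoint transpositions.
    commute-AB-AC : Dx σ (σ ! β*) (σ ! γ*) (σ ! α) (σ ! second Q A′)
    commute-AB-AC = Dx-inv (tokens (tok {σ} bp (head∉ uB β∈)) (tok {σ} bp (head∉ uC γ∈))) (tokens (tok {σ} bp (head∉ uA (here refl))) (second-token A′ refl))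
        (⇝-trans (Looped.reach ab) (Looped.reach ac′)) (subst₂ (λ x y → Dx τ₁ x y (σ ! α) (σ ! second Q A′)) τ₁α τ₁Q
          (subst₂ (Dx τ₁ (τ₁ ! α*) (τ₁ ! Q)) τ₁β τ₁γ
            (⇝-respʳ (⇝-trans (⇝-sym (⇝-trans (Looped.reach ab) (Looped.reach ac′))) (⇝-trans (Looped.reach ac) (Looped.reach ab′)))
              (dx-agree τ₁ τ₂ α* Q β γ (λ e → AB α∈ (here e)) (λ e → AC α∈ (here e)) (Q∉ uB (here refl)) (Q∉ uC (here refl))
                (trans τ₂α (sym τ₁Q)) (trans τ₂Q (sym τ₁α)) (trans τ₂β (sym τ₁γ)) (trans τ₂γ (sym τ₁β)) others))))
      where
      second-token : ∀ L → A′ ≡ L → σ ! second Q L ≢ x₀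
      second-token [] e = tok {σ} bp P≢Q
      second-token (a ∷ L) refl = tok {σ} bp (head∉ uA (there (here refl)))
      ab = loop Θ σ bp
      τ = Looped.state ab
      ac′ = loop (th-BC Θ) τ (Looped.blank ab)
      τ₁ = Looped.state ac′
      ac = loop (th-BC Θ) σ bp
      ρ = Looped.state ac
      ab′ = loop Θ ρ (Looped.blank ac)
      τ₂ = Looped.state ab′
      B-in-τ₁ : ∀ {x} → x ∈ β ∷ B′ → τ₁ ! x ≡ τ ! x
      B-in-τ₁ x∈ = Looped.fixed ac′ (head∉ uB x∈ ∘ sym) (Q∉ uB x∈ ∘ sym) (λ a → AB a x∈) (λ c → BC x∈ c)
      C-in-τ : ∀ {x} → x ∈ γ ∷ C′ → τ ! x ≡ σ ! x
      C-in-τ x∈ = Looped.fixed ab (head∉ uC x∈ ∘ sym) (Q∉ uC x∈ ∘ sym) (λ a → AC a x∈) (λ b → BC b x∈)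
      C-in-τ₂ : ∀ {x} → x ∈ γ ∷ C′ → τ₂ ! x ≡ ρ ! x
      C-in-τ₂ x∈ = Looped.fixed ab′ (head∉ uC x∈ ∘ sym) (Q∉ uC x∈ ∘ sym) (λ a → AC a x∈) (λ b → BC b x∈)
      B-in-ρ : ∀ {x} → x ∈ β ∷ B′ → ρ ! x ≡ σ ! x
      B-in-ρ x∈ = Looped.fixed ac (head∉ uB x∈ ∘ sym) (Q∉ uB x∈ ∘ sym) (λ a → AB a x∈) (λ c → BC x∈ c)
      τ₁α : τ₁ ! α* ≡ σ ! β*
      τ₁α = trans (Looped.on-lst ac′) (proj₂ (proj₂ (loop-B ab)))
      τ₁Q : τ₁ ! Q ≡ σ ! γ*
      τ₁Q = trans (proj₂ (proj₂ (loop-B ac′))) (C-in-τ γ∈)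
      τ₁β : τ₁ ! β ≡ σ ! α
      τ₁β = trans (B-in-τ₁ (here refl)) (proj₁ (loop-B ab))
      τ₁γ : τ₁ ! γ ≡ σ ! second Q A′
      τ₁γ = trans (proj₁ (loop-B ac′)) (loop-first ab)
      τ₂α : τ₂ ! α* ≡ σ ! γ*
      τ₂α = trans (Looped.on-lst ab′) (proj₂ (proj₂ (loop-B ac)))
      τ₂Q : τ₂ ! Q ≡ σ ! β*
      τ₂Q = trans (proj₂ (proj₂ (loop-B ab′))) (B-in-ρ β∈)
      τ₂γ : τ₂ ! γ ≡ σ ! α
      τ₂γ = trans (C-in-τ₂ (here refl)) (proj₁ (loop-B ac))
      τ₂β : τ₂ ! β ≡ σ ! second Q A′
      τ₂β = trans (proj₁ (loop-B ab′)) (loop-first ac)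
      ini-B : ∀ {x} → x ∈ ini β B′ → x ∈ β ∷ B′
      ini-B {x} x∈ = subst (x ∈_) (ini-lst β B′) (∈-++⁺ˡ x∈)
      ini-C : ∀ {x} → x ∈ ini γ C′ → x ∈ γ ∷ C′
      ini-C {x} x∈ = subst (x ∈_) (ini-lst γ C′) (∈-++⁺ˡ x∈)
      onA : ∀ {x} → x ∈ ini α A′ → τ₂ ! x ≡ τ₁ ! x
      onA = map-agree {f = τ₂ !_} {g = τ₁ !_} (trans (Looped.on-ini ab′) (trans tails (sym (Looped.on-ini ac′))))
        where
        agree-A : ∀ {x} → x ∈ α ∷ A′ → ρ ! x ≡ τ ! x
        agree-A {x} x∈ with x ≟ᶠ α*
        ... | yes refl = trans (Looped.on-lst ac) (sym (Looped.on-lst ab))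
        ... | no ne = map-agree {f = ρ !_} {g = τ !_} (trans (Looped.on-ini ac) (sym (Looped.on-ini ab))) (ini-or-lst x∈ ne)
        tails : map (ρ !_) A′ ≡ map (τ !_) A′
        tails = agree-map (agree-A ∘ there)
      onB : ∀ {x} → x ∈ B′ → τ₂ ! x ≡ τ₁ ! x
      onB x∈ = trans (map-agree {f = τ₂ !_} {g = τ !_} (trans (proj₁ (proj₂ (loop-B ab′))) (trans (agree-map (B-in-ρ ∘ ini-B)) (sym (proj₁ (proj₂ (loop-B ab)))))) x∈)
                 (sym (B-in-τ₁ (there x∈)))
      onC : ∀ {x} → x ∈ C′ → τ₂ ! x ≡ τ₁ ! x
      onC x∈ = trans (C-in-τ₂ (there x∈))
                 (map-agree {f = ρ !_} {g = τ₁ !_} (trans (proj₁ (proj₂ (loop-B ac))) (trans (sym (agree-map (C-in-τ ∘ ini-C))) (sym (proj₁ (proj₂ (loop-B ac′)))))) x∈)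
      others : ∀ x → x ≢ α* → x ≢ Q → x ≢ β → x ≢ γ → τ₂ ! x ≡ τ₁ ! x
      others x xα xQ xβ xγ with x ≟ᶠ P | x ∈? (α ∷ A′) | x ∈? B′ | x ∈? C′
      ... | yes refl | _ | _ | _ = trans (Looped.blank ab′) (sym (Looped.blank ac′))
      ... | no _ | yes a | _ | _ = onA (ini-or-lst a xα)
      ... | no _ | no _ | yes b | _ = onB b
      ... | no _ | no _ | no _ | yes c = onC c
      ... | no xP | no a | no b | no c = trans (trans (Looped.fixed ab′ xP xQ a b′) (Looped.fixed ac xP xQ a c′)) (sym (trans (Looped.fixed ac′ xP xQ a c′) (Looped.fixed ab xP xQ a b′)))
        where
        b′ : x ∉ β ∷ B′
        b′ (here e) = xβ e
        b′ (there y) = b y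
        c′ : x ∉ γ ∷ C′
        c′ (here e) = xγ e
        c′ (there y) = c y

    -- The same commutator for two loops that share B. As both run through B in the same direction,
    -- a pair of transpositions at another place of the theta results.
    commute-AB-CB : Dx σ (σ ! Q) (σ ! β*) (σ ! γ) (σ ! α)
    commute-AB-CB = Dx-inv (tokens (tok {σ} bp P≢Q) (tok {σ} bp (head∉ uB β∈))) (tokens (tok {σ} bp (head∉ uC (here refl))) (tok {σ} bp (head∉ uA (here refl))))
        (⇝-trans (Looped.reach ab) (Looped.reach cb′)) (subst₂ (λ x y → Dx τ₁ x y (σ ! γ) (σ ! α)) τ₁α τ₁γ
          (subst₂ (Dx τ₁ (τ₁ ! α*) (τ₁ ! γ*)) τ₁β τ₁t
            (⇝-respʳ (⇝-trans (⇝-sym (⇝-trans (Looped.reach ab) (Looped.reach cb′))) (⇝-trans (Looped.reach cb) (Looped.reach ab′)))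
              (dx-agree τ₁ τ₂ α* γ* β t (λ e → AB α∈ (here e)) (λ e → t-out α∈ AB uA e) (λ e → BC (here e) γ∈) (λ e → t-out γ∈ (λ c b → BC b c) uC e)
                (trans τ₂α (sym τ₁γ)) (trans τ₂γ (sym τ₁α)) (trans τ₂β (sym τ₁t)) (trans τ₂t (sym τ₁β)) others))))
      where
      t = second Q B′
      t-out : ∀ {x A} → x ∈ A → Disjoint A (β ∷ B′) → Unique (P ∷ Q ∷ A) → x ≢ t
      t-out {x} {A} x∈ d u = go B′ refl
        where
        go : ∀ L → B′ ≡ L → x ≢ second Q L
        go [] _ e = Q∉ u x∈ (sym e)
        go (b ∷ L) refl refl = d x∈ (there (here refl))
      ab = loop Θ σ bp
      τ = Looped.state ab
      cb′ = loop (th-AC Θ) τ (Looped.blank ab)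
      τ₁ = Looped.state cb′
      cb = loop (th-AC Θ) σ bp
      ρ = Looped.state cb
      ab′ = loop Θ ρ (Looped.blank cb)
      τ₂ = Looped.state ab′
      A-in-τ₁ : ∀ {x} → x ∈ α ∷ A′ → τ₁ ! x ≡ τ ! x
      A-in-τ₁ x∈ = Looped.fixed cb′ (head∉ uA x∈ ∘ sym) (Q∉ uA x∈ ∘ sym) (λ c → AC x∈ c) (λ b → AB x∈ b)
      C-in-τ : ∀ {x} → x ∈ γ ∷ C′ → τ ! x ≡ σ ! x
      C-in-τ x∈ = Looped.fixed ab (head∉ uC x∈ ∘ sym) (Q∉ uC x∈ ∘ sym) (λ a → AC a x∈) (λ b → BC b x∈)
      C-in-τ₂ : ∀ {x} → x ∈ γ ∷ C′ → τ₂ ! x ≡ ρ ! x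
      C-in-τ₂ x∈ = Looped.fixed ab′ (head∉ uC x∈ ∘ sym) (Q∉ uC x∈ ∘ sym) (λ a → AC a x∈) (λ b → BC b x∈)
      A-in-ρ : ∀ {x} → x ∈ α ∷ A′ → ρ ! x ≡ σ ! x
      A-in-ρ x∈ = Looped.fixed cb (head∉ uA x∈ ∘ sym) (Q∉ uA x∈ ∘ sym) (λ c → AC x∈ c) (λ b → AB x∈ b)
      τ₁α : τ₁ ! α* ≡ σ ! Q
      τ₁α = trans (A-in-τ₁ α∈) (Looped.on-lst ab)
      τ₁γ : τ₁ ! γ* ≡ σ ! β*
      τ₁γ = trans (Looped.on-lst cb′) (proj₂ (proj₂ (loop-B ab)))
      τ₁β : τ₁ ! β ≡ σ ! γ
      τ₁β = trans (proj₁ (loop-B cb′)) (C-in-τ (here refl))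
      rest : List (Fin n) → List (Fin n)
      rest [] = []
      rest (b ∷ L) = L ++ Q ∷ []
      W-split : ∀ L → L ++ Q ∷ [] ≡ second Q L ∷ rest L
      W-split [] = refl
      W-split (b ∷ L) = refl
      τ-W : map (τ !_) (B′ ++ Q ∷ []) ≡ map (σ !_) (β ∷ B′)
      τ-W = proj₂ (∷-injective (Looped.on-BQ ab))
      ρ-W : map (ρ !_) (B′ ++ Q ∷ []) ≡ map (σ !_) (β ∷ B′)
      ρ-W = proj₂ (∷-injective (Looped.on-BQ cb))
      τ₁-W : map (τ₁ !_) (second Q B′ ∷ rest B′) ≡ τ ! β ∷ map (τ !_) B′
      τ₁-W = trans (cong (map (τ₁ !_)) (sym (W-split B′))) (proj₂ (∷-injective (Looped.on-BQ cb′)))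
      τ₂-W : map (τ₂ !_) (second Q B′ ∷ rest B′) ≡ ρ ! β ∷ map (ρ !_) B′
      τ₂-W = trans (cong (map (τ₂ !_)) (sym (W-split B′))) (proj₂ (∷-injective (Looped.on-BQ ab′)))
      τ₁t : τ₁ ! t ≡ σ ! α
      τ₁t = trans (proj₁ (∷-injective τ₁-W)) (proj₁ (loop-B ab))
      τ₂t : τ₂ ! t ≡ σ ! γ
      τ₂t = trans (proj₁ (∷-injective τ₂-W)) (proj₁ (loop-B cb))
      ρτ-B′ : map (ρ !_) B′ ≡ map (τ !_) B′
      ρτ-B′ = agree-map (λ x∈ → map-agree {f = ρ !_} {g = τ !_} (trans ρ-W (sym τ-W)) (∈-++⁺ˡ x∈))
      onW : ∀ {x} → x ∈ B′ ++ Q ∷ [] → x ≢ t → τ₂ ! x ≡ τ₁ ! x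
      onW {x} x∈ xt = go (subst (x ∈_) (W-split B′) x∈)
        where
        go : x ∈ second Q B′ ∷ rest B′ → τ₂ ! x ≡ τ₁ ! x
        go (here e) = ⊥-elim (xt e)
        go (there y) = map-agree {f = τ₂ !_} {g = τ₁ !_} (trans (proj₂ (∷-injective τ₂-W)) (trans ρτ-B′ (sym (proj₂ (∷-injective τ₁-W))))) y
      τ₂α : τ₂ ! α* ≡ σ ! β*
      τ₂α = trans (Looped.on-lst ab′) (proj₂ (proj₂ (loop-B cb)))
      τ₂γ : τ₂ ! γ* ≡ σ ! Q
      τ₂γ = trans (C-in-τ₂ γ∈) (Looped.on-lst cb)
      τ₂β : τ₂ ! β ≡ σ ! α
      τ₂β = trans (proj₁ (loop-B ab′)) (A-in-ρ (here refl))
      onA : ∀ {x} → x ∈ ini α A′ → τ₂ ! x ≡ τ₁ ! x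
      onA {x} x∈ = trans (map-agree {f = τ₂ !_} {g = τ !_} (trans (Looped.on-ini ab′) (trans (agree-map (A-in-ρ ∘ there)) (sym (Looped.on-ini ab)))) x∈)
                     (sym (A-in-τ₁ (subst (x ∈_) (ini-lst α A′) (∈-++⁺ˡ x∈))))
      onC : ∀ {x} → x ∈ ini γ C′ → τ₂ ! x ≡ τ₁ ! x
      onC {x} x∈ = trans (C-in-τ₂ (subst (x ∈_) (ini-lst γ C′) (∈-++⁺ˡ x∈)))
                     (map-agree {f = ρ !_} {g = τ₁ !_} (trans (Looped.on-ini cb) (sym (trans (Looped.on-ini cb′) (agree-map (C-in-τ ∘ there))))) x∈)
      others : ∀ x → x ≢ α* → x ≢ γ* → x ≢ β → x ≢ t → τ₂ ! x ≡ τ₁ ! x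
      others x xα xγ xβ xt with x ≟ᶠ P | x ∈? (α ∷ A′) | x ∈? (γ ∷ C′) | x ∈? (B′ ++ Q ∷ [])
      ... | yes refl | _ | _ | _ = trans (Looped.blank ab′) (sym (Looped.blank cb′))
      ... | no _ | yes a | _ | _ = onA (ini-or-lst a xα)
      ... | no _ | no _ | yes c | _ = onC (ini-or-lst c xγ)
      ... | no _ | no _ | no _ | yes w = onW w xt
      ... | no xP | no a | no c | no w = trans (trans (Looped.fixed ab′ xP xQ a b′) (Looped.fixed cb xP xQ c b′)) (sym (trans (Looped.fixed cb′ xP xQ c b′) (Looped.fixed ab xP xQ a b′)))
        where
        xQ : x ≢ Q
        xQ refl = w (∈-++⁺ʳ B′ (here refl))
        b′ : x ∉ β ∷ B′
        b′ (here e) = xβ e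
        b′ (there y) = w (∈-++⁺ˡ y)

  -- when B is empty the two ways round differ by a 3-cycle
  module _ {P Q α A′ γ C′} (Θ : Theta P Q (α ∷ A′) [] (γ ∷ C′)) (σ : Permutation′ n) (bp : σ ! P ≡ x₀) where

    open Theta Θ

    private
      α* = lst α A′
      γ* = lst γ C′
      α∈ = lst∈ α A′
      γ∈ = lst∈ γ C′

    zero-tri : Tri σ (σ ! γ*) (σ ! α) (σ ! second Q A′)
    zero-tri = tri (tok {σ} bp (head∉ uC γ∈)) (tok {σ} bp (head∉ uA (here refl))) s≢x₀ (λ e → AC (here refl) (subst (_∈ γ ∷ C′) (!-inj σ e) γ∈)) (λ e → α≢s A′ refl (!-inj σ e)) (λ e → s∉C A′ refl (!-inj σ e))
        (Dx-commˡ {σ} (Dx-inv (tokens (tok {σ} bp (head∉ uA (here refl))) (tok {σ} bp (head∉ uC γ∈))) (tokens (tok {σ} bp (head∉ uA (here refl))) s≢x₀)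
          (⇝-trans (Looped.reach ab) (Looped.reach ac′)) (subst₂ (λ x y → Dx τ₁ x y x (σ ! second Q A′)) τ₁α τ₁Q
            (subst (Dx τ₁ (τ₁ ! α*) (τ₁ ! Q) (τ₁ ! α*)) τ₁γ
              (⇝-respʳ (⇝-trans (⇝-sym (⇝-trans (Looped.reach ab) (Looped.reach ac′))) (⇝-trans (Looped.reach ac) (Looped.reach ab′)))
                (cyc-agree τ₁ τ₂ α* Q γ (Q∉ uA α∈ ∘ sym) (Q∉ uC (here refl)) (λ e → AC α∈ (here e))
                  (trans τ₂α (sym τ₁Q)) (trans τ₂Q (sym τ₁γ)) (trans τ₂γ (sym τ₁α)) others))))))
      where
      s≢x₀ : σ ! second Q A′ ≢ x₀
      s≢x₀ = go A′ refl
        where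
        go : ∀ L → A′ ≡ L → σ ! second Q L ≢ x₀
        go [] e = tok {σ} bp P≢Q
        go (a ∷ L) refl = tok {σ} bp (head∉ uA (there (here refl)))
      α≢s : ∀ L → A′ ≡ L → α ≢ second Q L
      α≢s [] e h = Q∉ uA (here refl) (sym h)
      α≢s (a ∷ L) refl h = unique-head (unique-tail (unique-tail uA)) (here h)
      s∉C : ∀ L → A′ ≡ L → γ* ≢ second Q L
      s∉C [] e h = Q∉ uC γ∈ (sym h)
      s∉C (a ∷ L) refl h = AC (there (here refl)) (subst (_∈ γ ∷ C′) h γ∈)
      ab = loop Θ σ bp
      τ = Looped.state ab
      ac′ = loop (th-BC Θ) τ (Looped.blank ab)
      τ₁ = Looped.state ac′
      ac = loop (th-BC Θ) σ bp
      ρ = Looped.state ac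
      ab′ = loop Θ ρ (Looped.blank ac)
      τ₂ = Looped.state ab′
      C-in-τ : ∀ {x} → x ∈ γ ∷ C′ → τ ! x ≡ σ ! x
      C-in-τ x∈ = Looped.fixed ab (head∉ uC x∈ ∘ sym) (Q∉ uC x∈ ∘ sym) (λ a → AC a x∈) (λ ())
      C-in-τ₂ : ∀ {x} → x ∈ γ ∷ C′ → τ₂ ! x ≡ ρ ! x
      C-in-τ₂ x∈ = Looped.fixed ab′ (head∉ uC x∈ ∘ sym) (Q∉ uC x∈ ∘ sym) (λ a → AC a x∈) (λ ())
      τ₁α : τ₁ ! α* ≡ σ ! α
      τ₁α = trans (Looped.on-lst ac′) (proj₁ (∷-injective (Looped.on-BQ ab)))
      τ₁Q : τ₁ ! Q ≡ σ ! γ*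
      τ₁Q = trans (proj₂ (proj₂ (loop-B ac′))) (C-in-τ γ∈)
      τ₁γ : τ₁ ! γ ≡ σ ! second Q A′
      τ₁γ = trans (proj₁ (loop-B ac′)) (loop-first ab)
      τ₂α : τ₂ ! α* ≡ σ ! γ*
      τ₂α = trans (Looped.on-lst ab′) (proj₂ (proj₂ (loop-B ac)))
      τ₂Q : τ₂ ! Q ≡ σ ! second Q A′
      τ₂Q = trans (proj₁ (∷-injective (Looped.on-BQ ab′))) (loop-first ac)
      τ₂γ : τ₂ ! γ ≡ σ ! α
      τ₂γ = trans (C-in-τ₂ (here refl)) (proj₁ (loop-B ac))
      ini-C : ∀ {x} → x ∈ ini γ C′ → x ∈ γ ∷ C′
      ini-C {x} x∈ = subst (x ∈_) (ini-lst γ C′) (∈-++⁺ˡ x∈)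
      onA : ∀ {x} → x ∈ ini α A′ → τ₂ ! x ≡ τ₁ ! x
      onA = map-agree {f = τ₂ !_} {g = τ₁ !_} (trans (Looped.on-ini ab′) (trans tails (sym (Looped.on-ini ac′))))
        where
        agree-A : ∀ {x} → x ∈ α ∷ A′ → ρ ! x ≡ τ ! x
        agree-A {x} x∈ with x ≟ᶠ α*
        ... | yes refl = trans (Looped.on-lst ac) (sym (Looped.on-lst ab))
        ... | no ne = map-agree {f = ρ !_} {g = τ !_} (trans (Looped.on-ini ac) (sym (Looped.on-ini ab))) (ini-or-lst x∈ ne)
        tails : map (ρ !_) A′ ≡ map (τ !_) A′
        tails = agree-map (agree-A ∘ there)
      onC : ∀ {x} → x ∈ C′ → τ₂ ! x ≡ τ₁ ! x
      onC x∈ = trans (C-in-τ₂ (there x∈))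
                 (map-agree {f = ρ !_} {g = τ₁ !_} (trans (proj₁ (proj₂ (loop-B ac))) (trans (sym (agree-map (C-in-τ ∘ ini-C))) (sym (proj₁ (proj₂ (loop-B ac′)))))) x∈)
      others : ∀ x → x ≢ α* → x ≢ Q → x ≢ γ → τ₂ ! x ≡ τ₁ ! x
      others x xα xQ xγ with x ≟ᶠ P | x ∈? (α ∷ A′) | x ∈? C′
      ... | yes refl | _ | _ = trans (Looped.blank ab′) (sym (Looped.blank ac′))
      ... | no _ | yes a | _ = onA (ini-or-lst a xα)
      ... | no _ | no _ | yes c = onC c
      ... | no xP | no a | no c = trans (trans (Looped.fixed ab′ xP xQ a (λ ())) (Looped.fixed ac xP xQ a c′)) (sym (trans (Looped.fixed ac′ xP xQ a c′) (Looped.fixed ab xP xQ a (λ ()))))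
        where
        c′ : x ∉ γ ∷ C′
        c′ (here e) = xγ e
        c′ (there y) = c y

-- All tokens on a good theta are related.

module ThetaGood {n : ℕ} (X : Graph n) (simple : IsSimple X) (part : Fin n → ℕ)
  (x₀ : Fin n) (lone : ∀ {u} → u ≢ x₀ → part u ≢ part x₀) (tokens : ∀ {u v} → u ≢ x₀ → v ≢ x₀ → part u ≡ part v) where

  open GraphTheory X simple
  open FSCore X simple part
  open Wilson X simple part x₀ lone tokens
  open Thetas X simple
  open ThetaMoves X simple part x₀ lone tokens
  open ThetaRelations X simple part x₀ lone tokens

  shift-at : ∀ {τ σ : Permutation′ n} {d z} l X {a b Y} → map (τ !_) (d ∷ l) ≡ map (σ !_) l ++ z ∷ [] → d ∷ l ≡ X ++ a ∷ b ∷ Y → τ ! a ≡ σ ! b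
  shift-at (b ∷ l) [] h refl = proj₁ (∷-injective h)
  shift-at {τ} {σ} (e ∷ l) (x ∷ X) h q = shift-at {τ} {σ} l X (proj₂ (∷-injective h)) (proj₂ (∷-injective q))
  shift-at [] (x ∷ []) h ()
  shift-at [] (x ∷ y ∷ X) h ()

  -- a relation between a vertex off a cycle through the blank and one vertex of the cycle spreads to the whole cycle
  module _ {p d l} (cyc : Path p (d ∷ l) p) (u : Unique (p ∷ d ∷ l)) {q} (q∉ : q ∉ p ∷ d ∷ l) where

    Rel : Fin n → Set
    Rel r = ∀ σ → σ ! p ≡ x₀ → R σ (σ ! q) (σ ! r)

    -- A loop of the blank moves the occupant of `b` to `a` and leaves `q` alone, so a relation
    -- valid at `a` in all states holds at `b` too.
    rel-next : ∀ {a b} → (∀ σ (c : Cycled σ p d l) → Cycled.state c ! a ≡ σ ! b) → Rel a → Rel b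
    rel-next {a} {b} h rel σ bp = go (cycle-once cyc u σ bp)
      where
      go : Cycled σ p d l → R σ (σ ! q) (σ ! b)
      go c = R-inv (Cycled.reach c) (subst₂ (R (Cycled.state c)) (Cycled.fixed c q∉) (h σ c) (rel (Cycled.state c) (Cycled.blank c)))

    rel-forward : ∀ X {a} Y → d ∷ l ≡ X ++ a ∷ Y → Rel a → ∀ {y} → y ∈ a ∷ Y → Rel y
    rel-forward X Y e r (here refl) = r
    rel-forward X {a} (b ∷ Y) e r (there y∈) = rel-forward (X ++ a ∷ []) Y (trans e (sym (++-assoc X (a ∷ []) (b ∷ Y))))
      (rel-next {a} {b} (λ σ c → shift-at {Cycled.state c} {σ} l X (Cycled.content c) e) r) y∈

    rel-all : ∀ {r₀} → r₀ ∈ d ∷ l → Rel r₀ → ∀ {r} → r ∈ d ∷ l → Rel r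
    rel-all {r₀} r₀∈ rel r∈ with ∈-∃++ r₀∈
    ... | X , Y , e = rel-forward [] l refl (rel-next {lst d l} {d} (λ σ c → last-first σ c)
          (rel-forward X Y e rel (subst (_∈ r₀ ∷ Y) (last-of X e) (lst∈ r₀ Y)))) r∈
      where
      last-of : ∀ X → d ∷ l ≡ X ++ r₀ ∷ Y → lst r₀ Y ≡ lst d l
      last-of [] refl = refl
      last-of (x ∷ X) refl = sym (lst-++ d X Y)
      last-first : ∀ σ (c : Cycled σ p d l) → Cycled.state c ! lst d l ≡ σ ! d
      last-first σ c = ∷ʳ-injectiveʳ (map (Cycled.state c !_) (ini d l)) (map (σ !_) l)
        (trans (sym (map-++ (Cycled.state c !_) (ini d l) (lst d l ∷ []))) (trans (cong (map (Cycled.state c !_)) (ini-lst d l)) (Cycled.content c)))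

  module _ {P Q α A′ B C} (Θ : Theta P Q (α ∷ A′) B C) {p₀ r₀} (p₀∈ : p₀ ∈ C) (r₀∈ : r₀ ∈ (α ∷ A′) ++ Q ∷ reverse B)
    (seed : ∀ σ → σ ! P ≡ x₀ → R σ (σ ! p₀) (σ ! r₀)) where

    open Theta Θ

    around-AB : ∀ {r} → r ∈ (α ∷ A′) ++ Q ∷ reverse B → ∀ σ → σ ! P ≡ x₀ → R σ (σ ! p₀) (σ ! r)
    around-AB = rel-all (cycle-path Θ) (cycle-unique Θ)
      (λ { (here e) → head∉ uC p₀∈ (sym e)
         ; (there x) → [ (λ a → AC a p₀∈) , (λ { (here e) → Q∉ uC p₀∈ (sym e) ; (there b) → BC (∈-reverse⁻ b) p₀∈ }) ]′ (∈-++⁻ (α ∷ A′) x) })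
      r₀∈ seed

    around-CB : ∀ {r} → r ∈ C ++ Q ∷ reverse B → ∀ σ → σ ! P ≡ x₀ → R σ (σ ! α) (σ ! r)
    around-CB {r} r∈ = go C refl p₀∈
      where
      go : ∀ L → C ≡ L → p₀ ∈ L → ∀ σ → σ ! P ≡ x₀ → R σ (σ ! α) (σ ! r)
      go (γ ∷ L) refl p∈ = rel-all (cycle-path (th-AC Θ)) (cycle-unique (th-AC Θ))
        (λ { (here e) → head∉ uA (here refl) (sym e)
           ; (there x) → [ (λ c → AC (here refl) c) , (λ { (here e) → Q∉ uA (here refl) (sym e) ; (there b) → AB (here refl) (∈-reverse⁻ b) }) ]′ (∈-++⁻ (γ ∷ L) x) })
        (∈-++⁺ˡ p∈) (λ σ bp → R-sym (around-AB (∈-++⁺ˡ {xs = α ∷ A′} (here refl)) σ bp)) r∈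

    from-α : ∀ {x} → x ∈ verts Θ → x ≢ P → ∀ σ → σ ! P ≡ x₀ → R σ (σ ! α) (σ ! x)
    from-α {x} x∈ x≢P σ bp with where-of Θ x∈
    ... | isP e = ⊥-elim (x≢P e)
    ... | isQ e = around-CB (∈-++⁺ʳ C (here e)) σ bp
    ... | inA a = R-trans (R-sym (around-AB (∈-++⁺ˡ {xs = α ∷ A′} (here refl)) σ bp)) (around-AB (∈-++⁺ˡ a) σ bp)
    ... | inB b = around-CB (∈-++⁺ʳ C (there (∈-reverse b))) σ bp
    ... | inC c = around-CB (∈-++⁺ˡ c) σ bp

    -- One relation between C and the cycle through A and B suffices: it spreads over that cycle,
    -- and then, seen from `α`, over the cycle through C and B. Together these cover the theta.
    all-related : ∀ {x y} → x ∈ verts Θ → y ∈ verts Θ → x ≢ P → y ≢ P → ∀ σ → σ ! P ≡ x₀ → R σ (σ ! x) (σ ! y)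
    all-related x∈ y∈ x≢ y≢ σ bp = R-trans (R-sym (from-α x∈ x≢ σ bp)) (from-α y∈ y≢ σ bp)

  unique-place : ∀ {A : Set} {a : A} us {vs} ys {zs} → Unique (ys ++ a ∷ zs) → us ++ a ∷ vs ≡ ys ++ a ∷ zs → length us ≡ length ys
  unique-place [] [] u e = refl
  unique-place [] (y ∷ ys) u e with ∷-injective e
  ... | refl , _ = ⊥-elim (unique-head u (∈-++⁺ʳ ys (here refl)))
  unique-place (x ∷ us) [] {zs} u e with ∷-injective e
  ... | refl , refl = ⊥-elim (unique-head u (∈-++⁺ʳ us (here refl)))
  unique-place (x ∷ us) (y ∷ ys) u e = cong suc (unique-place us ys (unique-tail u) (proj₂ (∷-injective e)))

  reverse-last : (β : Fin n) (B′ : List (Fin n)) → reverse (β ∷ B′) ≡ lst β B′ ∷ reverse (ini β B′)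
  reverse-last β B′ = trans (cong reverse (sym (ini-lst β B′))) (reverse-++ (ini β B′) (lst β B′ ∷ []))

  module _ {P Q α A′ β B′ γ C′} (Θ : Theta P Q (α ∷ A′) (β ∷ B′) (γ ∷ C′)) where

    open Theta Θ

    private
      A = α ∷ A′
      β* = lst β B′
      γ* = lst γ C′
      β∈ = lst∈ β B′
      γ∈ = lst∈ γ C′

    rB : List (Fin n)
    rB = reverse (ini β B′)

    around : List (Fin n)
    around = A ++ Q ∷ reverse (β ∷ B′)

    around-split : around ≡ (A ++ Q ∷ []) ++ β* ∷ rB
    around-split = trans (cong (λ z → A ++ Q ∷ z) (reverse-last β B′)) (sym (++-assoc A (Q ∷ []) (β* ∷ rB)))

    -- The pair (Q β*) again, now combined with a transposition of the last vertex of C and the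
    -- person `z` that the turn brings to β*. This is the occupant of `α` exactly if A and B have
    -- equal length.
    record Far (σ : Permutation′ n) : Set where
      constructor far
      field
        z : Fin n
        zT : z ≢ x₀
        z≢γ : ∀ {c} → c ∈ γ ∷ C′ → z ≢ σ ! c
        place : length A ≡ length (β ∷ B′) → z ≡ σ ! α
        away : length A ≢ length (β ∷ B′) → z ≢ σ ! α
        dx : Dx σ (σ ! Q) (σ ! β*) z (σ ! γ*)

    -- turn the cycle until Q is next to the blank
    far-relation′ : ∀ σ → σ ! P ≡ x₀ → Far σ
    far-relation′ σ bp = go (cycle-turn (cycle-path Θ) (cycle-unique Θ) (map (σ !_) A) {map (σ !_) (Q ∷ reverse (β ∷ B′))} σ bp (map-++ (σ !_) A (Q ∷ reverse (β ∷ B′))))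
      where
      go : Turned σ P around (map (σ !_) (Q ∷ reverse (β ∷ B′)) ++ map (σ !_) A) → Far σ
      go (turned ρ r bρ ct fx) = far (ρ ! β*) (tok {ρ} bρ (head∉ uB β∈))
          (λ {c} c∈ e → BC β∈ (subst (_∈ γ ∷ C′) (sym (!-inj ρ (trans e (sym (fixC c∈))))) c∈)) same other
          (Dx-inv (tokens (tok {σ} bp P≢Q) (tok {σ} bp (head∉ uB β∈))) (tokens (tok {ρ} bρ (head∉ uB β∈)) (tok {σ} bp (head∉ uC γ∈))) r
            (Dx-sym {ρ} (tokens (tok {ρ} bρ (head∉ uB β∈)) (tok {σ} bp (head∉ uC γ∈))) (tokens (tok {σ} bp P≢Q) (tok {σ} bp (head∉ uB β∈)))
              (subst₂ (λ x y → Dx ρ (ρ ! β*) (σ ! γ*) x y) ρα (ρs A′ refl) (subst (λ x → Dx ρ (ρ ! β*) x (ρ ! α) (ρ ! second Q A′)) (fixC γ∈) (commute-AB-AC Θ ρ bρ)))))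
        where
        fixC : ∀ {c} → c ∈ γ ∷ C′ → ρ ! c ≡ σ ! c
        fixC {c} c∈ = fx λ { (here e) → head∉ uC c∈ (sym e)
          ; (there x) → [ (λ a → AC a c∈) , (λ { (here e) → Q∉ uC c∈ (sym e) ; (there b) → BC (∈-reverse⁻ b) c∈ }) ]′ (∈-++⁻ A x) }
        ρα : ρ ! α ≡ σ ! Q
        ρα = proj₁ (∷-injective ct)
        ct' : map (ρ !_) (A ++ Q ∷ []) ++ ρ ! β* ∷ map (ρ !_) rB ≡ map (σ !_) (Q ∷ reverse (β ∷ B′)) ++ map (σ !_) A
        ct' = trans (sym (trans (cong (map (ρ !_)) around-split) (map-++ (ρ !_) (A ++ Q ∷ []) (β* ∷ rB)))) ct
        ρs : ∀ L → A′ ≡ L → ρ ! second Q L ≡ σ ! β*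
        ρs L e = trans (head-eq L e) (cong (head′ ∘ map (σ !_)) (reverse-last β B′))
          where
          head′ : List (Fin n) → Fin n
          head′ [] = x₀
          head′ (x ∷ _) = x
          tail-eq : map (ρ !_) (A′ ++ Q ∷ reverse (β ∷ B′)) ≡ map (σ !_) (reverse (β ∷ B′)) ++ map (σ !_) A
          tail-eq = proj₂ (∷-injective ct)
          head-++ : ∀ xs {ys} → 1 ≤ length xs → head′ (xs ++ ys) ≡ head′ xs
          head-++ (x ∷ xs) _ = refl
          nonempty : 1 ≤ length (map (σ !_) (reverse (β ∷ B′)))
          nonempty = subst (1 ≤_) (sym (trans (Lₚ.length-map (σ !_) (reverse (β ∷ B′))) (length-reverse (β ∷ B′)))) (s≤s z≤n)
          head-eq : ∀ L → A′ ≡ L → ρ ! second Q L ≡ head′ (map (σ !_) (reverse (β ∷ B′)))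
          head-eq [] e = trans (cong head′ (subst (λ L → map (ρ !_) (L ++ Q ∷ reverse (β ∷ B′)) ≡ map (σ !_) (reverse (β ∷ B′)) ++ map (σ !_) A) e tail-eq)) (head-++ (map (σ !_) (reverse (β ∷ B′))) nonempty)
          head-eq (a ∷ L) e = trans (cong head′ (subst (λ L → map (ρ !_) (L ++ Q ∷ reverse (β ∷ B′)) ≡ map (σ !_) (reverse (β ∷ B′)) ++ map (σ !_) A) e tail-eq)) (head-++ (map (σ !_) (reverse (β ∷ B′))) nonempty)
        len₁ : length (map (ρ !_) (A ++ Q ∷ [])) ≡ suc (length A)
        len₁ = trans (Lₚ.length-map (ρ !_) (A ++ Q ∷ [])) (trans (length-++ A) (ℕₚ.+-comm _ 1))
        len₂ : length (map (σ !_) (Q ∷ reverse (β ∷ B′))) ≡ suc (length (β ∷ B′))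
        len₂ = cong suc (trans (Lₚ.length-map (σ !_) (reverse (β ∷ B′))) (length-reverse (β ∷ B′)))
        same : length A ≡ length (β ∷ B′) → ρ ! β* ≡ σ ! α
        same h = proj₁ (∷-injective (proj₂ (++-cancel (map (ρ !_) (A ++ Q ∷ [])) (map (σ !_) (Q ∷ reverse (β ∷ B′))) (trans len₁ (trans (cong suc h) (sym len₂))) ct')))
        uσ : Unique (map (σ !_) (Q ∷ reverse (β ∷ B′)) ++ map (σ !_) A)
        uσ = subst Unique (map-++ (σ !_) (Q ∷ reverse (β ∷ B′)) A) (Uₚ.map⁺ (!-inj σ) (unique-swap A (unique-tail (cycle-unique Θ))))
        other : length A ≢ length (β ∷ B′) → ρ ! β* ≢ σ ! α
        other h e = h (ℕₚ.suc-injective (trans (sym len₁) (trans (unique-place (map (ρ !_) (A ++ Q ∷ [])) (map (σ !_) (Q ∷ reverse (β ∷ B′))) uσ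
          (subst (λ x → map (ρ !_) (A ++ Q ∷ []) ++ x ∷ map (ρ !_) rB ≡ map (σ !_) (Q ∷ reverse (β ∷ B′)) ++ map (σ !_) A) e ct')) len₂)))

    abstract
      far-relation : ∀ σ → σ ! P ≡ x₀ → Far σ
      far-relation = far-relation′

    -- The pairs (Q β*)(γ α) and (Q β*)(α γ*) share a factor; their product is a 3-cycle as long as
    -- C has two ends.
    seed-equal : length A ≡ length (β ∷ B′) → γ ≢ γ* → ∀ σ → σ ! P ≡ x₀ → R σ (σ ! γ) (σ ! α)
    seed-equal h γ≢ σ bp with far-relation σ bp
    ... | far z zT z≢γ place away dz = inj₂ (σ ! γ* , tri-of-share {σ} {σ ! γ} {σ ! γ*} {σ ! Q} {σ ! β*} {σ ! α} αT (tok {σ} bp (head∉ uC (here refl))) (tok {σ} bp (head∉ uC γ∈)) (tok {σ} bp P≢Q) (tok {σ} bp (head∉ uB β∈))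
        (λ e → AC (here refl) (here (!-inj σ e))) (λ e → AC (here refl) (subst (_∈ γ ∷ C′) (sym (!-inj σ e)) γ∈)) (γ≢ ∘ !-inj σ)
        (Dx-commʳ {σ} (commute-AB-CB Θ σ bp)) (subst (λ x → Dx σ (σ ! Q) (σ ! β*) x (σ ! γ*)) (place h) dz))
      where
      αT = tok {σ} bp (head∉ uA (here refl))

    -- Here C has one vertex, and the two transpositions beside (Q β*) are (γ α) and (z γ) with `z`
    -- different from the occupant of `α`.
    seed-single : length A ≢ length (β ∷ B′) → γ ≡ γ* → ∀ σ → σ ! P ≡ x₀ → R σ (σ ! γ) (σ ! α)
    seed-single h γ≡ σ bp with far-relation σ bp
    ... | far z zT z≢γ place away dz = R-sym (inj₂ (z , tri-of-share {σ} {σ ! α} {z} {σ ! Q} {σ ! β*} {σ ! γ} (tok {σ} bp (head∉ uC (here refl))) (tok {σ} bp (head∉ uA (here refl))) zT (tok {σ} bp P≢Q) (tok {σ} bp (head∉ uB β∈))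
        (λ e → AC (here refl) (here (sym (!-inj σ e)))) (z≢γ (here refl) ∘ sym) (away h ∘ sym)
        (commute-AB-CB Θ σ bp) (Dx-commʳ {σ} (subst (λ x → Dx σ (σ ! Q) (σ ! β*) z (σ ! x)) (sym γ≡) dz))))

  module _ {P Q α₁ α₂ α₃ A₃ β B′ γ C′} (Θ : Theta P Q (α₁ ∷ α₂ ∷ α₃ ∷ A₃) (β ∷ B′) (γ ∷ C′))
    {b₂ b₃ N} (rev : reverse (ini β B′) ≡ b₂ ∷ b₃ ∷ N) where

    open Theta Θ

    private
      β* = lst β B′
      γ* = lst γ C′
      β∈ = lst∈ β B′
      γ∈ = lst∈ γ C′
      s = second Q A₃

    rB≡ : reverse (β ∷ B′) ≡ β* ∷ b₂ ∷ b₃ ∷ N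
    rB≡ = trans (reverse-last β B′) (cong (β* ∷_) rev)

    uR : Unique (β* ∷ b₂ ∷ b₃ ∷ N)
    uR = subst Unique rB≡ (unique-reverse (unique-tail (unique-tail uB)))

    b₃∈ : b₃ ∈ β ∷ B′
    b₃∈ = ∈-reverse⁻ (subst (b₃ ∈_) (sym rB≡) (there (there (here refl))))

    s-from : (s ≡ Q) ⊎ (s ∈ A₃)
    s-from = go A₃ refl
      where
      go : ∀ L → A₃ ≡ L → (second Q L ≡ Q) ⊎ (second Q L ∈ A₃)
      go [] e = inj₁ refl
      go (a ∷ L) refl = inj₂ (here refl)

    -- Two steps of the loop turn (β* γ*)(α₁ α₂) into (b₃ γ*)(α₃ s). Since both arcs have three
    -- vertices, the latter fixes α₁, α₂ and β*, so conjugation replaces γ* by b₃; the two pairs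
    -- then share (α₁ α₂).
    seed-long : ∀ σ → σ ! P ≡ x₀ → R σ (σ ! γ*) (σ ! β*)
    seed-long σ bp = go (cycle-turn (cycle-path Θ) (cycle-unique Θ) (σ ! α₁ ∷ σ ! α₂ ∷ []) {map (σ !_) (α₃ ∷ A₃ ++ Q ∷ reverse (β ∷ B′))} σ bp refl)
      where
      tA : ∀ {x} → x ∈ α₁ ∷ α₂ ∷ α₃ ∷ A₃ → σ ! x ≢ x₀
      tA x∈ = tok {σ} bp (head∉ uA x∈)
      tβ = tok {σ} bp (head∉ uB β∈)
      tγ = tok {σ} bp (head∉ uC γ∈)
      tb₃ = tok {σ} bp (head∉ uB b₃∈)
      ts : σ ! s ≢ x₀
      ts = [ (λ e → subst (λ x → σ ! x ≢ x₀) (sym e) (tok {σ} bp P≢Q)) , (λ x∈ → tA (there (there (there x∈)))) ]′ s-from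
      u₃ : Unique (α₁ ∷ α₂ ∷ α₃ ∷ A₃)
      u₃ = unique-tail (unique-tail uA)
      s≢A : ∀ {x} → x ∈ α₁ ∷ α₂ ∷ [] → x ≢ s
      s≢A {x} x∈ e = [ (λ q → Q∉ uA (widen x∈) (sym (trans e q))) , (λ y → unique-disjoint (α₁ ∷ α₂ ∷ []) u₃ x∈ (there (subst (_∈ A₃) (sym e) y))) ]′ s-from
        where
        widen : x ∈ α₁ ∷ α₂ ∷ [] → x ∈ α₁ ∷ α₂ ∷ α₃ ∷ A₃
        widen (here e) = here e
        widen (there (here e)) = there (here e)
      s≢B : ∀ {x} → x ∈ β ∷ B′ → x ≢ s
      s≢B x∈ e = [ (λ q → Q∉ uB x∈ (sym (trans e q))) , (λ y → AB (there (there (there y))) (subst (_∈ β ∷ B′) e x∈)) ]′ s-from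
      β≢b₃ : β* ≢ b₃
      β≢b₃ e = unique-head uR (there (here e))
      go : Turned σ P ((α₁ ∷ α₂ ∷ α₃ ∷ A₃) ++ Q ∷ reverse (β ∷ B′)) (map (σ !_) (α₃ ∷ A₃ ++ Q ∷ reverse (β ∷ B′)) ++ σ ! α₁ ∷ σ ! α₂ ∷ []) → R σ (σ ! γ*) (σ ! β*)
      go (turned ρ r bρ ct fx) = inj₂ (σ ! b₃ , tri-of-share {σ} {σ ! γ*} {σ ! b₃} {σ ! α₁} {σ ! α₂} {σ ! β*} tβ tγ tb₃ (tA (here refl)) (tA (there (here refl)))
          (λ e → BC β∈ (subst (_∈ γ ∷ C′) (sym (!-inj σ e)) γ∈)) (β≢b₃ ∘ !-inj σ) (λ e → BC b₃∈ (subst (_∈ γ ∷ C′) (!-inj σ e) γ∈))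
          (Dx-sym {σ} (tokens tβ tγ) (tokens (tA (here refl)) (tA (there (here refl)))) here-dx)
          (Dx-sym {σ} (tokens tβ tb₃) (tokens (tA (here refl)) (tA (there (here refl)))) moved-dx))
        where
        here-dx : Dx σ (σ ! β*) (σ ! γ*) (σ ! α₁) (σ ! α₂)
        here-dx = commute-AB-AC Θ σ bp
        ρα₁ : ρ ! α₁ ≡ σ ! α₃
        ρα₁ = proj₁ (∷-injective ct)
        tail₁ : map (ρ !_) (α₂ ∷ α₃ ∷ A₃ ++ Q ∷ reverse (β ∷ B′)) ≡ map (σ !_) (A₃ ++ Q ∷ reverse (β ∷ B′)) ++ σ ! α₁ ∷ σ ! α₂ ∷ []
        tail₁ = proj₂ (∷-injective ct)
        ρα₂ : ρ ! α₂ ≡ σ ! s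
        ρα₂ = second-of A₃ tail₁
          where
          second-of : ∀ L {l m} → ρ ! α₂ ∷ l ≡ map (σ !_) (L ++ Q ∷ reverse (β ∷ B′)) ++ m → ρ ! α₂ ≡ σ ! second Q L
          second-of [] h = proj₁ (∷-injective h)
          second-of (a ∷ L) h = proj₁ (∷-injective h)
        ρβ : ρ ! β* ≡ σ ! b₃
        ρβ = proj₁ (∷-injective (proj₂ (++-cancel (map (ρ !_) ((α₁ ∷ α₂ ∷ α₃ ∷ A₃) ++ Q ∷ [])) (map (σ !_) ((α₃ ∷ A₃) ++ Q ∷ β* ∷ b₂ ∷ [])) lens
               (trans (sym (map-++ (ρ !_) ((α₁ ∷ α₂ ∷ α₃ ∷ A₃) ++ Q ∷ []) (β* ∷ b₂ ∷ b₃ ∷ N)))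
                 (trans (cong (map (ρ !_)) (trans (++-assoc (α₁ ∷ α₂ ∷ α₃ ∷ A₃) (Q ∷ []) (β* ∷ b₂ ∷ b₃ ∷ N)) (cong (λ z → α₁ ∷ α₂ ∷ α₃ ∷ A₃ ++ Q ∷ z) (sym rB≡))))
                   (trans ct (trans (cong (_++ σ ! α₁ ∷ σ ! α₂ ∷ []) (trans (cong (λ z → map (σ !_) (α₃ ∷ A₃ ++ Q ∷ z)) rB≡)
                     (trans (cong (map (σ !_)) (sym (++-assoc (α₃ ∷ A₃) (Q ∷ β* ∷ b₂ ∷ []) (b₃ ∷ N)))) (map-++ (σ !_) ((α₃ ∷ A₃) ++ Q ∷ β* ∷ b₂ ∷ []) (b₃ ∷ N)))))
                     (++-assoc (map (σ !_) ((α₃ ∷ A₃) ++ Q ∷ β* ∷ b₂ ∷ [])) _ _))))))))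
          where
          lens : length (map (ρ !_) ((α₁ ∷ α₂ ∷ α₃ ∷ A₃) ++ Q ∷ [])) ≡ length (map (σ !_) ((α₃ ∷ A₃) ++ Q ∷ β* ∷ b₂ ∷ []))
          lens = trans (Lₚ.length-map (ρ !_) ((α₁ ∷ α₂ ∷ α₃ ∷ A₃) ++ Q ∷ [])) (trans (length-++ (α₁ ∷ α₂ ∷ α₃ ∷ A₃))
            (trans (trans (cong (3 +_) (ℕₚ.+-comm (length A₃) 1)) (sym (cong suc (ℕₚ.+-comm (length A₃) 3)))) (sym (trans (Lₚ.length-map (σ !_) ((α₃ ∷ A₃) ++ Q ∷ β* ∷ b₂ ∷ [])) (length-++ (α₃ ∷ A₃))))))
        fixC : ρ ! γ* ≡ σ ! γ*
        fixC = fx λ { (here e) → head∉ uC γ∈ (sym e)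
          ; (there x) → [ (λ a → AC a γ∈) , (λ { (here e) → Q∉ uC γ∈ (sym e) ; (there b) → BC (∈-reverse⁻ b) γ∈ }) ]′ (∈-++⁻ (α₁ ∷ α₂ ∷ α₃ ∷ A₃) x) }
        there-dx : Dx σ (σ ! b₃) (σ ! γ*) (σ ! α₃) (σ ! s)
        there-dx = Dx-inv (tokens tb₃ tγ) (tokens (tA (there (there (here refl)))) ts) r
          (subst₂ (λ x y → Dx ρ x y (σ ! α₃) (σ ! s)) ρβ fixC (subst₂ (Dx ρ (ρ ! β*) (ρ ! γ*)) ρα₁ ρα₂ (commute-AB-AC Θ ρ bρ)))
        g = transpose (σ ! α₃) (σ ! s) ∘ₚ transpose (σ ! b₃) (σ ! γ*)
        gA : ∀ {x} → x ∈ α₁ ∷ α₂ ∷ [] → x ∈ α₁ ∷ α₂ ∷ α₃ ∷ A₃ → g ! (σ ! x) ≡ σ ! x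
        gA {x} x∈ x∈' = trans (cong (transpose (σ ! b₃) (σ ! γ*) !_) (tr-o (σ ! α₃) (σ ! s)
            (λ e → unique-disjoint (α₁ ∷ α₂ ∷ []) u₃ x∈ (here (!-inj σ e))) (s≢A x∈ ∘ !-inj σ)))
          (tr-o (σ ! b₃) (σ ! γ*) (λ e → AB x∈' (subst (_∈ β ∷ B′) (sym (!-inj σ e)) b₃∈)) (λ e → AC x∈' (subst (_∈ γ ∷ C′) (sym (!-inj σ e)) γ∈)))
        gβ : g ! (σ ! β*) ≡ σ ! β*
        gβ = trans (cong (transpose (σ ! b₃) (σ ! γ*) !_) (tr-o (σ ! α₃) (σ ! s)
            (λ e → AB (there (there (here refl))) (subst (_∈ β ∷ B′) (!-inj σ e) β∈)) (s≢B β∈ ∘ !-inj σ)))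
          (tr-o (σ ! b₃) (σ ! γ*) (β≢b₃ ∘ !-inj σ) (λ e → BC β∈ (subst (_∈ γ ∷ C′) (sym (!-inj σ e)) γ∈)))
        gγ : g ! (σ ! γ*) ≡ σ ! b₃
        gγ = trans (cong (transpose (σ ! b₃) (σ ! γ*) !_) (tr-o (σ ! α₃) (σ ! s)
            (λ e → AC (there (there (here refl))) (subst (_∈ γ ∷ C′) (!-inj σ e) γ∈))
            (λ e → [ (λ q → Q∉ uC γ∈ (sym (trans (!-inj σ e) q))) , (λ y → AC (there (there (there y))) (subst (_∈ γ ∷ C′) (!-inj σ e) γ∈)) ]′ s-from)))
          (tr-r (σ ! b₃) (σ ! γ*))
        moved-dx : Dx σ (σ ! β*) (σ ! b₃) (σ ! α₁) (σ ! α₂)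
        moved-dx = subst₂ (λ x y → Dx σ x y (σ ! α₁) (σ ! α₂)) gβ gγ (subst₂ (Dx σ (g ! (σ ! β*)) (g ! (σ ! γ*))) (gA (here refl) (here refl)) (gA (there (here refl)) (there (here refl)))
          (Dx-conj {σ} g (λ a → trans (tr-pres (tokens tb₃ tγ) (transpose (σ ! α₃) (σ ! s) ! a)) (tr-pres (tokens (tA (there (there (here refl)))) ts) a)) (tokens tβ tγ) (tokens (tA (here refl)) (tA (there (here refl))))
            (Dx-sym {σ} (tokens tb₃ tγ) (tokens (tA (there (there (here refl)))) ts) there-dx) here-dx))

  theta-related : ∀ {P Q A B C} (Θ : Theta P Q A B C) → Good Θ → ∀ {x y} → x ∈ verts Θ → y ∈ verts Θ → x ≢ P → y ≢ P →
    ∀ σ → σ ! P ≡ x₀ → R σ (σ ! x) (σ ! y)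
  theta-related {A = α ∷ A′} {C = γ ∷ C′} Θ (zero-B _ refl _) = all-related Θ (lst∈ γ C′) (here refl) (λ σ bp → inj₂ (_ , zero-tri Θ σ bp))
  theta-related {A = α ∷ A′} {β ∷ B′} {γ ∷ γ₂ ∷ C″} Θ (equal _ e _) = all-related Θ (here refl) (here refl)
    (seed-equal Θ e (λ h → unique-head (unique-tail (unique-tail (Theta.uC Θ))) (subst (_∈ γ₂ ∷ C″) (sym h) (lst∈ γ₂ C″))))
  theta-related {A = α ∷ A′} {β ∷ B′} {γ ∷ []} Θ (single-C _ _ ne _) = all-related Θ (here refl) (here refl) (seed-single Θ ne refl)
  theta-related {A = α₁ ∷ α₂ ∷ α₃ ∷ A₃} {β ∷ B′} {γ ∷ C′} Θ (long _ l _) = go (reverse (ini β B′)) refl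
    where
    two : 2 ≤ length (reverse (ini β B′))
    two = ℕₚ.≤-pred (subst (3 ≤_) (trans (cong length (sym (ini-lst β B′))) (trans (length-++ (ini β B′)) (trans (ℕₚ.+-comm _ 1) (cong suc (sym (length-reverse (ini β B′))))))) l)
    go : ∀ L → reverse (ini β B′) ≡ L → ∀ {x y} → x ∈ verts Θ → y ∈ verts Θ → x ≢ _ → y ≢ _ → ∀ σ → σ ! _ ≡ x₀ → R σ (σ ! x) (σ ! y)
    go [] e = ⊥-elim (ℕₚ.<⇒≱ (s≤s z≤n) (subst (λ L → 2 ≤ length L) e two))
    go (_ ∷ []) e = ⊥-elim (ℕₚ.<⇒≱ (s≤s (s≤s z≤n)) (subst (λ L → 2 ≤ length L) e two))
    go (b₂ ∷ b₃ ∷ N) e = all-related Θ (lst∈ γ C′) (∈-++⁺ʳ (α₁ ∷ α₂ ∷ α₃ ∷ A₃) (there (∈-reverse (lst∈ β B′)))) (seed-long Θ e)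
  theta-related {A = []} Θ (zero-B () _ _)
  theta-related {A = _ ∷ _} {C = []} Θ (zero-B _ _ ())
  theta-related {A = []} Θ (equal () _ _)
  theta-related {A = _ ∷ _} {[]} Θ (equal _ () _)
  theta-related {A = _ ∷ _} {_ ∷ _} {[]} Θ (equal _ _ ())
  theta-related {A = _ ∷ _} {_ ∷ _} {_ ∷ []} Θ (equal _ _ (s≤s ()))
  theta-related {A = []} Θ (single-C () _ _ _)
  theta-related {A = _ ∷ _} {[]} Θ (single-C _ () _ _)
  theta-related {A = _ ∷ _} {_ ∷ _} {[]} Θ (single-C _ _ _ ())
  theta-related {A = _ ∷ _} {_ ∷ _} {_ ∷ _ ∷ _} Θ (single-C _ _ _ ())
  theta-related {A = []} Θ (long () _ _)
  theta-related {A = _ ∷ []} Θ (long (s≤s ()) _ _)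
  theta-related {A = _ ∷ _ ∷ []} Θ (long (s≤s (s≤s ())) _ _)
  theta-related {A = _ ∷ _ ∷ _ ∷ _} {[]} Θ (long _ () _)
  theta-related {A = _ ∷ _ ∷ _ ∷ _} {_ ∷ _} {[]} Θ (long _ _ ())

-- Which thetas are usable.

bad : ℕ → ℕ → ℕ → Bool
bad 0 0 _ = true
bad 0 (suc _) 0 = true
bad (suc _) 0 0 = true
bad 1 1 1 = true
bad 1 2 2 = true
bad 2 1 2 = true
bad 2 2 1 = true
bad _ _ _ = false

-- Lengths from 3 on behave alike, so that ears of every length reduce to finitely many checks.
bad-large : ∀ a b x y → bad a b (3 + x) ≡ bad a b (3 + y)
bad-large 0 0 x y = refl
bad-large 0 (suc b) x y = refl
bad-large (suc a) 0 x y = refl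
bad-large 1 1 x y = refl
bad-large 1 2 x y = refl
bad-large 1 (suc (suc (suc b))) x y = refl
bad-large 2 1 x y = refl
bad-large 2 2 x y = refl
bad-large 2 (suc (suc (suc b))) x y = refl
bad-large (suc (suc (suc a))) (suc b) x y = refl

module Classify {n : ℕ} (X : Graph n) (simple : IsSimple X) where

  open GraphTheory X simple
  open Thetas X simple

  record GoodTheta : Set where
    constructor goodTheta
    field
      {P Q} : Fin n
      {A B C} : List (Fin n)
      Θ : Theta P Q A B C
      good : Good Θ

  data Exceptional (P Q : Fin n) (A B C : List (Fin n)) : Set where
    degenerate : length A + length B ≡ 0 ⊎ length C ≡ 0 → Exceptional P Q A B C
    k₂₃ : length A ≡ 1 → length B ≡ 1 → Exceptional P Q A B C
    hex : ∀ {g b c f e} → Theta P Q (g ∷ []) (b ∷ c ∷ []) (f ∷ e ∷ []) → Exceptional P Q A B C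

  th-rot : ∀ {P Q A B C} → Theta P Q A B C → Theta P Q B C A
  th-rot t = th-BC (th-AB t)

  -- The test `bad` depends on the lengths only. Evaluating it to `false` excludes the exceptions
  -- without looking at the theta.
  Class : ∀ P Q A B C → Set
  Class P Q A B C = GoodTheta ⊎ (bad (length A) (length B) (length C) ≡ true × Exceptional P Q A B C)

  private
    s≤ : ∀ {m} → 1 ≤ suc m
    s≤ = s≤s z≤n
    s≤² : ∀ {m} → 2 ≤ suc (suc m)
    s≤² = s≤s s≤
    s≤³ : ∀ {m} → 3 ≤ suc (suc (suc m))
    s≤³ = s≤s s≤²

  classify : ∀ {P Q A B C} → Theta P Q A B C → Class P Q A B C
  classify {A = []} {[]} Θ = inj₂ (refl , degenerate (inj₁ refl))
  classify {A = []} {_ ∷ _} {[]} Θ = inj₂ (refl , degenerate (inj₂ refl))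
  classify {A = []} {_ ∷ _} {_ ∷ _} Θ = inj₁ (goodTheta (th-AB Θ) (zero-B s≤ refl s≤))
  classify {A = _ ∷ _} {[]} {[]} Θ = inj₂ (refl , degenerate (inj₂ refl))
  classify {A = _ ∷ _} {[]} {_ ∷ _} Θ = inj₁ (goodTheta Θ (zero-B s≤ refl s≤))
  classify {A = _ ∷ _} {_ ∷ _} {[]} Θ = inj₁ (goodTheta (th-BC Θ) (zero-B s≤ refl s≤))
  classify {A = _ ∷ []} {_ ∷ []} {_ ∷ []} Θ = inj₂ (refl , k₂₃ refl refl)
  classify {A = _ ∷ []} {_ ∷ []} {_ ∷ _ ∷ _} Θ = inj₁ (goodTheta Θ (equal s≤ refl s≤²))
  classify {A = _ ∷ []} {_ ∷ _ ∷ _} {_ ∷ []} Θ = inj₁ (goodTheta (th-BC Θ) (equal s≤ refl s≤²))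
  classify {A = _ ∷ _ ∷ _} {_ ∷ []} {_ ∷ []} Θ = inj₁ (goodTheta (th-rot Θ) (equal s≤ refl s≤²))
  classify {A = _ ∷ []} {_ ∷ _ ∷ []} {_ ∷ _ ∷ []} Θ = inj₂ (refl , hex Θ)
  classify {A = _ ∷ _ ∷ []} {_ ∷ []} {_ ∷ _ ∷ []} Θ = inj₂ (refl , hex (th-AB Θ))
  classify {A = _ ∷ _ ∷ []} {_ ∷ _ ∷ []} {_ ∷ []} Θ = inj₂ (refl , hex (th-AC Θ))
  classify {A = _ ∷ []} {_ ∷ _ ∷ []} {_ ∷ _ ∷ _ ∷ _} Θ = inj₁ (goodTheta (th-rot Θ) (single-C s≤ s≤ (λ ()) refl))
  classify {A = _ ∷ []} {_ ∷ _ ∷ _ ∷ _} {_ ∷ _ ∷ []} Θ = inj₁ (goodTheta (th-rot Θ) (single-C s≤ s≤ (λ ()) refl))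
  classify {A = _ ∷ []} {_ ∷ _ ∷ _ ∷ _} {_ ∷ _ ∷ _ ∷ _} Θ = inj₁ (goodTheta (th-rot Θ) (long s≤³ s≤³ s≤))
  classify {A = _ ∷ _ ∷ []} {_ ∷ []} {_ ∷ _ ∷ _ ∷ _} Θ = inj₁ (goodTheta (th-BC Θ) (single-C s≤ s≤ (λ ()) refl))
  classify {A = _ ∷ _ ∷ _ ∷ _} {_ ∷ []} {_ ∷ _ ∷ []} Θ = inj₁ (goodTheta (th-BC Θ) (single-C s≤ s≤ (λ ()) refl))
  classify {A = _ ∷ _ ∷ _ ∷ _} {_ ∷ []} {_ ∷ _ ∷ _ ∷ _} Θ = inj₁ (goodTheta (th-BC Θ) (long s≤³ s≤³ s≤))
  classify {A = _ ∷ _ ∷ []} {_ ∷ _ ∷ _ ∷ _} {_ ∷ []} Θ = inj₁ (goodTheta Θ (single-C s≤ s≤ (λ ()) refl))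
  classify {A = _ ∷ _ ∷ _ ∷ _} {_ ∷ _ ∷ []} {_ ∷ []} Θ = inj₁ (goodTheta Θ (single-C s≤ s≤ (λ ()) refl))
  classify {A = _ ∷ _ ∷ _ ∷ _} {_ ∷ _ ∷ _ ∷ _} {_ ∷ _} Θ = inj₁ (goodTheta Θ (long s≤³ s≤³ s≤))
  classify {A = _ ∷ _ ∷ []} {_ ∷ _ ∷ []} {_ ∷ _ ∷ _} Θ = inj₁ (goodTheta Θ (equal s≤ refl s≤²))
  classify {A = _ ∷ _ ∷ []} {_ ∷ _ ∷ _ ∷ _} {_ ∷ _ ∷ []} Θ = inj₁ (goodTheta (th-BC Θ) (equal s≤ refl s≤²))
  classify {A = _ ∷ _ ∷ _ ∷ _} {_ ∷ _ ∷ []} {_ ∷ _ ∷ []} Θ = inj₁ (goodTheta (th-rot Θ) (equal s≤ refl s≤²))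
  classify {A = _ ∷ _ ∷ []} {_ ∷ _ ∷ _ ∷ _} {_ ∷ _ ∷ _ ∷ _} Θ = inj₁ (goodTheta (th-rot Θ) (long s≤³ s≤³ s≤))
  classify {A = _ ∷ _ ∷ _ ∷ _} {_ ∷ _ ∷ []} {_ ∷ _ ∷ _ ∷ _} Θ = inj₁ (goodTheta (th-BC Θ) (long s≤³ s≤³ s≤))

-- A theta subgraph of θ₀ together with an ear from i to j that runs along
-- the ear: the third path is pre, the ear, post.
record Detour : Set where
  constructor detour
  field
    P Q : Fin 7
    A B pre post : List (Fin 7)

-- The only pair whose choice depends on the length of the ear is {0, 3}: θ₀ must not reappear.
detours : Bool → Fin 7 → Fin 7 → Detour
detours _ 0F 1F = detour 0F 1F (6F ∷ 3F ∷ 2F ∷ []) [] [] []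
detours _ 0F 2F = detour 0F 2F (1F ∷ []) (5F ∷ 4F ∷ 3F ∷ []) [] []
detours true 0F 3F = detour 0F 3F (1F ∷ 2F ∷ []) (5F ∷ 4F ∷ []) [] []
detours false 0F 3F = detour 0F 3F (1F ∷ 2F ∷ []) (6F ∷ []) [] []
detours _ 0F 4F = detour 0F 4F (1F ∷ 2F ∷ 3F ∷ []) (5F ∷ []) [] []
detours _ 0F 5F = detour 0F 5F (6F ∷ 3F ∷ 4F ∷ []) [] [] []
detours _ 0F 6F = detour 0F 6F (1F ∷ 2F ∷ 3F ∷ []) [] [] []
detours _ 1F 2F = detour 0F 3F (5F ∷ 4F ∷ []) (6F ∷ []) (1F ∷ []) (2F ∷ [])
detours _ 1F 3F = detour 1F 3F (0F ∷ 5F ∷ 4F ∷ []) (2F ∷ []) [] []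
detours _ 1F 4F = detour 1F 0F (2F ∷ 3F ∷ 6F ∷ []) [] [] (4F ∷ 5F ∷ [])
detours _ 1F 5F = detour 0F 5F (6F ∷ 3F ∷ 4F ∷ []) [] (1F ∷ []) []
detours _ 1F 6F = detour 0F 6F (5F ∷ 4F ∷ 3F ∷ []) [] (1F ∷ []) []
detours _ 2F 3F = detour 2F 3F (1F ∷ 0F ∷ 6F ∷ []) [] [] []
detours _ 2F 4F = detour 2F 3F (1F ∷ 0F ∷ 6F ∷ []) [] [] (4F ∷ [])
detours _ 2F 5F = detour 0F 5F (6F ∷ 3F ∷ 4F ∷ []) [] (1F ∷ 2F ∷ []) []
detours _ 2F 6F = detour 3F 6F (4F ∷ 5F ∷ 0F ∷ []) [] (2F ∷ []) []
detours _ 3F 4F = detour 3F 4F (6F ∷ 0F ∷ 5F ∷ []) [] [] []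
detours _ 3F 5F = detour 3F 5F (2F ∷ 1F ∷ 0F ∷ []) (4F ∷ []) [] []
detours _ 3F 6F = detour 3F 6F (2F ∷ 1F ∷ 0F ∷ []) [] [] []
detours _ 4F 5F = detour 3F 0F (2F ∷ 1F ∷ []) (6F ∷ []) (4F ∷ []) (5F ∷ [])
detours _ 4F 6F = detour 3F 6F (2F ∷ 1F ∷ 0F ∷ []) [] (4F ∷ []) []
detours _ 5F 6F = detour 0F 6F (1F ∷ 2F ∷ 3F ∷ []) [] (5F ∷ []) []
detours _ _ _ = detour 0F 0F [] [] [] []

simple₇ : IsSimple θ₀
simple₇ = from-yes (Fₚ.all? λ u → θ₀ u u ≟ᵇ false) , from-yes (Fₚ.all? λ u → Fₚ.all? λ v → θ₀ u v ≟ᵇ θ₀ v u)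

module G₇ = GraphTheory θ₀ simple₇

-- The piece before or after the ear may be empty, in which case the ear starts at `P` or ends at
-- `Q` itself; hence the separate form of `Walk₇` and `Entry₇`.
Walk₇ : Fin 7 → List (Fin 7) → Fin 7 → Set
Walk₇ u [] v = u ≡ v
Walk₇ u (w ∷ l) v = Adj θ₀ u w × Walk₇ w l v

Entry₇ : Fin 7 → List (Fin 7) → Fin 7 → Set
Entry₇ j [] q = j ≡ q
Entry₇ j (w ∷ l) q = j ≡ w × G₇.Path w l q

walk₇? : ∀ u l v → Dec (Walk₇ u l v)
walk₇? u [] v = u ≟ᶠ v
walk₇? u (w ∷ l) v = G₇.adj? u w ×-dec walk₇? w l v

path₇? : ∀ u l v → Dec (G₇.Path u l v)
path₇? u [] v = G₇.adj? u v
path₇? u (w ∷ l) v = G₇.adj? u w ×-dec path₇? w l v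

entry₇? : ∀ j l q → Dec (Entry₇ j l q)
entry₇? j [] q = j ≟ᶠ q
entry₇? j (w ∷ l) q = (j ≟ᶠ w) ×-dec path₇? w l q

Valid : Fin 7 → Fin 7 → Detour → Set
Valid i j (detour P Q A B pre post) = G₇.Path P A Q × G₇.Path P B Q × Walk₇ P pre i × Entry₇ j post Q × Unique (P ∷ Q ∷ A ++ B ++ pre ++ post)

valid? : ∀ i j d → Dec (Valid i j d)
valid? i j (detour P Q A B pre post) = path₇? P A Q ×-dec (path₇? P B Q ×-dec (walk₇? P pre i ×-dec (entry₇? j post Q ×-dec unique? _≟ᶠ_ (P ∷ Q ∷ A ++ B ++ pre ++ post))))

detourBad : ℕ → Detour → Bool
detourBad r (detour P Q A B pre post) = bad (length A) (length B) (length pre + (r + length post))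

isTwo : ℕ → Bool
isTwo r = r ≡ᵇ 2

abstract
  detours-valid : ∀ b i j → toℕ i < toℕ j → Valid i j (detours b i j)
  detours-valid true = from-yes (Fₚ.all? λ i → Fₚ.all? λ j → (toℕ i ℕ.<? toℕ j) →-dec valid? i j (detours true i j))
  detours-valid false = from-yes (Fₚ.all? λ i → Fₚ.all? λ j → (toℕ i ℕ.<? toℕ j) →-dec valid? i j (detours false i j))

  detours-good₀ : ∀ i j → toℕ i < toℕ j → θ₀ i j ≡ false → detourBad 0 (detours false i j) ≡ false
  detours-good₀ = from-yes (Fₚ.all? λ i → Fₚ.all? λ j → (toℕ i ℕ.<? toℕ j) →-dec ((θ₀ i j ≟ᵇ false) →-dec (detourBad 0 (detours false i j) ≟ᵇ false)))

  detours-good₁ : ∀ i j → toℕ i < toℕ j → detourBad 1 (detours false i j) ≡ false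
  detours-good₁ = from-yes (Fₚ.all? λ i → Fₚ.all? λ j → (toℕ i ℕ.<? toℕ j) →-dec (detourBad 1 (detours false i j) ≟ᵇ false))

  detours-good₂ : ∀ i j → toℕ i < toℕ j → detourBad 2 (detours true i j) ≡ false
  detours-good₂ = from-yes (Fₚ.all? λ i → Fₚ.all? λ j → (toℕ i ℕ.<? toℕ j) →-dec (detourBad 2 (detours true i j) ≟ᵇ false))

  detours-good₃ : ∀ i j → toℕ i < toℕ j → detourBad 3 (detours false i j) ≡ false
  detours-good₃ = from-yes (Fₚ.all? λ i → Fₚ.all? λ j → (toℕ i ℕ.<? toℕ j) →-dec (detourBad 3 (detours false i j) ≟ᵇ false))

bad-many : ∀ a b p q x → bad a b (p + (3 + x + q)) ≡ bad a b (p + (3 + q))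
bad-many a b p q x = trans (cong (bad a b) (move p (x + q))) (trans (bad-large a b (p + (x + q)) (p + q)) (cong (bad a b) (sym (move p q))))
  where
  move : ∀ p y → p + (3 + y) ≡ 3 + (p + y)
  move p y = trans (ℕₚ.+-suc p (2 + y)) (cong suc (trans (ℕₚ.+-suc p (1 + y)) (cong suc (ℕₚ.+-suc p y))))

-- Four tables, for ears with 0, 1, 2 and 3 inner vertices, are checked by evaluation. Without inner
-- vertices the ear is a chord, which must not be an edge of θ₀.
detours-good : ∀ r i j → toℕ i < toℕ j → (r ≡ 0 → θ₀ i j ≡ false) → detourBad r (detours (isTwo r) i j) ≡ false
detours-good 0 i j l h = detours-good₀ i j l (h refl)
detours-good 1 i j l h = detours-good₁ i j l
detours-good 2 i j l h = detours-good₂ i j l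
detours-good (suc (suc (suc x))) i j l h = trans (bad-many _ _ (length (Detour.pre d)) (length (Detour.post d)) x) (detours-good₃ i j l)
  where d = detours false i j

-- Thetas with path lengths 1, 2, 2 in a larger graph.

module Hexagons {n : ℕ} (X : Graph n) (simple : IsSimple X) where

  open GraphTheory X simple
  open Thetas X simple
  open Classify X simple

  edges₇ : List (Fin 7 × Fin 7)
  edges₇ = (0F , 1F) ∷ (1F , 2F) ∷ (2F , 3F) ∷ (3F , 4F) ∷ (4F , 5F) ∷ (5F , 0F) ∷ (6F , 0F) ∷ (6F , 3F) ∷ []

  isEdge : Fin 7 → Fin 7 → Set
  isEdge i j = Any (λ e → i ≡ proj₁ e × j ≡ proj₂ e) edges₇

  isEdge? : ∀ i j → Dec (isEdge i j)
  isEdge? i j = Any.any? (λ e → (i ≟ᶠ proj₁ e) ×-dec (j ≟ᶠ proj₂ e)) edges₇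

  abstract
    edges-of-θ₀ : ∀ i j → Adj θ₀ i j → isEdge i j ⊎ isEdge j i
    edges-of-θ₀ = from-yes (Fₚ.all? λ i → Fₚ.all? λ j → (θ₀ i j ≟ᵇ true) →-dec (isEdge? i j ⊎-dec isEdge? j i))

  module _ {P Q g b c f e} (Θ : Theta P Q (g ∷ []) (b ∷ c ∷ []) (f ∷ e ∷ [])) where

    open Theta Θ

    ps : List (Fin n)
    ps = P ∷ b ∷ c ∷ Q ∷ e ∷ f ∷ g ∷ []

    φ : Fin 7 → Fin n
    φ = lookup ps

    φ-edge : ∀ {i j} → isEdge i j → Adj X (φ i) (φ j)
    φ-edge (here (refl , refl)) = proj₁ pB
    φ-edge (there (here (refl , refl))) = proj₁ (proj₂ pB)
    φ-edge (there (there (here (refl , refl)))) = proj₂ (proj₂ pB)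
    φ-edge (there (there (there (here (refl , refl))))) = adj-sym (proj₂ (proj₂ pC))
    φ-edge (there (there (there (there (here (refl , refl)))))) = adj-sym (proj₁ (proj₂ pC))
    φ-edge (there (there (there (there (there (here (refl , refl))))))) = adj-sym (proj₁ pC)
    φ-edge (there (there (there (there (there (there (here (refl , refl)))))))) = adj-sym (proj₁ pA)
    φ-edge (there (there (there (there (there (there (there (here (refl , refl))))))))) = proj₂ pA

    φ-adj : ∀ {i j} → Adj θ₀ i j → Adj X (φ i) (φ j)
    φ-adj {i} {j} a = [ φ-edge {i} {j} , (λ r → adj-sym (φ-edge {j} {i} r)) ]′ (edges-of-θ₀ i j a)

    ps-unique : Unique ps
    ps-unique = unique-cons (λ { (here h) → unique-head uB (there (here h)) ; (there (here h)) → unique-head uB (there (there (here h))) ; (there (there (here h))) → P≢Q h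
        ; (there (there (there (here h)))) → unique-head uC (there (there (here h))) ; (there (there (there (there (here h))))) → unique-head uC (there (here h))
        ; (there (there (there (there (there (here h)))))) → unique-head uA (there (here h)) })
      (unique-cons (λ { (here h) → unique-head (unique-tail (unique-tail uB)) (here h) ; (there (here h)) → unique-head (unique-tail uB) (here (sym h))
        ; (there (there (here h))) → BC (here refl) (there (here h)) ; (there (there (there (here h)))) → BC (here refl) (here h) ; (there (there (there (there (here h))))) → AB (here refl) (here (sym h)) })
      (unique-cons (λ { (here h) → unique-head (unique-tail uB) (there (here (sym h))) ; (there (here h)) → BC (there (here refl)) (there (here h))
        ; (there (there (here h))) → BC (there (here refl)) (here h) ; (there (there (there (here h)))) → AB (here refl) (there (here (sym h))) })
      (unique-cons (λ { (here h) → unique-head (unique-tail uC) (there (here h)) ; (there (here h)) → unique-head (unique-tail uC) (here h) ; (there (there (here h))) → unique-head (unique-tail uA) (here h) })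
      (unique-cons (λ { (here h) → unique-head (unique-tail (unique-tail uC)) (here (sym h)) ; (there (here h)) → AC (here refl) (there (here (sym h))) })
      (unique-cons (λ { (here h) → AC (here refl) (here (sym h)) }) (unique-cons (λ ()) []))))))

    φ-inj : ∀ {i j} → φ i ≡ φ j → i ≡ j
    φ-inj = unique-lookup ps-unique

    φ-path : ∀ {u} l {v} → G₇.Path u l v → Path (φ u) (map φ l) (φ v)
    φ-path {u} [] {v} a = φ-adj {u} {v} a
    φ-path {u} (w ∷ l) (a , p) = φ-adj {u} {w} a , φ-path l p

    φ-walk : ∀ {u} pre {i M v} → Walk₇ u pre i → Path (φ i) M v → Path (φ u) (map φ pre ++ M) v
    φ-walk [] refl p = p
    φ-walk {u} (w ∷ pre) (a , r) p = φ-adj {u} {w} a , φ-walk pre r p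

    φ-entry : ∀ {u E j} post {q} → Path u E (φ j) → Entry₇ j post q → Path u (E ++ map φ post) (φ q)
    φ-entry {u} {E} [] p refl = subst (λ l → Path u l _) (sym (++-identityʳ E)) p
    φ-entry {E = E} (w ∷ post) p (refl , r) = path-++ E p (φ-path post r)

    ∈-φ : ∀ {i l} → φ i ∈ map φ l → i ∈ l
    ∈-φ {i} {l} h = let k , k∈ , eq = ∈-map⁻ φ h in subst (_∈ l) (sym (φ-inj eq)) k∈

    φ∉ : ∀ {l i} → i ∉ l → φ i ∉ map φ l
    φ∉ h = h ∘ ∈-φ

    φ∈ps : ∀ {l x} → x ∈ map φ l → x ∈ ps
    φ∈ps h = let k , _ , eq = ∈-map⁻ φ h in subst (_∈ ps) (sym eq) (∈-lookup k)

    φ-disjoint : ∀ {l m} → (∀ {i} → i ∈ l → i ∉ m) → ∀ {x} → x ∈ map φ l → x ∉ map φ m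
    φ-disjoint {l} {m} d h h' = let k , k∈ , eq = ∈-map⁻ φ h in d k∈ (∈-φ (subst (_∈ map φ m) eq h'))

    φ-unique : ∀ {l} → Unique l → Unique (map φ l)
    φ-unique = Uₚ.map⁺ φ-inj

    detour-theta : ∀ i j E d → Valid i j d → Path (φ i) E (φ j) → Unique E → (∀ {x} → x ∈ E → x ∉ ps) →
      Theta (φ (Detour.P d)) (φ (Detour.Q d)) (map φ (Detour.A d)) (map φ (Detour.B d)) (map φ (Detour.pre d) ++ E ++ map φ (Detour.post d))
    detour-theta i j E (detour p q A B pre post) (pA , pB , w , en , u) pE uE E∉ = theta (φ-path A pA) (φ-path B pB)
        (φ-walk pre w (φ-entry post pE en)) (λ h → unique-head u (here (φ-inj h)))
        (φ-unique {p ∷ q ∷ A} (unique-++ˡ {xs = p ∷ q ∷ A} u)) uB′ uC′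
        (φ-disjoint (λ a b → unique-disjoint A uR a (∈-++⁺ˡ b)))
        (λ {x} a → not-C (λ y → φ-disjoint {A} {pre} (λ a b → unique-disjoint A uR a (∈-++⁺ʳ B (∈-++⁺ˡ b))) a y) (λ y → E∉ y (φ∈ps {A} a)) (λ y → φ-disjoint {A} {post} (λ a b → unique-disjoint A uR a (∈-++⁺ʳ B (∈-++⁺ʳ pre b))) a y))
        (λ {x} a → not-C (λ y → φ-disjoint {B} {pre} (λ a b → unique-disjoint B uR′ a (∈-++⁺ˡ b)) a y) (λ y → E∉ y (φ∈ps {B} a)) (λ y → φ-disjoint {B} {post} (λ a b → unique-disjoint B uR′ a (∈-++⁺ʳ pre b)) a y))
      where
      uR : Unique (A ++ B ++ pre ++ post)
      uR = unique-tail (unique-tail u)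
      uR′ : Unique (B ++ pre ++ post)
      uR′ = unique-++ʳ A uR
      uR″ : Unique (pre ++ post)
      uR″ = unique-++ʳ B uR′
      not-C : ∀ {x} → x ∉ map φ pre → x ∉ E → x ∉ map φ post → x ∉ map φ pre ++ E ++ map φ post
      not-C a b c y = [ a , (λ z → [ b , c ]′ (∈-++⁻ E z)) ]′ (∈-++⁻ (map φ pre) y)
      ends : ∀ {k} → k ∈ p ∷ q ∷ [] → φ k ∉ map φ pre ++ E ++ map φ post
      ends {k} k∈ = not-C (φ∉ {pre} (λ y → dis k∈ (∈-++⁺ˡ y))) (λ y → E∉ y (∈-lookup k)) (φ∉ {post} (λ y → dis k∈ (∈-++⁺ʳ pre y)))
        where
        dis : k ∈ p ∷ q ∷ [] → k ∉ pre ++ post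
        dis k∈ y = unique-disjoint (p ∷ q ∷ []) u k∈ (∈-++⁺ʳ A (∈-++⁺ʳ B y))
      uB′ : Unique (map φ (p ∷ q ∷ B))
      uB′ = φ-unique (unique-cons (λ { (here h) → unique-head u (here h) ; (there h) → unique-head u (there (∈-++⁺ʳ A (∈-++⁺ˡ h))) })
              (unique-cons (λ h → unique-head (unique-tail u) (∈-++⁺ʳ A (∈-++⁺ˡ h))) (unique-++ˡ uR′)))
      uC′ : Unique (φ p ∷ φ q ∷ map φ pre ++ E ++ map φ post)
      uC′ = unique-cons (λ { (here h) → unique-head u (here (φ-inj h)) ; (there h) → ends (here refl) h })
        (unique-cons (ends (there (here refl))) (unique-++ (φ-unique (unique-++ˡ uR″)) (unique-++ uE (φ-unique (unique-++ʳ pre uR″)) (λ y z → E∉ y (φ∈ps {post} z)))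
          (λ {x} y z → [ (λ w → E∉ w (φ∈ps {pre} y)) , (λ w → φ-disjoint {pre} {post} (unique-disjoint pre uR″) y w) ]′ (∈-++⁻ E z))))

    detour-good : ∀ i j E → toℕ i < toℕ j → (length E ≡ 0 → θ₀ i j ≡ false) → Path (φ i) E (φ j) → Unique E → (∀ {x} → x ∈ E → x ∉ ps) → GoodTheta
    detour-good i j E l h pE uE E∉ = go (classify (detour-theta i j E d (detours-valid (isTwo (length E)) i j l) pE uE E∉))
      where
      d = detours (isTwo (length E)) i j
      open Detour d using (A; B; pre; post)
      lens : bad (length (map φ A)) (length (map φ B)) (length (map φ pre ++ E ++ map φ post)) ≡ detourBad (length E) d
      lens = trans (cong₂ (λ x y → bad x y (length (map φ pre ++ E ++ map φ post))) (Lₚ.length-map φ A) (Lₚ.length-map φ B))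
        (cong (bad (length A) (length B)) (trans (length-++ (map φ pre)) (cong₂ _+_ (Lₚ.length-map φ pre) (trans (length-++ E) (cong (length E +_) (Lₚ.length-map φ post))))))
      go : Class _ _ (map φ A) (map φ B) (map φ pre ++ E ++ map φ post) → GoodTheta
      go (inj₁ g) = g
      go (inj₂ (bd , _)) = ⊥-elim (true≢false bd (trans lens (detours-good (length E) i j l h)))

    detour-either : ∀ i j E → i ≢ j → (length E ≡ 0 → θ₀ i j ≡ false) → Path (φ i) E (φ j) → Unique E → (∀ {x} → x ∈ E → x ∉ ps) → GoodTheta
    detour-either i j E ne h pE uE E∉ with ℕₚ.<-cmp (toℕ i) (toℕ j)
    ... | tri< l _ _ = detour-good i j E l h pE uE E∉
    ... | tri≈ _ e _ = ⊥-elim (ne (toℕ-injective e))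
    ... | tri> _ _ l = detour-good j i (reverse E) l (λ e → trans (proj₂ simple₇ j i) (h (trans (sym (length-reverse E)) e))) (path-rev E pE) (unique-reverse uE) (E∉ ∘ ∈-reverse⁻)

    open Shapes X simple using (span-iso)

    -- The theta is a copy of θ₀ in X. Another vertex yields an ear, an additional edge yields a
    -- chord, and either is turned into a good theta by the table; with neither, X is θ₀.
    hexagon : Connected X → ¬ HasCutVertex X → ¬ Iso X θ₀ → GoodTheta
    hexagon conn nocut niso with any? (λ x → ¬? (x ∈? ps))
    ... | yes (x , x∉) with exit (here refl) x∉ (conn P x)
    ... | h , z , h∈ , z∉ , a with Entries.other-in X simple {h = h} ps-unique (s≤s (s≤s z≤n))
    ... | g' , g'∈ , g'≢ with open-ear conn nocut h∈ g'∈ g'≢ z∉ a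
    ... | h' , h'∈ , h'≢ , mkEar rest path uq out = detour-either (Any.index h∈) (Any.index h'∈) (z ∷ rest)
          (λ q → h'≢ (trans (lookup-index h'∈) (trans (cong φ (sym q)) (sym (lookup-index h∈))))) (λ ())
          (subst₂ (λ u v → Path u (z ∷ rest) v) (lookup-index h∈) (lookup-index h'∈) path) uq out
    hexagon conn nocut niso | no none with any? (λ i → any? (λ j → adj? (φ i) (φ j) ×-dec (θ₀ i j ≟ᵇ false)))
    ... | yes (i , j , a , nθ) = detour-either i j [] (λ { refl → adj-irr a }) (λ _ → nθ) a [] (λ ())
    ... | no nochord = ⊥-elim (niso (span-iso ps-unique (λ x → decidable-stable (x ∈? ps) (λ x∉ → none (x , x∉))) θ₀
          (λ i j → bool-ext (λ a → not-false (λ nθ → nochord (i , j , a , nθ))) (φ-adj {i} {j}))))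

-- A good theta in a graph with an odd cycle and no cut-vertex.

module WilsonTheorem {n : ℕ} (X : Graph n) (simple : IsSimple X) where

  open GraphTheory X simple
  open Thetas X simple
  open Classify X simple
  open Shapes X simple
  open Hexagons X simple

  closed-long : ∀ {c} l → Path c l c → 2 ≤ length (c ∷ l)
  closed-long [] e = ⊥-elim (adj-irr e)
  closed-long (_ ∷ _) _ = s≤s (s≤s z≤n)

  -- A chord of a spanning odd cycle is a path without interior and gives a good theta at once.
  -- Otherwise an ear is attached to the odd cycle, whose parity excludes K₂,₃ and the degenerate
  -- pattern.
  good-theta : Connected X → ¬ HasCutVertex X → ¬ IsCycle X → ¬ Iso X θ₀ → OddCycle → GoodTheta
  good-theta conn nocut ncyc niso (mkOdd c l p u o) with any? (λ x → ¬? (x ∈? (c ∷ l)))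
  ... | no none with cycle-or-chord p u (λ x → decidable-stable (x ∈? (c ∷ l)) (λ x∉ → none (x , x∉)))
  ... | inj₁ cyc = ⊥-elim (ncyc cyc)
  ... | inj₂ (chord x y l₁ l₂ q₁ q₂ a uq n₁ n₂ _ _) = goodTheta {x} {y} {l₁} {[]} {reverse l₂}
        (theta q₁ a (path-rev l₂ q₂) (adj-≢ a)
          (unique-cons (λ { (here e) → adj-≢ a e ; (there h) → unique-head uq (∈-++⁺ˡ h) })
            (unique-cons (λ h → unique-disjoint l₁ (unique-tail uq) h (here refl)) (unique-++ˡ (unique-tail uq))))
          (unique-cons (λ { (here e) → adj-≢ a e }) (unique-cons (λ ()) []))
          (unique-cons (λ { (here e) → adj-≢ a e ; (there h) → unique-head uq (∈-++⁺ʳ l₁ (there (∈-reverse⁻ h))) })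
            (unique-cons (λ h → unique-head (unique-++ʳ l₁ (unique-tail uq)) (∈-reverse⁻ h)) (unique-reverse (unique-tail (unique-++ʳ l₁ (unique-tail uq))))))
          (λ _ ()) (λ h h' → unique-disjoint l₁ (unique-tail uq) h (there (∈-reverse⁻ h'))) (λ ()))
        (zero-B n₁ refl (subst (1 ≤_) (sym (length-reverse l₂)) n₂))
  good-theta conn nocut ncyc niso (mkOdd c l p u o) | yes (x , x∉) with exit (here refl) x∉ (conn c x)
  ... | h , z , h∈ , z∉ , a = at-start (∈-∃++ h∈)
    where
    from-start : ∀ {m} → Path h m h → Unique (h ∷ m) → odd (length m) ≡ false → z ∉ h ∷ m → 2 ≤ length (h ∷ m) → GoodTheta
    from-start {m} p u o z∉ two with Entries.other-in X simple {h = h} u two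
    ... | g , g∈ , g≢ with open-ear conn nocut (here refl) g∈ g≢ z∉ a
    ... | h' , here e , h'≢ , ear = ⊥-elim (h'≢ e)
    ... | h' , there h'∈ , h'≢ , mkEar rest path uq out with ∈-∃++ h'∈
    ... | l₁ , l₂ , refl = conclude (classify Θ)
      where
      sp = path-split l₁ p
      Θ : Theta h h' l₁ (reverse l₂) (z ∷ rest)
      Θ = theta (proj₁ sp) (path-rev l₂ (proj₂ sp)) path (h'≢ ∘ sym)
        (unique-cons (λ { (here e) → h'≢ (sym e) ; (there y) → unique-head u (∈-++⁺ˡ y) })
          (unique-cons (λ y → unique-disjoint l₁ (unique-tail u) y (here refl)) (unique-++ˡ (unique-tail u))))
        (unique-cons (λ { (here e) → h'≢ (sym e) ; (there y) → unique-head u (∈-++⁺ʳ l₁ (there (∈-reverse⁻ y))) })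
          (unique-cons (λ y → unique-head (unique-++ʳ l₁ (unique-tail u)) (∈-reverse⁻ y)) (unique-reverse (unique-tail (unique-++ʳ l₁ (unique-tail u))))))
        (unique-cons (λ { (here e) → h'≢ (sym e) ; (there y) → out y (here refl) }) (unique-cons (λ y → out y (there (∈-++⁺ʳ l₁ (here refl)))) uq))
        (λ y y' → unique-disjoint l₁ (unique-tail u) y (there (∈-reverse⁻ y')))
        (λ y y' → out y' (there (∈-++⁺ˡ y))) (λ y y' → out y' (there (∈-++⁺ʳ l₁ (there (∈-reverse⁻ y)))))
      -- The two arcs of the odd cycle have interiors of different parity, so they are neither both
      -- empty nor both single vertices.
      odd-sum : odd (length l₁ + length (reverse l₂)) ≡ true
      odd-sum = not-false (λ e → true≢false (cong not e) (trans (cong odd (sym (trans (length-++ l₁) (trans (ℕₚ.+-suc (length l₁) (length l₂)) (cong (λ k → suc (length l₁ + k)) (sym (length-reverse l₂))))))) o))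
      conclude : Class h h' l₁ (reverse l₂) (z ∷ rest) → GoodTheta
      conclude (inj₁ g) = g
      conclude (inj₂ (_ , degenerate (inj₁ e))) = ⊥-elim (true≢false odd-sum (cong odd e))
      conclude (inj₂ (_ , degenerate (inj₂ ())))
      conclude (inj₂ (_ , k₂₃ e e')) = ⊥-elim (true≢false odd-sum (cong odd (cong₂ _+_ e e')))
      conclude (inj₂ (_ , hex Θ')) = hexagon Θ' conn nocut niso
    at-start : (∃₂ λ l₁ l₂ → c ∷ l ≡ l₁ ++ h ∷ l₂) → GoodTheta
    at-start ([] , l₂ , refl) = from-start p u o z∉ (closed-long l₂ p)
    at-start (_ ∷ l₁ , l₂ , refl) = from-start (path-rotate l₁ p) (unique-rotate l₁ u)
      (trans (cong odd (trans (length-++ l₂) (trans (ℕₚ.+-comm (length l₂) _) (trans (sym (ℕₚ.+-suc (length l₁) (length l₂))) (sym (length-++ l₁)))))) o)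
      (λ y → z∉ (∈-swap (h ∷ l₂) y)) (s≤s (subst (1 ≤_) (sym (trans (length-++ l₂) (ℕₚ.+-suc _ _))) (s≤s z≤n)))

-- Sufficiency for a single blank.

module WilsonConnected {n : ℕ} (X : Graph n) (simple : IsSimple X) (part : Fin n → ℕ)
  (x₀ : Fin n) (lone : ∀ {u} → u ≢ x₀ → part u ≢ part x₀) (tokens : ∀ {u v} → u ≢ x₀ → v ≢ x₀ → part u ≡ part v) where

  open GraphTheory X simple
  open FSCore X simple part
  open Wilson X simple part x₀ lone tokens
  open Thetas X simple
  open Classify X simple

  isT : Fin n → Bool
  isT u = not (Dec.does (u ≟ᶠ x₀))

  isT-of : ∀ {u} → u ≢ x₀ → isT u ≡ true
  isT-of {u} h with u ≟ᶠ x₀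
  ... | yes e = ⊥-elim (h e)
  ... | no _ = refl

  of-isT : ∀ {u} → isT u ≡ true → u ≢ x₀
  of-isT {u} e h with u ≟ᶠ x₀
  of-isT {u} () h | yes _
  ... | no ne = ne h

  of-notT : ∀ {u} → isT u ≡ false → u ≡ x₀
  of-notT {u} e with u ≟ᶠ x₀
  ... | yes h = h
  of-notT {u} () | no _

  x₀-blank : isT x₀ ≡ false
  x₀-blank = not-true (λ e → of-isT e refl)

  apart : ∀ u v → isT u ≢ isT v → part u ≢ part v
  apart u v h with u ≟ᶠ x₀ | v ≟ᶠ x₀
  ... | yes _ | yes _ = ⊥-elim (h refl)
  ... | yes refl | no b = lone b ∘ sym
  ... | no a | yes refl = lone a
  ... | no _ | no _ = ⊥-elim (h refl)

  open TwoColours X simple part isT apart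
  open Blanks (x₀ ∷ []) (unique-cons (λ ()) []) (∈-single {P = λ u → isT u ≡ false} x₀-blank) (λ u e → here (of-notT e))
  open Bases X simple part isT apart (x₀ ∷ []) (unique-cons (λ ()) []) (∈-single {P = λ u → isT u ≡ false} x₀-blank) (λ u e → here (of-notT e))
  open Grow R (inj₁ refl) (λ _ _ → R-sym) (λ _ _ _ → R-trans) (λ _ _ → R-inv)
  open ThetaGood X simple part x₀ lone tokens using (theta-related)

  blank-walk : ∀ {H y p} → Star (AdjIn H) y p → ∀ σ → σ ! y ≡ x₀ → ∃ λ τ → Within H σ τ × τ ! p ≡ x₀
  blank-walk ε σ e = σ , within-refl , e
  blank-walk {H} {y} (_◅_ {j = j} (a , y∈ , j∈) s) σ e with blank-walk s (swap y j σ) (trans (swap-r y j σ) e)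
  ... | τ , w , e' = τ , within-trans (within (swap-step a (λ h → lone (token-part {σ} e (adj-≢ a ∘ sym)) (trans (sym h) (cong part e))))
        (λ x∉ → swap-o y j σ (λ { refl → x∉ y∈ }) (λ { refl → x∉ j∈ }))) w , e'

  theta-connected : ∀ {P Q A B C} (Θ : Theta P Q A B C) → ConnIn (verts Θ)
  theta-connected {P} {Q} {A} {B} {C} Θ u∈ v∈ = Star.reverse (λ (a , x , y) → adj-sym a , y , x) (from-P u∈) ◅◅ from-P v∈
    where
    open Theta Θ
    along : ∀ {L} → Path P L Q → (∀ {x} → x ∈ L → x ∈ verts Θ) → ∀ {x} → x ∈ P ∷ L ++ Q ∷ [] → Star (AdjIn (verts Θ)) P x
    along {L} p sub x∈ = connIn-mono inside (connIn-chain (P ∷ L ++ Q ∷ []) (path→chain L p) (here refl) x∈)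
      where
      inside : ∀ {x} → x ∈ P ∷ L ++ Q ∷ [] → x ∈ verts Θ
      inside (here e) = here e
      inside (there y) = [ sub , (λ { (here e) → there (here e) }) ]′ (∈-++⁻ L y)
    from-P : ∀ {x} → x ∈ verts Θ → Star (AdjIn (verts Θ)) P x
    from-P x∈ with where-of Θ x∈
    ... | isP e = subst (Star (AdjIn (verts Θ)) P) (sym e) ε
    ... | isQ e = along pA (of-where Θ ∘ inA) (there (∈-++⁺ʳ A (here e)))
    ... | inA a = along pA (of-where Θ ∘ inA) (there (∈-++⁺ˡ a))
    ... | inB b = along pB (of-where Θ ∘ inB) (there (∈-++⁺ˡ b))
    ... | inC c = along pC (of-where Θ ∘ inC) (there (∈-++⁺ˡ c))

  good-length : ∀ {P Q A B C} {Θ : Theta P Q A B C} → Thetas.Good X simple Θ → 1 ≤ length A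
  good-length (zero-B h _ _) = h
  good-length (equal h _ _) = h
  good-length (single-C h _ _ _) = h
  good-length (long h _ _) = ≤-trans (s≤s z≤n) h

  theta-good : ∀ {P Q A B C} (Θ : Theta P Q A B C) → Thetas.Good X simple Θ → Grow.Good R (inj₁ refl) (λ _ _ → R-sym) (λ _ _ _ → R-trans) (λ _ _ → R-inv) (verts Θ)
  theta-good {P} Θ g σ a u v uT vT u∈ v∈ with blank-walk (theta-connected Θ (a (pos σ x₀) (trans (cong isT (!-pos σ x₀)) x₀-blank)) (here refl)) σ (!-pos σ x₀)
  ... | τ , w , bp = R-inv (Within.reach w) (subst₂ (R τ) (!-pos τ u) (!-pos τ v) (theta-related Θ g (keep-pos σ τ (Within.keep w) u∈) (keep-pos σ τ (Within.keep w) v∈) (off uT) (off vT) τ bp))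
    where
    off : ∀ {t} → isT t ≡ true → pos τ t ≢ P
    off {t} tT e = of-isT tT (trans (sym (!-pos τ t)) (trans (cong (τ !_) e) bp))

  module _ (rel : ∀ σ u v → u ≢ x₀ → v ≢ x₀ → R σ u v) where

    open Full rel
    open Parity X simple part

    tok-of : ∀ {u v} → part u ≡ part v → u ≢ v → u ≢ x₀
    tok-of {v = v} e ne refl = lone (ne ∘ sym) (sym e)

    -- A loop round an odd cycle shifts an even number of tokens cyclically, an odd permutation. All
    -- pairs of exchanges are available, so it is worth one single exchange.
    odd-loop : ∀ {c d f l σ τ u v} → Path c (d ∷ f ∷ l) c → Unique (c ∷ d ∷ f ∷ l) → odd (length (f ∷ l)) ≡ true →
      σ ⇝ τ → τ ! c ≡ x₀ → part u ≡ part v → u ≢ v → Ex σ u v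
    odd-loop {c} {d} {f} {l} {σ} {τ} {u} {v} p uniq o r bτ h u≢v = Dx-Ex {σ} t-same (double σ u v h u≢v) (Ex-inv t-same r
        (close (shift t-same double τ d (f ∷ l) (unique-tail uniq) (λ x∈ → tokens (tT (there x∈)) (tT (here refl)))) (cycle-once p uniq τ bτ)))
      where
      tT : ∀ {x} → x ∈ d ∷ f ∷ l → τ ! x ≢ x₀
      tT x∈ = token-part {τ} bτ (λ e → unique-head uniq (subst (_∈ d ∷ f ∷ l) e x∈))
      t₀ = τ ! d
      t₁ = τ ! f
      t-same : part t₀ ≡ part t₁
      t-same = tokens (tT (here refl)) (tT (there (here refl)))
      t₀≢t₁ : t₀ ≢ t₁
      t₀≢t₁ e = unique-head (unique-tail uniq) (here (!-inj τ e))
      double : ∀ σ u v → part u ≡ part v → u ≢ v → Dx σ u v t₀ t₁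
      double σ u v e ne = double-all σ u v t₀ t₁ (tok-of e ne) (tok-of (sym e) (ne ∘ sym)) (tT (here refl)) (tT (there (here refl))) ne t₀≢t₁
      close : Shifted t-same double τ d (f ∷ l) → Cycled τ c d (f ∷ l) → Ex τ t₀ t₁
      close sh cy = par-trans t-same double true false {τ} {S} {τ} (subst (λ b → Par t-same double b τ S) o (Shifted.par sh)) (⇝-sym (⇝-respʳ (Cycled.reach cy) meet))
        where
        S = Shifted.state sh
        meet : Cycled.state cy ≗ₚ S
        meet x with x ∈? (d ∷ f ∷ l) | x ≟ᶠ c
        ... | yes x∈ | _ = map-agree {f = Cycled.state cy !_} {g = S !_} (trans (Cycled.content cy) (sym (Shifted.content sh))) x∈
        ... | no x∉ | yes refl = trans (Cycled.blank cy) (sym (trans (Shifted.fixed sh x∉) bτ))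
        ... | no x∉ | no x≢ = trans (Cycled.fixed cy (λ { (here e) → x≢ e ; (there y) → x∉ y })) (sym (Shifted.fixed sh x∉))

    odd-exchange : Connected X → OddCycle → ∀ σ u v → part u ≡ part v → u ≢ v → Ex σ u v
    odd-exchange conn (mkOdd c l p u o) σ s t h s≢t = go l p u o
      where
      go : ∀ l → Path c l c → Unique (c ∷ l) → odd (length l) ≡ false → Ex σ s t
      go [] p u o = ⊥-elim (adj-irr p)
      go (d ∷ []) p u ()
      go (d ∷ f ∷ l) p u o with blank-walk (Star.map (λ e → e , ∈-allFin _ , ∈-allFin _) (conn (pos σ x₀) c)) σ (!-pos σ x₀)
      ... | τ , w , bτ = odd-loop p u (not-false (λ e → true≢false (cong not e) o)) (Within.reach w) bτ h s≢t

  theta-relates : Connected X → ¬ HasCutVertex X → GoodTheta → ∀ σ u v → u ≢ x₀ → v ≢ x₀ → R σ u v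
  theta-relates conn nocut (goodTheta {A = A} {B} {C} Θ g) σ u v uT vT =
    spread ext (suc n) (≤-trans (ℕₚ.n<1+n n) (ℕₚ.m≤n+m _ (length (verts Θ)))) (theta-connected Θ) (verts-unique Θ)
      (s≤s (s≤s (≤-trans (good-length g) (≤-trans (ℕₚ.m≤m+n (length A) (length (B ++ C))) (≤-reflexive (sym (length-++ A))))))) (theta-good Θ g) σ u v (isT-of uT) (isT-of vT)
    where
    ext : Extendable
    ext ch uh l x∉ = entry-swapIn ch uh l ≤-refl (Entries.entry-no-cut-vertex X simple conn nocut uh (ℕₚ.<⇒≤ l) x∉)

  connected-wilson : Connected X → ¬ HasCutVertex X → GoodTheta → OddCycle → FSConnected X Y
  connected-wilson conn nocut Θ O = connected-of-exchanges conn λ σ a b ab h →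
    odd-exchange (theta-relates conn nocut Θ) conn O σ (σ ! a) (σ ! b) h (adj-≢ ab ∘ !-inj σ)

-- Sums modulo two over vertices and over pairs.

xsum : {A : Set} → (A → Bool) → List A → Bool
xsum f [] = false
xsum f (x ∷ xs) = f x xor xsum f xs

psum : {A : Set} → (A → A → Bool) → List A → Bool
psum d [] = false
psum d (x ∷ xs) = xsum (d x) xs xor psum d xs

bool-all? : {P : Bool → Set} → (∀ b → Dec (P b)) → Dec (∀ b → P b)
bool-all? P? with P? true | P? false
... | yes t | yes f = yes (λ { true → t ; false → f })
... | no ¬t | _ = no (λ h → ¬t (h true))
... | yes _ | no ¬f = no (λ h → ¬f (h false))

abstract
  xor-4 : ∀ a b c d → (a xor b) xor (c xor d) ≡ (a xor c) xor (b xor d)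
  xor-4 = from-yes (bool-all? λ a → bool-all? λ b → bool-all? λ c → bool-all? λ d → ((a xor b) xor (c xor d)) ≟ᵇ ((a xor c) xor (b xor d)))

  xor-left : ∀ a b c → a xor (b xor c) ≡ b xor (a xor c)
  xor-left = from-yes (bool-all? λ a → bool-all? λ b → bool-all? λ c → (a xor (b xor c)) ≟ᵇ (b xor (a xor c)))

  xor-pair-swap : ∀ d p q r s → d ≡ s → (d xor p) xor (q xor r) ≡ (s xor q) xor (p xor r)
  xor-pair-swap d p q r .d refl = from-yes (bool-all? λ d → bool-all? λ p → bool-all? λ q → bool-all? λ r → ((d xor p) xor (q xor r)) ≟ᵇ ((d xor q) xor (p xor r))) d p q r

  -- the change of the two pairs {a, c} and {b, c} when the people on a and b are exchanged
  inversion-change : ∀ ha hb pa pb sa sb →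
    ((hb ∧ (pa xor sb)) xor (ha ∧ (pa xor sa))) xor ((ha ∧ (pb xor sa)) xor (hb ∧ (pb xor sb))) ≡ (ha xor hb) ∧ (pa xor pb)
  inversion-change = from-yes (bool-all? λ a → bool-all? λ b → bool-all? λ c → bool-all? λ d → bool-all? λ e → bool-all? λ f →
    (((b ∧ (c xor f)) xor (a ∧ (c xor e))) xor ((a ∧ (d xor e)) xor (b ∧ (d xor f)))) ≟ᵇ ((a xor b) ∧ (c xor d)))

  inversion-swap : ∀ h p s → (h ∧ (p xor not s)) xor (h ∧ (p xor s)) ≡ h
  inversion-swap = from-yes (bool-all? λ h → bool-all? λ p → bool-all? λ s → ((h ∧ (p xor not s)) xor (h ∧ (p xor s))) ≟ᵇ h)

  -- When two people of different colours swap across a bicoloured edge, the number of marked people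
  -- on marked vertices changes by one.
  incidence-change : ∀ ca cb ta tb → cb ≡ not ca → tb ≡ not ta → ((ca ∧ tb) xor (cb ∧ ta)) xor ((ca ∧ ta) xor (cb ∧ tb)) ≡ true
  incidence-change ca _ ta _ refl refl = from-yes (bool-all? λ c → bool-all? λ t → (((c ∧ not t) xor (not c ∧ t)) xor ((c ∧ t) xor (not c ∧ not t))) ≟ᵇ true) ca ta

xsum-↭ : ∀ {A : Set} (f : A → Bool) {xs ys : List A} → xs ↭ ys → xsum f xs ≡ xsum f ys
xsum-↭ f Perm.refl = refl
xsum-↭ f (Perm.prep x p) = cong (f x xor_) (xsum-↭ f p)
xsum-↭ f (Perm.swap x y p) = trans (cong (λ z → f x xor (f y xor z)) (xsum-↭ f p)) (xor-left (f x) (f y) _)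
xsum-↭ f (Perm.trans p q) = trans (xsum-↭ f p) (xsum-↭ f q)

psum-↭ : ∀ {A : Set} (d : A → A → Bool) → (∀ x y → d x y ≡ d y x) → {xs ys : List A} → xs ↭ ys → psum d xs ≡ psum d ys
psum-↭ d s Perm.refl = refl
psum-↭ d s (Perm.prep x p) = cong₂ _xor_ (xsum-↭ (d x) p) (psum-↭ d s p)
psum-↭ d s (Perm.swap {xs} {ys} x y p) = trans (xor-pair-swap (d x y) (xsum (d x) xs) (xsum (d y) xs) (psum d xs) (d y x) (s x y))
  (cong₂ _xor_ (cong (d y x xor_) (xsum-↭ (d y) p)) (cong₂ _xor_ (xsum-↭ (d x) p) (psum-↭ d s p)))
psum-↭ d s (Perm.trans p q) = trans (psum-↭ d s p) (psum-↭ d s q)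

xsum-xor : ∀ {A : Set} (f g : A → Bool) xs → xsum f xs xor xsum g xs ≡ xsum (λ x → f x xor g x) xs
xsum-xor f g [] = refl
xsum-xor f g (x ∷ xs) = trans (xor-4 (f x) (xsum f xs) (g x) (xsum g xs)) (cong ((f x xor g x) xor_) (xsum-xor f g xs))

psum-xor : ∀ {A : Set} (d e : A → A → Bool) xs → psum d xs xor psum e xs ≡ psum (λ x y → d x y xor e x y) xs
psum-xor d e [] = refl
psum-xor d e (x ∷ xs) = trans (xor-4 (xsum (d x) xs) (psum d xs) (xsum (e x) xs) (psum e xs)) (cong₂ _xor_ (xsum-xor (d x) (e x) xs) (psum-xor d e xs))

xsum-cong : ∀ {A : Set} {f g : A → Bool} xs → (∀ {x} → x ∈ xs → f x ≡ g x) → xsum f xs ≡ xsum g xs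
xsum-cong [] h = refl
xsum-cong (x ∷ xs) h = cong₂ _xor_ (h (here refl)) (xsum-cong xs (h ∘ there))

xsum-false : ∀ {A : Set} {f : A → Bool} xs → (∀ {x} → x ∈ xs → f x ≡ false) → xsum f xs ≡ false
xsum-false [] h = refl
xsum-false {f = f} (x ∷ xs) h = trans (cong (_xor xsum f xs) (h (here refl))) (xsum-false xs (h ∘ there))

psum-false : ∀ {A : Set} {d : A → A → Bool} xs → (∀ {x y} → x ∈ xs → y ∈ xs → d x y ≡ false) → psum d xs ≡ false
psum-false [] h = refl
psum-false {d = d} (x ∷ xs) h = trans (cong (_xor psum d xs) (xsum-false xs (λ y∈ → h (here refl) (there y∈)))) (psum-false xs (λ a b → h (there a) (there b)))

xsum-∧ : ∀ {A : Set} b (f : A → Bool) xs → xsum (λ x → b ∧ f x) xs ≡ b ∧ xsum f xs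
xsum-∧ true f xs = refl
xsum-∧ false f xs = xsum-false xs (λ _ → refl)

record PulledOut {n : ℕ} (a b : Fin n) : Set where
  constructor pulledOut
  field
    rest : List (Fin n)
    perm : allFin n ↭ a ∷ b ∷ rest
    a∉ : ∀ {c} → c ∈ rest → c ≢ a
    b∉ : ∀ {c} → c ∈ rest → c ≢ b

pull-out : ∀ {n} (a b : Fin n) → a ≢ b → PulledOut a b
pull-out {n} a b a≢b with ∈-∃++ (∈-allFin {n} a)
... | l , r , e with ∈-∃++ {v = b} {l ++ r} (from-∈ (subst (b ∈_) e (∈-allFin b)))
  where
  from-∈ : b ∈ l ++ a ∷ r → b ∈ l ++ r
  from-∈ h with ∈-++⁻ l h
  ... | inj₁ p = ∈-++⁺ˡ p
  ... | inj₂ (here q) = ⊥-elim (a≢b (sym q))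
  ... | inj₂ (there p) = ∈-++⁺ʳ l p
... | l′ , r′ , e′ = pulledOut (l′ ++ r′) all-perm (λ c∈ h → unique-head u (subst (_∈ b ∷ l′ ++ r′) h (there c∈))) (λ c∈ h → unique-head (unique-tail u) (subst (_∈ l′ ++ r′) h c∈))
  where
  all-perm : allFin n ↭ a ∷ b ∷ (l′ ++ r′)
  all-perm = ↭-trans (Perm.↭-reflexive e) (↭-trans (Permₚ.shift a l r) (Perm.prep a (↭-trans (Perm.↭-reflexive e′) (Permₚ.shift b l′ r′))))
  u₀ : Unique (l ++ a ∷ r)
  u₀ = subst Unique e (Uₚ.allFin⁺ n)
  u : Unique (a ∷ b ∷ l′ ++ r′)
  u = unique-cons (λ { (here h) → a≢b h ; (there h) → a∉lr (in-lr h) }) (unique-cons (λ h → [ (λ p → unique-disjoint l′ u₁ p (here refl)) , unique-head (unique-++ʳ l′ u₁) ]′ (∈-++⁻ l′ h))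
        (unique-++ (unique-++ˡ u₁) (unique-tail (unique-++ʳ l′ u₁)) (λ p q → unique-disjoint l′ u₁ p (there q))))
    where
    a∉lr : a ∉ l ++ r
    a∉lr h = [ (λ p → unique-disjoint l u₀ p (here refl)) , unique-head (unique-++ʳ l u₀) ]′ (∈-++⁻ l h)
    u₁ : Unique (l′ ++ b ∷ r′)
    u₁ = subst Unique e′ (unique-++ (unique-++ˡ u₀) (unique-tail (unique-++ʳ l u₀)) (λ p q → unique-disjoint l u₀ p (there q)))
    in-lr : ∀ {x} → x ∈ l′ ++ r′ → x ∈ l ++ r
    in-lr {x} h = subst (x ∈_) (sym e′) ([ ∈-++⁺ˡ , (λ p → ∈-++⁺ʳ l′ (there p)) ]′ (∈-++⁻ l′ h))

<ᵇ-true : ∀ {m k} → m < k → (m <ᵇ k) ≡ true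
<ᵇ-true {m} {k} h with m <ᵇ k in e
... | true = refl
... | false = ⊥-elim (subst B.T e (ℕₚ.<⇒<ᵇ h))

<ᵇ-false : ∀ {m k} → k ≤ m → (m <ᵇ k) ≡ false
<ᵇ-false {m} {k} h with m <ᵇ k in e
... | false = refl
... | true = ⊥-elim (ℕₚ.<⇒≱ (ℕₚ.<ᵇ⇒< m k (subst B.T (sym e) tt)) h)

infix 7 _<ᶠ_
_<ᶠ_ : ∀ {n} → Fin n → Fin n → Bool
x <ᶠ y = toℕ x <ᵇ toℕ y

<ᶠ-flip : ∀ {n} {x y : Fin n} → x ≢ y → y <ᶠ x ≡ not (x <ᶠ y)
<ᶠ-flip {x = x} {y} ne with ℕₚ.<-cmp (toℕ x) (toℕ y)
... | tri< a _ _ = trans (<ᵇ-false (ℕₚ.<⇒≤ a)) (cong not (sym (<ᵇ-true a)))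
... | tri≈ _ a _ = ⊥-elim (ne (toℕ-injective a))
... | tri> _ _ a = trans (<ᵇ-true a) (cong not (sym (<ᵇ-false (ℕₚ.<⇒≤ a))))

not-not-xor : ∀ a b → not a xor not b ≡ a xor b
not-not-xor true true = refl
not-not-xor true false = refl
not-not-xor false true = refl
not-not-xor false false = refl

record Swapped {n : ℕ} (σ ρ : Permutation′ n) (a b : Fin n) : Set where
  constructor swapped
  field
    at-a : ρ ! a ≡ σ ! b
    at-b : ρ ! b ≡ σ ! a
    else′ : ∀ c → c ≢ a → c ≢ b → ρ ! c ≡ σ ! c

-- Parity of the inversions among selected pairs of people.

module Inversions {n : ℕ} (h : Fin n → Fin n → Bool) (h-sym : ∀ u v → h u v ≡ h v u) (φ : Permutation′ n) where

  -- The relation `h` selects pairs of people; a selected pair counts if its order disagrees with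
  -- the order of the labels that φ gives to the positions.
  weight : Permutation′ n → Fin n → Fin n → Bool
  weight σ i j = h (σ ! i) (σ ! j) ∧ ((φ ! i <ᶠ φ ! j) xor (σ ! i <ᶠ σ ! j))

  inversions : Permutation′ n → Bool
  inversions σ = psum (weight σ) (allFin n)

  weight-sym : ∀ σ i j → weight σ i j ≡ weight σ j i
  weight-sym σ i j with i ≟ᶠ j
  ... | yes refl = refl
  ... | no ne = cong₂ _∧_ (h-sym _ _) (sym (trans (cong₂ _xor_ (<ᶠ-flip (ne ∘ !-inj φ)) (<ᶠ-flip (ne ∘ !-inj σ))) (not-not-xor (φ ! i <ᶠ φ ! j) (σ ! i <ᶠ σ ! j))))

  -- Only pairs meeting `a` or `b` matter. Besides the pair itself, a third position `c` contributes
  -- only if its label lies between those of `a` and `b`.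
  change : ∀ {σ ρ a b} → a ≢ b → Swapped σ ρ a b → (po : PulledOut a b) → inversions ρ xor inversions σ ≡
    h (σ ! a) (σ ! b) xor xsum (λ c → (h (σ ! a) (σ ! c) xor h (σ ! b) (σ ! c)) ∧ ((φ ! a <ᶠ φ ! c) xor (φ ! b <ᶠ φ ! c))) (PulledOut.rest po)
  change {σ} {ρ} {a} {b} a≢b (swapped ea eb eo) (pulledOut rest perm a∉ b∉) =
    trans (psum-xor (weight ρ) (weight σ) (allFin n)) (trans (psum-↭ d (λ x y → cong₂ _xor_ (weight-sym ρ x y) (weight-sym σ x y)) perm)
      (trans (xor-pair (d a b) (xsum (d a) rest) (xsum (d b) rest) (psum d rest) (psum-false rest zero-rest))
        (cong₂ _xor_ dab (trans (xsum-xor (d a) (d b) rest) (xsum-cong rest third)))))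
    where
    d : Fin n → Fin n → Bool
    d x y = weight ρ x y xor weight σ x y
    xor-pair : ∀ p q r s → s ≡ false → (p xor q) xor (r xor s) ≡ p xor (q xor r)
    xor-pair true true true _ refl = refl
    xor-pair true true false _ refl = refl
    xor-pair true false true _ refl = refl
    xor-pair true false false _ refl = refl
    xor-pair false true true _ refl = refl
    xor-pair false true false _ refl = refl
    xor-pair false false true _ refl = refl
    xor-pair false false false _ refl = refl
    off : ∀ {c} → c ∈ rest → ρ ! c ≡ σ ! c
    off c∈ = eo _ (a∉ c∈) (b∉ c∈)
    zero-rest : ∀ {x y} → x ∈ rest → y ∈ rest → d x y ≡ false
    zero-rest {x} {y} x∈ y∈ = trans (cong (_xor weight σ x y) (cong₂ (λ u v → h u v ∧ ((φ ! x <ᶠ φ ! y) xor (u <ᶠ v))) (off x∈) (off y∈))) (xor-same (weight σ x y))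
    dab : d a b ≡ h (σ ! a) (σ ! b)
    dab = trans (cong (_xor weight σ a b) (trans (cong₂ (λ u v → h u v ∧ ((φ ! a <ᶠ φ ! b) xor (u <ᶠ v))) ea eb)
      (cong₂ (λ u v → u ∧ ((φ ! a <ᶠ φ ! b) xor v)) (h-sym (σ ! b) (σ ! a)) (<ᶠ-flip (a≢b ∘ !-inj σ))))) (inversion-swap (h (σ ! a) (σ ! b)) (φ ! a <ᶠ φ ! b) (σ ! a <ᶠ σ ! b))
    third : ∀ {c} → c ∈ rest → d a c xor d b c ≡ (h (σ ! a) (σ ! c) xor h (σ ! b) (σ ! c)) ∧ ((φ ! a <ᶠ φ ! c) xor (φ ! b <ᶠ φ ! c))
    third {c} c∈ = trans (cong₂ _xor_ (cong (_xor weight σ a c) (cong₂ (λ u v → h u v ∧ ((φ ! a <ᶠ φ ! c) xor (u <ᶠ v))) ea (off c∈)))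
        (cong (_xor weight σ b c) (cong₂ (λ u v → h u v ∧ ((φ ! b <ᶠ φ ! c) xor (u <ᶠ v))) eb (off c∈))))
      (inversion-change (h (σ ! a) (σ ! c)) (h (σ ! b) (σ ! c)) (φ ! a <ᶠ φ ! c) (φ ! b <ᶠ φ ! c) (σ ! a <ᶠ σ ! c) (σ ! b <ᶠ σ ! c))

  inversions-cong : ∀ {σ ρ} → σ ≗ₚ ρ → inversions σ ≡ inversions ρ
  inversions-cong {σ} {ρ} e = go (allFin n)
    where
    go : ∀ xs → psum (weight σ) xs ≡ psum (weight ρ) xs
    go [] = refl
    go (x ∷ xs) = cong₂ _xor_ (xsum-cong xs (λ {y} _ → cong₂ (λ u v → h u v ∧ ((φ ! x <ᶠ φ ! y) xor (u <ᶠ v))) (e x) (e y))) (go xs)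

xor-≡ : ∀ {a b} → a xor b ≡ false → a ≡ b
xor-≡ {true} {true} e = refl
xor-≡ {false} {false} e = refl

xor-≢ : ∀ {a b} → a xor b ≡ true → a ≢ b
xor-≢ {true} {false} e ()
xor-≢ {false} {true} e ()

two-places : ∀ {n} (a b p q : Fin n) → a ≢ b → p ≢ q → ∃ λ (σ : Permutation′ n) → σ ! a ≡ p × σ ! b ≡ q
two-places a b p q a≢b p≢q = transpose a p ∘ₚ transpose q' q
    , trans (cong (transpose q' q !_) (tr-l a p)) (tr-o q' q (λ e → a≢b (!-inj (transpose a p) (trans (tr-l a p) e))) p≢q) , tr-l q' q
  where q' = transpose a p ! b

-- Invariants on bipartite graphs and cycles.

module Necessity {n : ℕ} (X : Graph n) (simple : IsSimple X) (part : Fin n → ℕ) where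

  open GraphTheory X simple
  open FSCore X simple part

  invariant : {A : Set} (I : Permutation′ n → A) → (∀ {σ ρ} → σ ≗ₚ ρ → I σ ≡ I ρ) →
    (∀ σ ρ a b → Adj X a b → part (σ ! a) ≢ part (σ ! b) → Swapped σ ρ a b → I ρ ≡ I σ) → FSConnected X Y → ∀ σ τ → I σ ≡ I τ
  invariant I resp inv fs σ τ with fs σ τ
  ... | ρ , s , e = trans (go s) (resp e)
    where
    go : ∀ {σ} → Star (FSEdge X Y) σ ρ → I σ ≡ I ρ
    go ε = refl
    go {σ} (_◅_ {j = σ'} d@(a , b , ab , f , p , q , o) s) = trans (sym (inv σ σ' a b ab (friend⁻¹ (σ ! a) (σ ! b) f) (swapped p q o))) (go s)

  preserved : (I : Permutation′ n → Set) → (∀ {σ ρ} → σ ≗ₚ ρ → I σ → I ρ) →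
    (∀ σ ρ a b → Adj X a b → part (σ ! a) ≢ part (σ ! b) → Swapped σ ρ a b → I σ → I ρ) → FSConnected X Y → ∀ σ τ → I σ → I τ
  preserved I resp inv fs σ τ i with fs σ τ
  ... | ρ , s , e = resp e (go s i)
    where
    go : ∀ {σ} → Star (FSEdge X Y) σ ρ → I σ → I ρ
    go ε i = i
    go {σ} (_◅_ {j = σ'} d@(a , b , ab , f , p , q , o) s) i = go s (inv σ σ' a b ab (friend⁻¹ (σ ! a) (σ ! b) f) (swapped p q o) i)

  connected-necessary : FSConnected X Y → Connected X
  connected-necessary fs u v = subst (Star (Adj X) u) pos-τ (preserved (λ σ → Star (Adj X) u (σ ⟨$⟩ˡ u)) (λ {σ} {ρ} e → subst (Star (Adj X) u) (pos-cong σ ρ e))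
      (λ σ ρ a b ab _ sw s → move σ ρ a b ab sw s) fs P.id (transpose u v) ε)
    where
    pos-τ : transpose u v ⟨$⟩ˡ u ≡ v
    pos-τ = trans (cong (transpose u v ⟨$⟩ˡ_) (sym (tr-r u v))) (inverseˡ (transpose u v))
    pos-cong : ∀ σ ρ → σ ≗ₚ ρ → σ ⟨$⟩ˡ u ≡ ρ ⟨$⟩ˡ u
    pos-cong σ ρ e = trans (sym (inverseˡ ρ)) (cong (ρ ⟨$⟩ˡ_) (trans (sym (e (σ ⟨$⟩ˡ u))) (inverseʳ σ)))
    move : ∀ σ ρ a b → Adj X a b → Swapped σ ρ a b → Star (Adj X) u (σ ⟨$⟩ˡ u) → Star (Adj X) u (ρ ⟨$⟩ˡ u)
    move σ ρ a b ab (swapped ea eb eo) s with σ ⟨$⟩ˡ u ≟ᶠ a | σ ⟨$⟩ˡ u ≟ᶠ b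
    ... | yes p | _ = subst (Star (Adj X) u) (trans (sym (inverseˡ ρ)) (cong (ρ ⟨$⟩ˡ_) (trans eb (trans (cong (σ !_) (sym p)) (inverseʳ σ))))) (s ◅◅ (subst (λ z → Adj X z b) (sym p) ab ◅ ε))
    ... | no _ | yes p = subst (Star (Adj X) u) (trans (sym (inverseˡ ρ)) (cong (ρ ⟨$⟩ˡ_) (trans ea (trans (cong (σ !_) (sym p)) (inverseʳ σ))))) (s ◅◅ (subst (λ z → Adj X z a) (sym p) (adj-sym ab) ◅ ε))
    ... | no p | no q = subst (Star (Adj X) u) (trans (sym (inverseˡ ρ)) (cong (ρ ⟨$⟩ˡ_) (trans (eo _ p q) (inverseʳ σ)))) s

  -- With all pairs selected, `inversions` is the sign. A friendly swap changes both the sign and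
  -- the parity of marked people on one side of X; exchanging two people of one colour changes only
  -- the sign.
  bipartite-necessary : (isT : Fin n → Bool) → (∀ u v → part u ≢ part v → isT u ≢ isT v) → (p q : Fin n) → p ≢ q → isT p ≡ isT q →
    FSConnected X Y → ¬ Bipartite X
  bipartite-necessary isT two p q p≢q pq fs (col , proper) =
      xor-≢ differ (invariant total (λ {σ} {ρ} → total-cong {σ} {ρ}) total-step fs σ (swap p q σ))
    where
    open Inversions (λ _ _ → true) (λ _ _ → refl) P.id
    σ = P.id {n}
    incidence : Permutation′ n → Bool
    incidence σ = xsum (λ c → col c ∧ isT (σ ! c)) (allFin n)
    total : Permutation′ n → Bool
    total σ = inversions σ xor incidence σ
    total-cong : ∀ {σ ρ} → σ ≗ₚ ρ → total σ ≡ total ρ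
    total-cong {σ} {ρ} e = cong₂ _xor_ (inversions-cong {σ} {ρ} e) (xsum-cong (allFin n) (λ {c} _ → cong (λ u → col c ∧ isT u) (e c)))
    sign-change : ∀ {σ ρ a b} → a ≢ b → Swapped σ ρ a b → inversions ρ xor inversions σ ≡ true
    sign-change {σ} {ρ} {a} {b} ne sw = trans (change {σ} {ρ} ne sw po) (cong (true xor_) (xsum-false (PulledOut.rest po) (λ _ → refl)))
      where po = pull-out a b ne
    incidence-diff : ∀ {σ ρ a b} → a ≢ b → Swapped σ ρ a b → incidence ρ xor incidence σ ≡
      ((col a ∧ isT (σ ! b)) xor (col b ∧ isT (σ ! a))) xor ((col a ∧ isT (σ ! a)) xor (col b ∧ isT (σ ! b)))
    incidence-diff {σ} {ρ} {a} {b} ne (swapped ea eb eo) = trans (cong₂ _xor_ (xsum-↭ _ (PulledOut.perm po)) (xsum-↭ _ (PulledOut.perm po)))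
        (trans (cong (λ z → ((col a ∧ isT (ρ ! a)) xor ((col b ∧ isT (ρ ! b)) xor z)) xor (ya xor (yb xor r))) same)
          (trans (cancel (col a ∧ isT (ρ ! a)) (col b ∧ isT (ρ ! b)) ya yb r) (cong₂ (λ x y → (x xor y) xor (ya xor yb)) (cong (λ u → col a ∧ isT u) ea) (cong (λ u → col b ∧ isT u) eb))))
      where
      po = pull-out a b ne
      ya = col a ∧ isT (σ ! a)
      yb = col b ∧ isT (σ ! b)
      r = xsum (λ c → col c ∧ isT (σ ! c)) (PulledOut.rest po)
      same : xsum (λ c → col c ∧ isT (ρ ! c)) (PulledOut.rest po) ≡ r
      same = xsum-cong (PulledOut.rest po) (λ {c} c∈ → cong (λ u → col c ∧ isT u) (eo c (PulledOut.a∉ po c∈) (PulledOut.b∉ po c∈)))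
      cancel : ∀ x y u v r → (x xor (y xor r)) xor (u xor (v xor r)) ≡ (x xor y) xor (u xor v)
      cancel = from-yes (bool-all? λ x → bool-all? λ y → bool-all? λ u → bool-all? λ v → bool-all? λ r → ((x xor (y xor r)) xor (u xor (v xor r))) ≟ᵇ ((x xor y) xor (u xor v)))
    total-step : ∀ σ ρ a b → Adj X a b → part (σ ! a) ≢ part (σ ! b) → Swapped σ ρ a b → total ρ ≡ total σ
    total-step σ ρ a b ab f sw = xor-≡ (trans (xor-4 (inversions ρ) (incidence ρ) (inversions σ) (incidence σ))
      (cong₂ _xor_ (sign-change {σ} {ρ} (adj-≢ ab) sw) (trans (incidence-diff {σ} {ρ} (adj-≢ ab) sw)
        (incidence-change (col a) (col b) (isT (σ ! a)) (isT (σ ! b)) (≢⇒≡not (proper a b ab)) (≢⇒≡not (two (σ ! a) (σ ! b) f))))))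
    sw₀ : Swapped σ (swap p q σ) p q
    sw₀ = swapped (swap-l p q σ) (swap-r p q σ) (λ c → swap-o p q σ)
    differ : total σ xor total (swap p q σ) ≡ true
    differ = trans (xor-4 (inversions σ) (incidence σ) (inversions (swap p q σ)) (incidence (swap p q σ))) (cong₂ _xor_
      (trans (xor-comm′ (inversions σ) (inversions (swap p q σ))) (sign-change {σ} {swap p q σ} p≢q sw₀))
      (trans (xor-comm′ (incidence σ) (incidence (swap p q σ))) (trans (incidence-diff {σ} {swap p q σ} p≢q sw₀) (trans (cong (λ z → ((col p ∧ z) xor (col q ∧ isT p)) xor ((col p ∧ isT p) xor (col q ∧ z))) (sym pq)) (xor-same ((col p ∧ isT p) xor (col q ∧ isT p)))))))
      where
      xor-comm′ : ∀ a b → a xor b ≡ b xor a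
      xor-comm′ true true = refl
      xor-comm′ true false = refl
      xor-comm′ false true = refl
      xor-comm′ false false = refl

  -- Selected pairs are classmates. Between consecutive labels there is no third one, so ordinary
  -- edges change nothing. Across the closing edge all others lie between, and the change is the sum
  -- of two rows of `h`, which cancel because every row has the same parity `d`.
  cycle-necessary : IsCycle X → 3 ≤ n → (h : Fin n → Fin n → Bool) → (∀ u v → h u v ≡ h v u) → (∀ u → h u u ≡ false) →
    (∀ u v → part u ≢ part v → h u v ≡ false) → (d : Bool) → (∀ σ u → xsum (λ c → h u (σ ! c)) (allFin n) ≡ d) →
    (p q : Fin n) → h p q ≡ true → ¬ FSConnected X Y
  cycle-necessary (φ , cyc) 3≤n h h-sym h-irr h-part d degree p q hpq fs =
      xor-≢ differ (invariant inversions (λ {σ} {ρ} → inversions-cong {σ} {ρ}) move fs (swap a₀ b₀ σ) σ)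
    where
    open Inversions h h-sym φ
    2≤n = ≤-trans (s≤s (s≤s z≤n)) 3≤n
    a₀ b₀ : Fin n
    a₀ = φ ⟨$⟩ˡ fromℕ< (≤-trans (s≤s z≤n) 2≤n)
    -- The places labelled 0 and 1 are neighbours on the cycle, so exchanging a selected pair there
    -- changes the count by this one pair.
    b₀ = φ ⟨$⟩ˡ fromℕ< 2≤n
    φa₀ : toℕ (φ ! a₀) ≡ 0
    φa₀ = trans (cong toℕ (inverseʳ φ)) (toℕ-fromℕ< _)
    φb₀ : toℕ (φ ! b₀) ≡ 1
    φb₀ = trans (cong toℕ (inverseʳ φ)) (toℕ-fromℕ< _)
    a₀≢b₀ : a₀ ≢ b₀
    a₀≢b₀ e = case trans (sym φa₀) (trans (cong (λ z → toℕ (φ ! z)) e) φb₀) of λ ()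
    p≢q : p ≢ q
    p≢q e = true≢false hpq (trans (cong (λ z → h z q) e) (h-irr q))
    placed = two-places a₀ b₀ p q a₀≢b₀ p≢q
    σ = proj₁ placed
    near : ∀ i j k → suc i ≡ j → k ≢ i → k ≢ j → (i <ᵇ k) xor (j <ᵇ k) ≡ false
    near i .(suc i) k refl k≢i k≢j with ℕₚ.<-cmp i k
    ... | tri< l _ _ = trans (cong₂ _xor_ (<ᵇ-true l) (<ᵇ-true (ℕₚ.≤∧≢⇒< l (≢-sym k≢j)))) refl
    ... | tri≈ _ e _ = ⊥-elim (k≢i (sym e))
    ... | tri> _ _ l = trans (cong₂ _xor_ (<ᵇ-false (ℕₚ.<⇒≤ l)) (<ᵇ-false (ℕₚ.m≤n⇒m≤1+n (ℕₚ.<⇒≤ l)))) refl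
    far : ∀ i j k → i ≡ 0 → j ≡ n ∸ 1 → k < n → k ≢ i → (i <ᵇ k) xor (j <ᵇ k) ≡ true
    far .0 .(n ∸ 1) k refl refl k<n k≢i = trans (cong₂ _xor_ (<ᵇ-true (ℕₚ.n≢0⇒n>0 k≢i)) (<ᵇ-false (ℕₚ.∸-monoˡ-≤ 1 k<n))) refl
    flip-xor : ∀ x y {b} → x xor y ≡ b → y xor x ≡ b
    flip-xor true true e = e
    flip-xor true false e = e
    flip-xor false true e = e
    flip-xor false false e = e
    label-≢ : ∀ {a c} → c ≢ a → toℕ (φ ! c) ≢ toℕ (φ ! a)
    label-≢ ne e = ne (!-inj φ (toℕ-injective e))
    consecutive : ∀ {a b} → Consecutive (φ ! a) (φ ! b) → ∀ c → c ≢ a → c ≢ b → (φ ! a <ᶠ φ ! c) xor (φ ! b <ᶠ φ ! c) ≡ false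
    consecutive {a} {b} (inj₁ e) c ca cb = near _ _ (toℕ (φ ! c)) e (label-≢ ca) (label-≢ cb)
    consecutive {a} {b} (inj₂ e) c ca cb = flip-xor (φ ! b <ᶠ φ ! c) (φ ! a <ᶠ φ ! c) (near _ _ (toℕ (φ ! c)) e (label-≢ cb) (label-≢ ca))
    still : ∀ σ ρ a b → a ≢ b → h (σ ! a) (σ ! b) ≡ false → Swapped σ ρ a b → ∀ b′ →
      (∀ c → c ≢ a → c ≢ b → (φ ! a <ᶠ φ ! c) xor (φ ! b <ᶠ φ ! c) ≡ b′) → inversions ρ ≡ inversions σ
    still σ ρ a b ne hab sw false side = xor-≡ (trans (change {σ} {ρ} ne sw po) (cong₂ _xor_ hab
        (xsum-false (PulledOut.rest po) (λ {c} c∈ → trans (cong (λ z → (h (σ ! a) (σ ! c) xor h (σ ! b) (σ ! c)) ∧ z) (side c (PulledOut.a∉ po c∈) (PulledOut.b∉ po c∈))) (∧-false′ _)))))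
      where
      po = pull-out a b ne
      ∧-false′ : ∀ x → x ∧ false ≡ false
      ∧-false′ true = refl
      ∧-false′ false = refl
    still σ ρ a b ne hab sw true side = xor-≡ (trans (change {σ} {ρ} ne sw po) (cong₂ _xor_ hab
        (trans (xsum-cong (PulledOut.rest po) (λ {c} c∈ → trans (cong (λ z → (h (σ ! a) (σ ! c) xor h (σ ! b) (σ ! c)) ∧ z) (side c (PulledOut.a∉ po c∈) (PulledOut.b∉ po c∈))) (∧-true′ _)))
          (trans (sym (xsum-xor (λ c → h (σ ! a) (σ ! c)) (λ c → h (σ ! b) (σ ! c)) (PulledOut.rest po)))
            (trans (cong₂ _xor_ (row (σ ! a) (h-irr (σ ! a)) hab) (row (σ ! b) (trans (h-sym (σ ! b) (σ ! a)) hab) (h-irr (σ ! b)))) (xor-same d))))))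
      where
      po = pull-out a b ne
      ∧-true′ : ∀ x → x ∧ true ≡ x
      ∧-true′ true = refl
      ∧-true′ false = refl
      row : ∀ u → h u (σ ! a) ≡ false → h u (σ ! b) ≡ false → xsum (λ c → h u (σ ! c)) (PulledOut.rest po) ≡ d
      row u ea eb = trans (sym (trans (xsum-↭ _ (PulledOut.perm po)) (cong₂ (λ x y → x xor (y xor xsum (λ c → h u (σ ! c)) (PulledOut.rest po))) ea eb))) (degree σ u)
    move : ∀ σ ρ a b → Adj X a b → part (σ ! a) ≢ part (σ ! b) → Swapped σ ρ a b → inversions ρ ≡ inversions σ
    move σ ρ a b ab f sw with cycleGraph-sound {i = φ ! a} {φ ! b} (trans (sym (cyc a b)) ab)
    ... | inj₁ c = still σ ρ a b (adj-≢ ab) (h-part _ _ f) sw false (consecutive c)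
    ... | inj₂ (inj₁ (ea , eb)) = still σ ρ a b (adj-≢ ab) (h-part _ _ f) sw true (λ c ca cb → far _ _ _ ea eb (toℕ<n (φ ! c)) (label-≢ ca))
    ... | inj₂ (inj₂ (eb , ea)) = still σ ρ a b (adj-≢ ab) (h-part _ _ f) sw true (λ c ca cb → flip-xor (φ ! b <ᶠ φ ! c) (φ ! a <ᶠ φ ! c) (far _ _ _ eb ea (toℕ<n (φ ! c)) (label-≢ cb)))
    po₀ = pull-out a₀ b₀ a₀≢b₀
    differ : inversions (swap a₀ b₀ σ) xor inversions σ ≡ true
    differ = trans (change {σ} {swap a₀ b₀ σ} a₀≢b₀ (swapped (swap-l a₀ b₀ σ) (swap-r a₀ b₀ σ) (λ c → swap-o a₀ b₀ σ)) po₀)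
      (cong₂ _xor_ (trans (cong₂ h (proj₁ (proj₂ placed)) (proj₂ (proj₂ placed))) hpq)
        (xsum-false (PulledOut.rest po₀) (λ {c} c∈ → trans (cong (λ z → (h (σ ! a₀) (σ ! c) xor h (σ ! b₀) (σ ! c)) ∧ z)
          (consecutive (inj₁ (trans (cong suc φa₀) (sym φb₀))) c (PulledOut.a∉ po₀ c∈) (PulledOut.b∉ po₀ c∈))) (∧-false″ _))))
      where
      ∧-false″ : ∀ x → x ∧ false ≡ false
      ∧-false″ true = refl
      ∧-false″ false = refl

  xsum-one : ∀ {A : Set} {f : A → Bool} {c₀} xs → Unique xs → c₀ ∈ xs → f c₀ ≡ true → (∀ c → c ≢ c₀ → f c ≡ false) → xsum f xs ≡ true
  xsum-one (x ∷ xs) u (here refl) t o = cong₂ _xor_ t (xsum-false xs (λ {c} c∈ → o c (λ e → unique-head u (subst (_∈ xs) e c∈))))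
  xsum-one (x ∷ xs) u (there h) t o = cong₂ _xor_ (o x (λ e → unique-head u (subst (_∈ xs) (sym e) h))) (xsum-one xs (unique-tail u) h t o)

  _==_ : Fin n → Fin n → Bool
  u == v = Dec.does (u ≟ᶠ v)

  ==-refl : ∀ u → u == u ≡ true
  ==-refl u with u ≟ᶠ u
  ... | yes _ = refl
  ... | no h = ⊥-elim (h refl)

  ==-≢ : ∀ {u v} → u ≢ v → u == v ≡ false
  ==-≢ {u} {v} ne with u ≟ᶠ v
  ... | yes e = ⊥-elim (ne e)
  ... | no _ = refl

  ==-sound : ∀ {u v} → u == v ≡ true → u ≡ v
  ==-sound {u} {v} e with u ≟ᶠ v
  ... | yes p = p

  -- the inversions among three people of one class
  cycle-necessary-three : IsCycle X → 3 ≤ n → (p q r : Fin n) → p ≢ q → p ≢ r → q ≢ r → part p ≡ part q → part p ≡ part r → ¬ FSConnected X Y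
  cycle-necessary-three cyc 3≤n p q r pq pr qr epq epr =
    cycle-necessary cyc 3≤n h h-sym h-irr h-part false degree p q hpq
    where
    pair : Fin n → Fin n → Fin n → Fin n → Bool
    pair x y u v = ((u == x) ∧ (v == y)) xor ((u == y) ∧ (v == x))
    h : Fin n → Fin n → Bool
    -- Each of the three people lies in two of the three pairs, so all rows are even.
    h u v = pair p q u v xor (pair p r u v xor pair q r u v)
    pair-flip : ∀ a b c d → (a ∧ b) xor (c ∧ d) ≡ (d ∧ c) xor (b ∧ a)
    pair-flip = from-yes (bool-all? λ a → bool-all? λ b → bool-all? λ c → bool-all? λ d → ((a ∧ b) xor (c ∧ d)) ≟ᵇ ((d ∧ c) xor (b ∧ a)))
    pair-sym : ∀ x y u v → pair x y u v ≡ pair x y v u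
    pair-sym x y u v = pair-flip (u == x) (v == y) (u == y) (v == x)
    h-sym : ∀ u v → h u v ≡ h v u
    h-sym u v = cong₂ _xor_ (pair-sym p q u v) (cong₂ _xor_ (pair-sym p r u v) (pair-sym q r u v))
    pair-irr : ∀ x y u → pair x y u u ≡ false
    pair-irr x y u = same (u == x) (u == y)
      where
      same : ∀ a b → (a ∧ b) xor (b ∧ a) ≡ false
      same = from-yes (bool-all? λ a → bool-all? λ b → ((a ∧ b) xor (b ∧ a)) ≟ᵇ false)
    h-irr : ∀ u → h u u ≡ false
    h-irr u = cong₂ _xor_ (pair-irr p q u) (cong₂ _xor_ (pair-irr p r u) (pair-irr q r u))
    both : ∀ {x y u v} → part x ≡ part y → part u ≢ part v → (u == x) ∧ (v == y) ≡ false
    both {x} {y} {u} {v} e ne with u ≟ᶠ x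
    ... | no _ = refl
    ... | yes refl = ==-≢ {v} {y} (λ vy → ne (trans e (cong part (sym vy))))
    pair-part : ∀ {x y u v} → part x ≡ part y → part u ≢ part v → pair x y u v ≡ false
    pair-part {x} {y} {u} {v} e ne = cong₂ _xor_ (both {x} {y} {u} {v} e ne) (both {y} {x} {u} {v} (sym e) ne)
    h-part : ∀ u v → part u ≢ part v → h u v ≡ false
    h-part u v ne = cong₂ _xor_ (pair-part {p} {q} {u} {v} epq ne) (cong₂ _xor_ (pair-part {p} {r} {u} {v} epr ne) (pair-part {q} {r} {u} {v} (trans (sym epq) epr) ne))
    one : ∀ σ x → xsum (λ c → (σ ! c) == x) (allFin n) ≡ true
    one σ x = xsum-one {c₀ = σ ⟨$⟩ˡ x} (allFin n) (Uₚ.allFin⁺ n) (∈-allFin _) (trans (cong (_== x) (inverseʳ σ)) (==-refl x))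
      (λ c ne → ==-≢ (λ e → ne (trans (sym (inverseˡ σ)) (cong (σ ⟨$⟩ˡ_) e))))
    half : ∀ σ x y u → xsum (λ c → (u == x) ∧ ((σ ! c) == y)) (allFin n) ≡ u == x
    half σ x y u = trans (xsum-∧ (u == x) (λ c → (σ ! c) == y) (allFin n)) (trans (cong ((u == x) ∧_) (one σ y)) (∧-true (u == x)))
      where
      ∧-true : ∀ a → a ∧ true ≡ a
      ∧-true true = refl
      ∧-true false = refl
    pair-degree : ∀ σ x y u → xsum (λ c → pair x y u (σ ! c)) (allFin n) ≡ (u == x) xor (u == y)
    pair-degree σ x y u = trans (sym (xsum-xor (λ c → (u == x) ∧ ((σ ! c) == y)) (λ c → (u == y) ∧ ((σ ! c) == x)) (allFin n))) (cong₂ _xor_ (half σ x y u) (half σ y x u))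
    degree : ∀ σ u → xsum (λ c → h u (σ ! c)) (allFin n) ≡ false
    degree σ u = trans (sym (xsum-xor (λ c → pair p q u (σ ! c)) (λ c → pair p r u (σ ! c) xor pair q r u (σ ! c)) (allFin n)))
      (trans (cong₂ _xor_ (pair-degree σ p q u) (trans (sym (xsum-xor (λ c → pair p r u (σ ! c)) (λ c → pair q r u (σ ! c)) (allFin n)))
        (cong₂ _xor_ (pair-degree σ p r u) (pair-degree σ q r u)))) (cancel (u == p) (u == q) (u == r)))
      where
      cancel : ∀ a b c → (a xor b) xor ((a xor c) xor (b xor c)) ≡ false
      cancel = from-yes (bool-all? λ a → bool-all? λ b → bool-all? λ c → ((a xor b) xor ((a xor c) xor (b xor c))) ≟ᵇ false)
    hpq : h p q ≡ true
    hpq rewrite ==-refl p | ==-refl q | ==-≢ pq | ==-≢ (≢-sym pq) | ==-≢ pr | ==-≢ qr = refl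

  -- the inversions inside classes of size two
  cycle-necessary-pairs : IsCycle X → 3 ≤ n → (partner : Fin n → Fin n) → (∀ u → partner u ≢ u) → (∀ u → part (partner u) ≡ part u) →
    (∀ u v → part u ≡ part v → v ≡ u ⊎ v ≡ partner u) → Fin n → ¬ FSConnected X Y
  cycle-necessary-pairs cyc 3≤n partner ne same only p =
    cycle-necessary cyc 3≤n h h-sym h-irr h-part true degree p (partner p) (h-partner p)
    where
    h : Fin n → Fin n → Bool
    h u v = (part u ≡ᵇ part v) ∧ not (u == v)
    ≡ᵇ-sym : ∀ a b → (a ≡ᵇ b) ≡ (b ≡ᵇ a)
    ≡ᵇ-sym a b = bool-ext (λ e → ≡ᵇ-complete (sym (≡ᵇ-sound {a} e))) (λ e → ≡ᵇ-complete (sym (≡ᵇ-sound {b} e)))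
    h-sym : ∀ u v → h u v ≡ h v u
    h-sym u v = cong₂ (λ x y → x ∧ not y) (≡ᵇ-sym (part u) (part v)) (bool-ext (λ e → trans (cong (_== u) (sym (==-sound {u} {v} e))) (==-refl u)) (λ e → trans (cong (_== v) (sym (==-sound {v} {u} e))) (==-refl v)))
    ∧-false : ∀ a b → b ≡ true → a ∧ not b ≡ false
    ∧-false true _ refl = refl
    ∧-false false _ refl = refl
    h-irr : ∀ u → h u u ≡ false
    h-irr u = ∧-false (part u ≡ᵇ part u) (u == u) (==-refl u)
    h-part : ∀ u v → part u ≢ part v → h u v ≡ false
    h-part u v f = cong (_∧ not (u == v)) (not-true (λ e → f (≡ᵇ-sound e)))
    h-partner : ∀ u → h u (partner u) ≡ true
    h-partner u = cong₂ (λ x y → x ∧ not y) (≡ᵇ-complete (sym (same u))) (==-≢ (≢-sym (ne u)))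
    h-only : ∀ u v → v ≢ partner u → h u v ≡ false
    h-only u v v≢ with u ≟ᶠ v
    ... | yes refl = ∧-false′ (part u ≡ᵇ part u)
      where
      ∧-false′ : ∀ a → a ∧ false ≡ false
      ∧-false′ true = refl
      ∧-false′ false = refl
    ... | no n₁ = cong (_∧ true) (not-true (λ e → [ (λ q → n₁ (sym q)) , v≢ ]′ (only u v (≡ᵇ-sound e))))
    degree : ∀ σ u → xsum (λ c → h u (σ ! c)) (allFin n) ≡ true
    degree σ u = xsum-one {c₀ = σ ⟨$⟩ˡ partner u} (allFin n) (Uₚ.allFin⁺ n) (∈-allFin _) (trans (cong (h u) (inverseʳ σ)) (h-partner u))
      (λ c ne′ → h-only u (σ ! c) (λ e → ne′ (trans (sym (inverseˡ σ)) (cong (σ ⟨$⟩ˡ_) e))))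

-- Distance levels along a bridge.

module BridgeLevels {n : ℕ} (X : Graph n) (simple : IsSimple X) where

  open GraphTheory X simple
  open Entries X simple
  open Claws X simple

  -- Level 0 is the near side, the levels 1 to k are single vertices, and level k + 1 is the far
  -- side. This covers cut-vertices and longer bridges alike.
  record Levels (k : ℕ) : Set where
    field
      ℓ : Fin n → ℕ
      close : ∀ {u v} → Adj X u v → ℓ u ≤ suc (ℓ v)
      narrow : ∀ {u v} → ℓ u ≡ ℓ v → 1 ≤ ℓ u → ℓ u ≤ k → u ≡ v
      reached : ∀ j → j ≤ suc k → ∃ λ x → ℓ x ≡ j

  cut-levels : HasCutVertex X → Levels 1
  cut-levels (w , u , v , u≢w , v≢w , _ , cut) = record { ℓ = ℓ ; close = close ; narrow = narrow ; reached = reached }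
    where
    R = AdjMinusVertex X w
    reach? = star? {R = R} (λ a b → adj? a b ×-dec (¬? (a ≟ᶠ w) ×-dec ¬? (b ≟ᶠ w))) u
    level : ∀ {x} → Dec (x ≡ w) → Dec (Star R u x) → ℕ
    level (yes _) _ = 1
    level (no _) (yes _) = 0
    level (no _) (no _) = 2
    ℓ : Fin n → ℕ
    ℓ x = level (x ≟ᶠ w) (reach? x)
    close : ∀ {x y} → Adj X x y → ℓ x ≤ suc (ℓ y)
    close {x} {y} e with x ≟ᶠ w | reach? x | y ≟ᶠ w | reach? y
    ... | yes _ | _ | _ | _ = s≤s z≤n
    ... | no _ | yes _ | _ | _ = z≤n
    ... | no _ | no _ | yes _ | _ = ≤-refl
    ... | no _ | no _ | no _ | no _ = ℕₚ.n≤1+n 2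
    ... | no a | no b | no c | yes d = ⊥-elim (b (d ◅◅ ((adj-sym e , c , a) ◅ ε)))
    narrow : ∀ {x y} → ℓ x ≡ ℓ y → 1 ≤ ℓ x → ℓ x ≤ 1 → x ≡ y
    narrow {x} {y} e p q with x ≟ᶠ w | reach? x | y ≟ᶠ w | reach? y
    ... | yes a | _ | yes b | _ = trans a (sym b)
    ... | yes _ | _ | no _ | yes _ = case e of λ ()
    ... | yes _ | _ | no _ | no _ = case e of λ ()
    ... | no _ | yes _ | _ | _ = ⊥-elim (ℕₚ.<⇒≱ p z≤n)
    ... | no _ | no _ | _ | _ = ⊥-elim (ℕₚ.<⇒≱ ≤-refl q)
    reached : ∀ j → j ≤ 2 → ∃ λ x → ℓ x ≡ j
    reached zero _ = u , zero-at
      where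
      zero-at : ℓ u ≡ 0
      zero-at with u ≟ᶠ w | reach? u
      ... | yes e | _ = ⊥-elim (u≢w e)
      ... | no _ | yes _ = refl
      ... | no _ | no h = ⊥-elim (h ε)
    reached (suc zero) _ = w , one-at
      where
      one-at : ℓ w ≡ 1
      one-at with w ≟ᶠ w
      ... | yes _ = refl
      ... | no h = ⊥-elim (h refl)
    reached (suc (suc zero)) _ = v , two-at
      where
      two-at : ℓ v ≡ 2
      two-at with v ≟ᶠ w | reach? v
      ... | yes e | _ = ⊥-elim (v≢w e)
      ... | no _ | yes h = ⊥-elim (cut h)
      ... | no _ | no _ = refl
    reached (suc (suc (suc _))) (s≤s (s≤s ()))

  bridge-levels : ∀ m → HasBridge X (suc (suc m)) → Levels (suc (suc m))
  bridge-levels m (v , inj , cut , deg2 , deg₀ , degₗ) = record { ℓ = ℓ ; close = close ; narrow = narrow ; reached = reached }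
    where
    k = suc (suc m)
    R = AdjMinusEdge X (v F.zero) (v (F.suc F.zero))
    reach? = star? {R = R} (λ a b → adj? a b ×-dec ¬? (((a ≟ᶠ v F.zero) ×-dec (b ≟ᶠ v (F.suc F.zero))) ⊎-dec ((a ≟ᶠ v (F.suc F.zero)) ×-dec (b ≟ᶠ v F.zero)))) (v F.zero)
    on? : ∀ x → Dec (∃ λ j → v j ≡ x)
    on? x = any? (λ j → v j ≟ᶠ x)
    level : ∀ {x} → Dec (∃ λ j → v j ≡ x) → Dec (Star R (v F.zero) x) → ℕ
    level (yes (j , _)) _ = suc (toℕ j)
    level (no _) (yes _) = 0
    level (no _) (no _) = suc k
    ℓ : Fin n → ℕ
    ℓ x = level (on? x) (reach? x)
    ℓ-on : ∀ j → ℓ (v j) ≡ suc (toℕ j)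
    ℓ-on j with on? (v j)
    ... | yes (i , e) = cong (suc ∘ toℕ) (inj e)
    ... | no h = ⊥-elim (h (j , refl))
    ℓ-near : ∀ {x} → ¬ (∃ λ j → v j ≡ x) → Star R (v F.zero) x → ℓ x ≡ 0
    ℓ-near {x} a b with on? x | reach? x
    ... | yes p | _ = ⊥-elim (a p)
    ... | no _ | yes _ = refl
    ... | no _ | no q = ⊥-elim (q b)
    ℓ-far : ∀ {x} → ¬ (∃ λ j → v j ≡ x) → ¬ Star R (v F.zero) x → ℓ x ≡ suc k
    ℓ-far {x} a b with on? x | reach? x
    ... | yes p | _ = ⊥-elim (a p)
    ... | no _ | yes q = ⊥-elim (b q)
    ... | no _ | no _ = refl
    link : ∀ (i : Fin (suc m)) → Adj X (v (inject₁ i)) (v (F.suc i))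
    link i = proj₁ (cut i)
    -- If a later bridge vertex could be reached without the first edge, walking back along the
    -- bridge would reach the second vertex that way too, and the first edge would be no cut-edge.
    beyond : ∀ (j : Fin (suc m)) → ¬ Star R (v F.zero) (v (F.suc j))
    beyond j = go (toℕ j) j refl
      where
      go : ∀ d (j : Fin (suc m)) → toℕ j ≡ d → ¬ Star R (v F.zero) (v (F.suc j))
      go _ F.zero _ s = proj₂ (cut F.zero) s
      go (suc d) (F.suc j) e s = go d (inject₁ j) (trans (Fₚ.toℕ-inject₁ j) (ℕₚ.suc-injective e)) (s ◅◅ ((adj-sym (link (F.suc j))
        , [ (λ { (p , _) → case inj p of λ () }) , (λ { (p , _) → case inj p of λ () }) ]′) ◅ ε))
    off-step : ∀ {x y} → Adj X x y → (¬ (∃ λ j → v j ≡ x)) ⊎ (¬ (∃ λ j → v j ≡ y)) → Star R (v F.zero) x → Star R (v F.zero) y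
    off-step e (inj₁ h) s = s ◅◅ ((e , [ (λ { (p , _) → h (_ , sym p) }) , (λ { (p , _) → h (_ , sym p) }) ]′) ◅ ε)
    off-step e (inj₂ h) s = s ◅◅ ((e , [ (λ { (_ , p) → h (_ , sym p) }) , (λ { (_ , p) → h (_ , sym p) }) ]′) ◅ ε)
    inner : ∀ (j : Fin m) {y} → Adj X (v (F.suc (inject₁ j))) y → y ≡ v (F.suc (F.suc j)) ⊎ y ≡ v (inject₁ (inject₁ j))
    inner j e = deg2-neighbours (λ h → case cong toℕ (inj h) of λ q → ℕₚ.<⇒≢ (ℕₚ.m≤n⇒m≤1+n (s≤s (≤-reflexive (trans (Fₚ.toℕ-inject₁ (inject₁ j)) (Fₚ.toℕ-inject₁ j))))) (sym q))
      (link (F.suc j)) (adj-sym (link (inject₁ j))) (deg2 j) e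
    data Place : Fin (suc (suc m)) → Set where
      first : Place F.zero
      middle : ∀ (j : Fin m) → Place (F.suc (inject₁ j))
      final : Place (fromℕ (suc m))
    place : ∀ {m} (j : Fin (suc m)) → (∃ λ (i : Fin m) → j ≡ inject₁ i) ⊎ j ≡ fromℕ m
    place {zero} F.zero = inj₂ refl
    place {suc m} F.zero = inj₁ (F.zero , refl)
    place {suc m} (F.suc j) with place j
    ... | inj₁ (i , e) = inj₁ (F.suc i , cong F.suc e)
    ... | inj₂ e = inj₂ (cong F.suc e)
    where-is : ∀ j → Place j
    where-is F.zero = first
    where-is (F.suc j) with place j
    ... | inj₁ (i , refl) = middle i
    ... | inj₂ refl = final
    apart : ∀ i j → Adj X (v i) (v j) → toℕ i < toℕ j → suc (toℕ i) ≡ toℕ j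
    apart i j e lt with where-is i
    apart .F.zero (F.suc F.zero) e lt | first = refl
    apart .F.zero (F.suc (F.suc j)) e lt | first = ⊥-elim (beyond (F.suc j)
      ((e , [ (λ { (_ , p) → case inj p of λ () }) , (λ { (p , _) → case inj p of λ () }) ]′) ◅ ε))
    apart .(F.suc (inject₁ i)) j e lt | middle i with inner i e
    ... | inj₁ p = trans (cong (suc ∘ suc) (Fₚ.toℕ-inject₁ i)) (cong toℕ (sym (inj p)))
    ... | inj₂ p = ⊥-elim (ℕₚ.<-asym lt (subst (λ z → toℕ z < suc (toℕ (inject₁ i))) (sym (inj p)) (s≤s (≤-reflexive (Fₚ.toℕ-inject₁ (inject₁ i))))))
    apart .(fromℕ (suc m)) j e lt | final = ⊥-elim (ℕₚ.<⇒≱ lt (subst (toℕ j ≤_) (sym (Fₚ.toℕ-fromℕ (suc m))) (ℕₚ.≤-pred (toℕ<n j))))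
    exit-near : ∀ {j y} → ¬ (∃ λ i → v i ≡ y) → Adj X (v j) y → (j ≡ F.zero × Star R (v F.zero) y) ⊎ (j ≡ fromℕ (suc m) × ¬ Star R (v F.zero) y)
    exit-near {j} {y} off e with where-is j
    ... | first = inj₁ (refl , off-step e (inj₂ off) ε)
    ... | middle i = ⊥-elim (off ([ (λ p → _ , sym p) , (λ p → _ , sym p) ]′ (inner i e)))
    ... | final = inj₂ (refl , λ s → beyond (fromℕ m) (off-step (adj-sym e) (inj₁ off) s))
    close : ∀ {x y} → Adj X x y → ℓ x ≤ suc (ℓ y)
    close {x} {y} e with on? x | on? y
    ... | yes (i , refl) | yes (j , refl) with ℕₚ.<-cmp (toℕ j) (toℕ i)
    ... | tri< l _ _ = s≤s (≤-reflexive (sym (apart j i (adj-sym e) l)))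
    ... | tri≈ _ q _ = s≤s (ℕₚ.m≤n⇒m≤1+n (≤-reflexive (sym q)))
    ... | tri> _ _ l = s≤s (ℕₚ.m≤n⇒m≤1+n (ℕₚ.<⇒≤ l))
    close {x} {y} e | yes (i , refl) | no h with exit-near h e
    ... | inj₁ (refl , s) = s≤s z≤n
    ... | inj₂ (refl , ¬s) with reach? y
    ... | yes s = ⊥-elim (¬s s)
    ... | no _ = s≤s (ℕₚ.m≤n⇒m≤1+n (ℕₚ.<⇒≤ (toℕ<n (fromℕ (suc m)))))
    close {x} {y} e | no h | yes (j , refl) with exit-near h (adj-sym e)
    ... | inj₁ (refl , s) with reach? x
    ... | yes _ = z≤n
    ... | no ¬s = ⊥-elim (¬s s)
    close {x} {y} e | no h | yes (j , refl) | inj₂ (refl , ¬s) with reach? x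
    ... | yes _ = z≤n
    ... | no _ = s≤s (s≤s (≤-reflexive (cong suc (sym (Fₚ.toℕ-fromℕ m)))))
    close {x} {y} e | no h | no h′ with reach? x | reach? y
    ... | yes _ | _ = z≤n
    ... | no ¬s | yes s = ⊥-elim (¬s (off-step (adj-sym e) (inj₁ h′) s))
    ... | no _ | no _ = ℕₚ.n≤1+n _
    narrow : ∀ {x y} → ℓ x ≡ ℓ y → 1 ≤ ℓ x → ℓ x ≤ k → x ≡ y
    narrow {x} {y} e p q with on? x | on? y | reach? x
    narrow e p q | no _ | _ | yes _ = ⊥-elim (ℕₚ.<⇒≱ p z≤n)
    narrow e p q | no _ | _ | no _ = ⊥-elim (ℕₚ.<⇒≱ ≤-refl q)
    narrow e p q | yes (i , refl) | yes (j , refl) | _ = cong v (toℕ-injective (ℕₚ.suc-injective e))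
    narrow {x} {y} e p q | yes (i , refl) | no _ | _ with reach? y
    ... | yes _ = case e of λ ()
    ... | no _ = ⊥-elim (ℕₚ.<⇒≢ (toℕ<n i) (ℕₚ.suc-injective e))
    reached : ∀ j → j ≤ suc k → ∃ λ x → ℓ x ≡ j
    reached zero _ = y , ℓ-near off (off-step e (inj₂ off) ε)
      where
      other = other-neighbour (link F.zero) deg₀
      y = proj₁ other
      e = proj₁ (proj₂ other)
      off : ¬ (∃ λ j → v j ≡ y)
      off (F.zero , h) = adj-≢ e h
      off (F.suc F.zero , h) = proj₂ (proj₂ other) (sym h)
      off (F.suc (F.suc j) , h) = case apart F.zero (F.suc (F.suc j)) (subst (Adj X (v F.zero)) (sym h) e) (s≤s z≤n) of λ ()
    reached (suc j) (s≤s le) with j ℕ.<? k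
    ... | yes lt = v (fromℕ< lt) , trans (ℓ-on _) (cong suc (toℕ-fromℕ< lt))
    ... | no ge = y , trans (ℓ-far off (λ s → beyond (fromℕ m) (off-step (adj-sym e) (inj₁ off) s))) (cong suc (ℕₚ.≤-antisym (ℕₚ.≮⇒≥ ge) le))
      where
      other = other-neighbour (adj-sym (link (fromℕ m))) degₗ
      y = proj₁ other
      e = proj₁ (proj₂ other)
      off : ¬ (∃ λ j → v j ≡ y)
      off (i , h) with ℕₚ.<-cmp (toℕ i) (toℕ (fromℕ (suc m)))
      ... | tri< l _ _ = proj₂ (proj₂ other) (trans (sym h) (cong v (toℕ-injective (ℕₚ.suc-injective (trans (apart i (fromℕ (suc m)) (subst (λ z → Adj X z _) (sym h) (adj-sym e)) l) (cong suc (sym (Fₚ.toℕ-inject₁ (fromℕ m)))))))))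
      ... | tri≈ _ q _ = adj-≢ (adj-sym e) (trans (sym h) (cong v (toℕ-injective q)))
      ... | tri> _ _ l = ℕₚ.<⇒≱ l (subst (toℕ i ≤_) (sym (Fₚ.toℕ-fromℕ (suc m))) (ℕₚ.≤-pred (toℕ<n i)))

  levels : ∀ {k} → HasBridge X k → Levels k
  levels {suc zero} = cut-levels
  levels {suc (suc m)} = bridge-levels m

  -- A bridge of n - 2 vertices has n occupied levels, so each level is a single vertex, and no
  -- vertex has more than one neighbour above and one below.
  claw-no-long-bridge : Claw → 2 ≤ n → ¬ HasBridge X (n ∸ 2)
  claw-no-long-bridge (claw c b₁ b₂ b₃ e₁ e₂ e₃ d₁₂ d₁₃ d₂₃) 2≤n hb = three (side e₁) (side e₂) (side e₃)
    where
    open Levels (levels hb)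
    at : Fin n → Fin n
    at i = proj₁ (reached (toℕ i) (ℕₚ.≤-pred (≤-trans (toℕ<n i) (≤-reflexive (trans (sym (ℕₚ.m∸n+n≡m 2≤n)) (ℕₚ.+-comm (n ∸ 2) 2))))))
    at-level : ∀ i → ℓ (at i) ≡ toℕ i
    at-level i = proj₂ (reached (toℕ i) _)
    all-at : ∀ x → ∃ λ i → x ≡ at i
    all-at x = let i , _ , e = ∈-map⁻ at (∈-of-full (Uₚ.map⁺ (λ {i} {j} e → toℕ-injective (trans (sym (at-level i)) (trans (cong ℓ e) (at-level j)))) (Uₚ.allFin⁺ n))
                       (≤-reflexive (sym (trans (Lₚ.length-map at (allFin n)) (Lₚ.length-tabulate {n = n} id)))) x) in i , e
    ℓ-inj : ∀ {x y} → ℓ x ≡ ℓ y → x ≡ y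
    ℓ-inj {x} {y} e with all-at x | all-at y
    ... | i , refl | j , refl = cong at (toℕ-injective (trans (sym (at-level i)) (trans e (at-level j))))
    side : ∀ {b} → Adj X c b → ℓ b ≡ suc (ℓ c) ⊎ suc (ℓ b) ≡ ℓ c
    side {b} e with ℕₚ.<-cmp (ℓ b) (ℓ c)
    ... | tri< l _ _ = inj₂ (ℕₚ.≤-antisym l (close e))
    ... | tri≈ _ q _ = ⊥-elim (adj-≢ e (sym (ℓ-inj q)))
    ... | tri> _ _ l = inj₁ (ℕₚ.≤-antisym (close (adj-sym e)) l)
    up : ∀ {x y} → ℓ x ≡ suc (ℓ c) → ℓ y ≡ suc (ℓ c) → x ≡ y
    up p q = ℓ-inj (trans p (sym q))
    down : ∀ {x y} → suc (ℓ x) ≡ ℓ c → suc (ℓ y) ≡ ℓ c → x ≡ y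
    down p q = ℓ-inj (ℕₚ.suc-injective (trans p (sym q)))
    three : ℓ b₁ ≡ suc (ℓ c) ⊎ suc (ℓ b₁) ≡ ℓ c → ℓ b₂ ≡ suc (ℓ c) ⊎ suc (ℓ b₂) ≡ ℓ c → ℓ b₃ ≡ suc (ℓ c) ⊎ suc (ℓ b₃) ≡ ℓ c → ⊥
    three (inj₁ p) (inj₁ q) _ = d₁₂ (up p q)
    three (inj₁ p) (inj₂ q) (inj₁ r) = d₁₃ (up p r)
    three (inj₁ p) (inj₂ q) (inj₂ r) = d₂₃ (down q r)
    three (inj₂ p) (inj₁ q) (inj₁ r) = d₂₃ (up q r)
    three (inj₂ p) (inj₁ q) (inj₂ r) = d₁₃ (down p r)
    three (inj₂ p) (inj₂ q) _ = d₁₂ (down p q)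

-- A person t of a class with k outsiders cannot cross a k-bridge: standing at
-- level l it keeps at least l outsiders on the near side.
module BridgeNecessity {n : ℕ} (X : Graph n) (simple : IsSimple X) (part : Fin n → ℕ) {k : ℕ} (hb : HasBridge X k)
  (t : Fin n) (few : ∀ xs → Unique xs → (∀ {x} → x ∈ xs → part x ≢ part t) → length xs ≤ k) where

  open GraphTheory X simple
  open FSCore X simple part
  open Necessity X simple part
  open BridgeLevels X simple
  open Levels (levels hb)

  home : Permutation′ n → Fin n → ℕ
  home σ p = ℓ (σ ⟨$⟩ˡ p)

  at-home : ∀ σ {x p} → σ ! x ≡ p → home σ p ≡ ℓ x
  at-home σ {x} {p} refl = cong ℓ (inverseˡ σ)

  -- A witness that at least `l` outsiders stand strictly nearer than level `l`; it is a lower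
  -- bound, so it may be kept while other people move.
  record Behind (σ : Permutation′ n) (l : ℕ) : Set where
    constructor behind
    field
      people : List (Fin n)
      unique : Unique people
      apart : ∀ {x} → x ∈ people → part x ≢ part t
      lower : ∀ {x} → x ∈ people → home σ x < l
      many : l ≤ length people

  Kept : Permutation′ n → Set
  Kept σ = home σ t ≤ k × Behind σ (home σ t)

  resp : ∀ {σ ρ} → σ ≗ₚ ρ → Kept σ → Kept ρ
  resp {σ} {ρ} e (le , behind xs u a l m) = subst (_≤ k) (same t) le , behind xs u a (λ {x} h → subst₂ _<_ (same x) (same t) (l h)) (subst (_≤ length xs) (same t) m)
    where
    same : ∀ p → home σ p ≡ home ρ p
    same p = sym (at-home ρ (trans (sym (e _)) (inverseʳ σ)))

  module _ {σ ρ : Permutation′ n} {a b : Fin n} (ab : Adj X a b) (f : part (σ ! a) ≢ part (σ ! b)) (sw : Swapped σ ρ a b) where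

    open Swapped sw

    stay : ∀ p → p ≢ σ ! a → p ≢ σ ! b → home ρ p ≡ home σ p
    stay p na nb = at-home ρ (trans (else′ _ (λ e → na (trans (sym (inverseʳ σ)) (cong (σ !_) e))) (λ e → nb (trans (sym (inverseʳ σ)) (cong (σ !_) e)))) (inverseʳ σ))

    at-zero : σ ! a ≡ t → ℓ b ≡ 0 → Kept ρ
    at-zero ea eb = subst (_≤ k) (sym t-new) z≤n , behind [] [] (λ ()) (λ ()) (≤-reflexive t-new)
      where
      t-new : home ρ t ≡ 0
      t-new = trans (at-home ρ (trans at-b ea)) eb

    -- Moving up, `t` passes an outsider, who joins those behind; as there are at most `k`, level k
    -- + 1 stays out of reach. Moving down loses at most the one outsider that is passed.
    carried : σ ! a ≡ t → Kept σ → Kept ρ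
    carried ea (le , behind xs u ap lo many) = [ at-zero ea , go ]′ (zero-or-positive (ℓ b))
      where
      zero-or-positive : ∀ i → i ≡ 0 ⊎ 1 ≤ i
      zero-or-positive zero = inj₁ refl
      zero-or-positive (suc _) = inj₂ (s≤s z≤n)
      t-old : home σ t ≡ ℓ a
      t-old = at-home σ ea
      t-new : home ρ t ≡ ℓ b
      t-new = at-home ρ (trans at-b ea)
      many′ : ℓ a ≤ length xs
      many′ = subst (_≤ length xs) t-old many
      a≤k : ℓ a ≤ k
      a≤k = subst (_≤ k) t-old le
      below : ∀ {x} → x ∈ xs → home σ x < ℓ a
      below {x} h = subst (home σ x <_) t-old (lo h)
      not-t : ∀ {x} → x ∈ xs → x ≢ σ ! a
      not-t h e = ap h (cong part (trans e ea))
      go : 1 ≤ ℓ b → Kept ρ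
      go 1≤b with ℕₚ.<-cmp (ℓ a) (ℓ b)
      ... | tri< l _ _ = ≤-trans (≤-reflexive t-new) (≤-trans (close (adj-sym ab)) (≤-trans (s≤s many′) (few (σ ! b ∷ xs) u′ ap′)))
          , behind (σ ! b ∷ xs) u′ ap′ lo′ (≤-trans (≤-reflexive t-new) (≤-trans (close (adj-sym ab)) (s≤s many′)))
        where
        new : σ ! b ∉ xs
        new h = ℕₚ.<-asym l (subst (_< ℓ a) (at-home σ refl) (below h))
        u′ : Unique (σ ! b ∷ xs)
        u′ = unique-cons new u
        ap′ : ∀ {x} → x ∈ σ ! b ∷ xs → part x ≢ part t
        ap′ (here refl) e = f (trans (cong part ea) (sym e))
        ap′ (there h) = ap h
        lo′ : ∀ {x} → x ∈ σ ! b ∷ xs → home ρ x < home ρ t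
        lo′ (here refl) = subst₂ _<_ (sym (at-home ρ at-a)) (sym t-new) l
        lo′ {x} (there h) = subst₂ _<_ (sym (stay x (not-t h) (λ e → new (subst (_∈ xs) e h)))) (sym t-new) (ℕₚ.<-trans (below h) l)
      ... | tri≈ _ q _ = ⊥-elim (adj-≢ ab (narrow q (subst (1 ≤_) (sym q) 1≤b) a≤k))
      ... | tri> _ _ l = ≤-trans (≤-reflexive t-new) (≤-trans (ℕₚ.<⇒≤ l) a≤k) ,
          behind ys (Uₚ.filter⁺ kept? u) (λ h → ap (proj₁ (from h))) lo′ (≤-trans (≤-reflexive t-new) (ℕₚ.≤-pred (≤-trans l (≤-trans many′ (unique-⊆-length u into)))))
        where
        kept? : Decidable (λ x → x ≢ σ ! b)
        kept? x = ¬? (x ≟ᶠ σ ! b)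
        ys = filter kept? xs
        from : ∀ {x} → x ∈ ys → x ∈ xs × x ≢ σ ! b
        from = ∈-filter⁻ kept?
        into : ∀ {x} → x ∈ xs → x ∈ σ ! b ∷ ys
        into {x} h with x ≟ᶠ σ ! b
        ... | yes e = here e
        ... | no ne = there (∈-filter⁺ kept? h ne)
        lo′ : ∀ {x} → x ∈ ys → home ρ x < home ρ t
        lo′ {x} h = subst₂ _<_ (sym (stay x (not-t h′) ne)) (sym t-new) (ℕₚ.≤∧≢⇒< (ℕₚ.≤-pred (≤-trans (below h′) (close ab)))
            (λ e → ne (trans (sym (inverseʳ σ)) (cong (σ !_) (narrow e (subst (1 ≤_) (sym e) 1≤b) (≤-trans (≤-reflexive e) (≤-trans (ℕₚ.<⇒≤ l) a≤k)))))))
          where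
          h′ = proj₁ (from h)
          ne = proj₂ (from h)

    -- To overtake `t`, an outsider would first have to stand on the level of `t`, which is a single
    -- vertex occupied by `t`.
    watching : σ ! a ≢ t → σ ! b ≢ t → Kept σ → Kept ρ
    watching na nb (le , behind xs u ap lo many) = subst (_≤ k) (sym t-same) le , behind xs u ap lo′ (subst (_≤ length xs) (sym t-same) many)
      where
      t-same : home ρ t ≡ home σ t
      t-same = stay t (≢-sym na) (≢-sym nb)
      cross : ∀ {c d} → Adj X c d → σ ! d ≢ t → ℓ c < home σ t → ℓ d < home σ t
      cross cd ne l = ℕₚ.≤∧≢⇒< (≤-trans (close (adj-sym cd)) l) (λ e → ne (trans (cong (σ !_) (narrow e (subst (1 ≤_) (sym e) (≤-trans (s≤s z≤n) l)) (subst (_≤ k) (sym e) le))) (inverseʳ σ)))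
      lo′ : ∀ {x} → x ∈ xs → home ρ x < home ρ t
      lo′ {x} h with x ≟ᶠ σ ! a | x ≟ᶠ σ ! b
      ... | yes refl | _ = subst₂ _<_ (sym (at-home ρ at-b)) (sym t-same) (cross ab nb (subst (_< home σ t) (at-home σ refl) (lo h)))
      ... | no _ | yes refl = subst₂ _<_ (sym (at-home ρ at-a)) (sym t-same) (cross (adj-sym ab) na (subst (_< home σ t) (at-home σ refl) (lo h)))
      ... | no p | no q = subst₂ _<_ (sym (stay x p q)) (sym t-same) (lo h)

  kept-step : ∀ σ ρ a b → Adj X a b → part (σ ! a) ≢ part (σ ! b) → Swapped σ ρ a b → Kept σ → Kept ρ
  kept-step σ ρ a b ab f sw@(swapped p q o) with σ ! a ≟ᶠ t | σ ! b ≟ᶠ t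
  ... | yes e | _ = carried {σ} {ρ} ab f sw e
  ... | no _ | yes e = carried {σ} {ρ} (adj-sym ab) (f ∘ sym) (swapped q p (λ c x y → o c y x)) e
  ... | no x | no y = watching {σ} {ρ} ab f sw x y

  bridge-necessary : ¬ FSConnected X Y
  bridge-necessary fs = ℕₚ.<⇒≱ ≤-refl (subst (_≤ k) (trans (at-home (transpose v t) (tr-l v t)) (proj₂ far)) (proj₁ end))
    where
    near = reached 0 z≤n
    far = reached (suc k) ≤-refl
    v = proj₁ far
    t-home : home (transpose (proj₁ near) t) t ≡ 0
    t-home = trans (at-home (transpose (proj₁ near) t) (tr-l (proj₁ near) t)) (proj₂ near)
    end : Kept (transpose v t)
    end = preserved Kept (λ {σ} {ρ} → resp {σ} {ρ}) kept-step fs (transpose (proj₁ near) t) (transpose v t)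
      (subst (_≤ k) (sym t-home) z≤n , behind [] [] (λ ()) (λ ()) (≤-reflexive t-home))

-- θ₀ and one-factorizations of six points.

digit : ℕ → ℕ → ℕ
digit zero r = r ℕ.% 10
digit (suc i) r = digit i (r ℕ./ 10)

-- colour v x y is the colour of the pair {x, y} in a one-factorization of the
-- complete graph on the six vertices other than v, where the blank stands.
colour : Fin 7 → Fin 7 → Fin 7 → ℕ
colour v x y = digit (toℕ y) (V.lookup (V.lookup rows v) x)
  where
  -- Row `v`, entry `x`: the decimal digit of place `y`, counted from the right, is the colour of
  -- {x, y}. The digits belonging to `v` and to x = y are fillers.
  rows : Vec (Vec ℕ 7) 7
  rows = 
      (0 ∷ 4321000 ∷ 1432000 ∷ 3040210 ∷ 104320 ∷ 2010430 ∷ 203140 ∷ [])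
    ∷ (4321000 ∷ 0 ∷ 1432000 ∷ 3040201 ∷ 104302 ∷ 2010403 ∷ 203104 ∷ [])
    ∷ (3201040 ∷ 1320004 ∷ 0 ∷ 2430001 ∷ 4103020 ∷ 14032 ∷ 42013 ∷ [])
    ∷ (3200140 ∷ 1320004 ∷ 2430001 ∷ 0 ∷ 4100320 ∷ 10432 ∷ 40213 ∷ [])
    ∷ (3200140 ∷ 1302004 ∷ 2403001 ∷ 4100320 ∷ 0 ∷ 1432 ∷ 4213 ∷ [])
    ∷ (2010430 ∷ 4021003 ∷ 1032004 ∷ 3040210 ∷ 4321 ∷ 0 ∷ 3142 ∷ [])
    ∷ (203140 ∷ 321004 ∷ 432001 ∷ 40213 ∷ 104320 ∷ 10432 ∷ 0 ∷ []) ∷ []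

-- Sliding the blank from a to b carries the factorization at a to the one at b, up to renaming the colours.
recolour : Fin 7 → Fin 7 → ℕ → ℕ
recolour 1F 2F i = digit i 32014
recolour 2F 1F i = digit i 4312
recolour 4F 5F i = digit i 32140
recolour 5F 4F i = digit i 14320
recolour _ _ i = i

abstract
  -- The six edges other than 12 and 45 form a spanning tree of θ₀. Along them sliding keeps the
  -- colours, so the tables arise from the one at vertex 0, and only these two edges need a
  -- renaming.
  colour-slide : ∀ a b → θ₀ a b ≡ true → ∀ x → x ≢ a → ∀ y → y ≢ a → x ≢ y → colour b (transpose a b ! x) (transpose a b ! y) ≡ recolour a b (colour a x y)
  colour-slide = from-yes (Fₚ.all? λ a → Fₚ.all? λ b → (θ₀ a b ≟ᵇ true) →-dec Fₚ.all? λ x → ¬? (x ≟ᶠ a) →-dec Fₚ.all? λ y → ¬? (y ≟ᶠ a) →-dec (¬? (x ≟ᶠ y) →-dec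
    (colour b (transpose a b ! x) (transpose a b ! y) ℕ.≟ recolour a b (colour a x y))))

-- Whether two disjoint pairs of tokens have equal colours is unaffected by renaming colours, hence
-- by every slide. The permutations of six points that respect a one-factorization form the
-- exceptional group PGL(2,5), not all of S₆.
theta-necessary : (X : Graph 7) (simple : IsSimple X) (part : Fin 7 → ℕ) → (∀ {u v} → u ≢ F.zero → v ≢ F.zero → part u ≡ part v) →
  Iso X θ₀ → ¬ FSConnected X (FSCore.Y X simple part)
theta-necessary X simple part tokens (f , iso) fs = case trans (sym (colour-≡ {v' = 0F} {x' = 1F} {y' = 3F} (at 0F 0F refl) (at 1F 1F refl) (at 2F 3F refl))) (trans broken (colour-≡ {v' = 0F} {x' = 2F} {y' = 5F} (at 0F 0F refl) (at 3F 2F refl) (at 5F 5F refl))) of λ ()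
  where
  open GraphTheory X simple
  open FSCore X simple part
  open Necessity X simple part
  colour-≡ : ∀ {v v' x x' y y'} → v ≡ v' → x ≡ x' → y ≡ y' → colour v x y ≡ colour v' x' y'
  colour-≡ refl refl refl = refl
  place : Permutation′ 7 → Fin 7 → Fin 7
  place σ p = f ! (σ ⟨$⟩ˡ p)
  place-at : ∀ σ {x p} → σ ! x ≡ p → place σ p ≡ f ! x
  place-at σ refl = cong (f !_) (inverseˡ σ)
  place-inj : ∀ σ {p q} → place σ p ≡ place σ q → p ≡ q
  place-inj σ {p} {q} e = trans (sym (inverseʳ σ)) (trans (cong (σ !_) (!-inj f e)) (inverseʳ σ))
  Kept : Permutation′ 7 → Set
  Kept σ = colour (place σ 0F) (place σ 1F) (place σ 2F) ≡ colour (place σ 0F) (place σ 3F) (place σ 5F)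
  resp : ∀ {σ ρ} → σ ≗ₚ ρ → Kept σ → Kept ρ
  resp {σ} {ρ} e k = trans (colour-≡ (same 0F) (same 1F) (same 2F)) (trans k (sym (colour-≡ (same 0F) (same 3F) (same 5F))))
    where
    same : ∀ p → place ρ p ≡ place σ p
    same p = place-at ρ (trans (sym (e _)) (inverseʳ σ))
  slide : ∀ {σ ρ a b} → Adj X a b → Swapped σ ρ a b → σ ! a ≡ 0F → Kept σ → Kept ρ
  slide {σ} {ρ} {a} {b} ab (swapped ea eb eo) e₀ k = trans (recoloured 1F 2F (λ ()) (λ ()) λ ()) (trans (cong (recolour (f ! a) (f ! b)) k) (sym (recoloured 3F 5F (λ ()) (λ ()) λ ())))
    where
    a-place : place σ 0F ≡ f ! a
    a-place = place-at σ e₀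
    place-ρ : ∀ p → place ρ p ≡ transpose (f ! a) (f ! b) ! place σ p
    place-ρ p with tr-cases a b (σ ⟨$⟩ˡ p)
    ... | inj₁ (h , _) = trans (place-at ρ (trans eb (trans (cong (σ !_) (sym h)) (inverseʳ σ)))) (sym (trans (cong (λ z → transpose (f ! a) (f ! b) ! (f ! z)) h) (tr-l (f ! a) (f ! b))))
    ... | inj₂ (inj₁ (h , _)) = trans (place-at ρ (trans ea (trans (cong (σ !_) (sym h)) (inverseʳ σ)))) (sym (trans (cong (λ z → transpose (f ! a) (f ! b) ! (f ! z)) h) (tr-r (f ! a) (f ! b))))
    ... | inj₂ (inj₂ (h , h′ , _)) = trans (place-at ρ (trans (eo _ h h′) (inverseʳ σ))) (sym (tr-o (f ! a) (f ! b) (h ∘ !-inj f) (h′ ∘ !-inj f)))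
    recoloured : ∀ p q → p ≢ 0F → q ≢ 0F → p ≢ q → colour (place ρ 0F) (place ρ p) (place ρ q) ≡ recolour (f ! a) (f ! b) (colour (place σ 0F) (place σ p) (place σ q))
    recoloured p q p≢0 q≢0 p≢q = trans (colour-≡ (trans (place-ρ 0F) (trans (cong (transpose (f ! a) (f ! b) !_) a-place) (tr-l (f ! a) (f ! b)))) (place-ρ p) (place-ρ q))
      (trans (colour-slide (f ! a) (f ! b) (trans (sym (iso a b)) ab) (place σ p) (λ e → p≢0 (place-inj σ (trans e (sym a-place)))) (place σ q) (λ e → q≢0 (place-inj σ (trans e (sym a-place)))) (p≢q ∘ place-inj σ))
        (cong (recolour (f ! a) (f ! b)) (colour-≡ {x = place σ p} {y = place σ q} (sym a-place) refl refl)))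
  step-kept : ∀ σ ρ a b → Adj X a b → part (σ ! a) ≢ part (σ ! b) → Swapped σ ρ a b → Kept σ → Kept ρ
  step-kept σ ρ a b ab ne sw@(swapped ea eb eo) with σ ! a ≟ᶠ 0F | σ ! b ≟ᶠ 0F
  ... | yes e | _ = slide {σ} {ρ} ab sw e
  ... | no _ | yes e = slide {σ} {ρ} (adj-sym ab) (swapped eb ea (λ c x y → eo c y x)) e
  ... | no x | no y = ⊥-elim (ne (tokens x y))
  τ : Permutation′ 7
  -- Before this exchange {1, 2} and {3, 5} both have colour 0; after it these people stand on {1,
  -- 3} and {2, 5}, of colours 1 and 4.
  τ = f ∘ₚ transpose 2F 3F
  at : ∀ p q → transpose 2F 3F ! q ≡ p → place τ p ≡ q
  at p q e = trans (place-at τ {f ⟨$⟩ˡ q} (trans (cong (transpose 2F 3F !_) (inverseʳ f)) e)) (inverseʳ f)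
  start : ∀ p → place f p ≡ p
  start p = inverseʳ f
  broken : Kept τ
  broken = preserved Kept (λ {σ} {ρ} → resp {σ} {ρ}) step-kept fs f τ
    (trans (colour-≡ {v' = 0F} {x' = 1F} {y' = 2F} (start 0F) (start 1F) (start 2F)) (sym (colour-≡ {v' = 0F} {x' = 3F} {y' = 5F} (start 0F) (start 3F) (start 5F))))

-- Classes given by consecutive intervals of numbers.

class : ∀ {t} → Vec ℕ t → ℕ → ℕ
class ks = partOf (V.toList ks)

module _ {t : ℕ} {k : ℕ} {ks : Vec ℕ t} where

  class-low : ∀ {x} → x < k → class (k ∷ ks) x ≡ 0
  class-low h rewrite <ᵇ-true h = refl

  class-high : ∀ {x} → k ≤ x → class (k ∷ ks) x ≡ suc (class ks (x ∸ k))
  class-high h rewrite <ᵇ-false h = refl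

-- The place of `x` within its class. Class and offset determine `x`, which bounds the size of a
-- class by the largest entry.
offset : ∀ {t} → Vec ℕ t → ℕ → ℕ
offset [] x = x
offset (k ∷ ks) x = if x <ᵇ k then x else offset ks (x ∸ k)

module _ {t : ℕ} {k : ℕ} {ks : Vec ℕ t} where

  offset-low : ∀ {x} → x < k → offset (k ∷ ks) x ≡ x
  offset-low h rewrite <ᵇ-true h = refl

  offset-high : ∀ {x} → k ≤ x → offset (k ∷ ks) x ≡ offset ks (x ∸ k)
  offset-high h rewrite <ᵇ-false h = refl

∸-<-sum : ∀ {x} k s → k ≤ x → x < k + s → x ∸ k < s
∸-<-sum {x} k s le lt = subst (x ∸ k <_) (ℕₚ.m+n∸m≡n k s) (ℕₚ.∸-monoˡ-< lt le)

offset-< : ∀ {t} (ks : Vec ℕ t) {M x} → x < V.sum ks → (∀ i → V.lookup ks i ≤ M) → offset ks x < M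
offset-< (k ∷ ks) {M} {x} lt le with x ℕ.<? k
... | yes p = subst (_< M) (sym (offset-low {ks = ks} p)) (≤-trans p (le F.zero))
... | no p = subst (_< M) (sym (offset-high {ks = ks} (ℕₚ.≮⇒≥ p))) (offset-< ks (∸-<-sum k (V.sum ks) (ℕₚ.≮⇒≥ p) lt) (le ∘ F.suc))

class-offset-injective : ∀ {t} (ks : Vec ℕ t) {x y} → class ks x ≡ class ks y → offset ks x ≡ offset ks y → x ≡ y
class-offset-injective [] c o = o
class-offset-injective (k ∷ ks) {x} {y} c o with x ℕ.<? k | y ℕ.<? k
... | yes p | yes q = trans (sym (offset-low {ks = ks} p)) (trans o (offset-low {ks = ks} q))
... | yes p | no q = case trans (sym (class-low {ks = ks} p)) (trans c (class-high {ks = ks} (ℕₚ.≮⇒≥ q))) of λ ()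
... | no p | yes q = case trans (sym (class-low {ks = ks} q)) (trans (sym c) (class-high {ks = ks} (ℕₚ.≮⇒≥ p))) of λ ()
... | no p | no q = trans (sym (ℕₚ.m+[n∸m]≡n (ℕₚ.≮⇒≥ p))) (trans (cong (k +_) (class-offset-injective ks
    (ℕₚ.suc-injective (trans (sym (class-high {ks = ks} (ℕₚ.≮⇒≥ p))) (trans c (class-high {ks = ks} (ℕₚ.≮⇒≥ q)))))
    (trans (sym (offset-high {ks = ks} (ℕₚ.≮⇒≥ p))) (trans o (offset-high {ks = ks} (ℕₚ.≮⇒≥ q)))))) (ℕₚ.m+[n∸m]≡n (ℕₚ.≮⇒≥ q)))

last≤sum : ∀ {t} (ks : Vec ℕ t) → lastK ks ≤ V.sum ks
last≤sum [] = z≤n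
last≤sum (k ∷ []) = ℕₚ.m≤m+n k 0
last≤sum (k ∷ l ∷ ks) = ≤-trans (last≤sum (l ∷ ks)) (ℕₚ.m≤n+m _ k)

class-last : ∀ {t} (ks : Vec ℕ (suc t)) {x} → V.sum ks ∸ lastK ks ≤ x → x < V.sum ks → class ks x ≡ t
class-last (k ∷ []) {x} le lt = class-low {ks = []} (subst (x <_) (ℕₚ.+-identityʳ k) lt)
class-last (k ∷ ks@(l ∷ ls)) {x} le lt = trans (class-high {ks = ks} k≤x) (cong suc (class-last ks
    (subst (_≤ x ∸ k) (ℕₚ.m+n∸m≡n k _) (ℕₚ.∸-monoˡ-≤ k le′)) (∸-<-sum k (V.sum ks) k≤x lt)))
  where
  le′ : k + (V.sum ks ∸ lastK ks) ≤ x
  le′ = subst (_≤ x) (ℕₚ.+-∸-assoc k (last≤sum ks)) le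
  k≤x : k ≤ x
  k≤x = ≤-trans (ℕₚ.m≤m+n k _) le′

Increasing : ∀ {t} → Vec ℕ t → Set
Increasing {t} ks = ∀ (i j : Fin t) → i F.≤ j → V.lookup ks i ≤ V.lookup ks j

≤-last : ∀ {t} (ks : Vec ℕ t) → Increasing ks → ∀ i → V.lookup ks i ≤ lastK ks
≤-last (k ∷ []) inc F.zero = ≤-refl
≤-last (k ∷ ks@(l ∷ _)) inc F.zero = ≤-trans (inc F.zero (F.suc F.zero) z≤n) (≤-last ks (λ i j h → inc (F.suc i) (F.suc j) (s≤s h)) F.zero)
≤-last (k ∷ ks@(l ∷ _)) inc (F.suc i) = ≤-last ks (λ i j h → inc (F.suc i) (F.suc j) (s≤s h)) i

gcdAll∣ : ∀ {t} (ks : Vec ℕ t) i → gcdAll ks ∣ V.lookup ks i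
gcdAll∣ (k ∷ ks) F.zero = GCD.gcd[m,n]∣m k (gcdAll ks)
gcdAll∣ (k ∷ ks) (F.suc i) = ∣-trans (GCD.gcd[m,n]∣n k (gcdAll ks)) (gcdAll∣ ks i)

last-lookup : ∀ {t} (ks : Vec ℕ (suc t)) → V.lookup ks (fromℕ t) ≡ lastK ks
last-lookup (k ∷ []) = refl
last-lookup (k ∷ l ∷ ks) = last-lookup (l ∷ ks)

-- When all classes have size two, these are the intervals {2i, 2i + 1}, and this is the involution
-- that exchanges their members.
partner : ℕ → ℕ
partner zero = 1
partner (suc zero) = 0
partner (suc (suc x)) = suc (suc (partner x))

partner-≢ : ∀ x → partner x ≢ x
partner-≢ (suc (suc x)) e = partner-≢ x (ℕₚ.suc-injective (ℕₚ.suc-injective e))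

partner-< : ∀ {t} (ks : Vec ℕ t) → (∀ i → V.lookup ks i ≡ 2) → ∀ {x} → x < V.sum ks → partner x < V.sum ks
partner-< (k ∷ ks) two {x} lt with two F.zero
partner-< (k ∷ ks) two {zero} lt | refl = s≤s (s≤s z≤n)
partner-< (k ∷ ks) two {suc zero} lt | refl = s≤s z≤n
partner-< (k ∷ ks) two {suc (suc x)} (s≤s (s≤s lt)) | refl = s≤s (s≤s (partner-< ks (two ∘ F.suc) lt))

class-partner : ∀ {t} (ks : Vec ℕ t) → (∀ i → V.lookup ks i ≡ 2) → ∀ x → class ks (partner x) ≡ class ks x
class-partner [] two x = refl
class-partner (k ∷ ks) two x with two F.zero
class-partner (k ∷ ks) two zero | refl = refl
class-partner (k ∷ ks) two (suc zero) | refl = refl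
class-partner (k ∷ ks) two (suc (suc x)) | refl = cong suc (class-partner ks (two ∘ F.suc) x)

partner-only : ∀ {t} (ks : Vec ℕ t) → (∀ i → V.lookup ks i ≡ 2) → ∀ {x y} → x < V.sum ks → y < V.sum ks → class ks x ≡ class ks y → y ≡ x ⊎ y ≡ partner x
partner-only (k ∷ ks) two {x} {y} lx ly e with two F.zero
partner-only (k ∷ ks) two {zero} {zero} lx ly e | refl = inj₁ refl
partner-only (k ∷ ks) two {zero} {suc zero} lx ly e | refl = inj₂ refl
partner-only (k ∷ ks) two {suc zero} {zero} lx ly e | refl = inj₂ refl
partner-only (k ∷ ks) two {suc zero} {suc zero} lx ly e | refl = inj₁ refl
partner-only (k ∷ ks) two {suc (suc x)} {suc (suc y)} (s≤s (s≤s lx)) (s≤s (s≤s ly)) e | refl =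
  [ inj₁ ∘ cong (suc ∘ suc) , inj₂ ∘ cong (suc ∘ suc) ]′ (partner-only ks (two ∘ F.suc) lx ly (ℕₚ.suc-injective e))
partner-only (k ∷ ks) two {zero} {suc (suc y)} lx ly () | refl
partner-only (k ∷ ks) two {suc zero} {suc (suc y)} lx ly () | refl
partner-only (k ∷ ks) two {suc (suc x)} {zero} lx ly () | refl
partner-only (k ∷ ks) two {suc (suc x)} {suc zero} lx ly () | refl

third-value : ∀ a b → ∃ λ c → c ≤ 2 × c ≢ a × c ≢ b
third-value a b with 0 ℕ.≟ a | 0 ℕ.≟ b | 1 ℕ.≟ a | 1 ℕ.≟ b
... | no p | no q | _ | _ = 0 , z≤n , p , q
... | _ | _ | no p | no q = 1 , s≤s z≤n , p , q
... | yes refl | _ | _ | yes refl = 2 , ≤-refl , (λ ()) , (λ ())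
... | _ | yes refl | yes refl | _ = 2 , ≤-refl , (λ ()) , (λ ())
... | yes refl | _ | yes () | _
... | _ | yes refl | _ | yes ()

injected-length : ∀ {A : Set} {m} {ys : List A} (g : Fin m → A) → (∀ {i j} → g i ≡ g j → i ≡ j) → (∀ i → g i ∈ ys) → m ≤ length ys
injected-length {m = m} {ys} g inj h = subst (_≤ length ys) (trans (Lₚ.length-map g (allFin m)) (Lₚ.length-tabulate {n = m} id))
  (unique-⊆-length (Uₚ.map⁺ inj (Uₚ.allFin⁺ m)) (λ p → let i , _ , e = ∈-map⁻ g p in subst (_∈ ys) (sym e) (h i)))

-- The general arguments applied to given class sizes.

module Multipartite {n t : ℕ} (X : Graph n) (simple : IsSimple X) (ks : Vec ℕ (suc (suc t))) (total : n ≡ V.sum ks)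
  (positive : ∀ i → 1 ≤ V.lookup ks i) (largest : ∀ i → V.lookup ks i ≤ lastK ks) where

  part : Fin n → ℕ
  part u = class ks (toℕ u)

  open GraphTheory X simple
  open FSCore X simple part
  open Necessity X simple part
  open Shapes X simple
  open Claws X simple
  open PathBridges X simple
  open Entries X simple
  open BridgeLevels X simple
  open ThreeClasses X simple part

  in-range : ∀ (u : Fin n) → toℕ u < V.sum ks
  in-range u = subst (toℕ u <_) total (toℕ<n u)

  1≤last : 1 ≤ lastK ks
  1≤last = ≤-trans (positive F.zero) (largest F.zero)

  last≤n : lastK ks ≤ n
  last≤n = subst (lastK ks ≤_) (sym total) (last≤sum ks)

  1≤n : 1 ≤ n
  1≤n = ≤-trans 1≤last last≤n

  part-last : ∀ (u : Fin n) → n ∸ lastK ks ≤ toℕ u → part u ≡ suc t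
  part-last u le = class-last ks (subst (λ m → m ∸ lastK ks ≤ toℕ u) total le) (in-range u)

  -- The largest class is the last interval, so its members are most easily named by counting from
  -- the end.
  from-end : ∀ i → 1 ≤ i → i ≤ lastK ks → Σ (Fin n) λ u → toℕ u ≡ n ∸ i × n ∸ lastK ks ≤ toℕ u
  from-end i 1≤i le = fromℕ< lt , toℕ-fromℕ< lt , subst (n ∸ lastK ks ≤_) (sym (toℕ-fromℕ< lt)) (ℕₚ.∸-monoʳ-≤ n le)
    where
    lt : n ∸ i < n
    lt = ℕₚ.∸-monoʳ-< {n} {i} {0} 1≤i (≤-trans le last≤n)

  from-end-≢ : ∀ i j {1≤i 1≤j i≤ j≤} → i ≢ j → proj₁ (from-end i 1≤i i≤) ≢ proj₁ (from-end j 1≤j j≤)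
  from-end-≢ i j {p} {q} {r} {s} ne e = ne (ℕₚ.∸-cancelˡ-≡ (≤-trans r last≤n) (≤-trans s last≤n)
    (trans (sym (proj₁ (proj₂ (from-end i p r)))) (trans (cong toℕ e) (proj₁ (proj₂ (from-end j q s))))))

  part-from-end : ∀ i j {1≤i 1≤j i≤ j≤} → part (proj₁ (from-end i 1≤i i≤)) ≡ part (proj₁ (from-end j 1≤j j≤))
  part-from-end i j {p} {q} {r} {s} = trans (part-last _ (proj₂ (proj₂ (from-end i p r)))) (sym (part-last _ (proj₂ (proj₂ (from-end j q s)))))

  class-size : ∀ {c xs} → Unique xs → (∀ {x} → x ∈ xs → part x ≡ c) → length xs ≤ lastK ks
  class-size u h = unique-length (λ {x} _ → fromℕ< (offset-< ks (in-range x) largest))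
    (λ {x} {y} p q e → toℕ-injective (class-offset-injective ks (trans (h p) (sym (h q)))
      (trans (sym (toℕ-fromℕ< (offset-< ks (in-range x) largest))) (trans (cong toℕ e) (toℕ-fromℕ< (offset-< ks (in-range y) largest)))))) u

  -- No class exceeds the last one, so every person has at least as many outsiders as a member of
  -- the last class; by `bridge-≤` it is the last class that decides about bridges.
  outsiders-many : ∀ u → n ∸ lastK ks ≤ length (outsiders u)
  outsiders-many u = ≤-trans (ℕₚ.∸-monoʳ-≤ n small) (subst (n ∸ length insiders ≤_) (ℕₚ.m+n∸m≡n (length insiders) (length (outsiders u)))
      (ℕₚ.∸-monoˡ-≤ (length insiders) (subst (n ≤_) (length-++ insiders) (injected-length id id every))))
    where
    inside? : Decidable (λ x → inClass u x ≡ true)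
    inside? x = inClass u x ≟ᵇ true
    insiders = filter inside? (allFin n)
    small : length insiders ≤ lastK ks
    small = class-size (Uₚ.filter⁺ inside? (Uₚ.allFin⁺ n)) (λ {x} h → inClass-true {u} {x} (proj₂ (∈-filter⁻ inside? {xs = allFin n} h)))
    every : ∀ x → x ∈ insiders ++ outsiders u
    every x with inClass u x in e
    ... | true = ∈-++⁺ˡ (∈-filter⁺ inside? (∈-allFin x) e)
    ... | false = ∈-++⁺ʳ insiders (∈-filter⁺ (λ x → inClass u x ≟ᵇ false) (∈-allFin x) e)

  cycle-necessary-large : 3 ≤ lastK ks → IsCycle X → ¬ FSConnected X Y
  cycle-necessary-large three cyc = cycle-necessary-three cyc (≤-trans three last≤n) (place 1 1≤ l₁) (place 2 1≤ l₂) (place 3 1≤ three)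
      (from-end-≢ 1 2 {1≤} {1≤} {l₁} {l₂} λ ()) (from-end-≢ 1 3 {1≤} {1≤} {l₁} {three} λ ()) (from-end-≢ 2 3 {1≤} {1≤} {l₂} {three} λ ())
      (part-from-end 1 2 {1≤} {1≤} {l₁} {l₂}) (part-from-end 1 3 {1≤} {1≤} {l₁} {three})
    where
    place : ∀ i → 1 ≤ i → i ≤ lastK ks → Fin n
    place i p q = proj₁ (from-end i p q)
    1≤ : ∀ {i} → 1 ≤ suc i
    1≤ = s≤s z≤n
    l₂ : 2 ≤ lastK ks
    l₂ = ≤-trans (ℕₚ.n≤1+n 2) three
    l₁ : 1 ≤ lastK ks
    l₁ = ≤-trans (ℕₚ.n≤1+n 1) l₂

  cycle-necessary-two : (∀ i → V.lookup ks i ≡ 2) → 3 ≤ n → IsCycle X → ¬ FSConnected X Y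
  cycle-necessary-two two 3≤n cyc = cycle-necessary-pairs cyc 3≤n mate
      (λ u e → partner-≢ (toℕ u) (trans (sym (mate-index u)) (cong toℕ e)))
      (λ u → trans (cong (class ks) (mate-index u)) (class-partner ks two (toℕ u)))
      (λ u v e → [ inj₁ ∘ toℕ-injective , (λ h → inj₂ (toℕ-injective (trans h (sym (mate-index u))))) ]′ (partner-only ks two (in-range u) (in-range v) e))
      (proj₁ (from-end 1 ≤-refl 1≤last))
    where
    mate-< : ∀ u → partner (toℕ u) < n
    mate-< u = subst (partner (toℕ u) <_) (sym total) (partner-< ks two (in-range u))
    mate : Fin n → Fin n
    mate u = fromℕ< (mate-< u)
    mate-index : ∀ u → toℕ (mate u) ≡ partner (toℕ u)
    mate-index u = toℕ-fromℕ< (mate-< u)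

  no-last-bridge : HasBridge X (n ∸ lastK ks) → ¬ FSConnected X Y
  no-last-bridge hb = BridgeNecessity.bridge-necessary X simple part hb t₀ few
    where
    t₀ = proj₁ (from-end 1 ≤-refl 1≤last)
    early : ∀ {x} → part x ≢ part t₀ → toℕ x < n ∸ lastK ks
    early {x} ne = ℕₚ.≰⇒> (λ le → ne (trans (part-last x le) (sym (part-last t₀ (proj₂ (proj₂ (from-end 1 ≤-refl 1≤last)))))))
    few : ∀ xs → Unique xs → (∀ {x} → x ∈ xs → part x ≢ part t₀) → length xs ≤ n ∸ lastK ks
    few xs u h = unique-length (λ p → fromℕ< (early (h p))) (λ p q e → toℕ-injective
      (trans (sym (toℕ-fromℕ< (early (h p)))) (trans (cong toℕ e) (toℕ-fromℕ< (early (h q)))))) u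

  -- A path contains a bridge of every length that leaves a vertex free at both ends, and a last
  -- class of size two leaves exactly this room.
  path-necessary : 2 ≤ lastK ks → 2 ≤ n ∸ lastK ks → IsPath X → HasBridge X (n ∸ lastK ks)
  path-necessary 2≤l 2≤f path = subst (HasBridge X) (sym (eq 2≤f)) (path-bridge path (n ∸ lastK ks ∸ 2)
      (≤-trans (s≤s (s≤s (≤-reflexive (sym (eq 2≤f))))) (≤-trans (ℕₚ.+-monoˡ-≤ (n ∸ lastK ks) 2≤l) (≤-reflexive (ℕₚ.m+[n∸m]≡n last≤n)))))
    where
    eq : ∀ {m} → 2 ≤ m → m ≡ suc (suc (m ∸ 2))
    eq (s≤s (s≤s _)) = refl

  shape-of : Connected X → 2 ≤ n → ¬ Claw → Shape
  shape-of conn 2≤n nc = shape conn nc (fromℕ< 1≤n) (fromℕ< 2≤n) (λ e → case trans (sym (toℕ-fromℕ< 1≤n)) (trans (cong toℕ e) (toℕ-fromℕ< 2≤n)) of λ ())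

  connected-large : (∀ a b → ∃ λ e → part e ≢ part a × part e ≢ part b) → Connected X → Claw → 2 ≤ n ∸ lastK ks → ¬ HasBridge X (n ∸ lastK ks) → FSConnected X Y
  connected-large third conn C 2≤f nb = connected-three conn C third (λ u v _ _ → bridge-≤ 2≤f (outsiders-many u) nb)

  -- Without a claw X is a path or a cycle. The cycle is excluded by hypothesis, and the path would
  -- contain the forbidden bridge.
  many-classes : 2 ≤ n → (∀ a b → ∃ λ e → part e ≢ part a × part e ≢ part b) → 2 ≤ lastK ks → 2 ≤ n ∸ lastK ks →
    Connected X → ¬ IsCycle X → ¬ HasBridge X (n ∸ lastK ks) → FSConnected X Y
  many-classes 2≤n third 2≤l 2≤f conn ncyc nb with claw?
  ... | yes C = connected-large third conn C 2≤f nb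
  ... | no nc with shape-of conn 2≤n nc
  ... | cyclic c l p u full = ⊥-elim ([ ncyc , (λ ch → nc (chord-claw ch)) ]′ (cycle-or-chord p u full))
  ... | linear q p r ch u full leaf = ⊥-elim (nb (path-necessary 2≤l 2≤f (linear-iso conn nc ch u full leaf)))

  -- A claw alone already excludes an (n - 2)-bridge. A cycle is allowed here, because the singleton
  -- class turns the arrangement and no class has three members.
  pairs-and-singles : 3 ≤ n → (∀ a b → ∃ λ e → part e ≢ part a × part e ≢ part b) → V.lookup ks F.zero ≡ 1 → lastK ks ≡ 2 → 2 ≤ n ∸ lastK ks →
    Connected X → ¬ IsPath X → FSConnected X Y
  pairs-and-singles 3≤n third first last 2≤f conn npath with claw?
  ... | yes C = connected-large third conn C 2≤f (subst (λ l → ¬ HasBridge X (n ∸ l)) (sym last) (claw-no-long-bridge C (≤-trans (ℕₚ.n≤1+n 2) 3≤n)))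
  ... | no nc with shape-of conn (≤-trans (ℕₚ.n≤1+n 2) 3≤n) nc
  ... | linear q p r ch u full leaf = ⊥-elim (npath (linear-iso conn nc ch u full leaf))
  ... | cyclic c l p u full = CycleExchange.connected-cycle X simple part conn nc 3≤n w lone small p u full
    where
    w = fromℕ< 1≤n
    w-index : toℕ w ≡ 0
    w-index = toℕ-fromℕ< 1≤n
    lone-class : ∀ (ks : Vec ℕ (suc (suc t))) → V.lookup ks F.zero ≡ 1 → ∀ x → x ≢ 0 → class ks x ≢ class ks 0
    lone-class (.1 ∷ ks) refl zero ne = ⊥-elim (ne refl)
    lone-class (.1 ∷ ks) refl (suc x) ne ()
    lone : ∀ {x} → x ≢ w → part x ≢ part w
    lone {x} ne e = lone-class ks first (toℕ x) (λ h → ne (toℕ-injective (trans h (sym w-index)))) (trans e (cong (class ks) w-index))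
    small : ∀ {u v x} → part u ≡ part v → u ≢ v → x ≢ u → x ≢ v → part x ≢ part u
    small {u} {v} {x} uv u≢v x≢u x≢v e = ℕₚ.<⇒≱ ≤-refl (subst (3 ≤_) last (class-size {part u} {x ∷ u ∷ v ∷ []}
      (unique-cons (λ { (here h) → x≢u h ; (there (here h)) → x≢v h }) (two-unique u≢v)) λ { (here refl) → e ; (there (here refl)) → refl ; (there (there (here refl))) → sym uv }))

-- Two classes.

module TwoParts {n : ℕ} (X : Graph n) (simple : IsSimple X) (a : ℕ) (1≤a : 1 ≤ a) (a≤b : a ≤ n ∸ a) (2≤b : 2 ≤ n ∸ a) where

  a≤n : a ≤ n
  a≤n = ≤-trans a≤b (ℕₚ.m∸n≤m n a)

  sizes : Vec ℕ 2
  sizes = a ∷ (n ∸ a) ∷ []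

  sizes-positive : ∀ i → 1 ≤ V.lookup sizes i
  sizes-positive 0F = 1≤a
  sizes-positive 1F = ≤-trans 1≤a a≤b

  sizes-largest : ∀ i → V.lookup sizes i ≤ lastK sizes
  sizes-largest 0F = a≤b
  sizes-largest 1F = ≤-refl

  open Multipartite X simple sizes (sym (trans (cong (a +_) (ℕₚ.+-identityʳ (n ∸ a))) (ℕₚ.m+[n∸m]≡n a≤n)))
    sizes-positive sizes-largest public
  open GraphTheory X simple
  open FSCore X simple part
  open Necessity X simple part
  open PathBridges X simple

  early : Fin n → Bool
  early u = toℕ u <ᵇ a

  part-early : ∀ u → part u ≡ (if early u then 0 else 1)
  part-early u with toℕ u ℕ.<? a
  ... | yes p = trans (class-low {ks = (n ∸ a) ∷ []} p) (cong (if_then 0 else 1) (sym (<ᵇ-true p)))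
  ... | no p = trans (class-high {ks = (n ∸ a) ∷ []} (ℕₚ.≮⇒≥ p)) (trans (cong suc (class-low {ks = []} (ℕₚ.∸-monoˡ-< (toℕ<n u) (ℕₚ.≮⇒≥ p)))) (cong (if_then 0 else 1) (sym (<ᵇ-false (ℕₚ.≮⇒≥ p)))))

  same : ∀ u v → early u ≡ early v → part u ≡ part v
  same u v e = trans (part-early u) (trans (cong (if_then 0 else 1) e) (sym (part-early v)))

  apart : ∀ u v → early u ≢ early v → part u ≢ part v
  apart u v ne e = ne (if-inj (trans (sym (part-early u)) (trans e (part-early v))))
    where
    if-inj : ∀ {b c : Bool} → (if b then 0 else 1) ≡ (if c then 0 else 1) → b ≡ c
    if-inj {true} {true} _ = refl
    if-inj {false} {false} _ = refl

  early-apart : ∀ u v → part u ≢ part v → early u ≢ early v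
  early-apart u v ne e = ne (same u v e)

  front : n ∸ lastK sizes ≡ a
  front = ℕₚ.m∸[m∸n]≡n a≤n

  bipartite-two : FSConnected X Y → ¬ Bipartite X
  bipartite-two = bipartite-necessary early early-apart (proj₁ u) (proj₁ v) (from-end-≢ 1 2 {≤-refl} {s≤s z≤n} {1≤last} {2≤b} λ ())
      (trans (late 1 u) (sym (late 2 v)))
    where
    u = from-end 1 ≤-refl 1≤last
    v = from-end 2 (s≤s z≤n) 2≤b
    late : ∀ i (w : Σ (Fin n) λ u → toℕ u ≡ n ∸ i × n ∸ lastK sizes ≤ toℕ u) → early (proj₁ w) ≡ false
    late _ (w , _ , le) = <ᵇ-false (subst (_≤ toℕ w) front le)

  bridge-two : FSConnected X Y → ¬ HasBridge X a
  bridge-two fs hb = no-last-bridge (subst (HasBridge X) (sym front) hb) fs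

  cycle-two : 4 ≤ n → FSConnected X Y → ¬ IsCycle X
  cycle-two 4≤n fs cyc with 3 ℕ.≤? n ∸ a
  ... | yes large = cycle-necessary-large large cyc fs
  -- As n is at least 4, having no class of three people forces both classes to have two.
  ... | no small = cycle-necessary-two (λ { 0F → a≡2 ; 1F → b≡2 }) (≤-trans (ℕₚ.n≤1+n 3) 4≤n) cyc fs
    where
    b≡2 : n ∸ a ≡ 2
    b≡2 = ℕₚ.≤-antisym (ℕₚ.≤-pred (ℕₚ.≰⇒> small)) 2≤b
    a≡2 : a ≡ 2
    a≡2 = ℕₚ.≤-antisym (subst (a ≤_) b≡2 a≤b) (ℕₚ.+-cancelʳ-≤ 2 2 a (≤-trans 4≤n (≤-reflexive (trans (sym (ℕₚ.m+[n∸m]≡n a≤n)) (cong (a +_) b≡2)))))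

  sufficient-two : 2 ≤ a → Connected X → ¬ Bipartite X → ¬ IsCycle X → ¬ HasBridge X a → FSConnected X Y
  sufficient-two 2≤a conn nbip ncyc nb = T.connected-two conn ncyc nbip (fromℕ< 1≤n) (≤-trans 2≤a early-many) (≤-trans 2≤b late-many)
      (bridge-≤ 2≤a early-many nb) (bridge-≤ 2≤a (≤-trans a≤b late-many) nb)
    where
    module T = TwoClasses X simple part early apart same
    early-many : a ≤ length (T.coloured true)
    early-many = injected-length (λ i → fromℕ< (at i)) (λ {i} {j} e → toℕ-injective (trans (sym (toℕ-fromℕ< (at i))) (trans (cong toℕ e) (toℕ-fromℕ< (at j)))))
        (λ i → T.coloured-all true _ (<ᵇ-true (subst (_< a) (sym (toℕ-fromℕ< (at i))) (toℕ<n i))))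
      where
      at : ∀ (i : Fin a) → toℕ i < n
      at i = ≤-trans (toℕ<n i) a≤n
    late-many : n ∸ a ≤ length (T.coloured false)
    late-many = injected-length (λ i → fromℕ< (at i)) (λ {i} {j} e → toℕ-injective (ℕₚ.+-cancelˡ-≡ a _ _ (trans (sym (toℕ-fromℕ< (at i))) (trans (cong toℕ e) (toℕ-fromℕ< (at j))))))
        (λ i → T.coloured-all false _ (<ᵇ-false (subst (a ≤_) (sym (toℕ-fromℕ< (at i))) (ℕₚ.m≤m+n a (toℕ i)))))
      where
      at : ∀ (i : Fin (n ∸ a)) → a + toℕ i < n
      at i = subst (a + toℕ i <_) (ℕₚ.m+[n∸m]≡n a≤n) (ℕₚ.+-monoʳ-< a (toℕ<n i))

-- An isomorphism with θ₀ forces n = 7, so the blank and the six tokens can be listed and their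
-- classes compared by evaluation.
theta-necessary-iso : ∀ {n} (X : Graph n) → IsSimple X → Iso X θ₀ → ¬ FSConnected X (K (1 ∷ (n ∸ 1) ∷ []) n)
theta-necessary-iso X simple iso@(f , _) with P.↔⇒≡ f
... | refl = theta-necessary X simple part₇ (λ {u} {v} p q → tokens u p v q) iso
  where
  part₇ : Fin 7 → ℕ
  part₇ u = class (1 ∷ 6 ∷ []) (toℕ u)
  tokens : ∀ u → u ≢ 0F → ∀ v → v ≢ 0F → part₇ u ≡ part₇ v
  tokens = from-yes (Fₚ.all? λ u → ¬? (u ≟ᶠ 0F) →-dec Fₚ.all? λ v → ¬? (v ≟ᶠ 0F) →-dec (part₇ u ℕ.≟ part₇ v))

star-case : ∀ {n} (X : Graph n) → IsSimple X → 4 ≤ n →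
  FSConnected X (K (1 ∷ (n ∸ 1) ∷ []) n) ⇔ (Connected X × ¬ Bipartite X × ¬ IsCycle X × ¬ Iso X θ₀ × ¬ HasCutVertex X)
star-case {n} X simple 4≤n = mk⇔
    (λ fs → connected-necessary fs , bipartite-two fs , cycle-two 4≤n fs , (λ iso → theta-necessary-iso X simple iso fs) , bridge-two fs)
    (λ { (conn , nbip , ncyc , nθ , ncut) → let C = odd-cycle conn x₀ nbip in
      WilsonConnected.connected-wilson X simple part x₀ (λ {u} → lone {u}) (λ {u} {v} p q → same u v (trans (late p) (sym (late q)))) conn ncut (WilsonTheorem.good-theta X simple conn ncut ncyc nθ C) C })
  where
  3≤b : 3 ≤ n ∸ 1
  3≤b = ℕₚ.∸-monoˡ-≤ 1 4≤n
  open TwoParts X simple 1 ≤-refl (≤-trans (s≤s z≤n) 3≤b) (≤-trans (ℕₚ.n≤1+n 2) 3≤b)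
  open GraphTheory X simple
  open Necessity X simple part
  x₀ = fromℕ< 1≤n
  late : ∀ {u} → u ≢ x₀ → early u ≡ false
  late {u} ne = <ᵇ-false (ℕₚ.n≢0⇒n>0 (λ h → ne (toℕ-injective (trans h (sym (toℕ-fromℕ< 1≤n))))))
  lone : ∀ {u} → u ≢ x₀ → part u ≢ part x₀
  lone {u} ne = apart u x₀ (λ e → true≢false (<ᵇ-true (subst (_< 1) (sym (toℕ-fromℕ< 1≤n)) (s≤s z≤n))) (trans (sym e) (late ne)))

two-part-case : ∀ {n} (X : Graph n) → IsSimple X → 4 ≤ n → ∀ a → 2 ≤ a → a ≤ n ∸ a →
  FSConnected X (K (a ∷ (n ∸ a) ∷ []) n) ⇔ (Connected X × ¬ Bipartite X × ¬ IsCycle X × ¬ HasBridge X a)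
two-part-case X simple 4≤n a 2≤a a≤b = mk⇔
    (λ fs → connected-necessary fs , bipartite-two fs , cycle-two 4≤n fs , bridge-two fs)
    (λ { (conn , nbip , ncyc , nb) → sufficient-two 2≤a conn nbip ncyc nb })
  where
  open TwoParts X simple a (≤-trans (s≤s z≤n) 2≤a) a≤b (≤-trans 2≤a a≤b)
  open Necessity X simple part

-- At least three classes.

module ManyParts {n t : ℕ} (X : Graph n) (simple : IsSimple X) (k₀ k₁ k₂ : ℕ) (rest : Vec ℕ t) (total : n ≡ V.sum (k₀ ∷ k₁ ∷ k₂ ∷ rest)) (4≤n : 4 ≤ n)
  (1≤k₀ : 1 ≤ k₀) (inc : Increasing (k₀ ∷ k₁ ∷ k₂ ∷ rest)) where

  ks : Vec ℕ (3 + t)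
  ks = k₀ ∷ k₁ ∷ k₂ ∷ rest

  positive : ∀ i → 1 ≤ V.lookup ks i
  positive i = ≤-trans 1≤k₀ (inc F.zero i z≤n)

  open Multipartite X simple ks total positive (≤-last ks inc)
  open FSCore X simple part
  open Necessity X simple part

  1≤k₁ : 1 ≤ k₁
  1≤k₁ = positive 1F

  1≤k₂ : 1 ≤ k₂
  1≤k₂ = positive 2F

  3≤n : 3 ≤ n
  3≤n = ≤-trans (ℕₚ.n≤1+n 3) 4≤n

  class-member : ∀ c → c ≤ 2 → ∃ λ x → x < V.sum ks × class ks x ≡ c
  class-member 0 _ = 0 , ≤-trans 1≤k₀ (ℕₚ.m≤m+n k₀ _) , class-low {ks = k₁ ∷ k₂ ∷ rest} 1≤k₀
  class-member 1 _ = k₀ , ℕₚ.m<m+n k₀ (≤-trans 1≤k₁ (ℕₚ.m≤m+n k₁ _)) ,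
    trans (class-high {k = k₀} {ks = k₁ ∷ k₂ ∷ rest} ≤-refl) (cong suc (trans (cong (class (k₁ ∷ k₂ ∷ rest)) (ℕₚ.n∸n≡0 k₀)) (class-low {ks = k₂ ∷ rest} 1≤k₁)))
  class-member 2 _ = k₀ + k₁ , ℕₚ.+-monoʳ-< k₀ (ℕₚ.m<m+n k₁ (≤-trans 1≤k₂ (ℕₚ.m≤m+n k₂ _))) ,
    trans (class-high {ks = k₁ ∷ k₂ ∷ rest} (ℕₚ.m≤m+n k₀ k₁)) (cong suc (trans (cong (class (k₁ ∷ k₂ ∷ rest)) (ℕₚ.m+n∸m≡n k₀ k₁))
      (trans (class-high {k = k₁} {ks = k₂ ∷ rest} ≤-refl) (cong suc (trans (cong (class (k₂ ∷ rest)) (ℕₚ.n∸n≡0 k₁)) (class-low {ks = rest} 1≤k₂))))))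
  class-member (suc (suc (suc _))) (s≤s (s≤s ()))

  third : ∀ a b → ∃ λ e → part e ≢ part a × part e ≢ part b
  third a b with third-value (part a) (part b)
  ... | c , c≤2 , ca , cb with class-member c c≤2
  ... | x , lt , e = fromℕ< lt′ , (λ h → ca (trans (sym is-c) h)) , (λ h → cb (trans (sym is-c) h))
    where
    lt′ : x < n
    lt′ = subst (x <_) (sym total) lt
    is-c : part (fromℕ< lt′) ≡ c
    is-c = trans (cong (class ks) (toℕ-fromℕ< lt′)) e

  2≤front : 2 ≤ n ∸ lastK ks
  2≤front = subst (2 ≤_) (sym (trans (cong (_∸ lastK ks) total) (trans (ℕₚ.+-∸-assoc k₀ (last≤sum (k₁ ∷ k₂ ∷ rest))) (cong (k₀ +_) (ℕₚ.+-∸-assoc k₁ (last≤sum (k₂ ∷ rest)))))))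
    (ℕₚ.+-mono-≤ 1≤k₀ (≤-trans 1≤k₁ (ℕₚ.m≤m+n k₁ _)))

  gcd≤ : ∀ i → gcdAll ks ≤ V.lookup ks i
  gcd≤ i = ∣⇒≤ {{ℕ.>-nonZero (positive i)}} (gcdAll∣ ks i)

  2≤last : 2 < lastK ks ⊎ 1 < gcdAll ks → 2 ≤ lastK ks
  2≤last (inj₁ h) = ℕₚ.<⇒≤ h
  2≤last (inj₂ h) = ≤-trans h (subst (gcdAll ks ≤_) (last-lookup ks) (gcd≤ (fromℕ _)))

  cycle-many : 2 < lastK ks ⊎ 1 < gcdAll ks → FSConnected X Y → ¬ IsCycle X
  cycle-many big fs cyc with 3 ℕ.≤? lastK ks | big
  ... | yes large | _ = cycle-necessary-large large cyc fs
  ... | no small | inj₁ h = small h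
  -- A common divisor above 1 bounds every class from below by two, and no class has three members,
  -- so all classes are pairs.
  ... | no small | inj₂ h = cycle-necessary-two (λ i → ℕₚ.≤-antisym (≤-trans (≤-last ks inc i) (ℕₚ.≤-pred (ℕₚ.≰⇒> small))) (≤-trans h (gcd≤ i))) 3≤n cyc fs

  large-case : 2 < lastK ks ⊎ 1 < gcdAll ks → FSConnected X (K ks n) ⇔ (Connected X × ¬ IsCycle X × ¬ HasBridge X (n ∸ lastK ks))
  large-case big = mk⇔ (λ fs → connected-necessary fs , cycle-many big fs , (λ hb → no-last-bridge hb fs))
    (λ { (conn , ncyc , nb) → many-classes (≤-trans (ℕₚ.n≤1+n 2) 3≤n) third (2≤last big) 2≤front conn ncyc nb })

  small-case : k₀ ≡ 1 → lastK ks ≡ 2 → FSConnected X (K ks n) ⇔ (Connected X × ¬ IsPath X)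
  small-case first last = mk⇔ (λ fs → connected-necessary fs , (λ path → no-last-bridge (path-necessary (≤-reflexive (sym last)) 2≤front path) fs))
    (λ { (conn , npath) → pairs-and-singles 3≤n third first last 2≤front conn npath })

theorem1p3 : (t : ℕ) (ks : Vec ℕ t) (n : ℕ) (X : Graph n) →
    2 ≤ t →
    1 ≤ firstK ks →
    (∀ (i j : Fin t) → i F.≤ j → V.lookup ks i ≤ V.lookup ks j) →
    n ≡ V.sum ks →
    4 ≤ n →
    IsSimple X →
    (lastK ks ≡ n ∸ 1 →
      (FSConnected X (K (1 ∷ (n ∸ 1) ∷ []) n)
        ⇔ (Connected X × ¬ Bipartite X × ¬ IsCycle X × ¬ Iso X θ₀ × ¬ HasCutVertex X)))
    × (t ≡ 2 → 2 ≤ firstK ks →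
      (FSConnected X (K (firstK ks ∷ (n ∸ firstK ks) ∷ []) n)
        ⇔ (Connected X × ¬ Bipartite X × ¬ IsCycle X × ¬ HasBridge X (firstK ks))))
    × (2 < t → (2 < lastK ks ⊎ 1 < gcdAll ks) →
      (FSConnected X (K ks n)
        ⇔ (Connected X × ¬ IsCycle X × ¬ HasBridge X (n ∸ lastK ks))))
    × (2 < t → firstK ks ≡ 1 → lastK ks ≡ 2 →
      (FSConnected X (K ks n) ⇔ (Connected X × ¬ IsPath X)))
theorem1p3 (suc zero) ks n X (s≤s ()) first inc total 4≤n simple
theorem1p3 (suc (suc zero)) (a ∷ b ∷ []) n X 2≤t first inc total 4≤n simple =
  (λ _ → star-case X simple 4≤n) ,
  (λ _ 2≤a → two-part-case X simple 4≤n a 2≤a (subst (a ≤_) (sym b≡) (inc 0F 1F z≤n))) ,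
  (λ { (s≤s (s≤s ())) }) , (λ { (s≤s (s≤s ())) })
  where
  b≡ : n ∸ a ≡ b
  b≡ = trans (cong (_∸ a) (trans total (cong (a +_) (ℕₚ.+-identityʳ b)))) (ℕₚ.m+n∸m≡n a b)
theorem1p3 (suc (suc (suc t))) (k₀ ∷ k₁ ∷ k₂ ∷ rest) n X 2≤t first inc total 4≤n simple =
  (λ _ → star-case X simple 4≤n) , (λ ()) ,
  (λ _ → ManyParts.large-case X simple k₀ k₁ k₂ rest total 4≤n first inc) ,
  (λ _ → ManyParts.small-case X simple k₀ k₁ k₂ rest total 4≤n first inc)
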